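{- Let $\mathtt{A}$ be a type that has two different closed terms $\mathtt{s1}$ and $\mathtt{s2}$ (i.e. $\mathtt{s1}\neq_{\beta\eta c}\mathtt{s2}$). Then $\mathtt{A}$ is functionally complete with regard to $\mathtt{s1}$ and $\mathtt{s2}$: for every $n\ge 1$ and every function $f:\{0,1\}^n\to\{0,1\}$ there is a closed term $\mathtt{t}$, poly-typable by $\underbrace{\mathtt{A\to\cdots\to A}}_{n}\mathtt{\to A}$ with respect to every sequence of $n$ arguments drawn from $\{\mathtt{s1},\mathtt{s2}\}$, such that for all $(x_1,\dots,x_n)\in\{0,1\}^n$ and $y\in\{0,1\}$, \[ f(x_1,\dots,x_n) = y \iff \mathtt{t}\,\mathtt{x1}\cdots\mathtt{xn} =_{\beta\eta c} \mathtt{y}, \] where $\mathtt{x1},\dots,\mathtt{xn},\mathtt{y}$ are the images of $x_1,\dots,x_n,y$ under the map $0\mapsto\mathtt{s1}$, $1\mapsto\mathtt{s2}$.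
   Context: Linear $\lambda$-calculus in ML-like notation. Types: $\mathtt{A} ::= \mathtt{'a} \mid \mathtt{A1 * A2} \mid \mathtt{A1 \to A2}$ ($\mathtt{'a}$ type variables, $*$ tensor, $\to$ linear implication). Terms: $\mathtt{t} ::= \mathtt{x} \mid \mathtt{t}\,\mathtt{s} \mid \mathtt{fn\ x => t} \mid \mathtt{(s,t)} \mid \mathtt{let\ val\ (x,y)=s\ in\ t\ end}$. Typing judgements $\Gamma \vdash \mathtt{t:A}$ are derived by: $\mathtt{x:A}\vdash\mathtt{x:A}$; exchange; from $\mathtt{x:A},\Gamma\vdash \mathtt{t:B}$ infer $\Gamma\vdash\mathtt{fn\ x=>t : A\to B}$; from $\Gamma\vdash\mathtt{t:A\to B}$ and $\Delta\vdash\mathtt{s:A}$ infer $\Gamma,\Delta\vdash\mathtt{t\,s:B}$; from $\Gamma\vdash\mathtt{s:A}$ and $\Delta\vdash\mathtt{t:B}$ infer $\Gamma,\Delta\vdash\mathtt{(s,t):A*B}$; from $\Gamma\vdash\mathtt{s:A*B}$ and $\mathtt{x:A},\mathtt{y:B},\Delta\vdash\mathtt{t:C}$ infer $\Gamma,\Delta\vdash\mathtt{let\ val\ (x,y)=s\ in\ t\ end:C}$ ($\Gamma,\Delta$ disjoint lists of distinct variables). A closed term of type $\mathtt{A}$ is a term with $\vdash\mathtt{t:A}$ derivable. The equality $=_{\beta\eta c}$ is the least congruence on typed terms containing: $(\mathtt{fn\ x=>t})\,\mathtt{s} = \mathtt{t[s/x]}$; $\mathtt{let\ val\ (x,y)=(u,v)\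 in\ w\ end} = \mathtt{w[u/x,v/y]}$; $\mathtt{fn\ x=>(t\ x)} = \mathtt{t}$; $\mathtt{let\ val\ (x,y)=t\ in\ (x,y)\ end} = \mathtt{t}$; and $C[\mathtt{let\ val\ (x,y)=t\ in\ u\ end}] = \mathtt{let\ val\ (x,y)=t\ in}\ C[\mathtt{u}]\ \mathtt{end}$ for every one-hole context $C$ in which $\mathtt{x},\mathtt{y}$ are not free and whose binders capture no free variable of $\mathtt{t}$. Poly-typability: the principal type $\mathrm{PT}(\mathtt{t})$ of a typable term is a type $\mathtt{A}$ with $\Gamma\vdash\mathtt{t:A}$ derivable for some $\Gamma$ such that every derivable typing of $\mathtt{t}$ is a substitution instance of it. For closed terms $\mathtt{t},\mathtt{s}_1,\dots,\mathtt{s}_n$ with $\vdash \mathtt{t : A'_1\to\cdots\to A'_n\to B'}$ derivable for some types and $\vdash\mathtt{s}_i\mathtt{:A}_i$, $\mathtt{t}$ is poly-typable by $\mathtt{A_1\to\cdots\to A_n\to B}$ with respect to $\mathtt{s}_1,\dots,\mathtt{s}_n$ if there is a type substitution $\theta$ with $\theta(\mathrm{PT}(\mathtt{t})) = \mathtt{A''_1\to\cdots\to A''_n\to B}$ and $\theta(\mathrm{PT}(\mathtt{s}_i)) = \mathtt{A''_i}$ for each $i$. -}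

module Defs where

open import Data.Nat using (ℕ; zero; suc; _≟_)
open import Data.Bool using (Bool; true; false)
open import Data.List using (List; []; _∷_; _++_; map; filter; concatMap)
open import Data.List.Membership.Propositional using (_∈_; _∉_)
open import Data.List.Relation.Unary.All using (All)
open import Data.List.Relation.Unary.Unique.Propositional using (Unique)
open import Data.Vec as V using (Vec)
open import Data.Product using (_×_; _,_; proj₁; proj₂; Σ; ∃; ∃-syntax)
open import Relation.Nullary using (¬_; ¬?)
open import Relation.Binary.PropositionalEquality using (_≡_; _≢_)

infixr 7 _⊗_
infixr 6 _⊸_

data Ty : Set where
  tv  : ℕ → Ty
  _⊗_ : Ty → Ty → Ty
  _⊸_ : Ty → Ty → Ty

TySub : Set
TySub = ℕ → Ty

tsub : TySub → Ty → Ty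
tsub θ (tv a)    = θ a
tsub θ (A ⊗ B)   = tsub θ A ⊗ tsub θ B
tsub θ (A ⊸ B)   = tsub θ A ⊸ tsub θ B

data Tm : Set where
  var  : ℕ → Tm
  app  : Tm → Tm → Tm
  lam  : ℕ → Tm → Tm
  pair : Tm → Tm → Tm
  letp : ℕ → ℕ → Tm → Tm → Tm

_─_ : List ℕ → ℕ → List ℕ
xs ─ x = filter (λ z → ¬? (z ≟ x)) xs

FV : Tm → List ℕ
FV (var x)        = x ∷ []
FV (app t s)      = FV t ++ FV s
FV (lam x t)      = FV t ─ x
FV (pair s t)     = FV s ++ FV t
FV (letp x y s t) = FV s ++ ((FV t ─ x) ─ y)

BV : Tm → List ℕ
BV (var x)        = []
BV (app t s)      = BV t ++ BV s
BV (lam x t)      = x ∷ BV t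
BV (pair s t)     = BV s ++ BV t
BV (letp x y s t) = x ∷ y ∷ BV s ++ BV t

Vars : Tm → List ℕ
Vars t = FV t ++ BV t

-- Simultaneous (naive) substitution t[u1/x1,...]; it is only used under
-- the side condition that no binder of t captures a free variable of
-- the substituted terms, in which case it is capture-avoiding.

Subst : Set
Subst = List (ℕ × Tm)

look : Subst → ℕ → Tm
look []             x = var x
look ((y , u) ∷ σ)  x with x ≟ y
... | Relation.Nullary.yes _ = u
... | Relation.Nullary.no  _ = look σ x

dropS : ℕ → Subst → Subst
dropS x []              = []
dropS x ((y , u) ∷ σ) with x ≟ y
... | Relation.Nullary.yes _ = dropS x σ
... | Relation.Nullary.no  _ = (y , u) ∷ dropS x σ

subst : Subst → Tm → Tm
subst σ (var x)        = look σ x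
subst σ (app t s)      = app (subst σ t) (subst σ s)
subst σ (lam x t)      = lam x (subst (dropS x σ) t)
subst σ (pair s t)     = pair (subst σ s) (subst σ t)
subst σ (letp x y s t) = letp x y (subst σ s) (subst (dropS y (dropS x σ)) t)

FVS : Subst → List ℕ
FVS σ = concatMap (λ p → FV (proj₂ p)) σ

NoCapture : Subst → Tm → Set
NoCapture σ t = All (λ z → z ∉ BV t) (FVS σ)

data Hole : Set where
  ∙     : Hole
  appL  : Hole → Tm → Hole
  appR  : Tm → Hole → Hole
  lamC  : ℕ → Hole → Hole
  pairL : Hole → Tm → Hole
  pairR : Tm → Hole → Hole
  letL  : ℕ → ℕ → Hole → Tm → Hole
  letR  : ℕ → ℕ → Tm → Hole → Hole

plug : Hole → Tm → Tm
plug ∙             u = u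
plug (appL C s)    u = app (plug C u) s
plug (appR t C)    u = app t (plug C u)
plug (lamC x C)    u = lam x (plug C u)
plug (pairL C s)   u = pair (plug C u) s
plug (pairR s C)   u = pair s (plug C u)
plug (letL x y C t) u = letp x y (plug C u) t
plug (letR x y s C) u = letp x y s (plug C u)

FVC : Hole → List ℕ
FVC ∙              = []
FVC (appL C s)     = FVC C ++ FV s
FVC (appR t C)     = FV t ++ FVC C
FVC (lamC x C)     = FVC C ─ x
FVC (pairL C s)    = FVC C ++ FV s
FVC (pairR s C)    = FV s ++ FVC C
FVC (letL x y C t) = FVC C ++ ((FV t ─ x) ─ y)
FVC (letR x y s C) = FV s ++ ((FVC C ─ x) ─ y)

HoleBV : Hole → List ℕ
HoleBV ∙              = []
HoleBV (appL C s)     = HoleBV C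
HoleBV (appR t C)     = HoleBV C
HoleBV (lamC x C)     = x ∷ HoleBV C
HoleBV (pairL C s)    = HoleBV C
HoleBV (pairR s C)    = HoleBV C
HoleBV (letL x y C t) = HoleBV C
HoleBV (letR x y s C) = x ∷ y ∷ HoleBV C

Cx : Set
Cx = List (ℕ × Ty)

dom : Cx → List ℕ
dom = map proj₁

infix 4 _⊢_∶_

data _⊢_∶_ : Cx → Tm → Ty → Set where
  ax   : ∀ {x A} → ((x , A) ∷ []) ⊢ var x ∶ A
  exch : ∀ {Γ₁ Γ₂ p q t A} →
         (Γ₁ ++ p ∷ q ∷ Γ₂) ⊢ t ∶ A → (Γ₁ ++ q ∷ p ∷ Γ₂) ⊢ t ∶ A
  ⊸I   : ∀ {x A Γ t B} → ((x , A) ∷ Γ) ⊢ t ∶ B → Γ ⊢ lam x t ∶ A ⊸ B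
  ⊸E   : ∀ {Γ Δ t s A B} → Unique (dom (Γ ++ Δ)) →
         Γ ⊢ t ∶ A ⊸ B → Δ ⊢ s ∶ A → (Γ ++ Δ) ⊢ app t s ∶ B
  ⊗I   : ∀ {Γ Δ s t A B} → Unique (dom (Γ ++ Δ)) →
         Γ ⊢ s ∶ A → Δ ⊢ t ∶ B → (Γ ++ Δ) ⊢ pair s t ∶ A ⊗ B
  ⊗E   : ∀ {Γ Δ s t x y A B C} → Unique (dom (Γ ++ Δ)) →
         Γ ⊢ s ∶ A ⊗ B → ((x , A) ∷ (y , B) ∷ Δ) ⊢ t ∶ C →
         (Γ ++ Δ) ⊢ letp x y s t ∶ C

-- Basic (untyped) equations generating =βηc, including α-conversion
-- (terms are considered up to renaming of bound variables).

data Axiom : Tm → Tm → Set where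
  α-lam  : ∀ {x z t} → z ∉ Vars t →
           Axiom (lam x t) (lam z (subst ((x , var z) ∷ []) t))
  α-let  : ∀ {x y x' y' s t} → x' ≢ y' → x' ∉ Vars t → y' ∉ Vars t →
           Axiom (letp x y s t)
                 (letp x' y' s (subst ((x , var x') ∷ (y , var y') ∷ []) t))
  β-lam  : ∀ {x t s} → NoCapture ((x , s) ∷ []) t →
           Axiom (app (lam x t) s) (subst ((x , s) ∷ []) t)
  β-let  : ∀ {x y u v w} → NoCapture ((x , u) ∷ (y , v) ∷ []) w →
           Axiom (letp x y (pair u v) w) (subst ((x , u) ∷ (y , v) ∷ []) w)
  η-lam  : ∀ {x t} → Axiom (lam x (app t (var x))) t
  η-let  : ∀ {x y t} → Axiom (letp x y t (pair (var x) (var y))) t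
  c-comm : ∀ {C x y t u} → x ∉ FVC C → y ∉ FVC C →
           All (λ z → z ∉ HoleBV C) (FV t) →
           Axiom (plug C (letp x y t u)) (letp x y t (plug C u))

infix 4 _⊢_≐_∶_

data _⊢_≐_∶_ : Cx → Tm → Tm → Ty → Set where
  e-ax    : ∀ {Γ l r A} → Axiom l r → Γ ⊢ l ∶ A → Γ ⊢ r ∶ A → Γ ⊢ l ≐ r ∶ A
  e-refl  : ∀ {Γ t A} → Γ ⊢ t ∶ A → Γ ⊢ t ≐ t ∶ A
  e-sym   : ∀ {Γ t t' A} → Γ ⊢ t ≐ t' ∶ A → Γ ⊢ t' ≐ t ∶ A
  e-trans : ∀ {Γ t t' t'' A} → Γ ⊢ t ≐ t' ∶ A → Γ ⊢ t' ≐ t'' ∶ A →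
            Γ ⊢ t ≐ t'' ∶ A
  e-exch  : ∀ {Γ₁ Γ₂ p q t t' A} → (Γ₁ ++ p ∷ q ∷ Γ₂) ⊢ t ≐ t' ∶ A →
            (Γ₁ ++ q ∷ p ∷ Γ₂) ⊢ t ≐ t' ∶ A
  e-lam   : ∀ {x A Γ t t' B} → ((x , A) ∷ Γ) ⊢ t ≐ t' ∶ B →
            Γ ⊢ lam x t ≐ lam x t' ∶ A ⊸ B
  e-app   : ∀ {Γ Δ t t' s s' A B} → Unique (dom (Γ ++ Δ)) →
            Γ ⊢ t ≐ t' ∶ A ⊸ B → Δ ⊢ s ≐ s' ∶ A →
            (Γ ++ Δ) ⊢ app t s ≐ app t' s' ∶ B
  e-pair  : ∀ {Γ Δ s s' t t' A B} → Unique (dom (Γ ++ Δ)) →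
            Γ ⊢ s ≐ s' ∶ A → Δ ⊢ t ≐ t' ∶ B →
            (Γ ++ Δ) ⊢ pair s t ≐ pair s' t' ∶ A ⊗ B
  e-let   : ∀ {Γ Δ s s' t t' x y A B C} → Unique (dom (Γ ++ Δ)) →
            Γ ⊢ s ≐ s' ∶ A ⊗ B → ((x , A) ∷ (y , B) ∷ Δ) ⊢ t ≐ t' ∶ C →
            (Γ ++ Δ) ⊢ letp x y s t ≐ letp x y s' t' ∶ C

-- Principal types (only needed for closed terms here: a closed typable
-- term can only be typed in the empty context).

IsPT : Tm → Ty → Set
IsPT t P = ([] ⊢ t ∶ P) × (∀ B → [] ⊢ t ∶ B → ∃[ θ ] tsub θ P ≡ B)

arrows : ∀ {n} → Vec Ty n → Ty → Ty
arrows V.[]       B = B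
arrows (A V.∷ As) B = A ⊸ arrows As B

apps : ∀ {n} → Tm → Vec Tm n → Tm
apps t V.[]       = t
apps t (s V.∷ ss) = apps (app t s) ss

PolyTypable : ∀ {n} → Tm → Vec Tm n → Vec Ty n → Ty → Set
PolyTypable {n} t ss As B =
  (∃[ As' ] ∃[ B' ] ([] ⊢ t ∶ arrows {n} As' B')) ×
  (∀ i → [] ⊢ V.lookup ss i ∶ V.lookup As i) ×
  (∃[ P ] ∃[ Ps ] ∃[ θ ]
     (IsPT t P × (∀ i → IsPT (V.lookup ss i) (V.lookup Ps i)) ×
      tsub θ P ≡ arrows (V.map (tsub θ) Ps) B))

enc : Tm → Tm → Bool → Tm
enc s1 s2 false = s1
enc s1 s2 true  = s2

{-# OPTIONS --safe #-}
module Submission where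

-- On linear terms untyped conversion preserves types in both directions:
-- every variable occurs once, so subject expansion holds as well.  Hence a
-- realiser t of f may be built and verified untyped: its applications to
-- s1 and s2 are typable because their values are, and poly-typability
-- follows since typable terms have principal types.
--
-- A closed term is convertible to a cut-free proof of A, and a cut-free proof
-- is determined up to conversion by its axiom links, which pair occurrences
-- of atoms in A.  So s1 and s2 differ in some link (α , β).  Represent a bit
-- by a term that keeps or swaps the components of a pair.  Instantiating the
-- atoms of A by a bit together with a mark, planting the mark at β and
-- looking for it at α, one gets a closed Q that sends s1 and s2 to distinct
-- bits.  Through Q an argument x selects one of the realisers of f (0 , ·) and
-- f (1 , ·).  The other one is applied to s1 , … , s1; its value is turned into
-- a bit by Q and absorbed by letting it act on a pair of identities.

open import Defs
open import Data.Nat using (ℕ; _≤_)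
open import Data.Bool using (Bool)
open import Data.List using ([])
open import Data.Vec using (Vec; map; replicate)
open import Data.Product using (_×_; ∃-syntax)
open import Relation.Nullary using (¬_)
open import Relation.Binary.PropositionalEquality using (_≡_)
open import Function.Bundles using (_⇔_)
open import Data.Nat using (zero; suc; _≟_; _<_; _+_; s≤s; z≤n; _≤?_; _<?_; _≡ᵇ_)
import Data.Nat.Properties as ℕ
open import Data.Bool using (true; false; not; _∧_; _xor_; T)
import Data.Bool.Properties as Bool
open import Data.List as List using (List; _∷_; _++_)
import Data.List.Properties as List
open import Data.List.Extrema.Nat using (max; xs≤max; ⊥≤max)
open import Data.List.Membership.Propositional using (_∈_; _∉_; find; lose)
open import Data.List.Membership.Propositional.Properties using (∈-++⁺ˡ; ∈-++⁺ʳ; ∈-++⁻; ∈-filter⁺; ∈-filter⁻; ∈-map⁺)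
open import Data.List.Membership.DecPropositional _≟_ using (_∈?_)
open import Data.List.Relation.Unary.Any as Any using (Any; here; there)
open import Data.List.Relation.Unary.All as All using (All; []; _∷_)
import Data.List.Relation.Unary.All.Properties as AllP
open import Data.List.Relation.Unary.AllPairs using ([]; _∷_)
open import Data.List.Relation.Unary.Unique.Propositional using (Unique)
import Data.List.Relation.Unary.Unique.Propositional.Properties as Uniq
import Data.List.Relation.Unary.Unique.DecPropositional as UniqueDec
open import Data.List.Relation.Binary.Permutation.Propositional as ↭ using (_↭_; ↭-refl; ↭-sym; ↭-trans; prep; swap)
import Data.List.Relation.Binary.Permutation.Propositional.Properties as ↭
import Data.List.Relation.Binary.Permutation.Setoid.Properties as ↭SP
open import Data.Vec as Vec using ()
import Data.Vec.Properties as Vec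
open import Data.Fin as Fin using (Fin)
open import Data.Product using (_,_; proj₁; proj₂)
open import Data.Sum using (_⊎_; inj₁; inj₂)
open import Data.Empty using (⊥; ⊥-elim)
open import Data.Unit using (⊤; tt)
open import Function using (_∘_; id; case_of_)
open import Function.Bundles using (mk⇔)
open import Relation.Nullary using (¬?; Dec; yes; no)
open import Relation.Nullary.Decidable using (does; dec-true; dec-false; map′; _×-dec_; _⊎-dec_; from-yes; decidable-stable)
open import Relation.Binary.PropositionalEquality using (_≢_; refl; sym; trans; cong; cong₂; subst₂) renaming (subst to ≡subst)
import Relation.Binary.PropositionalEquality as PE
open import Algebra.Bundles using (module CommutativeRing)
open import Algebra.Solver.CommutativeMonoid (CommutativeRing.+-commutativeMonoid Bool.xor-∧-commutativeRing) using (solve; _⊜_; _⊕_)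

-- Preserving types from right to left excludes η from the untyped conversion:
-- `lam x (app t (var x))` forces an arrow type on `t`. Cut-free proofs, however, have axioms at
-- atoms only and are reached by η-expansion. A term is therefore compared with its cut-free form in
-- two ways: by the typed equality, which has η, and by a logical relation under which no test can
-- tell the two apart.
--
-- Linearity forbids copying a bit as well as ignoring one. A test can only add bits modulo 2, by
-- composing them, and every bit has to arrive somewhere. So links from α to β are counted by
-- parity, which is enough because a proof has at most one such link. Absorbing a bit is possible
-- because both bits fix a pair of equal components.
--
-- Formula occurrences are named by intervals of numbers that depend on the type alone, so the links
-- of two proofs of `A` can be compared. Proofs with equal links are matched rule by rule. At a rule
-- with two premises, colouring the names by premise shows how the other proof has to be divided.

variable
  A B C : Ty
  t s u v w t' s' u' v' : Tm
  σ τ υ : Subst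
  g h : ℕ → Ty
  xs ys zs : List ℕ
  x y z : ℕ

infix 4 _#_ _≋_ _⊑_

_#_ _⊑_ _≋_ : List ℕ → List ℕ → Set
xs # ys = ∀ {z} → z ∈ xs → z ∈ ys → ⊥
xs ⊑ ys = ∀ {z} → z ∈ xs → z ∈ ys
xs ≋ ys = (xs ⊑ ys) × (ys ⊑ xs)

-- Linearity, typing and substitution on raw terms

∈─⁺ : z ∈ xs → z ≢ x → z ∈ xs ─ x
∈─⁺ {x = x} p q = ∈-filter⁺ (λ z → ¬? (z ≟ x)) p q

∈─⁻ : z ∈ xs ─ x → z ∈ xs × z ≢ x
∈─⁻ {x = x} p = ∈-filter⁻ (λ z → ¬? (z ≟ x)) p

∈++ : ∀ (xs : List ℕ) → z ∈ xs ++ ys → z ∈ xs ⊎ z ∈ ys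
∈++ xs p = ∈-++⁻ xs p

inl : z ∈ xs → z ∈ xs ++ ys
inl = ∈-++⁺ˡ

inr : ∀ (xs : List ℕ) → z ∈ ys → z ∈ xs ++ ys
inr xs = ∈-++⁺ʳ xs

∈1 : z ∈ x ∷ [] → z ≡ x
∈1 (here e) = e

-- Linearity is kept apart from typing. With the use of variables controlled here, typing can take
-- total environments, and the splitting and exchange of contexts do not appear before `⊩⇒⊢`.
Lin : Tm → Set
Lin (var x)        = ⊤
Lin (app t s)      = Lin t × Lin s × (FV t # FV s)
Lin (lam x t)      = Lin t × x ∈ FV t
Lin (pair s t)     = Lin s × Lin t × (FV s # FV t)
Lin (letp x y s t) = Lin s × Lin t × x ∈ FV t × y ∈ FV t × x ≢ y × (FV s # ((FV t ─ x) ─ y))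

upd : (ℕ → Ty) → ℕ → Ty → ℕ → Ty
upd g x A z with z ≟ x
... | yes _ = A
... | no _  = g z

upd-same : ∀ g x A → upd g x A x ≡ A
upd-same g x A with x ≟ x
... | yes _ = refl
... | no x≢x = ⊥-elim (x≢x refl)

upd-other : ∀ g x A → z ≢ x → upd g x A z ≡ g z
upd-other {z} g x A z≢x with z ≟ x
... | yes e = ⊥-elim (z≢x e)
... | no _ = refl

upd-cong : ∀ x A → (z ≢ x → g z ≡ h z) → upd g x A z ≡ upd h x A z
upd-cong {z} x A e with z ≟ x
... | yes _ = refl
... | no z≢x = e z≢x

infix 4 _⊩_∶_

-- Typing as in the simply typed calculus. On linear terms it agrees with `⊢`, by `⊩⇒⊢` and
-- `⊢⇒Cart`. In `⊩let` the outer update belongs to `x`, as `look` tries `x` first.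
data _⊩_∶_ : (ℕ → Ty) → Tm → Ty → Set where
  ⊩var  : g x ≡ A → g ⊩ var x ∶ A
  ⊩app  : g ⊩ t ∶ A ⊸ B → g ⊩ s ∶ A → g ⊩ app t s ∶ B
  ⊩lam  : upd g x A ⊩ t ∶ B → g ⊩ lam x t ∶ A ⊸ B
  ⊩pair : g ⊩ s ∶ A → g ⊩ t ∶ B → g ⊩ pair s t ∶ A ⊗ B
  ⊩let  : g ⊩ s ∶ A ⊗ B → upd (upd g y B) x A ⊩ t ∶ C → g ⊩ letp x y s t ∶ C

⊩-ext : (∀ {z} → z ∈ FV t → g z ≡ h z) → g ⊩ t ∶ A → h ⊩ t ∶ A
⊩-ext e (⊩var p) = ⊩var (trans (sym (e (here refl))) p)
⊩-ext {t = app t s} e (⊩app p q) = ⊩app (⊩-ext (e ∘ inl) p) (⊩-ext (e ∘ inr (FV t)) q)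
⊩-ext e (⊩lam {x = x} {A = A} p) = ⊩lam (⊩-ext (λ m → upd-cong x A λ ne → e (∈─⁺ m ne)) p)
⊩-ext {t = pair t s} e (⊩pair p q) = ⊩pair (⊩-ext (e ∘ inl) p) (⊩-ext (e ∘ inr (FV t)) q)
⊩-ext {t = letp _ _ s _} e (⊩let {A = A} {B = B} {y = y} {x = x} p q) =
  ⊩let (⊩-ext (e ∘ inl) p)
       (⊩-ext (λ m → upd-cong x A λ ne → upd-cong y B λ ne' → e (inr (FV s) (∈─⁺ (∈─⁺ m ne) ne'))) q)

look-here : ∀ x u σ → look ((x , u) ∷ σ) x ≡ u
look-here x u σ with x ≟ x
... | yes _ = refl
... | no ne = ⊥-elim (ne refl)

look-there : ∀ u σ → z ≢ x → look ((x , u) ∷ σ) z ≡ look σ z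
look-there {z} {x} u σ ne with z ≟ x
... | yes e = ⊥-elim (ne e)
... | no _ = refl

drop-same : ∀ x σ → look (dropS x σ) x ≡ var x
drop-same x [] = refl
drop-same x ((y , u) ∷ σ) with x ≟ y
... | yes e = drop-same x σ
... | no ne = trans (look-there u (dropS x σ) ne) (drop-same x σ)

drop-other : ∀ σ → z ≢ x → look (dropS x σ) z ≡ look σ z
drop-other [] ne = refl
drop-other {z} {x} ((y , u) ∷ σ) ne with x ≟ y
drop-other {z} {x} ((y , u) ∷ σ) ne | yes refl = trans (drop-other σ ne) (sym (look-there u σ ne))
drop-other {z} {x} ((y , u) ∷ σ) ne | no ne' with z ≟ y
... | yes _ = refl
... | no _ = drop-other σ ne

dropFVS : ∀ x σ → FVS (dropS x σ) ⊑ FVS σ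
dropFVS x [] m = m
dropFVS x ((y , u) ∷ σ) m with x ≟ y
... | yes _ = inr (FV u) (dropFVS x σ m)
... | no _ with ∈++ (FV u) m
...   | inj₁ p = inl p
...   | inj₂ p = inr (FV u) (dropFVS x σ p)

look-FV : ∀ σ → w ≡ look σ z → x ∈ FV w → (x ≡ z × look σ z ≡ var z) ⊎ x ∈ FVS σ
look-FV [] refl m = inj₁ (∈1 m , refl)
look-FV {z = z} ((y , u) ∷ σ) e m with z ≟ y
look-FV ((y , u) ∷ σ) refl m | yes _ = inj₂ (inl m)
look-FV ((y , u) ∷ σ) e m | no _ with look-FV σ e m
... | inj₁ p = inj₁ p
... | inj₂ p = inj₂ (inr (FV u) p)

drop₂ : ℕ → ℕ → Subst → Subst
drop₂ x y σ = dropS y (dropS x σ)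

drop₂-x : ∀ x y σ → look (drop₂ x y σ) x ≡ var x
drop₂-x x y σ with x ≟ y
... | yes refl = drop-same x (dropS x σ)
... | no ne = trans (drop-other (dropS x σ) ne) (drop-same x σ)

drop₂-y : ∀ x y σ → look (drop₂ x y σ) y ≡ var y
drop₂-y x y σ = drop-same y (dropS x σ)

drop₂-other : ∀ σ → z ≢ x → z ≢ y → look (drop₂ x y σ) z ≡ look σ z
drop₂-other {x = x} σ n m = trans (drop-other (dropS x σ) m) (drop-other σ n)

NC : Subst → Tm → Set
NC σ t = FVS σ # BV t

NC→NoCapture : NC σ t → NoCapture σ t
NC→NoCapture nc = All.tabulate λ p q → nc p q

NC-lam : ∀ σ x t → NC σ (lam x t) → NC (dropS x σ) t
NC-lam σ x t nc p q = nc (dropFVS x σ p) (there q)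

NC-let : ∀ σ x y s t → NC σ (letp x y s t) → NC (drop₂ x y σ) t
NC-let σ x y s t nc p q = nc (dropFVS x σ (dropFVS y (dropS x σ) p)) (there (there (inr (BV s) q)))

NC-x : ∀ σ → z ∈ FV (look σ x) → (z ∈ FVS σ → z ≢ y) → x ≢ y → z ≢ y
NC-x σ m nc ne with look-FV σ refl m
... | inj₁ (refl , _) = ne
... | inj₂ p = nc p

FV-subst⁻ : ∀ σ t → NC σ t → z ∈ FV (subst σ t) → ∃[ w ] (w ∈ FV t × z ∈ FV (look σ w))
FV-subst⁻ σ (var x) nc m = x , here refl , m
FV-subst⁻ σ (app t s) nc m with ∈++ (FV (subst σ t)) m
... | inj₁ p = case FV-subst⁻ σ t (λ a b → nc a (inl b)) p of λ (w , a , b) → w , inl a , b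
... | inj₂ p = case FV-subst⁻ σ s (λ a b → nc a (inr (BV t) b)) p of λ (w , a , b) → w , inr (FV t) a , b
FV-subst⁻ {z} σ (lam x t) nc m with ∈─⁻ m
... | p , z≢x with FV-subst⁻ (dropS x σ) t (NC-lam σ x t nc) p
... | w , a , b with w ≟ x
... | yes refl = ⊥-elim (z≢x (∈1 (≡subst (λ k → z ∈ FV k) (drop-same x σ) b)))
... | no ne = w , ∈─⁺ a ne , ≡subst (λ k → z ∈ FV k) (drop-other σ ne) b
FV-subst⁻ σ (pair t s) nc m with ∈++ (FV (subst σ t)) m
... | inj₁ p = case FV-subst⁻ σ t (λ a b → nc a (inl b)) p of λ (w , a , b) → w , inl a , b
... | inj₂ p = case FV-subst⁻ σ s (λ a b → nc a (inr (BV t) b)) p of λ (w , a , b) → w , inr (FV t) a , b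
FV-subst⁻ {z} σ (letp x y s t) nc m with ∈++ (FV (subst σ s)) m
... | inj₁ p = case FV-subst⁻ σ s (λ a b → nc a (there (there (inl b)))) p of λ (w , a , b) → w , inl a , b
... | inj₂ p with ∈─⁻ p
... | p' , z≢y with ∈─⁻ p'
... | p'' , z≢x with FV-subst⁻ (drop₂ x y σ) t (NC-let σ x y s t nc) p''
... | w , a , b with w ≟ x | w ≟ y
... | yes refl | _ = ⊥-elim (z≢x (∈1 (≡subst (λ k → z ∈ FV k) (drop₂-x w y σ) b)))
... | no _ | yes refl = ⊥-elim (z≢y (∈1 (≡subst (λ k → z ∈ FV k) (drop₂-y x w σ) b)))
... | no ne | no ne' = w , inr (FV s) (∈─⁺ (∈─⁺ a ne) ne') , ≡subst (λ k → z ∈ FV k) (drop₂-other σ ne ne') b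

FV-subst⁺ : ∀ σ t → NC σ t → x ∈ FV t → z ∈ FV (look σ x) → z ∈ FV (subst σ t)
FV-subst⁺ σ (var x) nc (here refl) m = m
FV-subst⁺ σ (app t s) nc p m with ∈++ (FV t) p
... | inj₁ q = inl (FV-subst⁺ σ t (λ a b → nc a (inl b)) q m)
... | inj₂ q = inr (FV (subst σ t)) (FV-subst⁺ σ s (λ a b → nc a (inr (BV t) b)) q m)
FV-subst⁺ {z = z} σ (lam x t) nc p m with ∈─⁻ p
... | q , ne = ∈─⁺ (FV-subst⁺ (dropS x σ) t (NC-lam σ x t nc) q (≡subst (λ k → z ∈ FV k) (sym (drop-other σ ne)) m))
                   (NC-x σ m (λ { i refl → nc i (here refl) }) ne)
FV-subst⁺ σ (pair t s) nc p m with ∈++ (FV t) p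
... | inj₁ q = inl (FV-subst⁺ σ t (λ a b → nc a (inl b)) q m)
... | inj₂ q = inr (FV (subst σ t)) (FV-subst⁺ σ s (λ a b → nc a (inr (BV t) b)) q m)
FV-subst⁺ {z = z} σ (letp x y s t) nc p m with ∈++ (FV s) p
... | inj₁ q = inl (FV-subst⁺ σ s (λ a b → nc a (there (there (inl b)))) q m)
... | inj₂ q with ∈─⁻ q
... | q' , ne' with ∈─⁻ q'
... | q'' , ne = inr (FV (subst σ s)) (∈─⁺ (∈─⁺
        (FV-subst⁺ (drop₂ x y σ) t (NC-let σ x y s t nc) q'' (≡subst (λ k → z ∈ FV k) (sym (drop₂-other σ ne ne')) m))
        (NC-x σ m (λ { i refl → nc i (here refl) }) ne))
        (NC-x σ m (λ { i refl → nc i (there (here refl)) }) ne'))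

-- The condition under which a substitution cannot create a second occurrence of a variable.
Sep-look : Subst → Tm → Set
Sep-look σ t = ∀ {x y} → x ∈ FV t → y ∈ FV t → x ≢ y → FV (look σ x) # FV (look σ y)

fresh-var : ∀ σ → (z ∈ FVS σ → ⊥) → z ≢ x → z ∈ FV (look σ x) → ⊥
fresh-var σ nf ne m with look-FV σ refl m
... | inj₁ (e , _) = ne e
... | inj₂ p = nf p

Sep-look-lam : ∀ σ x t → NC σ (lam x t) → Sep-look σ (lam x t) → Sep-look (dropS x σ) t
Sep-look-lam σ x t nc sep {a} {b} p q ne {z} m n with a ≟ x | b ≟ x
... | yes refl | yes refl = ne refl
... | yes refl | no nb = case ∈1 (≡subst (λ k → z ∈ FV k) (drop-same x σ) m) of
        λ { refl → fresh-var σ (λ i → nc i (here refl)) (nb ∘ sym) (≡subst (λ k → z ∈ FV k) (drop-other σ nb) n) }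
... | no na | yes refl = case ∈1 (≡subst (λ k → z ∈ FV k) (drop-same x σ) n) of
        λ { refl → fresh-var σ (λ i → nc i (here refl)) (na ∘ sym) (≡subst (λ k → z ∈ FV k) (drop-other σ na) m) }
... | no na | no nb = sep (∈─⁺ p na) (∈─⁺ q nb) ne
        (≡subst (λ k → z ∈ FV k) (drop-other σ na) m) (≡subst (λ k → z ∈ FV k) (drop-other σ nb) n)

Lin-look-lam : ∀ σ x t → (∀ {z} → z ∈ FV (lam x t) → Lin (look σ z)) → ∀ {z} → z ∈ FV t → Lin (look (dropS x σ) z)
Lin-look-lam σ x t ll {z} m with z ≟ x
... | yes refl = ≡subst Lin (sym (drop-same x σ)) tt
... | no ne = ≡subst Lin (sym (drop-other σ ne)) (ll (∈─⁺ m ne))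

Lin-subst : ∀ σ t → NC σ t → Lin t → (∀ {z} → z ∈ FV t → Lin (look σ z)) → Sep-look σ t → Lin (subst σ t)
Lin-subst σ (var x) nc l ll sep = ll (here refl)
Lin-subst σ (app t s) nc (lt , ls , d) ll sep =
  Lin-subst σ t nct lt (ll ∘ inl) (λ p q → sep (inl p) (inl q)) ,
  Lin-subst σ s ncs ls (ll ∘ inr (FV t)) (λ p q → sep (inr (FV t) p) (inr (FV t) q)) ,
  λ p q → case FV-subst⁻ σ t nct p of λ (a , i , i') → case FV-subst⁻ σ s ncs q of λ (b , j , j') →
    sep (inl i) (inr (FV t) j) (λ { refl → d i j }) i' j'
  where nct : NC σ t
        nct a b = nc a (inl b)
        ncs : NC σ s
        ncs a b = nc a (inr (BV t) b)
Lin-subst σ (lam x t) nc (l , m) ll sep =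
  Lin-subst (dropS x σ) t (NC-lam σ x t nc) l (Lin-look-lam σ x t ll) (Sep-look-lam σ x t nc sep) ,
  FV-subst⁺ (dropS x σ) t (NC-lam σ x t nc) m (≡subst (λ k → x ∈ FV k) (sym (drop-same x σ)) (here refl))
Lin-subst σ (pair t s) nc (lt , ls , d) ll sep =
  Lin-subst σ t nct lt (ll ∘ inl) (λ p q → sep (inl p) (inl q)) ,
  Lin-subst σ s ncs ls (ll ∘ inr (FV t)) (λ p q → sep (inr (FV t) p) (inr (FV t) q)) ,
  λ p q → case FV-subst⁻ σ t nct p of λ (a , i , i') → case FV-subst⁻ σ s ncs q of λ (b , j , j') →
    sep (inl i) (inr (FV t) j) (λ { refl → d i j }) i' j'
  where nct : NC σ t
        nct a b = nc a (inl b)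
        ncs : NC σ s
        ncs a b = nc a (inr (BV t) b)
Lin-subst σ (letp x y s t) nc (ls , lt , mx , my , ne , d) ll sep =
  Lin-subst σ s ncs ls (ll ∘ inl) (λ p q → sep (inl p) (inl q)) ,
  Lin-subst (drop₂ x y σ) t nct lt
    -- A let binds like two abstractions. The conditions are passed through `lam x (lam y t)`, where
    -- the two variables are removed in the other order; `swap─` accounts for that.
    (Lin-look-lam (dropS x σ) y t λ m → case ∈─⁻ {xs = FV t} {x = y} m of λ (m' , my) →
        Lin-look-lam σ x (lam y t) (λ m → ll (inr (FV s) (swap─ {xs = FV t} m))) (∈─⁺ m' my))
    (Sep-look-lam (dropS x σ) y t nc₂ (Sep-look-lam σ x (lam y t) nc₁ (λ p q → sep (inr (FV s) (swap─ {xs = FV t} p)) (inr (FV s) (swap─ {xs = FV t} q))))) ,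
  FV-subst⁺ (drop₂ x y σ) t nct mx (≡subst (λ k → x ∈ FV k) (sym (drop₂-x x y σ)) (here refl)) ,
  FV-subst⁺ (drop₂ x y σ) t nct my (≡subst (λ k → y ∈ FV k) (sym (drop₂-y x y σ)) (here refl)) ,
  ne ,
  λ p q → case ∈─⁻ q of λ (q , zy) → case ∈─⁻ q of λ (q , zx) →
    case FV-subst⁻ σ s ncs p of λ (a , i , i') → case FV-subst⁻ (drop₂ x y σ) t nct q of λ (b , j , j') → lem p i i' zy zx j j'
  where
    ncs : NC σ s
    ncs a b = nc a (there (there (inl b)))
    nct : NC (drop₂ x y σ) t
    nct = NC-let σ x y s t nc
    nc₁ : NC σ (lam x (lam y t))
    nc₁ a (here e) = nc a (here e)
    nc₁ a (there (here e)) = nc a (there (here e))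
    nc₁ a (there (there b)) = nc a (there (there (inr (BV s) b)))
    nc₂ : NC (dropS x σ) (lam y t)
    nc₂ = NC-lam σ x (lam y t) nc₁
    swap─ : ∀ {z xs} → z ∈ (xs ─ y) ─ x → z ∈ (xs ─ x) ─ y
    swap─ {xs = xs} m = case ∈─⁻ m of λ (m , nx) → case ∈─⁻ {xs = xs} m of λ (m , ny) → ∈─⁺ (∈─⁺ {xs = xs} m nx) ny
    lem : ∀ {a b z} → z ∈ FV (subst σ s) → a ∈ FV s → z ∈ FV (look σ a) → z ≢ y → z ≢ x → b ∈ FV t → z ∈ FV (look (drop₂ x y σ) b) → ⊥
    lem {a} {b} {z} p i i' zy zx j j' with b ≟ x | b ≟ y
    ... | yes refl | _ = zx (∈1 (≡subst (λ k → z ∈ FV k) (drop₂-x b y σ) j'))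
    ... | no _ | yes refl = zy (∈1 (≡subst (λ k → z ∈ FV k) (drop₂-y x b σ) j'))
    ... | no nx | no ny = sep (inl i) (inr (FV s) j⁺) (λ { refl → d i j⁺ }) i' (≡subst (λ k → z ∈ FV k) (drop₂-other σ nx ny) j')
      where j⁺ = ∈─⁺ (∈─⁺ j nx) ny

⊩-subst : ∀ σ t → NC σ t → (∀ {z} → z ∈ FV t → h ⊩ look σ z ∶ g z) → g ⊩ t ∶ A → h ⊩ subst σ t ∶ A
⊩-subst σ (var x) nc e (⊩var refl) = e (here refl)
⊩-subst σ (app t s) nc e (⊩app p q) =
  ⊩app (⊩-subst σ t (λ a b → nc a (inl b)) (e ∘ inl) p) (⊩-subst σ s (λ a b → nc a (inr (BV t) b)) (e ∘ inr (FV t)) q)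
⊩-subst {h} {g} σ (lam x t) nc e (⊩lam {A = A} p) = ⊩lam (⊩-subst (dropS x σ) t (NC-lam σ x t nc) f p)
  where
    f : ∀ {z} → z ∈ FV t → upd h x A ⊩ look (dropS x σ) z ∶ upd g x A z
    f {z} m with z ≟ x
    ... | yes refl = ≡subst (λ k → _ ⊩ k ∶ A) (sym (drop-same x σ)) (⊩var (upd-same h x A))
    ... | no ne = ≡subst (λ k → _ ⊩ k ∶ g z) (sym (drop-other σ ne))
      (⊩-ext (λ {i} j → sym (upd-other h x A (NC-x σ j (λ { k refl → nc k (here refl) }) ne))) (e (∈─⁺ m ne)))
⊩-subst σ (pair t s) nc e (⊩pair p q) =
  ⊩pair (⊩-subst σ t (λ a b → nc a (inl b)) (e ∘ inl) p) (⊩-subst σ s (λ a b → nc a (inr (BV t) b)) (e ∘ inr (FV t)) q)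
⊩-subst {h} {g} σ (letp x y s t) nc e (⊩let {A = A} {B = B} p q) =
  ⊩let (⊩-subst σ s (λ a b → nc a (there (there (inl b)))) (e ∘ inl) p)
       (⊩-subst (drop₂ x y σ) t (NC-let σ x y s t nc) f q)
  where
    f : ∀ {z} → z ∈ FV t → upd (upd h y B) x A ⊩ look (drop₂ x y σ) z ∶ upd (upd g y B) x A z
    f {z} m with z ≟ x
    ... | yes refl = ≡subst (λ k → _ ⊩ k ∶ A) (sym (drop₂-x x y σ)) (⊩var (upd-same (upd h y B) x A))
    ... | no ne with z ≟ y
    ...   | yes refl = ≡subst (λ k → _ ⊩ k ∶ B) (sym (drop₂-y x y σ)) (⊩var (trans (upd-other (upd h y B) x A ne) (upd-same h y B)))
    ...   | no ne' = ≡subst (λ k → _ ⊩ k ∶ g z) (sym (drop₂-other σ ne ne'))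
      (⊩-ext (λ {i} j → sym (trans (upd-other (upd h y B) x A (NC-x σ j (λ { k refl → nc k (here refl) }) ne))
                                    (upd-other h y B (NC-x σ j (λ { k refl → nc k (there (here refl)) }) ne'))))
             (e (inr (FV s) (∈─⁺ (∈─⁺ m ne) ne'))))

merge : List ℕ → (ℕ → Ty) → (ℕ → Ty) → ℕ → Ty
merge xs g h z with z ∈? xs
... | yes _ = g z
... | no _ = h z

merge-l : ∀ xs g h → z ∈ xs → merge xs g h z ≡ g z
merge-l {z} xs g h m with z ∈? xs
... | yes _ = refl
... | no n = ⊥-elim (n m)

merge-r : ∀ xs g h → (z ∈ xs → ⊥) → merge xs g h z ≡ h z
merge-r {z} xs g h n with z ∈? xs
... | yes m = ⊥-elim (n m)
... | no _ = refl

-- The converse of ⊩-subst: in a linear term every variable has one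
-- occurrence, so the types of the substituted terms can be read off.
Expand : (ℕ → Ty) → Subst → Tm → Ty → Set
Expand h σ t A = ∃[ g ] ((g ⊩ t ∶ A) × (∀ {z} → z ∈ FV t → h ⊩ look σ z ∶ g z))

⊩var⁻ : g ⊩ var x ∶ A → g x ≡ A
⊩var⁻ (⊩var e) = e

⊩-expand : ∀ σ t → NC σ t → Lin t → h ⊩ subst σ t ∶ A → Expand h σ t A

-- Each subterm yields an environment of its own. Linearity makes their relevant parts disjoint, so
-- both survive in the merged one.
expand-merge : ∀ {σ t s A B} → FV t # FV s → Expand h σ t A → Expand h σ s B →
  ∃[ g ] ((g ⊩ t ∶ A) × (g ⊩ s ∶ B) × (∀ {z} → z ∈ FV t ++ FV s → h ⊩ look σ z ∶ g z))
expand-merge {h} {σ} {t} {s} d (g₁ , p , e) (g₂ , q , f) =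
  merge (FV t) g₁ g₂ ,
  ⊩-ext (λ m → sym (merge-l (FV t) g₁ g₂ m)) p ,
  ⊩-ext (λ m → sym (merge-r (FV t) g₁ g₂ (λ m' → d m' m))) q ,
  λ {z} m → case ∈++ (FV t) m of λ
    { (inj₁ i) → ≡subst (λ k → h ⊩ look σ z ∶ k) (sym (merge-l (FV t) g₁ g₂ i)) (e i)
    ; (inj₂ i) → ≡subst (λ k → h ⊩ look σ z ∶ k) (sym (merge-r (FV t) g₁ g₂ (λ m' → d m' i))) (f i) }

⊩-expand {h} {A} σ (var x) nc l p = (λ _ → A) , ⊩var refl , λ { (here refl) → p }
⊩-expand σ (app t s) nc (lt , ls , d) (⊩app p q)
  with expand-merge {σ = σ} {t} {s} d (⊩-expand σ t (λ a b → nc a (inl b)) lt p) (⊩-expand σ s (λ a b → nc a (inr (BV t) b)) ls q)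
... | G , a , b , c = G , ⊩app a b , c
⊩-expand {h} σ (lam x t) nc (l , mx) (⊩lam {A = A} p) with ⊩-expand (dropS x σ) t (NC-lam σ x t nc) l p
... | g , q , e = g , ⊩lam (⊩-ext (λ {z} m → eq m) q) , f
  where
    -- The occurrence of `x` that linearity guarantees is used here: under the binder `x` is
    -- replaced by itself, and its type there fixes `g x`.
    gx : g x ≡ A
    gx = sym (trans (sym (upd-same h x A)) (⊩var⁻ (≡subst (λ k → upd h x A ⊩ k ∶ g x) (drop-same x σ) (e mx))))
    eq : ∀ {z} → z ∈ FV t → g z ≡ upd g x A z
    eq {z} m with z ≟ x
    ... | yes refl = gx
    ... | no _ = refl
    f : ∀ {z} → z ∈ FV t ─ x → h ⊩ look σ z ∶ g z
    f {z} m with ∈─⁻ m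
    ... | i , ne = ⊩-ext (λ {k} j → upd-other h x A (NC-x σ j (λ { k refl → nc k (here refl) }) ne))
                     (≡subst (λ k → upd h x A ⊩ k ∶ g z) (drop-other σ ne) (e i))
⊩-expand σ (pair t s) nc (lt , ls , d) (⊩pair p q)
  with expand-merge {σ = σ} {t} {s} d (⊩-expand σ t (λ a b → nc a (inl b)) lt p) (⊩-expand σ s (λ a b → nc a (inr (BV t) b)) ls q)
... | G , a , b , c = G , ⊩pair a b , c
⊩-expand {h} {C} σ (letp x y s t) nc (ls , lt , mx , my , x≢y , d) (⊩let {A = A} {B = B} p q)
  with ⊩-expand σ s (λ a b → nc a (there (there (inl b)))) ls p | ⊩-expand (drop₂ x y σ) t (NC-let σ x y s t nc) lt q
... | g₁ , p' , e₁ | g₂ , q' , e₂ = G , ⊩let (⊩-ext (λ m → sym (merge-l (FV s) g₁ g₂ m)) p') (⊩-ext eq q') , f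
  where
    G = merge (FV s) g₁ g₂
    h' = upd (upd h y B) x A
    gx : g₂ x ≡ A
    gx = sym (trans (sym (upd-same (upd h y B) x A)) (⊩var⁻ (≡subst (λ k → h' ⊩ k ∶ g₂ x) (drop₂-x x y σ) (e₂ mx))))
    gy : g₂ y ≡ B
    gy = sym (trans (sym (trans (upd-other (upd h y B) x A (x≢y ∘ sym)) (upd-same h y B)))
                    (⊩var⁻ (≡subst (λ k → h' ⊩ k ∶ g₂ y) (drop₂-y x y σ) (e₂ my))))
    eq : ∀ {z} → z ∈ FV t → g₂ z ≡ upd (upd G y B) x A z
    eq {z} m with z ≟ x
    ... | yes refl = gx
    ... | no ne with z ≟ y
    ...   | yes refl = gy
    ...   | no ne' = sym (merge-r (FV s) g₁ g₂ (λ i → d i (∈─⁺ (∈─⁺ m ne) ne')))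
    f : ∀ {z} → z ∈ FV s ++ ((FV t ─ x) ─ y) → h ⊩ look σ z ∶ G z
    f {z} m with ∈++ (FV s) m
    ... | inj₁ i = ≡subst (λ k → h ⊩ look σ z ∶ k) (sym (merge-l (FV s) g₁ g₂ i)) (e₁ i)
    ... | inj₂ j with ∈─⁻ j
    ...   | j' , ny with ∈─⁻ j'
    ...     | i , nx = ≡subst (λ k → h ⊩ look σ z ∶ k) (sym (merge-r (FV s) g₁ g₂ (λ i → d i j)))
      (⊩-ext (λ {k} m' → trans (upd-other (upd h y B) x A (NC-x σ m' (λ { k refl → nc k (here refl) }) nx))
                               (upd-other h y B (NC-x σ m' (λ { k refl → nc k (there (here refl)) }) ny)))
             (≡subst (λ k → h' ⊩ k ∶ g₂ z) (drop₂-other σ nx ny) (e₂ i)))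

drop-id : (z ∈ xs ─ x → look σ z ≡ var z) → z ∈ xs → look (dropS x σ) z ≡ var z
drop-id {z} {x = x} {σ = σ} e m with z ≟ x
... | yes refl = drop-same x σ
... | no ne = trans (drop-other σ ne) (e (∈─⁺ m ne))

subst-id : ∀ σ t → (∀ {z} → z ∈ FV t → look σ z ≡ var z) → subst σ t ≡ t
subst-id σ (var x) e = e (here refl)
subst-id σ (app t s) e = cong₂ app (subst-id σ t (e ∘ inl)) (subst-id σ s (e ∘ inr (FV t)))
subst-id σ (lam x t) e = cong (lam x) (subst-id (dropS x σ) t (drop-id {σ = σ} e))
subst-id σ (pair t s) e = cong₂ pair (subst-id σ t (e ∘ inl)) (subst-id σ s (e ∘ inr (FV t)))
subst-id σ (letp x y s t) e = cong₂ (letp x y) (subst-id σ s (e ∘ inl)) (subst-id (drop₂ x y σ) t f)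
  where
    f : ∀ {z} → z ∈ FV t → look (drop₂ x y σ) z ≡ var z
    f {z} m with z ≟ x | z ≟ y
    ... | yes refl | _ = drop₂-x x y σ
    ... | no _ | yes refl = drop₂-y x y σ
    ... | no nx | no ny = trans (drop₂-other σ nx ny) (e (inr (FV s) (∈─⁺ (∈─⁺ m nx) ny)))

subst-ext : ∀ σ τ t → (∀ {z} → z ∈ FV t → look σ z ≡ look τ z) → subst σ t ≡ subst τ t
subst-ext σ τ (var x) e = e (here refl)
subst-ext σ τ (app t s) e = cong₂ app (subst-ext σ τ t (e ∘ inl)) (subst-ext σ τ s (e ∘ inr (FV t)))
subst-ext σ τ (lam x t) e = cong (lam x) (subst-ext (dropS x σ) (dropS x τ) t f)
  where
    f : ∀ {z} → z ∈ FV t → look (dropS x σ) z ≡ look (dropS x τ) z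
    f {z} m with z ≟ x
    ... | yes refl = trans (drop-same x σ) (sym (drop-same x τ))
    ... | no ne = trans (drop-other σ ne) (trans (e (∈─⁺ m ne)) (sym (drop-other τ ne)))
subst-ext σ τ (pair t s) e = cong₂ pair (subst-ext σ τ t (e ∘ inl)) (subst-ext σ τ s (e ∘ inr (FV t)))
subst-ext σ τ (letp x y s t) e = cong₂ (letp x y) (subst-ext σ τ s (e ∘ inl)) (subst-ext (drop₂ x y σ) (drop₂ x y τ) t f)
  where
    f : ∀ {z} → z ∈ FV t → look (drop₂ x y σ) z ≡ look (drop₂ x y τ) z
    f {z} m with z ≟ x | z ≟ y
    ... | yes refl | _ = trans (drop₂-x x y σ) (sym (drop₂-x x y τ))
    ... | no _ | yes refl = trans (drop₂-y x y σ) (sym (drop₂-y x y τ))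
    ... | no nx | no ny = trans (drop₂-other σ nx ny) (trans (e (inr (FV s) (∈─⁺ (∈─⁺ m nx) ny))) (sym (drop₂-other τ nx ny)))

-- Only `σ` has to avoid capture: below a binder `x` the terms inserted by `σ` do not contain `x`,
-- so they do not notice that `τ` loses its entry for `x`.
subst-comp : ∀ σ τ υ t → NC σ t → (∀ {z} → z ∈ FV t → subst τ (look σ z) ≡ look υ z) → subst τ (subst σ t) ≡ subst υ t
subst-comp σ τ υ (var x) nc e = e (here refl)
subst-comp σ τ υ (app t s) nc e =
  cong₂ app (subst-comp σ τ υ t (λ a b → nc a (inl b)) (e ∘ inl)) (subst-comp σ τ υ s (λ a b → nc a (inr (BV t) b)) (e ∘ inr (FV t)))
subst-comp σ τ υ (lam x t) nc e = cong (lam x) (subst-comp (dropS x σ) (dropS x τ) (dropS x υ) t (NC-lam σ x t nc) f)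
  where
    f : ∀ {z} → z ∈ FV t → subst (dropS x τ) (look (dropS x σ) z) ≡ look (dropS x υ) z
    f {z} m with z ≟ x
    ... | yes refl = trans (cong (subst (dropS x τ)) (drop-same x σ)) (trans (drop-same x τ) (sym (drop-same x υ)))
    ... | no ne = trans (cong (subst (dropS x τ)) (drop-other σ ne))
        (trans (subst-ext (dropS x τ) τ (look σ z) (λ j → drop-other τ (NC-x σ j (λ { k refl → nc k (here refl) }) ne)))
        (trans (e (∈─⁺ m ne)) (sym (drop-other υ ne))))
subst-comp σ τ υ (pair t s) nc e =
  cong₂ pair (subst-comp σ τ υ t (λ a b → nc a (inl b)) (e ∘ inl)) (subst-comp σ τ υ s (λ a b → nc a (inr (BV t) b)) (e ∘ inr (FV t)))
subst-comp σ τ υ (letp x y s t) nc e =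
  cong₂ (letp x y) (subst-comp σ τ υ s (λ a b → nc a (there (there (inl b)))) (e ∘ inl))
    (subst-comp (drop₂ x y σ) (drop₂ x y τ) (drop₂ x y υ) t (NC-let σ x y s t nc) f)
  where
    f : ∀ {z} → z ∈ FV t → subst (drop₂ x y τ) (look (drop₂ x y σ) z) ≡ look (drop₂ x y υ) z
    f {z} m with z ≟ x | z ≟ y
    ... | yes refl | _ = trans (cong (subst (drop₂ x y τ)) (drop₂-x x y σ)) (trans (drop₂-x x y τ) (sym (drop₂-x x y υ)))
    ... | no _ | yes refl = trans (cong (subst (drop₂ x y τ)) (drop₂-y x y σ)) (trans (drop₂-y x y τ) (sym (drop₂-y x y υ)))
    ... | no nx | no ny = trans (cong (subst (drop₂ x y τ)) (drop₂-other σ nx ny))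
        (trans (subst-ext (drop₂ x y τ) τ (look σ z) (λ j → drop₂-other τ
                  (NC-x σ j (λ { k refl → nc k (here refl) }) nx) (NC-x σ j (λ { k refl → nc k (there (here refl)) }) ny)))
        (trans (e (inr (FV s) (∈─⁺ (∈─⁺ m nx) ny))) (sym (drop₂-other υ nx ny))))

drop-BV : ∀ x σ → (∀ w → BV (look σ w) ⊑ xs) → ∀ w → BV (look (dropS x σ) w) ⊑ xs
drop-BV x σ e w m with w ≟ x
... | yes refl = case ≡subst (λ k → _ ∈ BV k) (drop-same x σ) m of λ ()
... | no ne = e w (≡subst (λ k → _ ∈ BV k) (drop-other σ ne) m)

BV-subst : ∀ σ t → (∀ w → BV (look σ w) ⊑ xs) → BV (subst σ t) ⊑ (BV t ++ xs)
BV-subst σ (var x) e m = e x m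
BV-subst σ (app t s) e m with ∈++ (BV (subst σ t)) m
... | inj₁ p = case ∈++ (BV t) (BV-subst σ t e p) of λ { (inj₁ q) → inl (inl q) ; (inj₂ q) → inr (BV t ++ BV s) q }
... | inj₂ p = case ∈++ (BV s) (BV-subst σ s e p) of λ { (inj₁ q) → inl (inr (BV t) q) ; (inj₂ q) → inr (BV t ++ BV s) q }
BV-subst σ (lam x t) e (here p) = here p
BV-subst σ (lam x t) e (there p) = there (BV-subst (dropS x σ) t (drop-BV x σ e) p)
BV-subst σ (pair t s) e m with ∈++ (BV (subst σ t)) m
... | inj₁ p = case ∈++ (BV t) (BV-subst σ t e p) of λ { (inj₁ q) → inl (inl q) ; (inj₂ q) → inr (BV t ++ BV s) q }
... | inj₂ p = case ∈++ (BV s) (BV-subst σ s e p) of λ { (inj₁ q) → inl (inr (BV t) q) ; (inj₂ q) → inr (BV t ++ BV s) q }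
BV-subst σ (letp x y s t) e (here p) = here p
BV-subst σ (letp x y s t) e (there (here p)) = there (here p)
BV-subst σ (letp x y s t) e (there (there m)) with ∈++ (BV (subst σ s)) m
... | inj₁ p = case ∈++ (BV s) (BV-subst σ s e p) of λ { (inj₁ q) → there (there (inl (inl q))) ; (inj₂ q) → there (there (inr (BV s ++ BV t) q)) }
... | inj₂ p = case ∈++ (BV t) (BV-subst (drop₂ x y σ) t (drop-BV y (dropS x σ) (drop-BV x σ e)) p) of λ
  { (inj₁ q) → there (there (inl (inr (BV s) q))) ; (inj₂ q) → there (there (inr (BV s ++ BV t) q)) }

-- Untyped conversion

-- Contexts of depth one: a let or a redex is moved past one layer at a time, and the layers are few
-- enough for case analysis.
data Frame : Set where
  lamF         : ℕ → Frame
  appLF appRF  : Tm → Frame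
  pairLF pairRF : Tm → Frame
  letRF        : ℕ → ℕ → Tm → Frame

variable
  F : Frame

infix 20 _⟦_⟧
_⟦_⟧ : Frame → Tm → Tm
lamF x ⟦ u ⟧      = lam x u
appLF s ⟦ u ⟧     = app u s
appRF t ⟦ u ⟧     = app t u
pairLF t ⟦ u ⟧    = pair u t
pairRF s ⟦ u ⟧    = pair s u
letRF x y s ⟦ u ⟧ = letp x y s u

FVF BVF : Frame → List ℕ
FVF (lamF x)      = []
FVF (appLF s)     = FV s
FVF (appRF t)     = FV t
FVF (pairLF t)    = FV t
FVF (pairRF s)    = FV s
FVF (letRF x y s) = FV s
BVF (lamF x)      = x ∷ []
BVF (letRF x y s) = x ∷ y ∷ []
BVF _             = []

-- Conversions are only ever exported to the typed equality, through `≈⇒≐`, so a selection of the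
-- axioms will do. The selection is made such that types are preserved in both directions.
data Step : Tm → Tm → Set where
  α-lam : z ∉ Vars t → Step (lam x t) (lam z (subst ((x , var z) ∷ []) t))
  α-let : ∀ {x' y'} → x' ≢ y' → x' ∉ Vars t → y' ∉ Vars t →
          Step (letp x y s t) (letp x' y' s (subst ((x , var x') ∷ (y , var y') ∷ []) t))
  β-lam : NC ((x , s) ∷ []) t → Step (app (lam x t) s) (subst ((x , s) ∷ []) t)
  β-let : NC ((x , u) ∷ (y , v) ∷ []) w → Step (letp x y (pair u v) w) (subst ((x , u) ∷ (y , v) ∷ []) w)
  c-comm : ∀ F → x ∉ FVF F → y ∉ FVF F → FV t # BVF F → Step (F ⟦ letp x y t u ⟧) (letp x y t (F ⟦ u ⟧))

look₁ : ∀ {x u} z → (z ≡ x × look ((x , u) ∷ []) z ≡ u) ⊎ (z ≢ x × look ((x , u) ∷ []) z ≡ var z)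
look₁ {x} z with z ≟ x
... | yes e = inj₁ (e , refl)
... | no ne = inj₂ (ne , refl)

look₂ : ∀ {x u y v} z → (z ≡ x × look ((x , u) ∷ (y , v) ∷ []) z ≡ u) ⊎
  (z ≢ x × z ≡ y × look ((x , u) ∷ (y , v) ∷ []) z ≡ v) ⊎ (z ≢ x × z ≢ y × look ((x , u) ∷ (y , v) ∷ []) z ≡ var z)
look₂ {x} {_} {y} z with z ≟ x
... | yes e = inj₁ (e , refl)
... | no ne with z ≟ y
...   | yes e = inj₂ (inj₁ (ne , e , refl))
...   | no ne' = inj₂ (inj₂ (ne , ne' , refl))

FV-subst₁⁻ : ∀ x s t → NC ((x , s) ∷ []) t → z ∈ FV (subst ((x , s) ∷ []) t) → z ∈ FV (lam x t) ++ FV s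
FV-subst₁⁻ {z} x s t nc m with FV-subst⁻ ((x , s) ∷ []) t nc m
... | w , a , b with look₁ {x} {s} w
... | inj₁ (refl , e) = inr (FV t ─ x) (≡subst (λ k → z ∈ FV k) e b)
... | inj₂ (ne , e) = case ∈1 (≡subst (λ k → z ∈ FV k) e b) of λ { refl → inl (∈─⁺ a ne) }

FV-subst₁⁺ : ∀ x s t → NC ((x , s) ∷ []) t → x ∈ FV t → z ∈ FV (lam x t) ++ FV s → z ∈ FV (subst ((x , s) ∷ []) t)
FV-subst₁⁺ {z} x s t nc mx m with ∈++ (FV t ─ x) m
... | inj₂ p = FV-subst⁺ _ t nc mx (≡subst (λ k → z ∈ FV k) (sym (look-here x s [])) p)
... | inj₁ p with ∈─⁻ p
... | i , ne = FV-subst⁺ _ t nc i (≡subst (λ k → z ∈ FV k) (sym (look-there s [] ne)) (here refl))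

Lin-subst₁ : ∀ x s t → NC ((x , s) ∷ []) t → Lin t → Lin s → (FV (lam x t) # FV s) → Lin (subst ((x , s) ∷ []) t)
Lin-subst₁ x s t nc lt ls d = Lin-subst ρ t nc lt ll sep
  where
    ρ = (x , s) ∷ []
    ll : ∀ {z} → z ∈ FV t → Lin (look ρ z)
    ll {z} m with look₁ {x} {s} z
    ... | inj₁ (_ , e) = ≡subst Lin (sym e) ls
    ... | inj₂ (_ , e) = ≡subst Lin (sym e) tt
    sep : Sep-look ρ t
    sep {a} {b} p q ne {w} i j with look₁ {x} {s} a | look₁ {x} {s} b
    ... | inj₁ (refl , _) | inj₁ (refl , _) = ne refl
    ... | inj₁ (_ , e) | inj₂ (nb , f) = case ∈1 (≡subst (λ k → w ∈ FV k) f j) of λ { refl → d (∈─⁺ q nb) (≡subst (λ k → w ∈ FV k) e i) }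
    ... | inj₂ (na , e) | inj₁ (_ , f) = case ∈1 (≡subst (λ k → w ∈ FV k) e i) of λ { refl → d (∈─⁺ p na) (≡subst (λ k → w ∈ FV k) f j) }
    ... | inj₂ (_ , e) | inj₂ (_ , f) = ne (trans (sym (∈1 (≡subst (λ k → w ∈ FV k) e i))) (∈1 (≡subst (λ k → w ∈ FV k) f j)))

FV-subst₂⁻ : ∀ x u y v t → NC ((x , u) ∷ (y , v) ∷ []) t → z ∈ FV (subst ((x , u) ∷ (y , v) ∷ []) t) → z ∈ (FV u ++ FV v) ++ ((FV t ─ x) ─ y)
FV-subst₂⁻ {z} x u y v t nc m with FV-subst⁻ ((x , u) ∷ (y , v) ∷ []) t nc m
... | w , a , b with look₂ {x} {u} {y} {v} w
... | inj₁ (refl , e) = inl (inl (≡subst (λ k → z ∈ FV k) e b))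
... | inj₂ (inj₁ (_ , refl , e)) = inl (inr (FV u) (≡subst (λ k → z ∈ FV k) e b))
... | inj₂ (inj₂ (n₁ , n₂ , e)) = case ∈1 (≡subst (λ k → z ∈ FV k) e b) of λ { refl → inr (FV u ++ FV v) (∈─⁺ (∈─⁺ a n₁) n₂) }

FV-subst₂⁺ : ∀ x u y v t → NC ((x , u) ∷ (y , v) ∷ []) t → x ≢ y → x ∈ FV t → y ∈ FV t →
  z ∈ (FV u ++ FV v) ++ ((FV t ─ x) ─ y) → z ∈ FV (subst ((x , u) ∷ (y , v) ∷ []) t)
FV-subst₂⁺ {z} x u y v t nc x≢y mx my m with ∈++ (FV u ++ FV v) m
... | inj₁ p with ∈++ (FV u) p
...   | inj₁ q = FV-subst⁺ _ t nc mx (≡subst (λ k → z ∈ FV k) (sym (look-here x u ((y , v) ∷ []))) q)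
...   | inj₂ q = FV-subst⁺ _ t nc my (≡subst (λ k → z ∈ FV k) (sym (trans (look-there u ((y , v) ∷ []) (x≢y ∘ sym)) (look-here y v []))) q)
FV-subst₂⁺ {z} x u y v t nc x≢y mx my m | inj₂ p with ∈─⁻ p
... | p' , ny with ∈─⁻ p'
... | i , nx = FV-subst⁺ _ t nc i (≡subst (λ k → z ∈ FV k) (sym (trans (look-there u ((y , v) ∷ []) nx) (look-there v [] ny))) (here refl))

Lin-subst₂ : ∀ x u y v t → NC ((x , u) ∷ (y , v) ∷ []) t → Lin t → Lin u → Lin v → (FV u # FV v) →
  ((FV u ++ FV v) # ((FV t ─ x) ─ y)) → Lin (subst ((x , u) ∷ (y , v) ∷ []) t)
Lin-subst₂ x u y v t nc lt lu lv d d' = Lin-subst ρ t nc lt ll sep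
  where
    ρ = (x , u) ∷ (y , v) ∷ []
    ll : ∀ {z} → z ∈ FV t → Lin (look ρ z)
    ll {z} m with look₂ {x} {u} {y} {v} z
    ... | inj₁ (_ , e) = ≡subst Lin (sym e) lu
    ... | inj₂ (inj₁ (_ , _ , e)) = ≡subst Lin (sym e) lv
    ... | inj₂ (inj₂ (_ , _ , e)) = ≡subst Lin (sym e) tt
    sep : Sep-look ρ t
    sep {a} {b} p q ne {w} i j with look₂ {x} {u} {y} {v} a | look₂ {x} {u} {y} {v} b
    ... | inj₁ (refl , _) | inj₁ (refl , _) = ne refl
    ... | inj₁ (_ , e) | inj₂ (inj₁ (_ , _ , f)) = d (≡subst (λ k → w ∈ FV k) e i) (≡subst (λ k → w ∈ FV k) f j)
    ... | inj₁ (_ , e) | inj₂ (inj₂ (n₁ , n₂ , f)) = case ∈1 (≡subst (λ k → w ∈ FV k) f j) of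
            λ { refl → d' (inl (≡subst (λ k → w ∈ FV k) e i)) (∈─⁺ (∈─⁺ q n₁) n₂) }
    ... | inj₂ (inj₁ (_ , _ , e)) | inj₁ (_ , f) = d (≡subst (λ k → w ∈ FV k) f j) (≡subst (λ k → w ∈ FV k) e i)
    ... | inj₂ (inj₁ (_ , refl , _)) | inj₂ (inj₁ (_ , refl , _)) = ne refl
    ... | inj₂ (inj₁ (_ , _ , e)) | inj₂ (inj₂ (n₁ , n₂ , f)) = case ∈1 (≡subst (λ k → w ∈ FV k) f j) of
            λ { refl → d' (inr (FV u) (≡subst (λ k → w ∈ FV k) e i)) (∈─⁺ (∈─⁺ q n₁) n₂) }
    ... | inj₂ (inj₂ (n₁ , n₂ , e)) | inj₁ (_ , f) = case ∈1 (≡subst (λ k → w ∈ FV k) e i) of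
            λ { refl → d' (inl (≡subst (λ k → w ∈ FV k) f j)) (∈─⁺ (∈─⁺ p n₁) n₂) }
    ... | inj₂ (inj₂ (n₁ , n₂ , e)) | inj₂ (inj₁ (_ , _ , f)) = case ∈1 (≡subst (λ k → w ∈ FV k) e i) of
            λ { refl → d' (inr (FV u) (≡subst (λ k → w ∈ FV k) f j)) (∈─⁺ (∈─⁺ p n₁) n₂) }
    ... | inj₂ (inj₂ (_ , _ , e)) | inj₂ (inj₂ (_ , _ , f)) = ne (trans (sym (∈1 (≡subst (λ k → w ∈ FV k) e i))) (∈1 (≡subst (λ k → w ∈ FV k) f j)))

c-Lin→ : ∀ F → x ∉ FVF F → y ∉ FVF F → FV t # BVF F → Lin (F ⟦ letp x y t u ⟧) → Lin (letp x y t (F ⟦ u ⟧))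
c-Lin→ {x} {y} {t} {u} (lamF z) nx ny d ((lt , lu , mx , my , ne , e) , mz) with ∈++ (FV t) mz
... | inj₁ p = ⊥-elim (d p (here refl))
... | inj₂ p with ∈─⁻ p
... | p' , zy with ∈─⁻ p'
... | mz' , zx = lt , (lu , mz') , ∈─⁺ mx (zx ∘ sym) , ∈─⁺ my (zy ∘ sym) , ne ,
  λ a b → case ∈─⁻ {xs = (FV u ─ z) ─ x} b of λ (b , wy) → case ∈─⁻ {xs = FV u ─ z} b of λ (b , wx) → case ∈─⁻ {xs = FV u} b of λ (b , _) → e a (∈─⁺ (∈─⁺ b wx) wy)
c-Lin→ {x} {y} {t} {u} (appLF s) nx ny d ((lt , lu , mx , my , ne , e) , ls , f) =
  lt , (lu , ls , g′) , inl mx , inl my , ne , h′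
  where
    g′ : FV u # FV s
    g′ {z} a b with z ≟ x | z ≟ y
    ... | yes refl | _ = nx b
    ... | _ | yes refl = ny b
    ... | no n | no m = f (inr (FV t) (∈─⁺ (∈─⁺ a n) m)) b
    h′ : FV t # (((FV u ++ FV s) ─ x) ─ y)
    h′ a b with ∈─⁻ b
    ... | b , wy with ∈─⁻ b
    ... | b , wx with ∈++ (FV u) b
    ... | inj₁ p = e a (∈─⁺ (∈─⁺ p wx) wy)
    ... | inj₂ p = f (inl a) p
c-Lin→ {x} {y} {t} {u} (appRF s) nx ny d (ls , (lt , lu , mx , my , ne , e) , f) =
  lt , (ls , lu , g′) , inr (FV s) mx , inr (FV s) my , ne , h′
  where
    g′ : FV s # FV u
    g′ {z} b a with z ≟ x | z ≟ y
    ... | yes refl | _ = nx b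
    ... | _ | yes refl = ny b
    ... | no n | no m = f b (inr (FV t) (∈─⁺ (∈─⁺ a n) m))
    h′ : FV t # (((FV s ++ FV u) ─ x) ─ y)
    h′ a b with ∈─⁻ b
    ... | b , wy with ∈─⁻ b
    ... | b , wx with ∈++ (FV s) b
    ... | inj₁ p = f p (inl a)
    ... | inj₂ p = e a (∈─⁺ (∈─⁺ p wx) wy)
c-Lin→ {t = t} {u} (pairLF s) = c-Lin→ {t = t} {u} (appLF s)
c-Lin→ {t = t} {u} (pairRF s) = c-Lin→ {t = t} {u} (appRF s)
c-Lin→ {x} {y} {t} {u} (letRF a b s) nx ny d (ls , (lt , lu , mx , my , ne , e) , ma , mb , a≢b , f) =
  lt , (ls , lu , proj₁ ma' , proj₁ mb' , a≢b , g′) ,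
  inr (FV s) (∈─⁺ (∈─⁺ mx (proj₁ (proj₂ ma') ∘ sym)) (proj₁ (proj₂ mb') ∘ sym)) ,
  inr (FV s) (∈─⁺ (∈─⁺ my (proj₂ (proj₂ ma') ∘ sym)) (proj₂ (proj₂ mb') ∘ sym)) , ne , h′
  where
    inner : ∀ {c} → c ∈ a ∷ b ∷ [] → c ∈ FV (letp x y t u) → c ∈ FV u × c ≢ x × c ≢ y
    inner i m with ∈++ (FV t) m
    ... | inj₁ p = ⊥-elim (d p i)
    ... | inj₂ p with ∈─⁻ p
    ... | p , cy with ∈─⁻ p
    ... | p , cx = p , cx , cy
    ma' = inner (here refl) ma
    mb' = inner (there (here refl)) mb
    g′ : FV s # ((FV u ─ a) ─ b)
    g′ {z} i j with z ≟ x | z ≟ y | ∈─⁻ {xs = FV u ─ a} j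
    ... | yes refl | _ | _ = nx i
    ... | _ | yes refl | _ = ny i
    ... | no n | no m | (j , zb) with ∈─⁻ {xs = FV u} j
    ... | j , za = f i (∈─⁺ (∈─⁺ (inr (FV t) (∈─⁺ (∈─⁺ j n) m)) za) zb)
    h′ : FV t # (((FV s ++ ((FV u ─ a) ─ b)) ─ x) ─ y)
    h′ i j with ∈─⁻ j
    ... | j , wy with ∈─⁻ j
    ... | j , wx with ∈++ (FV s) j
    ... | inj₁ p = f p (∈─⁺ (∈─⁺ (inl i) (λ { refl → d i (here refl) })) (λ { refl → d i (there (here refl)) }))
    ... | inj₂ p with ∈─⁻ {xs = FV u ─ a} p
    ... | p , _ with ∈─⁻ {xs = FV u} p
    ... | p , _ = e i (∈─⁺ (∈─⁺ p wx) wy)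

c-Lin← : ∀ F → x ∉ FVF F → y ∉ FVF F → FV t # BVF F → Lin (letp x y t (F ⟦ u ⟧)) → Lin (F ⟦ letp x y t u ⟧)
c-Lin← {x} {y} {t} {u} (lamF z) nx ny d (lt , (lu , mz) , mx , my , ne , e) with ∈─⁻ mx | ∈─⁻ my
... | mx' , xz | my' , yz = (lt , lu , mx' , my' , ne , f) , inr (FV t) (∈─⁺ (∈─⁺ mz (xz ∘ sym)) (yz ∘ sym))
  where
    f : FV t # ((FV u ─ x) ─ y)
    f {w} i j with w ≟ z | ∈─⁻ {xs = FV u ─ x} j
    ... | yes refl | _ = d i (here refl)
    ... | no wz | j , wy with ∈─⁻ {xs = FV u} j
    ... | j , wx = e i (∈─⁺ (∈─⁺ (∈─⁺ j wz) wx) wy)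
c-Lin← {x} {y} {t} {u} (appLF s) nx ny d (lt , (lu , ls , f) , mx , my , ne , e) =
  (lt , lu , only nx mx , only ny my , ne , λ i j → case ∈─⁻ {xs = FV u ─ x} j of λ (j , wy) → case ∈─⁻ {xs = FV u} j of λ (j , wx) → e i (∈─⁺ (∈─⁺ (inl j) wx) wy)) , ls , g′
  where
    only : ∀ {a} → a ∉ FV s → a ∈ FV u ++ FV s → a ∈ FV u
    only n m with ∈++ (FV u) m
    ... | inj₁ p = p
    ... | inj₂ p = ⊥-elim (n p)
    g′ : (FV t ++ ((FV u ─ x) ─ y)) # FV s
    g′ i j with ∈++ (FV t) i
    ... | inj₁ p = e p (∈─⁺ (∈─⁺ (inr (FV u) j) (λ { refl → nx j })) (λ { refl → ny j }))
    ... | inj₂ p with ∈─⁻ p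
    ... | p , _ with ∈─⁻ p
    ... | p , _ = f p j
c-Lin← {x} {y} {t} {u} (appRF s) nx ny d (lt , (ls , lu , f) , mx , my , ne , e) =
  ls , (lt , lu , only nx mx , only ny my , ne , λ i j → case ∈─⁻ j of λ (j , wy) → case ∈─⁻ j of λ (j , wx) → e i (∈─⁺ (∈─⁺ (inr (FV s) j) wx) wy)) , g′
  where
    only : ∀ {a} → a ∉ FV s → a ∈ FV s ++ FV u → a ∈ FV u
    only n m with ∈++ (FV s) m
    ... | inj₁ p = ⊥-elim (n p)
    ... | inj₂ p = p
    g′ : FV s # (FV t ++ ((FV u ─ x) ─ y))
    g′ j i with ∈++ (FV t) i
    ... | inj₁ p = e p (∈─⁺ (∈─⁺ (inl j) (λ { refl → nx j })) (λ { refl → ny j }))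
    ... | inj₂ p with ∈─⁻ p
    ... | p , _ with ∈─⁻ p
    ... | p , _ = f j p
c-Lin← {t = t} {u} (pairLF s) = c-Lin← {t = t} {u} (appLF s)
c-Lin← {t = t} {u} (pairRF s) = c-Lin← {t = t} {u} (appRF s)
c-Lin← {x} {y} {t} {u} (letRF a b s) nx ny d (lt , (ls , lu , ma , mb , a≢b , f) , mx , my , ne , e) =
  ls , (lt , lu , proj₁ mx' , proj₁ my' , ne , g′) ,
  inr (FV t) (∈─⁺ (∈─⁺ ma (proj₁ (proj₂ mx') ∘ sym)) (proj₁ (proj₂ my') ∘ sym)) ,
  inr (FV t) (∈─⁺ (∈─⁺ mb (proj₂ (proj₂ mx') ∘ sym)) (proj₂ (proj₂ my') ∘ sym)) , a≢b , h′
  where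
    inner : ∀ {c} → c ∉ FV s → c ∈ FV (letp a b s u) → c ∈ FV u × c ≢ a × c ≢ b
    inner i m with ∈++ (FV s) m
    ... | inj₁ p = ⊥-elim (i p)
    ... | inj₂ p with ∈─⁻ p
    ... | p , cy with ∈─⁻ p
    ... | p , cx = p , cx , cy
    mx' = inner nx mx
    my' = inner ny my
    g′ : FV t # ((FV u ─ x) ─ y)
    g′ {z} i j with z ≟ a | z ≟ b | ∈─⁻ {xs = FV u ─ x} j
    ... | yes refl | _ | _ = d i (here refl)
    ... | _ | yes refl | _ = d i (there (here refl))
    ... | no n | no m | (j , zb) with ∈─⁻ {xs = FV u} j
    ... | j , za = e i (∈─⁺ (∈─⁺ (inr (FV s) (∈─⁺ (∈─⁺ j n) m)) za) zb)
    h′ : FV s # (((FV t ++ ((FV u ─ x) ─ y)) ─ a) ─ b)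
    h′ i j with ∈─⁻ j
    ... | j , wy with ∈─⁻ j
    ... | j , wx with ∈++ (FV t) j
    ... | inj₁ p = e p (∈─⁺ (∈─⁺ (inl i) (λ { refl → nx i })) (λ { refl → ny i }))
    ... | inj₂ p with ∈─⁻ {xs = FV u ─ x} p
    ... | p , _ with ∈─⁻ {xs = FV u} p
    ... | p , _ = f i (∈─⁺ (∈─⁺ p wx) wy)

≋refl : xs ≋ xs
≋refl = id , id

FV-frame⁻ : ∀ F {u} → z ∈ FV (F ⟦ u ⟧) → z ∈ FVF F ⊎ (z ∈ FV u × z ∉ BVF F)
FV-frame⁻ (lamF x) m = case ∈─⁻ m of λ (p , n) → inj₂ (p , λ { (here e) → n e })
FV-frame⁻ (appLF s) {u} m with ∈++ (FV u) m
... | inj₁ p = inj₂ (p , λ ())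
... | inj₂ p = inj₁ p
FV-frame⁻ (appRF s) {u} m with ∈++ (FV s) m
... | inj₁ p = inj₁ p
... | inj₂ p = inj₂ (p , λ ())
FV-frame⁻ (pairLF s) {u} m = FV-frame⁻ (appLF s) {u} m
FV-frame⁻ (pairRF s) {u} m = FV-frame⁻ (appRF s) {u} m
FV-frame⁻ (letRF x y s) m with ∈++ (FV s) m
... | inj₁ p = inj₁ p
... | inj₂ p = case ∈─⁻ p of λ (p , ny) → case ∈─⁻ p of λ (p , nx) → inj₂ (p , λ { (here e) → nx e ; (there (here e)) → ny e })

FV-frame⁺ : ∀ F {u} → z ∈ FVF F ⊎ (z ∈ FV u × z ∉ BVF F) → z ∈ FV (F ⟦ u ⟧)
FV-frame⁺ (lamF x) (inj₂ (p , n)) = ∈─⁺ p (n ∘ here)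
FV-frame⁺ (appLF s) {u} (inj₁ p) = inr (FV u) p
FV-frame⁺ (appLF s) (inj₂ (p , _)) = inl p
FV-frame⁺ (appRF s) (inj₁ p) = inl p
FV-frame⁺ (appRF s) (inj₂ (p , _)) = inr (FV s) p
FV-frame⁺ (pairLF s) {u} (inj₁ p) = inr (FV u) p
FV-frame⁺ (pairLF s) (inj₂ (p , _)) = inl p
FV-frame⁺ (pairRF s) (inj₁ p) = inl p
FV-frame⁺ (pairRF s) (inj₂ (p , _)) = inr (FV s) p
FV-frame⁺ (letRF x y s) (inj₁ p) = inl p
FV-frame⁺ (letRF x y s) (inj₂ (p , n)) = inr (FV s) (∈─⁺ (∈─⁺ p (n ∘ here)) (n ∘ there ∘ here))

c-FV : ∀ F → x ∉ FVF F → y ∉ FVF F → FV t # BVF F → FV (F ⟦ letp x y t u ⟧) ≋ FV (letp x y t (F ⟦ u ⟧))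
c-FV {x} {y} {t} {u} F nx ny d = f , g′
  where
    f : FV (F ⟦ letp x y t u ⟧) ⊑ FV (letp x y t (F ⟦ u ⟧))
    f m with FV-frame⁻ F m
    ... | inj₁ p = inr (FV t) (∈─⁺ (∈─⁺ (FV-frame⁺ F (inj₁ p)) (λ { refl → nx p })) (λ { refl → ny p }))
    ... | inj₂ (p , n) with ∈++ (FV t) p
    ... | inj₁ q = inl q
    ... | inj₂ q with ∈─⁻ q
    ... | q , zy with ∈─⁻ q
    ... | q , zx = inr (FV t) (∈─⁺ (∈─⁺ (FV-frame⁺ F (inj₂ (q , n))) zx) zy)
    g′ : FV (letp x y t (F ⟦ u ⟧)) ⊑ FV (F ⟦ letp x y t u ⟧)
    g′ m with ∈++ (FV t) m
    ... | inj₁ p = FV-frame⁺ F (inj₂ (inl p , d p))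
    ... | inj₂ p with ∈─⁻ p
    ... | p , zy with ∈─⁻ p
    ... | p , zx with FV-frame⁻ F p
    ... | inj₁ q = FV-frame⁺ F (inj₁ q)
    ... | inj₂ (q , n) = FV-frame⁺ F (inj₂ (inr (FV t) (∈─⁺ (∈─⁺ q zx) zy) , n))

Vars-FV : x ∉ Vars t → x ∉ FV t
Vars-FV n m = n (inl m)

Vars-NC₁ : z ∉ Vars t → NC ((x , var z) ∷ []) t
Vars-NC₁ {t = t} n (here refl) q = n (inr (FV t) q)

Vars-NC₂ : ∀ {x' y'} → x' ∉ Vars t → y' ∉ Vars t → NC ((x , var x') ∷ (y , var y') ∷ []) t
Vars-NC₂ {t = t} n m (here refl) q = n (inr (FV t) q)
Vars-NC₂ {t = t} n m (there (here refl)) q = m (inr (FV t) q)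

-- Contracting a redex with a vacuous binder would lose the variables of the argument; in a linear
-- term the bound variable occurs, so the argument survives.
step-FV : Step t s → Lin t → FV t ≋ FV s
step-FV (α-lam {z = z} {t = t} {x = x} nz) (lt , mx) =
  (λ m → case ∈─⁻ m of λ (p , n) → ∈─⁺ (FV-subst₁⁺ x (var z) t nc mx (inl m)) (λ { refl → Vars-FV {t = t} nz p })) ,
  λ m → case ∈─⁻ m of λ (p , n) → case ∈++ (FV (lam x t)) (FV-subst₁⁻ x (var z) t nc p) of λ
    { (inj₁ q) → q ; (inj₂ q) → ⊥-elim (n (∈1 q)) }
  where nc = Vars-NC₁ {t = t} {x = x} nz
step-FV (α-let {t = t} {x = x} {y = y} {s = s} {x' = x'} {y' = y'} ne nx ny) (ls , lt , mx , my , x≢y , d) = f , g′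
  where
    nc : NC ((x , var x') ∷ (y , var y') ∷ []) t
    nc = Vars-NC₂ {t = t} {x = x} {y = y} nx ny
    f : (FV s ++ ((FV t ─ x) ─ y)) ⊑ (FV s ++ ((FV (subst ((x , var x') ∷ (y , var y') ∷ []) t) ─ x') ─ y'))
    f m with ∈++ (FV s) m
    ... | inj₁ p = inl p
    ... | inj₂ p = inr (FV s) (∈─⁺ (∈─⁺ (FV-subst₂⁺ x (var x') y (var y') t nc x≢y mx my (inr (x' ∷ y' ∷ []) p))
            (λ { refl → Vars-FV {t = t} nx (proj₁ (∈─⁻ {xs = FV t} (proj₁ (∈─⁻ {xs = FV t ─ x} p)))) })) (λ { refl → Vars-FV {t = t} ny (proj₁ (∈─⁻ {xs = FV t} (proj₁ (∈─⁻ {xs = FV t ─ x} p)))) }))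
    g′ : (FV s ++ ((FV (subst ((x , var x') ∷ (y , var y') ∷ []) t) ─ x') ─ y')) ⊑ (FV s ++ ((FV t ─ x) ─ y))
    g′ m with ∈++ (FV s) m
    ... | inj₁ p = inl p
    ... | inj₂ p with ∈─⁻ p
    ... | p , zy with ∈─⁻ p
    ... | p , zx with FV-subst₂⁻ x (var x') y (var y') t nc p
    ... | here e = ⊥-elim (zx e)
    ... | there (here e) = ⊥-elim (zy e)
    ... | there (there q) = inr (FV s) q
step-FV (β-lam {x = x} {s = s} {t = t} nc) ((lt , mx) , ls , d) = FV-subst₁⁺ x s t nc mx , FV-subst₁⁻ x s t nc
step-FV (β-let {x = x} {u = u} {y = y} {v = v} {w = w} nc) (_ , lw , mx , my , ne , d) = FV-subst₂⁺ x u y v w nc ne mx my , FV-subst₂⁻ x u y v w nc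
step-FV (c-comm {t = t} {u = u} F nx ny d) l = c-FV {t = t} {u} F nx ny d

step-Lin : Step t s → Lin t → Lin s
step-Lin (α-lam {z = z} {t = t} {x = x} nz) (lt , mx) =
  Lin-subst₁ x (var z) t nc lt tt (λ i j → case ∈1 j of λ { refl → nz (inl (proj₁ (∈─⁻ {xs = FV t} i))) }) ,
  FV-subst₁⁺ x (var z) t nc mx (inr (FV t ─ x) (here refl))
  where nc = Vars-NC₁ {t = t} {x = x} nz
step-Lin (α-let {t = t} {x = x} {y = y} {s = s} {x' = x'} {y' = y'} ne nx ny) (ls , lt , mx , my , x≢y , d) =
  ls , Lin-subst₂ x (var x') y (var y') t nc lt tt tt (λ { (here refl) (here e) → ne e }) fr ,
  FV-subst₂⁺ x (var x') y (var y') t nc x≢y mx my (here refl) , FV-subst₂⁺ x (var x') y (var y') t nc x≢y mx my (there (here refl)) , ne , f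
  where
    nc : NC ((x , var x') ∷ (y , var y') ∷ []) t
    nc = Vars-NC₂ {t = t} {x = x} {y = y} nx ny
    fr : (x' ∷ y' ∷ []) # ((FV t ─ x) ─ y)
    fr (here refl) q = nx (inl (proj₁ (∈─⁻ {xs = FV t} (proj₁ (∈─⁻ {xs = FV t ─ x} q)))))
    fr (there (here refl)) q = ny (inl (proj₁ (∈─⁻ {xs = FV t} (proj₁ (∈─⁻ {xs = FV t ─ x} q)))))
    f : FV s # ((FV (subst ((x , var x') ∷ (y , var y') ∷ []) t) ─ x') ─ y')
    f i p with ∈─⁻ p
    ... | p , zy with ∈─⁻ p
    ... | p , zx with FV-subst₂⁻ x (var x') y (var y') t nc p
    ... | here e = zx e
    ... | there (here e) = zy e
    ... | there (there q) = d i q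
step-Lin (β-lam {x = x} {s = s} {t = t} nc) ((lt , mx) , ls , d) = Lin-subst₁ x s t nc lt ls d
step-Lin (β-let {x = x} {u = u} {y = y} {v = v} {w = w} nc) ((lu , lv , d') , lw , mx , my , ne , d) = Lin-subst₂ x u y v w nc lw lu lv d' d
step-Lin (c-comm {t = t} {u = u} F nx ny d) l = c-Lin→ {t = t} {u} F nx ny d l

infix 4 _≗_
_≗_ : (ℕ → Ty) → (ℕ → Ty) → Set
g ≗ h = ∀ z → g z ≡ h z

upd-comm : x ≢ y → upd (upd g x A) y B ≗ upd (upd g y B) x A
upd-comm {x} {y} {g} {A} {B} ne z = go (z ≟ x) (z ≟ y)
  where
    go : Dec (z ≡ x) → Dec (z ≡ y) → upd (upd g x A) y B z ≡ upd (upd g y B) x A z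
    go (yes refl) (yes e) = ⊥-elim (ne e)
    go (yes refl) (no n) = trans (trans (upd-other _ y B n) (upd-same g z A)) (sym (upd-same _ z A))
    go (no n) (yes refl) = trans (upd-same _ z B) (sym (trans (upd-other _ x A n) (upd-same g z B)))
    go (no n) (no m) = trans (upd-other _ y B m) (trans (upd-other g x A n)
                         (sym (trans (upd-other _ x A n) (upd-other g y B m))))

upd-≗ : ∀ x A → g ≗ h → upd g x A ≗ upd h x A
upd-≗ {g} {h} x A e z = upd-cong {z} {g} {h} x A λ _ → e z

≗-trans : ∀ {g h k : ℕ → Ty} → g ≗ h → h ≗ k → g ≗ k
≗-trans p q z = trans (p z) (q z)

⊩-≗ : g ≗ h → g ⊩ t ∶ A → h ⊩ t ∶ A
⊩-≗ e = ⊩-ext λ {z} _ → e z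

upd₂-other : ∀ g {x y} → z ≢ x → z ≢ y → upd (upd g y B) x A z ≡ g z
upd₂-other {B = B} {A} g {x} {y} n m = trans (upd-other (upd g y B) x A n) (upd-other g y B m)

avoid : x ∉ xs → z ∈ xs → z ≢ x
avoid n m refl = n m

-- Linearity supplies the freshness that makes the updates commute: a variable bound by `F` occurs
-- in `letp x y t u` but not in `t`, hence it differs from `x` and `y`.
c-⊩→ : ∀ F → x ∉ FVF F → y ∉ FVF F → FV t # BVF F → Lin (F ⟦ letp x y t u ⟧) →
       g ⊩ F ⟦ letp x y t u ⟧ ∶ A → g ⊩ letp x y t (F ⟦ u ⟧) ∶ A
c-⊩→ {x} {y} {t} {u} {g} (lamF z) nx ny d ((lt , lu , mx , my , ne , e) , mz) (⊩lam (⊩let p q)) with ∈++ (FV t) mz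
... | inj₁ i = ⊥-elim (d i (here refl))
... | inj₂ i with ∈─⁻ {xs = FV u ─ x} i
... | i , zy with ∈─⁻ {xs = FV u} i
... | i , zx = ⊩let (⊩-ext (λ m → upd-other g z _ (λ { refl → d m (here refl) })) p)
   (⊩lam (⊩-≗ (≗-trans (upd-≗ x _ (upd-comm zy)) (upd-comm zx)) q))
c-⊩→ {g = g} (appLF s) nx ny d l (⊩app (⊩let p q) r) =
  ⊩let p (⊩app q (⊩-ext (λ m → sym (upd₂-other g (avoid nx m) (avoid ny m))) r))
c-⊩→ {g = g} (appRF s) nx ny d l (⊩app r (⊩let p q)) =
  ⊩let p (⊩app (⊩-ext (λ m → sym (upd₂-other g (avoid nx m) (avoid ny m))) r) q)
c-⊩→ {g = g} (pairLF s) nx ny d l (⊩pair (⊩let p q) r) =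
  ⊩let p (⊩pair q (⊩-ext (λ m → sym (upd₂-other g (avoid nx m) (avoid ny m))) r))
c-⊩→ {g = g} (pairRF s) nx ny d l (⊩pair r (⊩let p q)) =
  ⊩let p (⊩pair (⊩-ext (λ m → sym (upd₂-other g (avoid nx m) (avoid ny m))) r) q)
c-⊩→ {x} {y} {t} {u} {g} (letRF a b s) nx ny d (ls , lr , ma , mb , _) (⊩let r (⊩let p q)) =
  ⊩let (⊩-ext (λ m → upd₂-other g (λ { refl → d m (here refl) }) (λ { refl → d m (there (here refl)) })) p)
       (⊩let (⊩-ext (λ m → sym (upd₂-other g (avoid nx m) (avoid ny m))) r)
             (⊩-≗ (≗-trans (upd-≗ x _ (≗-trans (upd-comm (sep y (inj₂ refl) ma {here refl})) (upd-≗ a _ (upd-comm (sep y (inj₂ refl) mb {there (here refl)})))))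
                            (≗-trans (upd-comm (sep x (inj₁ refl) ma {here refl})) (upd-≗ a _ (upd-comm (sep x (inj₁ refl) mb {there (here refl)}))))) q))
  where
    sep : ∀ k → k ≡ x ⊎ k ≡ y → ∀ {c} → c ∈ FV (letp x y t u) → {_ : c ∈ a ∷ b ∷ []} → c ≢ k
    sep k o {c} m {i} e with ∈++ (FV t) m
    ... | inj₁ j = d j i
    ... | inj₂ j with ∈─⁻ {xs = FV u ─ x} j
    ... | j , cy with ∈─⁻ {xs = FV u} j | o
    ... | j , cx | inj₁ refl = cx e
    ... | j , cx | inj₂ refl = cy e

c-⊩← : ∀ F → x ∉ FVF F → y ∉ FVF F → FV t # BVF F → Lin (F ⟦ letp x y t u ⟧) →
       g ⊩ letp x y t (F ⟦ u ⟧) ∶ A → g ⊩ F ⟦ letp x y t u ⟧ ∶ A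
c-⊩← {x} {y} {t} {u} {g} (lamF z) nx ny d ((lt , lu , mx , my , ne , e) , mz) (⊩let p (⊩lam q)) with ∈++ (FV t) mz
... | inj₁ i = ⊥-elim (d i (here refl))
... | inj₂ i with ∈─⁻ {xs = FV u ─ x} i
... | i , zy with ∈─⁻ {xs = FV u} i
... | i , zx = ⊩lam (⊩let (⊩-ext (λ m → sym (upd-other g z _ (λ { refl → d m (here refl) }))) p)
   (⊩-≗ (≗-trans (upd-comm (zx ∘ sym)) (upd-≗ x _ (upd-comm (zy ∘ sym)))) q))
c-⊩← {g = g} (appLF s) nx ny d l (⊩let p (⊩app q r)) =
  ⊩app (⊩let p q) (⊩-ext (λ m → upd₂-other g (avoid nx m) (avoid ny m)) r)
c-⊩← {g = g} (appRF s) nx ny d l (⊩let p (⊩app r q)) =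
  ⊩app (⊩-ext (λ m → upd₂-other g (avoid nx m) (avoid ny m)) r) (⊩let p q)
c-⊩← {g = g} (pairLF s) nx ny d l (⊩let p (⊩pair q r)) =
  ⊩pair (⊩let p q) (⊩-ext (λ m → upd₂-other g (avoid nx m) (avoid ny m)) r)
c-⊩← {g = g} (pairRF s) nx ny d l (⊩let p (⊩pair r q)) =
  ⊩pair (⊩-ext (λ m → upd₂-other g (avoid nx m) (avoid ny m)) r) (⊩let p q)
c-⊩← {x} {y} {t} {u} {g} (letRF a b s) nx ny d (ls , lr , ma , mb , _) (⊩let p (⊩let r q)) =
  ⊩let (⊩-ext (λ m → upd₂-other g (avoid nx m) (avoid ny m)) r)
       (⊩let (⊩-ext (λ m → sym (upd₂-other g (λ { refl → d m (here refl) }) (λ { refl → d m (there (here refl)) }))) p)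
             (⊩-≗ (≗-trans (≗-trans (upd-≗ a _ (upd-comm (sep x (inj₁ refl) mb {there (here refl)} ∘ sym))) (upd-comm (sep x (inj₁ refl) ma {here refl} ∘ sym)))
                   (upd-≗ x _ (≗-trans (upd-≗ a _ (upd-comm (sep y (inj₂ refl) mb {there (here refl)} ∘ sym))) (upd-comm (sep y (inj₂ refl) ma {here refl} ∘ sym))))) q))
  where
    sep : ∀ k → k ≡ x ⊎ k ≡ y → ∀ {c} → c ∈ FV (letp x y t u) → {_ : c ∈ a ∷ b ∷ []} → c ≢ k
    sep k o {c} m {i} e with ∈++ (FV t) m
    ... | inj₁ j = d j i
    ... | inj₂ j with ∈─⁻ {xs = FV u ─ x} j
    ... | j , cy with ∈─⁻ {xs = FV u} j | o
    ... | j , cx | inj₁ refl = cx e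
    ... | j , cx | inj₂ refl = cy e

⊩-subst₁ : NC ((x , s) ∷ []) t → (∀ {z} → z ∈ FV t → z ≢ x → h z ≡ g z) → h ⊩ s ∶ A → upd g x A ⊩ t ∶ B →
           h ⊩ subst ((x , s) ∷ []) t ∶ B
⊩-subst₁ {x} {s} {t} {h} {g} {A} nc e p = ⊩-subst ((x , s) ∷ []) t nc f
  where
    f : ∀ {z} → z ∈ FV t → h ⊩ look ((x , s) ∷ []) z ∶ upd g x A z
    f {z} m with z ≟ x
    ... | yes refl = p
    ... | no ne = ⊩var (e m ne)

⊩-expand₁ : NC ((x , s) ∷ []) t → Lin t → x ∈ FV t → h ⊩ subst ((x , s) ∷ []) t ∶ B →
            ∃[ A ] ((h ⊩ s ∶ A) × (upd h x A ⊩ t ∶ B))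
⊩-expand₁ {x} {s} {t} {h} nc l mx p with ⊩-expand ((x , s) ∷ []) t nc l p
... | g , q , e = g x , ≡subst (λ k → h ⊩ k ∶ g x) (look-here x s []) (e mx) , ⊩-ext f q
  where
    f : ∀ {z} → z ∈ FV t → g z ≡ upd h x (g x) z
    f {z} m with look₁ {x} {s} z
    ... | inj₁ (refl , _) = sym (upd-same h x (g x))
    ... | inj₂ (ne , w) = trans (sym (⊩var⁻ (≡subst (λ k → h ⊩ k ∶ g z) w (e m)))) (sym (upd-other h x (g x) ne))

⊩-subst₂ : x ≢ y → NC ((x , u) ∷ (y , v) ∷ []) t → (∀ {z} → z ∈ FV t → z ≢ x → z ≢ y → h z ≡ g z) →
           h ⊩ u ∶ A → h ⊩ v ∶ B → upd (upd g y B) x A ⊩ t ∶ C → h ⊩ subst ((x , u) ∷ (y , v) ∷ []) t ∶ C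
⊩-subst₂ {x} {y} {u} {v} {t} {h} {g} {A} {B} ne nc e p q = ⊩-subst ((x , u) ∷ (y , v) ∷ []) t nc f
  where
    f : ∀ {z} → z ∈ FV t → h ⊩ look ((x , u) ∷ (y , v) ∷ []) z ∶ upd (upd g y B) x A z
    f {z} m with z ≟ x
    ... | yes refl = p
    ... | no nx with z ≟ y
    ...   | yes refl = q
    ...   | no ny = ⊩var (e m nx ny)

⊩-expand₂ : x ≢ y → NC ((x , u) ∷ (y , v) ∷ []) t → Lin t → x ∈ FV t → y ∈ FV t → h ⊩ subst ((x , u) ∷ (y , v) ∷ []) t ∶ C →
            ∃[ A ] ∃[ B ] ((h ⊩ u ∶ A) × (h ⊩ v ∶ B) × (upd (upd h y B) x A ⊩ t ∶ C))
⊩-expand₂ {x} {y} {u} {v} {t} {h} x≢y nc l mx my p with ⊩-expand ((x , u) ∷ (y , v) ∷ []) t nc l p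
... | g , q , e = g x , g y , ≡subst (λ k → h ⊩ k ∶ g x) (look-here x u _) (e mx) ,
        ≡subst (λ k → h ⊩ k ∶ g y) (trans (look-there u _ (x≢y ∘ sym)) (look-here y v [])) (e my) , ⊩-ext f q
  where
    f : ∀ {z} → z ∈ FV t → g z ≡ upd (upd h y (g y)) x (g x) z
    f {z} m with look₂ {x} {u} {y} {v} z
    ... | inj₁ (refl , _) = sym (upd-same (upd h y (g y)) x (g x))
    ... | inj₂ (inj₁ (ne , refl , _)) = sym (trans (upd-other (upd h y (g y)) x (g x) ne) (upd-same h y (g y)))
    ... | inj₂ (inj₂ (nx , ny , w)) =
            trans (sym (⊩var⁻ (≡subst (λ k → h ⊩ k ∶ g z) w (e m)))) (sym (upd₂-other h nx ny))

step-⊩→ : Step t s → Lin t → g ⊩ t ∶ A → g ⊩ s ∶ A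
step-⊩→ {g = g} (α-lam {z = z} {t = t} {x = x} nz) l (⊩lam p) =
  ⊩lam (⊩-subst₁ (Vars-NC₁ {t = t} {x = x} nz) (λ { m ne → upd-other g z _ (avoid (Vars-FV {t = t} nz) m) }) (⊩var (upd-same g z _)) p)
step-⊩→ {g = g} (α-let {t = t} {x = x} {y = y} {x' = x'} {y' = y'} ne nx ny) (ls , lt , mx , my , x≢y , d) (⊩let p q) =
  ⊩let p (⊩-subst₂ x≢y (Vars-NC₂ {t = t} {x = x} {y = y} nx ny)
    (λ m _ _ → upd₂-other g (avoid (Vars-FV {t = t} nx) m) (avoid (Vars-FV {t = t} ny) m))
    (⊩var (upd-same (upd g y' _) x' _)) (⊩var (trans (upd-other (upd g y' _) x' _ (ne ∘ sym)) (upd-same g y' _))) q)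
step-⊩→ (β-lam nc) l (⊩app (⊩lam p) q) = ⊩-subst₁ nc (λ _ _ → refl) q p
step-⊩→ (β-let nc) (_ , _ , _ , _ , ne , _) (⊩let (⊩pair p q) r) = ⊩-subst₂ ne nc (λ _ _ _ → refl) p q r
step-⊩→ (c-comm {t = t} {u = u} F nx ny d) l p = c-⊩→ {t = t} {u} F nx ny d l p

step-⊩← : Step t s → Lin t → g ⊩ s ∶ A → g ⊩ t ∶ A
step-⊩← {g = g} (α-lam {z = z} {t = t} {x = x} nz) (lt , mx) (⊩lam {A = A} p)
  with ⊩-expand₁ (Vars-NC₁ {t = t} {x = x} nz) lt mx p
... | A' , q , r with trans (sym (⊩var⁻ q)) (upd-same g z A)
... | refl = ⊩lam (⊩-ext (λ {w} m → upd-cong {w} {upd g z A} {g} x A λ _ → upd-other g z A (avoid (Vars-FV {t = t} nz) m)) r)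
step-⊩← {g = g} (α-let {t = t} {x = x} {y = y} {x' = x'} {y' = y'} ne nx ny) (ls , lt , mx , my , x≢y , d) (⊩let {A = A} {B = B} p q)
  with ⊩-expand₂ x≢y (Vars-NC₂ {t = t} {x = x} {y = y} nx ny) lt mx my q
... | A' , B' , a , b , r with trans (sym (⊩var⁻ a)) (upd-same (upd g y' B) x' A)
    | trans (sym (⊩var⁻ b)) (trans (upd-other (upd g y' B) x' A (ne ∘ sym)) (upd-same g y' B))
... | refl | refl = ⊩let p (⊩-ext (λ {w} m → upd-cong {w} {upd (upd (upd g y' B) x' A) y B} {upd g y B} x A λ _ → upd-cong {w} {upd (upd g y' B) x' A} {g} y B λ _ →
        upd₂-other g (avoid (Vars-FV {t = t} nx) m) (avoid (Vars-FV {t = t} ny) m)) r)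
step-⊩← (β-lam nc) ((lt , mx) , _) p = case ⊩-expand₁ nc lt mx p of λ (A , q , r) → ⊩app (⊩lam r) q
step-⊩← (β-let nc) (_ , lw , mx , my , ne , _) p = case ⊩-expand₂ ne nc lw mx my p of λ (A , B , q , r , o) → ⊩let (⊩pair q r) o
step-⊩← (c-comm {t = t} {u = u} F nx ny d) l p = c-⊩← {t = t} {u} F nx ny d l p

infix 4 _≈_
-- A step stores the linearity of its source, because a contractum can be linear when the redex is
-- not, as in `app (lam x (var y)) s` with `x` distinct from `y`. This makes linearity pass
-- backwards in `≈-Lin`.
data _≈_ : Tm → Tm → Set where
  step    : Step t s → Lin t → t ≈ s
  ≈-refl  : t ≈ t
  ≈-sym   : t ≈ s → s ≈ t
  ≈-trans : t ≈ s → s ≈ u → t ≈ u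
  ≈-app   : t ≈ t' → s ≈ s' → app t s ≈ app t' s'
  ≈-lam   : t ≈ t' → lam x t ≈ lam x t'
  ≈-pair  : s ≈ s' → t ≈ t' → pair s t ≈ pair s' t'
  ≈-let   : s ≈ s' → t ≈ t' → letp x y s t ≈ letp x y s' t'

≈-≡ : t ≡ s → t ≈ s
≈-≡ refl = ≈-refl

++-≋ : ∀ {as bs cs ds} → as ≋ bs → cs ≋ ds → (as ++ cs) ≋ (bs ++ ds)
++-≋ {as} {bs} p q = (λ m → case ∈++ as m of λ { (inj₁ i) → inl (proj₁ p i) ; (inj₂ i) → inr bs (proj₁ q i) }) ,
                     (λ m → case ∈++ bs m of λ { (inj₁ i) → inl (proj₂ p i) ; (inj₂ i) → inr as (proj₂ q i) })

─-≋ : ∀ x → xs ≋ ys → (xs ─ x) ≋ (ys ─ x)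
─-≋ {xs} {ys} x p = (λ m → case ∈─⁻ {xs = xs} m of λ (i , n) → ∈─⁺ (proj₁ p i) n) ,
                    (λ m → case ∈─⁻ {xs = ys} m of λ (i , n) → ∈─⁺ (proj₂ p i) n)

≈-FV : t ≈ s → FV t ≋ FV s
≈-FV (step p l) = step-FV p l
≈-FV ≈-refl = ≋refl
≈-FV (≈-sym p) = proj₂ (≈-FV p) , proj₁ (≈-FV p)
≈-FV (≈-trans p q) = (λ m → proj₁ (≈-FV q) (proj₁ (≈-FV p) m)) , (λ m → proj₂ (≈-FV p) (proj₂ (≈-FV q) m))
≈-FV (≈-app p q) = ++-≋ (≈-FV p) (≈-FV q)
≈-FV (≈-pair p q) = ++-≋ (≈-FV p) (≈-FV q)
≈-FV (≈-lam {x = x} p) = ─-≋ x (≈-FV p)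
≈-FV (≈-let {x = x} {y = y} p q) = ++-≋ (≈-FV p) (─-≋ y (─-≋ x (≈-FV q)))

#-≋ : ∀ {as bs cs ds} → as ≋ bs → cs ≋ ds → as # cs → bs # ds
#-≋ p q d i j = d (proj₂ p i) (proj₂ q j)

≋-sym : xs ≋ ys → ys ≋ xs
≋-sym p = proj₂ p , proj₁ p

≈-Lin : t ≈ s → (Lin t → Lin s) × (Lin s → Lin t)
≈-Lin (step p l) = step-Lin p , λ _ → l
≈-Lin ≈-refl = id , id
≈-Lin (≈-sym p) = proj₂ (≈-Lin p) , proj₁ (≈-Lin p)
≈-Lin (≈-trans p q) = proj₁ (≈-Lin q) ∘ proj₁ (≈-Lin p) , proj₂ (≈-Lin p) ∘ proj₂ (≈-Lin q)
≈-Lin (≈-app p q) =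
  (λ (a , b , d) → proj₁ (≈-Lin p) a , proj₁ (≈-Lin q) b , #-≋ (≈-FV p) (≈-FV q) d) ,
  (λ (a , b , d) → proj₂ (≈-Lin p) a , proj₂ (≈-Lin q) b , #-≋ (≋-sym (≈-FV p)) (≋-sym (≈-FV q)) d)
≈-Lin (≈-pair p q) =
  (λ (a , b , d) → proj₁ (≈-Lin p) a , proj₁ (≈-Lin q) b , #-≋ (≈-FV p) (≈-FV q) d) ,
  (λ (a , b , d) → proj₂ (≈-Lin p) a , proj₂ (≈-Lin q) b , #-≋ (≋-sym (≈-FV p)) (≋-sym (≈-FV q)) d)
≈-Lin (≈-lam p) =
  (λ (a , m) → proj₁ (≈-Lin p) a , proj₁ (≈-FV p) m) , (λ (a , m) → proj₂ (≈-Lin p) a , proj₂ (≈-FV p) m)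
≈-Lin (≈-let {x = x} {y = y} p q) =
  (λ (a , b , mx , my , ne , d) → proj₁ (≈-Lin p) a , proj₁ (≈-Lin q) b , proj₁ (≈-FV q) mx , proj₁ (≈-FV q) my , ne ,
     #-≋ (≈-FV p) (─-≋ y (─-≋ x (≈-FV q))) d) ,
  (λ (a , b , mx , my , ne , d) → proj₂ (≈-Lin p) a , proj₂ (≈-Lin q) b , proj₂ (≈-FV q) mx , proj₂ (≈-FV q) my , ne ,
     #-≋ (≋-sym (≈-FV p)) (≋-sym (─-≋ y (─-≋ x (≈-FV q)))) d)

-- Linearity gives subject expansion along with subject reduction.
≈-⊩→ : t ≈ s → g ⊩ t ∶ A → g ⊩ s ∶ A
≈-⊩← : t ≈ s → g ⊩ s ∶ A → g ⊩ t ∶ A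
≈-⊩→ (step p l) q = step-⊩→ p l q
≈-⊩→ ≈-refl q = q
≈-⊩→ (≈-sym p) q = ≈-⊩← p q
≈-⊩→ (≈-trans p p') q = ≈-⊩→ p' (≈-⊩→ p q)
≈-⊩→ (≈-app p p') (⊩app q q') = ⊩app (≈-⊩→ p q) (≈-⊩→ p' q')
≈-⊩→ (≈-lam p) (⊩lam q) = ⊩lam (≈-⊩→ p q)
≈-⊩→ (≈-pair p p') (⊩pair q q') = ⊩pair (≈-⊩→ p q) (≈-⊩→ p' q')
≈-⊩→ (≈-let p p') (⊩let q q') = ⊩let (≈-⊩→ p q) (≈-⊩→ p' q')
≈-⊩← (step p l) q = step-⊩← p l q
≈-⊩← ≈-refl q = q
≈-⊩← (≈-sym p) q = ≈-⊩→ p q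
≈-⊩← (≈-trans p p') q = ≈-⊩← p (≈-⊩← p' q)
≈-⊩← (≈-app p p') (⊩app q q') = ⊩app (≈-⊩← p q) (≈-⊩← p' q')
≈-⊩← (≈-lam p) (⊩lam q) = ⊩lam (≈-⊩← p q)
≈-⊩← (≈-pair p p') (⊩pair q q') = ⊩pair (≈-⊩← p q) (≈-⊩← p' q')
≈-⊩← (≈-let p p') (⊩let q q') = ⊩let (≈-⊩← p q) (≈-⊩← p' q')

-- Agreement of the two typing relations on linear terms

x∈─-id : ∀ xs → x ∉ xs → xs ─ x ≡ xs
x∈─-id {x} xs n = List.filter-all (λ z → ¬? (z ≟ x)) (All.tabulate λ { m refl → n m })

unique-remove : Unique xs → x ∈ xs → xs ↭ x ∷ (xs ─ x)
unique-remove {y ∷ xs} {x} (p ∷ q) m with y ≟ x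
... | yes refl = prep y (↭.↭-reflexive (sym (trans (List.filter-reject (λ z → ¬? (z ≟ y)) (λ n → n refl)) (x∈─-id xs (λ i → All.lookup p i refl)))))
... | no ne with m
...   | here e = ⊥-elim (ne (sym e))
...   | there i = ↭-trans (↭-trans (prep y (unique-remove q i)) (swap y x ↭-refl))
          (prep x (↭.↭-reflexive (sym (List.filter-accept (λ z → ¬? (z ≟ x)) ne))))

-- Contexts are recomputed from `FV`, whose order changes under conversion. Exchange along this
-- permutation repairs the order.
≋⇒↭ : Unique xs → Unique ys → xs ≋ ys → xs ↭ ys
≋⇒↭ {[]} {[]} _ _ e = ↭-refl
≋⇒↭ {[]} {y ∷ ys} _ _ e = case proj₂ e (here refl) of λ ()
≋⇒↭ {x ∷ xs} {ys} (p ∷ q) u e =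
  ↭-trans (prep x (≋⇒↭ q (Uniq.filter⁺ (λ z → ¬? (z ≟ x)) u) (f , g′))) (↭-sym (unique-remove u (proj₁ e (here refl))))
  where
    f : xs ⊑ (ys ─ x)
    f m = ∈─⁺ (proj₁ e (there m)) (λ { refl → All.lookup p m refl })
    g′ : (ys ─ x) ⊑ xs
    g′ m with ∈─⁻ {xs = ys} m
    ... | i , n with proj₂ e i
    ... | here e' = ⊥-elim (n e')
    ... | there j = j

Lin⇒Unique : ∀ t → Lin t → Unique (FV t)
Lin⇒Unique (var x) l = [] ∷ []
Lin⇒Unique (app t s) (a , b , d) = Uniq.++⁺ (Lin⇒Unique t a) (Lin⇒Unique s b) λ (i , j) → d i j
Lin⇒Unique (lam x t) (a , m) = Uniq.filter⁺ (λ z → ¬? (z ≟ x)) (Lin⇒Unique t a)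
Lin⇒Unique (pair t s) (a , b , d) = Uniq.++⁺ (Lin⇒Unique t a) (Lin⇒Unique s b) λ (i , j) → d i j
Lin⇒Unique (letp x y s t) (a , b , _ , _ , _ , d) =
  Uniq.++⁺ (Lin⇒Unique s a) (Uniq.filter⁺ (λ z → ¬? (z ≟ y)) (Uniq.filter⁺ (λ z → ¬? (z ≟ x)) (Lin⇒Unique t b))) λ (i , j) → d i j

ctx : (ℕ → Ty) → List ℕ → Cx
ctx g = List.map λ x → x , g x

dom-ctx : ∀ g xs → dom (ctx g xs) ≡ xs
dom-ctx g xs = trans (sym (List.map-∘ xs)) (List.map-id xs)

dom-ctx₂ : ∀ g xs ys → dom (ctx g xs ++ ctx g ys) ≡ xs ++ ys
dom-ctx₂ g xs ys = trans (List.map-++ proj₁ (ctx g xs) (ctx g ys)) (cong₂ _++_ (dom-ctx g xs) (dom-ctx g ys))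

module _ (P : Cx → Set) (ex : ∀ {Γ₁ Γ₂ : Cx} {p q : ℕ × Ty} → P (Γ₁ ++ p ∷ q ∷ Γ₂) → P (Γ₁ ++ q ∷ p ∷ Γ₂)) where

  -- The prefix `Ξ` collects the entries already passed: exchange is available at any depth, whereas
  -- a permutation is taken apart from the front.
  permute-under : ∀ Ξ {Γ Δ} → Γ ↭ Δ → P (Ξ ++ Γ) → P (Ξ ++ Δ)
  permute-under Ξ ↭.refl d = d
  permute-under Ξ {Γ = _ ∷ Γ} {Δ = _ ∷ Δ} (prep p r) d =
    ≡subst P (List.++-assoc Ξ (p ∷ []) Δ) (permute-under (Ξ ++ p ∷ []) r (≡subst P (sym (List.++-assoc Ξ (p ∷ []) Γ)) d))
  permute-under Ξ {Γ = _ ∷ _ ∷ Γ} {Δ = _ ∷ _ ∷ Δ} (swap p q r) d =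
    ≡subst P (List.++-assoc Ξ (q ∷ p ∷ []) Δ)
      (permute-under (Ξ ++ q ∷ p ∷ []) r (≡subst P (sym (List.++-assoc Ξ (q ∷ p ∷ []) Γ)) (ex {Γ₁ = Ξ} d)))
  permute-under Ξ (↭.trans r r') d = permute-under Ξ r' (permute-under Ξ r d)

  permute : ∀ {Γ Δ} → Γ ↭ Δ → P Γ → P Δ
  permute = permute-under []

⊢-↭ : ∀ {Γ Δ} → Γ ↭ Δ → Γ ⊢ t ∶ A → Δ ⊢ t ∶ A
⊢-↭ {t} {A} = permute (λ Γ → Γ ⊢ t ∶ A) λ {Γ₁} → exch {Γ₁ = Γ₁}

≐-↭ : ∀ {Γ Δ} → Γ ↭ Δ → Γ ⊢ t ≐ s ∶ A → Δ ⊢ t ≐ s ∶ A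
≐-↭ {t} {s} {A} = permute (λ Γ → Γ ⊢ t ≐ s ∶ A) λ {Γ₁} → e-exch {Γ₁ = Γ₁}

ctx-cong : (∀ {z} → z ∈ xs → g z ≡ h z) → ctx g xs ≡ ctx h xs
ctx-cong {[]} e = refl
ctx-cong {x ∷ xs} e = cong₂ _∷_ (cong (x ,_) (e (here refl))) (ctx-cong (e ∘ there))

ctx-bind : ∀ g x A {t} → Lin t → x ∈ FV t → ctx (upd g x A) (FV t) ↭ (x , A) ∷ ctx g (FV t ─ x)
ctx-bind g x A {t} l m = ↭-trans (↭.map⁺ _ (unique-remove (Lin⇒Unique t l) m))
  (↭.↭-reflexive (cong₂ _∷_ (cong (x ,_) (upd-same g x A)) (ctx-cong λ i → upd-other g x A (proj₂ (∈─⁻ {xs = FV t} i)))))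

ctx-bind₂ : ∀ g x y A B {t} → Lin t → x ∈ FV t → y ∈ FV t → x ≢ y →
  ctx (upd (upd g y B) x A) (FV t) ↭ (x , A) ∷ (y , B) ∷ ctx g ((FV t ─ x) ─ y)
ctx-bind₂ g x y A B {t} l mx my ne = ↭-trans (ctx-bind (upd g y B) x A l mx)
  (prep (x , A) (ctx-bind g y B {lam x t} (l , mx) (∈─⁺ my (ne ∘ sym))))

-- `FV` lists the variables in the order in which the rules concatenate their contexts, so that
-- exchange is called for at binders only.
⊩⇒⊢ : Lin t → g ⊩ t ∶ A → ctx g (FV t) ⊢ t ∶ A
⊩⇒⊢ l (⊩var refl) = ax
⊩⇒⊢ {app t s} {g} l@(a , b , _) (⊩app p q) = ≡subst (_⊢ _ ∶ _) (sym (List.map-++ _ (FV t) (FV s)))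
  (⊸E (≡subst Unique (sym (dom-ctx₂ g (FV t) (FV s))) (Lin⇒Unique (app t s) l)) (⊩⇒⊢ a p) (⊩⇒⊢ b q))
⊩⇒⊢ {lam x t} {g} (l , m) (⊩lam {A = A} p) = ⊸I (⊢-↭ (ctx-bind g x A l m) (⊩⇒⊢ l p))
⊩⇒⊢ {pair t s} {g} l@(a , b , _) (⊩pair p q) = ≡subst (_⊢ _ ∶ _) (sym (List.map-++ _ (FV t) (FV s)))
  (⊗I (≡subst Unique (sym (dom-ctx₂ g (FV t) (FV s))) (Lin⇒Unique (pair t s) l)) (⊩⇒⊢ a p) (⊩⇒⊢ b q))
⊩⇒⊢ {letp x y s t} {g} l@(a , b , mx , my , ne , _) (⊩let {A = A} {B = B} p q) = ≡subst (_⊢ _ ∶ _) (sym (List.map-++ _ (FV s) _))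
  (⊗E (≡subst Unique (sym (dom-ctx₂ g (FV s) ((FV t ─ x) ─ y))) (Lin⇒Unique (letp x y s t) l)) (⊩⇒⊢ a p)
      (⊢-↭ (ctx-bind₂ g x y A B b mx my ne) (⊩⇒⊢ b q)))

Fits : (ℕ → Ty) → Cx → Set
Fits g Γ = ∀ {x B} → (x , B) ∈ Γ → g x ≡ B

-- What remains of a derivation when the order of its context is forgotten. `unique` belongs to the
-- invariant because discharging `x` must not touch the other entries of the context.
record Cart (Γ : Cx) (t : Tm) (A : Ty) : Set where
  field
    lin    : Lin t
    fv     : FV t ≋ dom Γ
    unique : Unique (dom Γ)
    typed  : Fits g Γ → g ⊩ t ∶ A
open Cart

dom-++ : ∀ Γ Δ → dom (Γ ++ Δ) ≡ dom Γ ++ dom Δ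
dom-++ Γ Δ = List.map-++ proj₁ Γ Δ

Unique-# : ∀ {xs ys : List ℕ} → Unique (xs ++ ys) → xs # ys
Unique-# {x ∷ xs} (p ∷ _) (here refl) j = All.lookup p (inr xs j) refl
Unique-# {x ∷ xs} (_ ∷ u) (there i) j = Unique-# u i j

⊢⇒Cart : ∀ {Γ} → Γ ⊢ t ∶ A → Cart Γ t A
⊢⇒Cart ax = record { lin = tt ; fv = ≋refl ; unique = [] ∷ [] ; typed = λ f → ⊩var (f (here refl)) }
⊢⇒Cart (exch {Γ₁} {Γ₂} {p} {q} d) = record
  { lin = lin c
  ; fv = (λ m → ↭.∈-resp-↭ (↭.map⁺ proj₁ perm) (proj₁ (fv c) m)) , (λ m → proj₂ (fv c) (↭.∈-resp-↭ (↭.map⁺ proj₁ (↭-sym perm)) m))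
  ; unique = ↭SP.Unique-resp-↭ (PE.setoid ℕ) (↭.↭⇒↭ₛ (↭.map⁺ proj₁ perm)) (unique c)
  ; typed = λ f → typed c λ m → f (↭.∈-resp-↭ perm m) }
  where
    c = ⊢⇒Cart d
    perm : Γ₁ ++ p ∷ q ∷ Γ₂ ↭ Γ₁ ++ q ∷ p ∷ Γ₂
    perm = ↭.++⁺ˡ Γ₁ (swap p q ↭-refl)
⊢⇒Cart (⊸I {x} {A} {Γ} {t} d) with ⊢⇒Cart d
... | c with unique c
... | p ∷ u = record
  { lin = lin c , proj₂ (fv c) (here refl)
  ; fv = (λ m → case ∈─⁻ {xs = FV t} m of λ (i , n) → case proj₁ (fv c) i of λ { (here e) → ⊥-elim (n e) ; (there j) → j }) ,
         (λ m → ∈─⁺ (proj₂ (fv c) (there m)) λ { refl → All.lookup p m refl })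
  ; unique = u
  ; typed = λ {g} f → ⊩lam (typed c λ { (here refl) → upd-same g x A
      ; (there m) → trans (upd-other g x A (λ { refl → All.lookup p (∈-map⁺ proj₁ m) refl })) (f m) }) }
⊢⇒Cart (⊸E {Γ} {Δ} {t} {s} u d e) = record
  { lin = lin c , lin c' , λ i j → Unique-# uu (proj₁ (fv c) i) (proj₁ (fv c') j)
  ; fv = ≡subst (λ k → (FV t ++ FV s) ≋ k) (sym (dom-++ Γ Δ)) (++-≋ (fv c) (fv c'))
  ; unique = u
  ; typed = λ f → ⊩app (typed c λ m → f (∈-++⁺ˡ m)) (typed c' λ m → f (∈-++⁺ʳ Γ m)) }
  where c = ⊢⇒Cart d
        c' = ⊢⇒Cart e
        uu = ≡subst Unique (dom-++ Γ Δ) u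
⊢⇒Cart (⊗I {Γ} {Δ} {t} {s} u d e) = record
  { lin = lin c , lin c' , λ i j → Unique-# uu (proj₁ (fv c) i) (proj₁ (fv c') j)
  ; fv = ≡subst (λ k → (FV t ++ FV s) ≋ k) (sym (dom-++ Γ Δ)) (++-≋ (fv c) (fv c'))
  ; unique = u
  ; typed = λ f → ⊩pair (typed c λ m → f (∈-++⁺ˡ m)) (typed c' λ m → f (∈-++⁺ʳ Γ m)) }
  where c = ⊢⇒Cart d
        c' = ⊢⇒Cart e
        uu = ≡subst Unique (dom-++ Γ Δ) u
⊢⇒Cart (⊗E {Γ} {Δ} {s} {t} {x} {y} {A} {B} u d e) with ⊢⇒Cart d | ⊢⇒Cart e
... | c | c' with unique c'
... | (x≢y ∷ px) ∷ (py ∷ _) = record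
  { lin = lin c , lin c' , proj₂ (fv c') (here refl) , proj₂ (fv c') (there (here refl)) , x≢y ,
          λ i j → Unique-# uu (proj₁ (fv c) i) (proj₁ fv₂ j)
  ; fv = ≡subst (λ k → (FV s ++ ((FV t ─ x) ─ y)) ≋ k) (sym (dom-++ Γ Δ)) (++-≋ (fv c) fv₂)
  ; unique = u
  ; typed = λ {g} f → ⊩let (typed c λ m → f (∈-++⁺ˡ m)) (typed c' λ
      { (here refl) → upd-same (upd g y B) x A
      ; (there (here refl)) → trans (upd-other (upd g y B) x A (x≢y ∘ sym)) (upd-same g y B)
      ; (there (there m)) → trans (upd₂-other g (λ { refl → All.lookup px (∈-map⁺ proj₁ m) refl }) (λ { refl → All.lookup py (∈-map⁺ proj₁ m) refl }))
                                  (f (∈-++⁺ʳ Γ m)) }) }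
  where
    uu = ≡subst Unique (dom-++ Γ Δ) u
    fv₂ : ((FV t ─ x) ─ y) ≋ dom Δ
    fv₂ = (λ m → case ∈─⁻ {xs = FV t ─ x} m of λ (i , ny) → case ∈─⁻ {xs = FV t} i of λ (i , nx) →
              case proj₁ (fv c') i of λ { (here e) → ⊥-elim (nx e) ; (there (here e)) → ⊥-elim (ny e) ; (there (there j)) → j }) ,
          (λ m → ∈─⁺ (∈─⁺ (proj₂ (fv c') (there (there m))) (λ { refl → All.lookup px m refl })) (λ { refl → All.lookup py m refl }))

-- Typed equality in contexts computed from the terms

⟦_⟧ᶠ : Frame → Hole
⟦ lamF x ⟧ᶠ = lamC x ∙
⟦ appLF s ⟧ᶠ = appL ∙ s
⟦ appRF t ⟧ᶠ = appR t ∙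
⟦ pairLF s ⟧ᶠ = pairL ∙ s
⟦ pairRF t ⟧ᶠ = pairR t ∙
⟦ letRF x y s ⟧ᶠ = letR x y s ∙

plug-frame : ∀ F u → plug ⟦ F ⟧ᶠ u ≡ F ⟦ u ⟧
plug-frame (lamF _) u = refl
plug-frame (appLF _) u = refl
plug-frame (appRF _) u = refl
plug-frame (pairLF _) u = refl
plug-frame (pairRF _) u = refl
plug-frame (letRF _ _ _) u = refl

FVC-frame : ∀ F → FVC ⟦ F ⟧ᶠ ⊑ FVF F
FVC-frame (appLF _) m = m
FVC-frame (appRF t) m = case ∈++ (FV t) m of λ { (inj₁ p) → p }
FVC-frame (pairLF _) m = m
FVC-frame (pairRF t) m = case ∈++ (FV t) m of λ { (inj₁ p) → p }
FVC-frame (letRF _ _ s) m = case ∈++ (FV s) m of λ { (inj₁ p) → p }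

HoleBV-frame : ∀ F → HoleBV ⟦ F ⟧ᶠ ⊑ BVF F
HoleBV-frame (lamF _) m = m
HoleBV-frame (letRF _ _ _) m = m

Step⇒Axiom : Step t s → Axiom t s
Step⇒Axiom (α-lam n) = α-lam n
Step⇒Axiom (α-let a b c) = α-let a b c
Step⇒Axiom (β-lam {x = x} {s} {t} nc) = β-lam (NC→NoCapture {(x , s) ∷ []} {t} nc)
Step⇒Axiom (β-let {x = x} {u} {y} {v} {w} nc) = β-let (NC→NoCapture {(x , u) ∷ (y , v) ∷ []} {w} nc)
Step⇒Axiom (c-comm {x} {y} {t} {u} F nx ny d) =
  subst₂ Axiom (plug-frame F _) (cong (letp x y t) (plug-frame F u))
    (c-comm {⟦ F ⟧ᶠ} (nx ∘ FVC-frame F) (ny ∘ FVC-frame F) (All.tabulate λ i j → d i (HoleBV-frame F j)))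

infix 4 _⊩_≐_∶_
-- The context is that of the left-hand side, so symmetry and transitivity have to permute it along
-- `≋`. The wrapper keeps `g` and `t` inferable, which they are not from `ctx g (FV t)`.
record _⊩_≐_∶_ (g : ℕ → Ty) (t s : Tm) (A : Ty) : Set where
  constructor ⟪_⟫
  field conv : ctx g (FV t) ⊢ t ≐ s ∶ A
open _⊩_≐_∶_

ctx-≋ : Lin t → Lin s → FV t ≋ FV s → ctx g (FV t) ↭ ctx g (FV s)
ctx-≋ {t} {s} l l' e = ↭.map⁺ _ (≋⇒↭ (Lin⇒Unique t l) (Lin⇒Unique s l') e)

≐-refl : Lin t → g ⊩ t ∶ A → g ⊩ t ≐ t ∶ A
≐-refl l p = ⟪ e-refl (⊩⇒⊢ l p) ⟫

≐-app : Lin (app t s) → g ⊩ t ≐ t' ∶ A ⊸ B → g ⊩ s ≐ s' ∶ A → g ⊩ app t s ≐ app t' s' ∶ B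
≐-app {t} {s} {g} l ⟪ p ⟫ ⟪ q ⟫ = ⟪ ≡subst (_⊢ _ ≐ _ ∶ _) (sym (List.map-++ _ (FV t) (FV s)))
  (e-app (≡subst Unique (sym (dom-ctx₂ g (FV t) (FV s))) (Lin⇒Unique (app t s) l)) p q) ⟫

≐-pair : Lin (pair t s) → g ⊩ t ≐ t' ∶ A → g ⊩ s ≐ s' ∶ B → g ⊩ pair t s ≐ pair t' s' ∶ A ⊗ B
≐-pair {t} {s} {g} l ⟪ p ⟫ ⟪ q ⟫ = ⟪ ≡subst (_⊢ _ ≐ _ ∶ _) (sym (List.map-++ _ (FV t) (FV s)))
  (e-pair (≡subst Unique (sym (dom-ctx₂ g (FV t) (FV s))) (Lin⇒Unique (pair t s) l)) p q) ⟫

≐-lam : Lin (lam x t) → upd g x A ⊩ t ≐ t' ∶ B → g ⊩ lam x t ≐ lam x t' ∶ A ⊸ B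
≐-lam {x} {t} {g} {A} (l , m) ⟪ p ⟫ = ⟪ e-lam (≐-↭ (ctx-bind g x A l m) p) ⟫

≐-let : Lin (letp x y s t) → g ⊩ s ≐ s' ∶ A ⊗ B → upd (upd g y B) x A ⊩ t ≐ t' ∶ C →
        g ⊩ letp x y s t ≐ letp x y s' t' ∶ C
≐-let {x} {y} {s} {t} {g} {A = A} {B} l@(a , b , mx , my , ne , _) ⟪ p ⟫ ⟪ q ⟫ = ⟪ ≡subst (_⊢ _ ≐ _ ∶ _) (sym (List.map-++ _ (FV s) _))
  (e-let (≡subst Unique (sym (dom-ctx₂ g (FV s) ((FV t ─ x) ─ y))) (Lin⇒Unique (letp x y s t) l)) p
         (≐-↭ (ctx-bind₂ g x y A B b mx my ne) q)) ⟫

≐-trans : Lin t → Lin s → FV t ≋ FV s → g ⊩ t ≐ s ∶ A → g ⊩ s ≐ u ∶ A → g ⊩ t ≐ u ∶ A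
≐-trans {t} {s} l l' e ⟪ p ⟫ ⟪ q ⟫ = ⟪ e-trans p (≐-↭ (↭-sym (ctx-≋ {t} {s} l l' e)) q) ⟫

≐-axiom : Axiom t s → Lin t → Lin s → FV t ≋ FV s → g ⊩ t ∶ A → g ⊩ s ∶ A → g ⊩ t ≐ s ∶ A
≐-axiom {t} {s} x l l' e p q = ⟪ e-ax x (⊩⇒⊢ l p) (⊢-↭ (↭-sym (ctx-≋ {t} {s} l l' e)) (⊩⇒⊢ l' q)) ⟫

≐-sym : Lin t → Lin s → FV t ≋ FV s → g ⊩ t ≐ s ∶ A → g ⊩ s ≐ t ∶ A
≐-sym {t} {s} l l' e ⟪ p ⟫ = ⟪ ≐-↭ (ctx-≋ {t} {s} l l' e) (e-sym p) ⟫

≐-ext : (∀ {z} → z ∈ FV t → g z ≡ h z) → g ⊩ t ≐ s ∶ A → h ⊩ t ≐ s ∶ A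
≐-ext {t} {s = s} {A} e ⟪ p ⟫ = ⟪ ≡subst (λ Γ → Γ ⊢ t ≐ s ∶ A) (ctx-cong e) p ⟫

-- The typed equality wants types for the intermediate terms of a conversion. Subject reduction
-- provides them along transitivity and subject expansion along symmetry.
≈⇒≐ : t ≈ s → Lin t → g ⊩ t ∶ A → g ⊩ t ≐ s ∶ A
≈⇒≐ (step p _) l q = ≐-axiom (Step⇒Axiom p) l (step-Lin p l) (step-FV p l) q (step-⊩→ p l q)
≈⇒≐ ≈-refl l q = ≐-refl l q
≈⇒≐ (≈-sym p) l q = ≐-sym l' l (≈-FV p) (≈⇒≐ p l' (≈-⊩← p q))
  where l' = proj₂ (≈-Lin p) l
≈⇒≐ (≈-trans p p') l q = ≐-trans l l' (≈-FV p) (≈⇒≐ p l q) (≈⇒≐ p' l' (≈-⊩→ p q))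
  where l' = proj₁ (≈-Lin p) l
≈⇒≐ (≈-app p p') l@(a , b , _) (⊩app q q') = ≐-app l (≈⇒≐ p a q) (≈⇒≐ p' b q')
≈⇒≐ (≈-lam p) l@(a , _) (⊩lam q) = ≐-lam l (≈⇒≐ p a q)
≈⇒≐ (≈-pair p p') l@(a , b , _) (⊩pair q q') = ≐-pair l (≈⇒≐ p a q) (≈⇒≐ p' b q')
≈⇒≐ (≈-let p p') l@(a , b , _) (⊩let q q') = ≐-let l (≈⇒≐ p a q) (≈⇒≐ p' b q')

-- Renaming apart, and moving redexes through frames

fresh : ∀ (xs : List ℕ) → ∃[ z ] (z ∉ xs)
fresh xs = suc (max 0 xs) , λ m → ℕ.1+n≰n (All.lookup (xs≤max 0 xs) m)

look₁-BV : ∀ x s w → BV (look ((x , s) ∷ []) w) ⊑ BV s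
look₁-BV x s w m with look₁ {x} {s} w
... | inj₁ (_ , e) = ≡subst (λ k → _ ∈ BV k) e m
... | inj₂ (_ , e) = case ≡subst (λ k → _ ∈ BV k) e m of λ ()

look₂-BV : ∀ x u y v w → BV (look ((x , u) ∷ (y , v) ∷ []) w) ⊑ (BV u ++ BV v)
look₂-BV x u y v w m with look₂ {x} {u} {y} {v} w
... | inj₁ (_ , e) = inl (≡subst (λ k → _ ∈ BV k) e m)
... | inj₂ (inj₁ (_ , _ , e)) = inr (BV u) (≡subst (λ k → _ ∈ BV k) e m)
... | inj₂ (inj₂ (_ , _ , e)) = case ≡subst (λ k → _ ∈ BV k) e m of λ ()

++-# : ∀ (xs : List ℕ) → xs # zs → ys # zs → (xs ++ ys) # zs
++-# xs d d' i j = case ∈++ xs i of λ { (inj₁ p) → d p j ; (inj₂ p) → d' p j }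

-- Substitution is naive, so a redex whose argument might be captured is first renamed with the
-- variables of the argument as `X`.
refresh : ∀ X t → Lin t → ∃[ t' ] (t ≈ t' × BV t' # X)
refresh X (var x) l = var x , ≈-refl , λ ()
refresh X (app t s) (a , b , _) with refresh X t a | refresh X s b
... | t' , p , d | s' , q , d' = app t' s' , ≈-app p q , ++-# (BV t') d d'
refresh X (pair t s) (a , b , _) with refresh X t a | refresh X s b
... | t' , p , d | s' , q , d' = pair t' s' , ≈-pair p q , ++-# (BV t') d d'
refresh X (lam x t) (a , m) with refresh X t a
... | t' , p , d with fresh (Vars t' ++ X)
... | z , nz = _ , ≈-trans (≈-lam p) (step (α-lam (nz ∘ inl)) (proj₁ (≈-Lin (≈-lam p)) (a , m))) , d'
  where
    d' : (z ∷ BV (subst ((x , var z) ∷ []) t')) # X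
    d' (here refl) j = nz (inr (Vars t') j)
    d' {k} (there i) j = d (case ∈++ (BV t') (BV-subst _ t' (look₁-BV x (var z)) i) of λ { (inj₁ o) → o }) j
refresh X (letp x y s t) l@(b , a , _) with refresh X s b | refresh X t a
... | s' , q , d' | t' , p , d with fresh (Vars t' ++ X)
... | z , nz with fresh (z ∷ Vars t' ++ X)
... | z' , nz' = _ , ≈-trans (≈-let q p) (step (α-let (λ { refl → nz' (here refl) }) (nz ∘ inl) (nz' ∘ there ∘ inl)) (proj₁ (≈-Lin (≈-let q p)) l)) , d''
  where
    d'' : (z ∷ z' ∷ BV s' ++ BV (subst ((x , var z) ∷ (y , var z') ∷ []) t')) # X
    d'' (here refl) j = nz (inr (Vars t') j)
    d'' (there (here refl)) j = nz' (there (inr (Vars t') j))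
    d'' {k} (there (there i)) j with ∈++ (BV s') i
    ... | inj₁ m = d' m j
    ... | inj₂ m = d (case ∈++ (BV t') (BV-subst _ t' (look₂-BV x (var z) y (var z')) m) of λ { (inj₁ o) → o }) j

≈-frame : ∀ F → t ≈ t' → F ⟦ t ⟧ ≈ F ⟦ t' ⟧
≈-frame (lamF x) p = ≈-lam p
≈-frame (appLF s) p = ≈-app p ≈-refl
≈-frame (appRF s) p = ≈-app ≈-refl p
≈-frame (pairLF s) p = ≈-pair p ≈-refl
≈-frame (pairRF s) p = ≈-pair ≈-refl p
≈-frame (letRF x y s) p = ≈-let ≈-refl p

NC₁ : BV t # FV s → NC ((x , s) ∷ []) t
NC₁ {s = s} d i j = case ∈++ (FV s) i of λ { (inj₁ p) → d j p }

subst-fresh : x ∉ FV t → subst ((x , s) ∷ []) t ≡ t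
subst-fresh n = subst-id _ _ λ m → look-there _ [] (avoid n m)

β-float : ∀ F → x ∉ FVF F → FV s # BVF F → Lin (F ⟦ app (lam x u) s ⟧) → Lin (app (lam x (F ⟦ u ⟧)) s)
β-float {x} {s} {u} (lamF z) nx d (((lu , mx) , ls , e) , mz) with ∈++ (FV u ─ x) mz
... | inj₂ p = ⊥-elim (d p (here refl))
... | inj₁ p with ∈─⁻ {xs = FV u} p
... | p , zx = ((lu , p) , ∈─⁺ mx (zx ∘ sym)) , ls ,
  λ i j → case ∈─⁻ {xs = FV u ─ z} i of λ (i , a) → case ∈─⁻ {xs = FV u} i of λ (i , _) → e (∈─⁺ i a) j
β-float {x} {s} {u} (appLF t) nx d (((lu , mx) , ls , e) , lt , f) =
  ((lu , lt , λ {z} i j → f (inl (∈─⁺ i (avoid nx j))) j) , inl mx) , ls ,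
  λ i j → case ∈─⁻ {xs = FV u ++ FV t} i of λ (i , n) → case ∈++ (FV u) i of λ
    { (inj₁ p) → e (∈─⁺ p n) j ; (inj₂ p) → f (inr (FV u ─ x) j) p }
β-float {x} {s} {u} (appRF t) nx d (lt , ((lu , mx) , ls , e) , f) =
  ((lt , lu , λ {z} j i → f j (inl (∈─⁺ i (avoid nx j)))) , inr (FV t) mx) , ls ,
  λ i j → case ∈─⁻ {xs = FV t ++ FV u} i of λ (i , n) → case ∈++ (FV t) i of λ
    { (inj₂ p) → e (∈─⁺ p n) j ; (inj₁ p) → f p (inr (FV u ─ x) j) }
β-float {u = u} (pairLF t) = β-float {u = u} (appLF t)
β-float {u = u} (pairRF t) = β-float {u = u} (appRF t)
β-float {x} {s} {u} (letRF a b t) nx d (lt , ((lu , mx) , ls , e) , ma , mb , a≢b , f) =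
  ((lt , lu , proj₁ ma' , proj₁ mb' , a≢b , g′) , inr (FV t) (∈─⁺ (∈─⁺ mx (proj₂ ma' ∘ sym)) (proj₂ mb' ∘ sym))) , ls , h′
  where
    inner : ∀ {c} → c ∈ a ∷ b ∷ [] → c ∈ (FV u ─ x) ++ FV s → c ∈ FV u × c ≢ x
    inner i m with ∈++ (FV u ─ x) m
    ... | inj₂ p = ⊥-elim (d p i)
    ... | inj₁ p = ∈─⁻ p
    ma' = inner (here refl) ma
    mb' = inner (there (here refl)) mb
    g′ : FV t # ((FV u ─ a) ─ b)
    g′ i j with ∈─⁻ {xs = FV u ─ a} j
    ... | j , nb with ∈─⁻ {xs = FV u} j
    ... | j , na = f i (∈─⁺ (∈─⁺ (inl (∈─⁺ j (avoid nx i))) na) nb)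
    h′ : ((FV t ++ ((FV u ─ a) ─ b)) ─ x) # FV s
    h′ i j with ∈─⁻ {xs = FV t ++ ((FV u ─ a) ─ b)} i
    ... | i , wx with ∈++ (FV t) i
    ... | inj₁ p = f p (∈─⁺ (∈─⁺ (inr (FV u ─ x) j) (λ { refl → d j (here refl) })) (λ { refl → d j (there (here refl)) }))
    ... | inj₂ p = e (∈─⁺ (proj₁ (∈─⁻ {xs = FV u} (proj₁ (∈─⁻ {xs = FV u ─ a} p)))) wx) j

-- The subterm of a frame that has to be renamed apart. At `lamF` there is none, and a variable
-- serves as a placeholder, ignored by `frame-with`.
frame-tm : Frame → Tm
frame-tm (lamF x)      = var x
frame-tm (appLF s)     = s
frame-tm (appRF s)     = s
frame-tm (pairLF s)    = s
frame-tm (pairRF s)    = s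
frame-tm (letRF _ _ s) = s

frame-with : Frame → Tm → Frame
frame-with (lamF x) _      = lamF x
frame-with (appLF _) s     = appLF s
frame-with (appRF _) s     = appRF s
frame-with (pairLF _) s    = pairLF s
frame-with (pairRF _) s    = pairRF s
frame-with (letRF x y _) s = letRF x y s

frame-with-≈ : ∀ F → frame-tm F ≈ s → F ⟦ t ⟧ ≈ frame-with F s ⟦ t ⟧
frame-with-≈ (lamF x) p = ≈-refl
frame-with-≈ (appLF _) p = ≈-app ≈-refl p
frame-with-≈ (appRF _) p = ≈-app p ≈-refl
frame-with-≈ (pairLF _) p = ≈-pair ≈-refl p
frame-with-≈ (pairRF _) p = ≈-pair p ≈-refl
frame-with-≈ (letRF x y _) p = ≈-let p ≈-refl

frame-Lin : ∀ F → Lin (F ⟦ t ⟧) → Lin (frame-tm F)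
frame-Lin (lamF x) l = tt
frame-Lin (appLF _) (_ , l , _) = l
frame-Lin (appRF _) (l , _) = l
frame-Lin (pairLF _) (_ , l , _) = l
frame-Lin (pairRF _) (l , _) = l
frame-Lin (letRF x y _) (l , _) = l

frame-BV : ∀ F → FV s # BVF F → BV (frame-tm F) # FV s → BV u # FV s → BV (F ⟦ u ⟧) # FV s
frame-BV (lamF x) d e f (here refl) j = d j (here refl)
frame-BV (lamF x) d e f (there i) j = f i j
frame-BV {u = u} (appLF t) d e f i j = case ∈++ (BV u) i of λ { (inj₁ p) → f p j ; (inj₂ p) → e p j }
frame-BV (appRF t) d e f i j = case ∈++ (BV t) i of λ { (inj₁ p) → e p j ; (inj₂ p) → f p j }
frame-BV {u = u} (pairLF t) d e f i j = case ∈++ (BV u) i of λ { (inj₁ p) → f p j ; (inj₂ p) → e p j }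
frame-BV (pairRF t) d e f i j = case ∈++ (BV t) i of λ { (inj₁ p) → e p j ; (inj₂ p) → f p j }
frame-BV (letRF x y t) d e f (here refl) j = d j (here refl)
frame-BV (letRF x y t) d e f (there (here refl)) j = d j (there (here refl))
frame-BV (letRF x y t) d e f (there (there i)) j = case ∈++ (BV t) i of λ { (inj₁ p) → e p j ; (inj₂ p) → f p j }

drop-single : ∀ {x s} z → z ≢ x → dropS z ((x , s) ∷ []) ≡ (x , s) ∷ []
drop-single {x} z ne with z ≟ x
... | yes e = ⊥-elim (ne e)
... | no _ = refl

frame-subst : ∀ F → x ∉ FVF F → x ∉ BVF F → subst ((x , s) ∷ []) (F ⟦ u ⟧) ≡ F ⟦ subst ((x , s) ∷ []) u ⟧
frame-subst {u = u} (lamF z) nx nb = cong (λ ρ → lam z (subst ρ u)) (drop-single z (λ { refl → nb (here refl) }))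
frame-subst (appLF t) nx nb = cong (app _) (subst-fresh nx)
frame-subst (appRF t) nx nb = cong (λ k → app k _) (subst-fresh nx)
frame-subst (pairLF t) nx nb = cong (pair _) (subst-fresh nx)
frame-subst (pairRF t) nx nb = cong (λ k → pair k _) (subst-fresh nx)
frame-subst {x} {s} {u} (letRF a b t) nx nb = cong₂ (letp a b) (subst-fresh nx)
  (cong (λ ρ → subst ρ u) (trans (cong (dropS b) (drop-single a (λ { refl → nb (here refl) }))) (drop-single b (λ { refl → nb (there (here refl)) }))))

BVF-used : ∀ F → Lin (F ⟦ t ⟧) → BVF F ⊑ FV t
BVF-used (lamF x) (_ , m) (here refl) = m
BVF-used (letRF x y s) (_ , _ , m , _) (here refl) = m
BVF-used (letRF x y s) (_ , _ , _ , m , _) (there (here refl)) = m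

frame-with-FVF : ∀ F → frame-tm F ≈ s → FVF (frame-with F s) ⊑ FVF F
frame-with-FVF (appLF _) p = proj₂ (≈-FV p)
frame-with-FVF (appRF _) p = proj₂ (≈-FV p)
frame-with-FVF (pairLF _) p = proj₂ (≈-FV p)
frame-with-FVF (pairRF _) p = proj₂ (≈-FV p)
frame-with-FVF (letRF x y _) p = proj₂ (≈-FV p)

frame-with-BVF : ∀ F s → BVF (frame-with F s) ≡ BVF F
frame-with-BVF (lamF _) s = refl
frame-with-BVF (appLF _) s = refl
frame-with-BVF (appRF _) s = refl
frame-with-BVF (pairLF _) s = refl
frame-with-BVF (pairRF _) s = refl
frame-with-BVF (letRF _ _ _) s = refl

frame-with-BV : ∀ F s {X} → BV s # X → BV (frame-tm (frame-with F s)) # X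
frame-with-BV (lamF _) s d ()
frame-with-BV (appLF _) s d = d
frame-with-BV (appRF _) s d = d
frame-with-BV (pairLF _) s d = d
frame-with-BV (pairRF _) s d = d
frame-with-BV (letRF _ _ _) s d = d

inner-Lin : ∀ F → Lin (F ⟦ t ⟧) → Lin t
inner-Lin (lamF _) (l , _) = l
inner-Lin (appLF _) (l , _) = l
inner-Lin (appRF _) (_ , l , _) = l
inner-Lin (pairLF _) (l , _) = l
inner-Lin (pairRF _) (_ , l , _) = l
inner-Lin (letRF _ _ _) (_ , l , _) = l

-- The redex is contracted inside the frame, the substitution passes through the frame as `x` does
-- not occur in it, and the redex is expanded again outside. Both contractions are free of capture
-- after renaming `u` and the frame.
float : ∀ F → x ∉ FVF F → FV s # BVF F → Lin (F ⟦ app (lam x u) s ⟧) → F ⟦ app (lam x u) s ⟧ ≈ app (lam x (F ⟦ u ⟧)) s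
float {x} {s} {u} F nx d l with refresh (FV s) (frame-tm F) (frame-Lin F l)
... | r , p , dr with inner-Lin F l
... | li@((lu , mx) , ls , e) with refresh (FV s) u lu
... | u' , q , du =
  ≈-trans (≈-frame F (≈-app (≈-lam {x = x} q) (≈-refl {s})))
  (≈-trans (frame-with-≈ F p)
  (≈-trans (≈-frame {t = app (lam x u') s} F' (step (β-lam (NC₁ {u'} {s} {x} du)) (proj₁ (≈-Lin (≈-app (≈-lam {x = x} q) (≈-refl {s}))) li)))
  (≈-trans (≈-≡ (sym (frame-subst {x = x} {s = s} {u = u'} F' nx' nb')))
  (≈-trans (≈-sym (step (β-lam (NC₁ {F' ⟦ u' ⟧} {s} {x} (frame-BV {s = s} {u = u'} F' d' (frame-with-BV F r dr) du))) l'))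
           (≈-app (≈-lam (≈-trans (≈-sym (frame-with-≈ F p)) (≈-frame F (≈-sym q)))) ≈-refl)))))
  where
    F' = frame-with F r
    nx' : x ∉ FVF F'
    nx' = nx ∘ frame-with-FVF F p
    d' : FV s # BVF F'
    d' = ≡subst (FV s #_) (sym (frame-with-BVF F r)) d
    nb : x ∉ BVF F
    nb i = case ∈++ (FV u ─ x) (BVF-used F l i) of λ
      { (inj₁ j) → proj₂ (∈─⁻ {xs = FV u} j) refl ; (inj₂ j) → d j i }
    nb' : x ∉ BVF F'
    nb' = ≡subst (x ∉_) (sym (frame-with-BVF F r)) nb
    l' : Lin (app (lam x (F' ⟦ u' ⟧)) s)
    l' = β-float {u = u'} F' nx' d' (proj₁ (≈-Lin (≈-trans (≈-frame F (≈-app (≈-lam {x = x} q) (≈-refl {s}))) (frame-with-≈ F p))) l)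

float-let : ∀ F → x ∉ FVF F → y ∉ FVF F → FV t # BVF F → Lin (F ⟦ letp x y t u ⟧) → F ⟦ letp x y t u ⟧ ≈ letp x y t (F ⟦ u ⟧)
float-let {t = t} {u} F nx ny d l = step (c-comm {t = t} {u = u} F nx ny d) l

β-unfloat : ∀ F → x ∉ FVF F → x ∈ FV u → FV s # BVF F → Lin (app (lam x (F ⟦ u ⟧)) s) → Lin (F ⟦ app (lam x u) s ⟧)
β-unfloat {x} {u} {s} (lamF z) nx mx d (((lu , mz) , mx') , ls , e) =
  ((lu , mx) , ls , λ i j → case ∈─⁻ {xs = FV u} i of λ (i , n) → e (∈─⁺ (∈─⁺ i (λ { refl → d j (here refl) })) n) j) ,
  inl (∈─⁺ mz (proj₂ (∈─⁻ {xs = FV u} mx') ∘ sym))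
β-unfloat {x} {u} {s} (appLF t) nx mx d (((lu , lt , f) , _) , ls , e) =
  ((lu , mx) , ls , λ i j → case ∈─⁻ {xs = FV u} i of λ (i , n) → e (∈─⁺ (inl i) n) j) , lt ,
  λ i j → case ∈++ (FV u ─ x) i of λ { (inj₁ p) → f (proj₁ (∈─⁻ {xs = FV u} p)) j ; (inj₂ p) → e (∈─⁺ (inr (FV u) j) (avoid nx j)) p }
β-unfloat {x} {u} {s} (appRF t) nx mx d (((lt , lu , f) , _) , ls , e) =
  lt , ((lu , mx) , ls , λ i j → case ∈─⁻ {xs = FV u} i of λ (i , n) → e (∈─⁺ (inr (FV t) i) n) j) ,
  λ j i → case ∈++ (FV u ─ x) i of λ { (inj₁ p) → f j (proj₁ (∈─⁻ {xs = FV u} p)) ; (inj₂ p) → e (∈─⁺ (inl j) (avoid nx j)) p }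
β-unfloat {u = u} (pairLF t) = β-unfloat {u = u} (appLF t)
β-unfloat {u = u} (pairRF t) = β-unfloat {u = u} (appRF t)
β-unfloat {x} {u} {s} (letRF a b t) nx mx d (((lt , lu , ma , mb , ne , f) , mx') , ls , e) =
  lt , ((lu , mx) , ls , λ i j → case ∈─⁻ {xs = FV u} i of λ (i , n) →
      e (∈─⁺ (inr (FV t) (∈─⁺ (∈─⁺ i (λ { refl → d j (here refl) })) (λ { refl → d j (there (here refl)) }))) n) j) ,
  inl (∈─⁺ ma (x≢ (here refl))) , inl (∈─⁺ mb (x≢ (there (here refl)))) , ne , g′
  where
    x≢ : ∀ {c} → c ∈ a ∷ b ∷ [] → c ≢ x
    x≢ i refl with ∈++ (FV t) mx'
    ... | inj₁ p = nx p
    ... | inj₂ p with ∈─⁻ {xs = FV u ─ a} p | i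
    ... | p , n | there (here refl) = n refl
    ... | p , n | here refl = proj₂ (∈─⁻ {xs = FV u} p) refl
    g′ : FV t # ((((FV u ─ x) ++ FV s) ─ a) ─ b)
    g′ i j with ∈─⁻ {xs = ((FV u ─ x) ++ FV s) ─ a} j
    ... | j , nb with ∈─⁻ {xs = (FV u ─ x) ++ FV s} j
    ... | j , na with ∈++ (FV u ─ x) j
    ... | inj₁ p = f i (∈─⁺ (∈─⁺ (proj₁ (∈─⁻ {xs = FV u} p)) na) nb)
    ... | inj₂ p = e (∈─⁺ (inl i) (avoid nx i)) p

unfloat : ∀ F → x ∉ FVF F → x ∈ FV u → FV s # BVF F → Lin (app (lam x (F ⟦ u ⟧)) s) → F ⟦ app (lam x u) s ⟧ ≈ app (lam x (F ⟦ u ⟧)) s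
unfloat {u = u} F nx mx d l = float {u = u} F nx d (β-unfloat {u = u} F nx mx d l)

β-id : Lin t → app (lam x (var x)) t ≈ t
β-id {t} {x} l = ≈-trans (step (β-lam λ _ ()) ((tt , here refl) , l , λ m j → case ∈─⁻ {xs = x ∷ []} m of λ { (here refl , n) → n refl })) (≈-≡ (look-here x t []))

-- Cut-free proofs

∥_∥ : Ty → ℕ
∥ tv a ∥  = 1
∥ A ⊗ B ∥ = suc (∥ A ∥ + ∥ B ∥)
∥ A ⊸ B ∥ = suc (∥ A ∥ + ∥ B ∥)

rt : ℕ → Ty → ℕ
rt n A = suc (n + ∥ A ∥)

-- An occurrence of A with name n owns the interval of names [n, n + ∥ A ∥):
-- its left and right components are named suc n and rt n A.
In : ℕ → ℕ → Ty → Set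
In z n A = n ≤ z × z < n + ∥ A ∥

∥∥>0 : ∀ A → 0 < ∥ A ∥
∥∥>0 (tv a)  = ℕ.≤-refl
∥∥>0 (A ⊗ B) = s≤s z≤n
∥∥>0 (A ⊸ B) = s≤s z≤n

in-root : ∀ n A → In n n A
in-root n A = ℕ.≤-refl , ℕ.m<m+n n (∥∥>0 A)

-- Stated for `⊸` and used for `⊗` as well: the two types have the same size, so `In` unfolds to the
-- same inequalities.
in-l : ∀ {z n} A B → In z (suc n) A → In z n (A ⊸ B)
in-l {z} {n} A B (p , q) = ℕ.<⇒≤ p , ℕ.<-≤-trans q (≡subst (suc (n + ∥ A ∥) ≤_) (sym (ℕ.+-suc n (∥ A ∥ + ∥ B ∥)))
  (s≤s (ℕ.+-monoʳ-≤ n (ℕ.m≤m+n ∥ A ∥ ∥ B ∥))))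

in-r : ∀ {z n} A B → In z (rt n A) B → In z n (A ⊸ B)
in-r {z} {n} A B (p , q) = ℕ.≤-trans (ℕ.≤-trans (ℕ.m≤m+n n ∥ A ∥) (ℕ.n≤1+n _)) p ,
  ≡subst (z <_) (trans (cong suc (ℕ.+-assoc n ∥ A ∥ ∥ B ∥)) (sym (ℕ.+-suc n (∥ A ∥ + ∥ B ∥)))) q

in-lr : ∀ {z n} A B → In z (suc n) A → In z (rt n A) B → ⊥
in-lr A B (_ , q) (p , _) = ℕ.<⇒≱ q p

root∉l : ∀ {n} A → In n (suc n) A → ⊥
root∉l A (p , _) = ℕ.1+n≰n p

root∉r : ∀ {n} A B → In n (rt n A) B → ⊥
root∉r {n} A B (p , _) = ℕ.1+n≰n (ℕ.≤-trans (s≤s (ℕ.m≤m+n n ∥ A ∥)) p)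

l≢r : ∀ n A → suc n ≢ rt n A
l≢r n A e = in-lr {suc n} {n} A (tv 0) (in-root (suc n) A) (≡subst (λ k → In (suc n) k (tv 0)) e (in-root (suc n) (tv 0)))

variable
  G : ℕ → Ty
  a m n p q : ℕ

-- Cut-free sequent proofs of a goal named n; G types all names.
data Nf (G : ℕ → Ty) : ℕ → Ty → Tm → Set where
  -- Axioms at atoms only: proofs are η-long and their links join atoms.
  nvar  : G x ≡ tv a → Nf G n (tv a) (var x)
  nlam  : G (suc n) ≡ A → Nf G (rt n A) B t → Nf G n (A ⊸ B) (lam (suc n) t)
  npair : Nf G (suc n) A s → Nf G (rt n A) B t → Nf G n (A ⊗ B) (pair s t)
  nlet  : G x ≡ A ⊗ B → G (suc x) ≡ A → G (rt x A) ≡ B → Nf G n C t →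
          Nf G n C (letp (suc x) (rt x A) (var x) t)
  -- The left rule for `⊸` names the result of the application by means of a redex, just as `nlet`
  -- names the components of a pair. This redex is the trace of a rule and counts as cut-free.
  napp  : G x ≡ A ⊸ B → G (rt x A) ≡ B → Nf G (suc x) A v → Nf G n C u →
          Nf G n C (app (lam (rt x A) u) (app (var x) v))

Disj : ℕ → Ty → ℕ → Ty → Set
Disj n A m B = ∀ {z} → In z n A → In z m B → ⊥

-- Renaming apart for sequents. As the intervals are disjoint as a whole, every name that a rule
-- further up may bind is fresh as well.
record Sep (G : ℕ → Ty) (n : ℕ) (C : Ty) (xs : List ℕ) : Set where
  field
    sep-goal : x ∈ xs → Disj x (G x) n C
    sep-ctx  : x ∈ xs → y ∈ xs → x ≢ y → Disj x (G x) y (G y)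
open Sep

-- The names owned by a sequent. The region of a premise lies within that of the conclusion, which
-- carries disjointness from conclusions to premises.
data Reg (G : ℕ → Ty) (n : ℕ) (C : Ty) (xs : List ℕ) (z : ℕ) : Set where
  in-goal : In z n C → Reg G n C xs z
  in-ctx  : x ∈ xs → In z x (G x) → Reg G n C xs z

Cross : (ℕ → Ty) → ℕ → Ty → List ℕ → ℕ → Ty → List ℕ → Set
Cross G n A xs m B ys = ∀ {z} → Reg G n A xs z → Reg G m B ys z → ⊥

name∉goal : Sep G n C xs → x ∈ xs → In x n C → ⊥
name∉goal {G} {x = x} S m i = sep-goal S m (in-root x (G x)) i

in-l′ : ∀ {z x} → G x ≡ A ⊸ B → In z (suc x) A → In z x (G x)
in-l′ {A = A} {B = B} {z = z} {x} e i = ≡subst (In z x) (sym e) (in-l A B i)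

in-r′ : ∀ {z x} → G x ≡ A ⊸ B → In z (rt x A) B → In z x (G x)
in-r′ {A = A} {B = B} {z = z} {x} e i = ≡subst (In z x) (sym e) (in-r A B i)

in-l″ : ∀ {z x} → G x ≡ A ⊗ B → In z (suc x) A → In z x (G x)
in-l″ {A = A} {B = B} {z = z} {x} e i = ≡subst (In z x) (sym e) (in-l A B i)

in-r″ : ∀ {z x} → G x ≡ A ⊗ B → In z (rt x A) B → In z x (G x)
in-r″ {A = A} {B = B} {z = z} {x} e i = ≡subst (In z x) (sym e) (in-r A B i)

Sep-⊑ : (∀ {z} → In z m B → In z n C) → ys ⊑ xs → Sep G n C xs → Sep G m B ys
Sep-⊑ i s S = record { sep-goal = λ m j k → sep-goal S (s m) j (i k) ; sep-ctx = λ p q → sep-ctx S (s p) (s q) }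

Sep-lam : Sep G n (A ⊸ B) (xs ─ suc n) → G (suc n) ≡ A → Sep G (rt n A) B xs
Sep-lam {G} {n} {A} {B} {xs} S e = record { sep-goal = goal ; sep-ctx = ctx′ }
  where
    goal : x ∈ xs → Disj x (G x) (rt n A) B
    goal {x} m i j with x ≟ suc n
    ... | yes refl = in-lr {n = n} A B (≡subst (In _ (suc n)) e i) j
    ... | no ne = sep-goal S (∈─⁺ m ne) i (in-r A B j)
    ctx′ : x ∈ xs → y ∈ xs → x ≢ y → Disj x (G x) y (G y)
    ctx′ {x} {y} p q ne i j with x ≟ suc n | y ≟ suc n
    ... | yes refl | yes refl = ne refl
    ... | yes refl | no ny = sep-goal S (∈─⁺ q ny) j (in-l A B (≡subst (In _ (suc n)) e i))
    ... | no nx | yes refl = sep-goal S (∈─⁺ p nx) i (in-l A B (≡subst (In _ (suc n)) e j))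
    ... | no nx | no ny = sep-ctx S (∈─⁺ p nx) (∈─⁺ q ny) ne i j

-- The origin of a variable above a left rule on `x`. The rules for `⊗` and `⊸` share this
-- description, and with it the preservation of `Sep` and `Reg`.
data Opened (G : ℕ → Ty) (xs : List ℕ) (x : ℕ) (A B : Ty) (y : ℕ) : Set where
  is-l : y ≡ suc x → G (suc x) ≡ A → Opened G xs x A B y
  is-r : y ≡ rt x A → G (rt x A) ≡ B → Opened G xs x A B y
  rest : y ∈ xs → y ≢ x → Opened G xs x A B y

Sep-open : Sep G n C xs → x ∈ xs → (∀ {z} → In z x (A ⊸ B) → In z x (G x)) →
           (∀ {y} → y ∈ ys → Opened G xs x A B y) → Sep G n C ys
Sep-open {G} {n} {C} {xs} {x} {A} {B} {ys} S mx nd op = record { sep-goal = λ m → goal (op m) ; sep-ctx = λ p q → ctx′ (op p) (op q) }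
  where
    goal : Opened G xs x A B y → Disj y (G y) n C
    goal (is-l refl e) i j = sep-goal S mx (nd (in-l A B (≡subst (In _ (suc x)) e i))) j
    goal (is-r refl e) i j = sep-goal S mx (nd (in-r A B (≡subst (In _ (rt x A)) e i))) j
    goal (rest m _) i j = sep-goal S m i j
    ctx′ : Opened G xs x A B y → Opened G xs x A B z → y ≢ z → Disj y (G y) z (G z)
    ctx′ (is-l refl _) (is-l refl _) ne = ⊥-elim (ne refl)
    ctx′ (is-l refl e) (is-r refl f) ne i j = in-lr {n = x} A B (≡subst (In _ (suc x)) e i) (≡subst (In _ (rt x A)) f j)
    ctx′ (is-l refl e) (rest m nx) ne i j = sep-ctx S m mx nx j (nd (in-l A B (≡subst (In _ (suc x)) e i)))
    ctx′ (is-r refl e) (is-l refl f) ne i j = in-lr {n = x} A B (≡subst (In _ (suc x)) f j) (≡subst (In _ (rt x A)) e i)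
    ctx′ (is-r refl _) (is-r refl _) ne = ⊥-elim (ne refl)
    ctx′ (is-r refl e) (rest m nx) ne i j = sep-ctx S m mx nx j (nd (in-r A B (≡subst (In _ (rt x A)) e i)))
    ctx′ (rest m nx) (is-l refl e) ne i j = sep-ctx S m mx nx i (nd (in-l A B (≡subst (In _ (suc x)) e j)))
    ctx′ (rest m nx) (is-r refl e) ne i j = sep-ctx S m mx nx i (nd (in-r A B (≡subst (In _ (rt x A)) e j)))
    ctx′ (rest m nx) (rest m' nx') ne = sep-ctx S m m' ne

let-opened : Lin (letp (suc x) (rt x A) (var x) t) → G (suc x) ≡ A → G (rt x A) ≡ B →
             y ∈ FV t → Opened G (FV (letp (suc x) (rt x A) (var x) t)) x A B y
let-opened {x} {A} {t} {y = y} (_ , _ , _ , _ , _ , d) e f m with y ≟ suc x | y ≟ rt x A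
... | yes p | _ = is-l p e
... | no _ | yes p = is-r p f
... | no n₁ | no n₂ = rest (there m') λ { refl → d (here refl) m' }
  where m' = ∈─⁺ (∈─⁺ m n₁) n₂

app-opened : Lin (app (lam (rt x A) u) (app (var x) v)) → G (rt x A) ≡ B →
             y ∈ FV u → Opened G (FV (app (lam (rt x A) u) (app (var x) v))) x A B y
app-opened {x} {A} {u} {y = y} (_ , _ , d) f m with y ≟ rt x A
... | yes p = is-r p f
... | no n₁ = rest (inl m') λ { refl → d m' (here refl) }
  where m' = ∈─⁺ m n₁

Sep-let : Lin (letp (suc x) (rt x A) (var x) t) → G x ≡ A ⊗ B → G (suc x) ≡ A → G (rt x A) ≡ B →
          Sep G n C (FV (letp (suc x) (rt x A) (var x) t)) → Sep G n C (FV t)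
Sep-let {x} {A} {t} {B = B} l e₀ e f S = Sep-open {x = x} {A = A} {B = B} S (here refl) (λ i → ≡subst (In _ x) (sym e₀) i) (let-opened {x} {A} {t} l e f)

Sep-app₂ : Lin (app (lam (rt x A) u) (app (var x) v)) → G x ≡ A ⊸ B → G (rt x A) ≡ B →
           Sep G n C (FV (app (lam (rt x A) u) (app (var x) v))) → Sep G n C (FV u)
Sep-app₂ {x} {A} {u} {v} {B = B} l e₀ f S = Sep-open {x = x} {A = A} {B = B} S (inr (FV u ─ rt x A) (here refl)) (λ i → ≡subst (In _ x) (sym e₀) i) (app-opened {x} {A} {u} {v} l f)

Sep-app₁ : Lin (app (lam (rt x A) u) (app (var x) v)) → G x ≡ A ⊸ B →
           Sep G n C (FV (app (lam (rt x A) u) (app (var x) v))) → Sep G (suc x) A (FV v)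
Sep-app₁ {x} {A} {u} {v} {G} {B} (_ , (_ , _ , d) , _) e₀ S = record
  { sep-goal = λ m i j → sep-ctx S (inv m) mx (λ { refl → d (here refl) m }) i (in-l′ {G} e₀ j)
  ; sep-ctx = λ p q → sep-ctx S (inv p) (inv q) }
  where
    mx : x ∈ (FV u ─ rt x A) ++ x ∷ FV v
    mx = inr (FV u ─ rt x A) (here refl)
    inv : FV v ⊑ ((FV u ─ rt x A) ++ x ∷ FV v)
    inv m = inr (FV u ─ rt x A) (there m)

Reg-⊑ : (∀ {z} → In z m B → Reg G n C xs z) → ys ⊑ xs → Reg G m B ys z → Reg G n C xs z
Reg-⊑ f s (in-goal i) = f i
Reg-⊑ f s (in-ctx m i) = in-ctx (s m) i

Reg-lam : G (suc n) ≡ A → Reg G (rt n A) B xs z → Reg G n (A ⊸ B) (xs ─ suc n) z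
Reg-lam {A = A} {B} e (in-goal i) = in-goal (in-r A B i)
Reg-lam {n = n} {A} {B} e (in-ctx {x} m i) with x ≟ suc n
... | yes refl = in-goal (in-l A B (≡subst (In _ (suc n)) e i))
... | no ne = in-ctx (∈─⁺ m ne) i

Reg-open : x ∈ xs → (∀ {z} → In z x (A ⊸ B) → In z x (G x)) →
           (∀ {y} → y ∈ ys → Opened G xs x A B y) → Reg G n C ys z → Reg G n C xs z
Reg-open mx nd op (in-goal i) = in-goal i
Reg-open {x} {xs} {A} {B} {G} {n = n} {C} {z} mx nd op (in-ctx m i) = go (op m) i
  where
    go : Opened G xs x A B y → In z y (G y) → Reg G n C xs z
    go (is-l refl e) i = in-ctx mx (nd (in-l A B (≡subst (In _ (suc x)) e i)))
    go (is-r refl e) i = in-ctx mx (nd (in-r A B (≡subst (In _ (rt x A)) e i)))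
    go (rest m' _) i = in-ctx m' i

Reg-let : Lin (letp (suc x) (rt x A) (var x) t) → G x ≡ A ⊗ B → G (suc x) ≡ A → G (rt x A) ≡ B →
          Reg G n C (FV t) z → Reg G n C (FV (letp (suc x) (rt x A) (var x) t)) z
Reg-let {x} {A} {t} {B = B} l e₀ e f = Reg-open {x} {A = A} {B} (here refl) (λ i → ≡subst (In _ x) (sym e₀) i) (let-opened {x} {A} {t} l e f)

Reg-app₂ : Lin (app (lam (rt x A) u) (app (var x) v)) → G x ≡ A ⊸ B → G (rt x A) ≡ B →
           Reg G n C (FV u) z → Reg G n C (FV (app (lam (rt x A) u) (app (var x) v))) z
Reg-app₂ {x} {A} {u} {v} {B = B} l e₀ f =
  Reg-open {x} {A = A} {B} (inr (FV u ─ rt x A) (here refl)) (λ i → ≡subst (In _ x) (sym e₀) i) (app-opened {x} {A} {u} {v} l f)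

Reg-app₁ : G x ≡ A ⊸ B → Reg G (suc x) A (FV v) z → Reg G n C (FV (app (lam (rt x A) u) (app (var x) v))) z
Reg-app₁ {G} {x} {A} {u = u} e (in-goal i) = in-ctx (inr (FV u ─ rt x A) (here refl)) (in-l′ {G} e i)
Reg-app₁ {x = x} {A} {u = u} e (in-ctx m i) = in-ctx (inr (FV u ─ rt x A) (there m)) i

-- Cut elimination

Sep-cut : Sep G p A xs → Sep G n C ys → Cross G p A xs n C ys → zs ⊑ ((ys ─ q) ++ xs) → Sep G n C zs
Sep-cut {G} {p} {A} {xs} {n} {C} {ys} {zs} {q} S T K s = record { sep-goal = goal ; sep-ctx = ctx′ }
  where
    split : x ∈ zs → x ∈ ys ⊎ x ∈ xs
    split m = case ∈++ (ys ─ q) (s m) of λ { (inj₁ p) → inj₁ (proj₁ (∈─⁻ {xs = ys} p)) ; (inj₂ p) → inj₂ p }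
    goal : x ∈ zs → Disj x (G x) n C
    goal m i j with split m
    ... | inj₁ p = sep-goal T p i j
    ... | inj₂ p = K (in-ctx p i) (in-goal j)
    ctx′ : x ∈ zs → y ∈ zs → x ≢ y → Disj x (G x) y (G y)
    ctx′ m m' ne i j with split m | split m'
    ... | inj₁ p | inj₁ q = sep-ctx T p q ne i j
    ... | inj₁ p | inj₂ q = K (in-ctx q j) (in-ctx p i)
    ... | inj₂ p | inj₁ q = K (in-ctx p i) (in-ctx q j)
    ... | inj₂ p | inj₂ q = sep-ctx S p q ne i j

-- Both sides contract to the simultaneous substitution of `s` and `v`. The right-hand side has it
-- as two cuts in sequence, one for each component.
cut-pair : q ≢ x → q ≢ y → y ∉ FV s → x ∉ FV s → x ∉ FV v → y ∉ FV v → Lin (app (lam q (letp x y (var q) t)) (pair s v)) →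
           app (lam q (letp x y (var q) t)) (pair s v) ≈ app (lam x (app (lam y t) v)) s
cut-pair {q} {x} {y} {s} {v} {t} qx qy ys xs' xv yv l@((( _ , lt , mx , my , x≢y , f) , _) , (ls , lv , d) , e)
  with refresh (FV s ++ FV v) t lt
... | t' , r , dt with refresh (FV s) v lv
... | v' , r' , dv =
  ≈-trans (≈-app (≈-lam (≈-let ≈-refl r)) (≈-pair ≈-refl r'))
  (≈-trans (step (β-lam ncP) lP)
  (≈-trans (≈-≡ (cong₂ (letp x y) (look-here q (pair s v') [])
        (trans (cong (λ ρ → subst ρ t') (trans (cong (dropS y) (drop-single x (qx ∘ sym))) (drop-single y (qy ∘ sym))))
               (subst-fresh {t = t'} q∉t'))))
  (≈-trans (step (β-let nc₂) lB)
  (≈-trans (≈-≡ (sym (subst-comp ((y , v') ∷ []) ((x , s) ∷ []) ((x , s) ∷ (y , v') ∷ []) t' nc₃ comp)))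
  (≈-trans (≈-sym (step (β-lam nc₄) lC))
  (≈-app (≈-lam (≈-trans (≈-sym (step (β-lam nc₃) lD)) (≈-app (≈-lam (≈-sym r)) (≈-sym r')))) ≈-refl))))))
  where
    fv' : FV v' ⊑ FV v
    fv' = proj₂ (≈-FV r')
    l' = proj₁ (≈-Lin (≈-app (≈-lam {x = q} (≈-let {x = x} {y = y} ≈-refl r)) (≈-pair (≈-refl {s}) r'))) l
    lP : Lin (app (lam q (letp x y (var q) t')) (pair s v'))
    lP = l'
    q∉t' : q ∉ FV t'
    q∉t' m = f (here refl) (∈─⁺ (∈─⁺ (proj₂ (≈-FV r) m) qx) qy)
    fromP : ∀ {z} → z ∈ FV (pair s v') → z ∈ FV s ++ FV v
    fromP i = case ∈++ (FV s) i of λ { (inj₁ p) → inl p ; (inj₂ p) → inr (FV s) (fv' p) }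
    ncP : NC ((q , pair s v') ∷ []) (letp x y (var q) t')
    ncP = NC₁ {letp x y (var q) t'} {pair s v'} {q} λ
      { (here refl) i → case ∈++ (FV s) (fromP i) of λ { (inj₁ p) → xs' p ; (inj₂ p) → xv p }
      ; (there (here refl)) i → case ∈++ (FV s) (fromP i) of λ { (inj₁ p) → ys p ; (inj₂ p) → yv p }
      ; (there (there i)) j → dt i (fromP j) }
    lt' : Lin t'
    lt' = proj₁ (≈-Lin r) lt
    lv' : Lin v'
    lv' = proj₁ (≈-Lin r') lv
    ds : FV s # (FV t ─ x)
    ds {z} i j = case ∈─⁻ {xs = FV t} j of λ (j , zx) → e (∈─⁺ {xs = q ∷ ((FV t ─ x) ─ y)} (there (∈─⁺ (∈─⁺ j zx) (avoid ys i))) (λ { refl → f (here refl) (∈─⁺ {xs = FV t ─ x} (∈─⁺ {xs = FV t} j zx) (avoid ys i)) })) (inl i)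
    dv' : FV v # (FV t ─ y)
    dv' {z} i j = case ∈─⁻ {xs = FV t} j of λ (j , zy) → e (∈─⁺ {xs = q ∷ ((FV t ─ x) ─ y)} (there (∈─⁺ (∈─⁺ j (avoid xv i)) zy)) (λ { refl → f (here refl) (∈─⁺ {xs = FV t ─ x} (∈─⁺ {xs = FV t} j (avoid xv i)) zy) })) (inr (FV s) i)
    lB : Lin (letp x y (pair s v') t')
    lB = (ls , lv' , λ i j → d i (fv' j)) , lt' , proj₁ (≈-FV r) mx , proj₁ (≈-FV r) my , x≢y , λ i j →
      case ∈─⁻ {xs = FV t' ─ x} j of λ (j , zy) → case ∈─⁻ {xs = FV t'} j of λ (j , zx) → case ∈++ (FV s) i of λ
        { (inj₁ p) → ds p (∈─⁺ (proj₂ (≈-FV r) j) zx) ; (inj₂ p) → dv' (fv' p) (∈─⁺ (proj₂ (≈-FV r) j) zy) }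
    nc₂ : NC ((x , s) ∷ (y , v') ∷ []) t'
    nc₂ i j = case ∈++ (FV s) i of λ { (inj₁ p) → dt j (inl p) ; (inj₂ p) → case ∈++ (FV v') p of λ { (inj₁ p) → dt j (inr (FV s) (fv' p)) } }
    nc₃ : NC ((y , v') ∷ []) t'
    nc₃ i j = case ∈++ (FV v') i of λ { (inj₁ p) → dt j (inr (FV s) (fv' p)) }
    comp : ∀ {z} → z ∈ FV t' → subst ((x , s) ∷ []) (look ((y , v') ∷ []) z) ≡ look ((x , s) ∷ (y , v') ∷ []) z
    comp {z} m with look₁ {y} {v'} z
    ... | inj₁ (refl , o) = trans (cong (subst ((x , s) ∷ [])) o) (trans (subst-fresh {t = v'} (xv ∘ fv')) (sym (trans (look-there s _ (x≢y ∘ sym)) (look-here y v' []))))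
    ... | inj₂ (zy , o) with z ≟ x
    ...   | yes refl = trans (cong (subst ((z , s) ∷ [])) o) (look-here z s [])
    ...   | no zx = trans (cong (subst ((x , s) ∷ [])) o) (trans (look-there s [] zx) (sym o))
    lD : Lin (app (lam y t') v')
    lD = (lt' , proj₁ (≈-FV r) my) , lv' , λ i j → case ∈─⁻ {xs = FV t'} i of λ (i , n) → dv' (fv' j) (∈─⁺ (proj₂ (≈-FV r) i) n)
    fvD : FV (app (lam y t') v') ≋ FV (subst ((y , v') ∷ []) t')
    fvD = ≈-FV (step (β-lam nc₃) lD)
    nc₄ : NC ((x , s) ∷ []) (subst ((y , v') ∷ []) t')
    nc₄ = NC₁ {subst ((y , v') ∷ []) t'} {s} {x} λ i j → case ∈++ (BV t') (BV-subst _ t' (look₁-BV y v') i) of λ { (inj₁ o) → dt o (inl j) ; (inj₂ o) → dv o j }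
    lC : Lin (app (lam x (subst ((y , v') ∷ []) t')) s)
    lC = (proj₁ (≈-Lin (step (β-lam nc₃) lD)) lD , proj₁ fvD (inl (∈─⁺ (proj₁ (≈-FV r) mx) x≢y))) , ls , λ i j →
      case ∈─⁻ {xs = FV (subst ((y , v') ∷ []) t')} i of λ (i , zx) → case ∈++ (FV t' ─ y) (proj₂ fvD i) of λ
        { (inj₁ o) → ds j (∈─⁺ (proj₂ (≈-FV r) (proj₁ (∈─⁻ {xs = FV t'} o))) zx) ; (inj₂ o) → d j (fv' o) }

-- An atomic goal has no components to be bound, so its name does not enter the term.
readdress : Nf G p (tv a) t → Nf G n (tv a) t
readdress (nvar e) = nvar e
readdress (nlet e f h D) = nlet e f h (readdress D)
readdress (napp e f D E) = napp e f D (readdress E)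

-- The shape of all commutative cases: the cut moves under the frame, the induction hypothesis
-- replaces it there by a cut-free `w`, and the conversion of `w` is carried back to the cut
-- outside.
commute : ∀ F u → q ∉ FVF F → q ∈ FV u → FV t # BVF F → Lin (app (lam q (F ⟦ u ⟧)) t) →
          Lin (app (lam q u) t) × (∀ {w} → w ≈ app (lam q u) t → F ⟦ w ⟧ ≈ app (lam q (F ⟦ u ⟧)) t)
commute {q} {t} F u n m d l = inner-Lin {t = app (lam q u) t} F (proj₂ (≈-Lin r) l) , λ p → ≈-trans (≈-frame F p) r
  where
    r : F ⟦ app (lam q u) t ⟧ ≈ app (lam q (F ⟦ u ⟧)) t
    r = unfloat {u = u} F n m d l

goal∉ : ∀ {z} → Cross G p A xs n C ys → In z n C → z ∉ xs
goal∉ {G} {z = z} K i m = K (in-ctx m (in-root z (G z))) (in-goal i)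

ctx∉ : ∀ {z} → Cross G p A xs n C ys → y ∈ ys → In z y (G y) → z ∉ xs
ctx∉ {G} {z = z} K my i m = K (in-ctx m (in-root z (G z))) (in-ctx my i)

#1 : x ∉ xs → xs # (x ∷ [])
#1 n i (here refl) = n i

#2 : x ∉ xs → y ∉ xs → xs # (x ∷ y ∷ [])
#2 n m i (here refl) = n i
#2 n m i (there (here refl)) = m i

suc≢ : ∀ {n} → n ≢ suc n
suc≢ ()

rt≢ : ∀ n A → n ≢ rt n A
rt≢ n A e = root∉r {n} A (tv 0) (≡subst (λ k → In n k (tv 0)) e (in-root n (tv 0)))

IH : (ℕ → Ty) → ℕ → Ty → ℕ → Tm → ℕ → Ty → Tm → Set
IH G p A q t n C u = Sep G n C (FV u) → Cross G p A (FV t) n C (FV u) → Lin (app (lam q u) t) →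
                     ∃[ w ] (Nf G n C w × w ≈ app (lam q u) t)

cut-nlet : ∀ {X Y b} → Nf G p A t → let u = letp (suc x) (rt x X) (var x) b in
  G x ≡ X ⊗ Y → G (suc x) ≡ X → G (rt x X) ≡ Y → q ≢ x → q ∈ FV u → Sep G n C (FV u) → Cross G p A (FV t) n C (FV u) →
  Lin (app (lam q u) t) → ({_ : q ∈ FV b} → IH G p A q t n C b) → ∃[ w ] (Nf G n C w × w ≈ app (lam q u) t)
cut-nlet {G} {x = x} {X = X} {Y} {b} D e₀ e₁ e₂ q≢x (here q≡x) T K l ih = ⊥-elim (q≢x q≡x)
cut-nlet {G} {x = x} {X = X} {Y} {b} D e₀ e₁ e₂ q≢x (there m′) T K l@((lu , _) , _) ih =
  let mq = proj₁ (∈─⁻ {xs = FV b} (proj₁ (∈─⁻ {xs = FV b ─ suc x} m′)))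
      (l′ , r) = commute (letRF (suc x) (rt x X) (var x)) b (λ { (here o) → q≢x o }) mq
         (#2 (ctx∉ K (here refl) (in-l″ {G} e₀ (in-root (suc x) X))) (ctx∉ K (here refl) (in-r″ {G} e₀ (in-root (rt x X) Y)))) l
      (w , W , r') = ih {mq} (Sep-let {x = x} {X} {b} lu e₀ e₁ e₂ T) (λ i j → K i (Reg-let {x = x} {X} {b} {G} lu e₀ e₁ e₂ j)) l′
  in _ , nlet e₀ e₁ e₂ W , r r'

cut-napp₁ : ∀ {X Y b} → let u = app (lam (rt x X) b) (app (var x) v) in
  G x ≡ X ⊸ Y → G (rt x X) ≡ Y → Nf G n C b → q ≢ x → q ∈ FV v → Sep G n C (FV u) → Cross G p A (FV t) n C (FV u) →
  Lin (app (lam q u) t) → IH G p A q t (suc x) X v → ∃[ w ] (Nf G n C w × w ≈ app (lam q u) t)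
cut-napp₁ {x} {v} {G} {X = X} {Y} {b} e₀ e₂ E₂ q≢x mq T K l@((lu@(_ , _ , d) , _) , _) ih =
  let (l₁ , r₁) = commute (appRF (lam (rt x X) b)) (app (var x) v) (λ i → d i (there mq)) (there mq) (λ _ ()) l
      (l₂ , r₂) = commute (appRF (var x)) v (λ { (here o) → q≢x o }) mq (λ _ ()) l₁
      (w , W , r') = ih (Sep-app₁ {x = x} {X} {b} {v} lu e₀ T) (λ i j → K i (Reg-app₁ {G} {x} {v = v} {u = b} e₀ j)) l₂
  in _ , napp e₀ e₂ W E₂ , r₁ (r₂ r')

cut-napp₂ : ∀ {X Y b} → let u = app (lam (rt x X) b) (app (var x) v) in
  G x ≡ X ⊸ Y → G (rt x X) ≡ Y → Nf G (suc x) X v → q ≢ x → q ∈ FV b ─ rt x X → Sep G n C (FV u) → Cross G p A (FV t) n C (FV u) →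
  Lin (app (lam q u) t) → IH G p A q t n C b → ∃[ w ] (Nf G n C w × w ≈ app (lam q u) t)
cut-napp₂ {x} {v} {G} {X = X} {Y} {b} e₀ e₂ E₁ q≢x mq T K l@((lu@(_ , _ , d) , _) , _) ih =
  let (l₁ , r₁) = commute (appLF (app (var x) v)) (lam (rt x X) b) (d mq) mq (λ _ ()) l
      (l₂ , r₂) = commute (lamF (rt x X)) b (λ ()) (proj₁ (∈─⁻ {xs = FV b} mq))
                     (#1 (ctx∉ K (inr (FV b ─ rt x X) (here refl)) (in-r′ {G} e₀ (in-root (rt x X) Y)))) l₁
      (w , W , r') = ih (Sep-app₂ {x = x} {X} {b} {v} lu e₀ e₂ T) (λ i j → K i (Reg-app₂ {x = x} {X} {b} {v} {G} lu e₀ e₂ j)) l₂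
  in _ , napp e₀ e₂ E₁ W , r₁ (r₂ r')

Cut : Ty → Set
Cut A = ∀ {G p t n C u q} → Nf G p A t → Nf G n C u → G q ≡ A → q ∈ FV u → Sep G p A (FV t) → Sep G n C (FV u) →
        Cross G p A (FV t) n C (FV u) → Lin (app (lam q u) t) → ∃[ w ] (Nf G n C w × w ≈ app (lam q u) t)

reg∉ : ∀ {z} → Cross G p A xs n C ys → Reg G p A xs z → z ∉ ys
reg∉ {G} {z = z} K i m = K i (in-ctx m (in-root z (G z)))

-- A cut on `X ⊗ Y` becomes one on `Y` and then one on `X`. The delicate condition is `K₁`: the
-- first result has variables from `b` and from `s₂`, and they are separated from `s₁` for different
-- reasons.
cut-npair : ∀ {X Y b s₁ s₂} → Cut X → Cut Y → Nf G (suc p) X s₁ → Nf G (rt p X) Y s₂ → let u = letp (suc q) (rt q X) (var q) b in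
  Nf G n C b → G q ≡ X ⊗ Y → G (suc q) ≡ X → G (rt q X) ≡ Y → Sep G p (X ⊗ Y) (FV s₁ ++ FV s₂) → Sep G n C (FV u) →
  Cross G p (X ⊗ Y) (FV s₁ ++ FV s₂) n C (FV u) → Lin (app (lam q u) (pair s₁ s₂)) → ∃[ w ] (Nf G n C w × w ≈ app (lam q u) (pair s₁ s₂))
cut-npair {G} {p} {q} {n} {C} {X} {Y} {b} {s₁} {s₂} cutX cutY D₁ D₂ E e e₁ e₂ S T K l@((lu@(_ , lb , m₁ , m₂ , _) , _) , (_ , _ , d₁₂) , _) = result
  where
    q₁ = suc q
    q₂ = rt q X
    n₁ : q₁ ∉ FV (pair s₁ s₂)
    n₁ = ctx∉ K (here refl) (in-l″ {G} e (in-root q₁ X))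
    n₂ : q₂ ∉ FV (pair s₁ s₂)
    n₂ = ctx∉ K (here refl) (in-r″ {G} e (in-root q₂ Y))
    r : app (lam q (letp q₁ q₂ (var q) b)) (pair s₁ s₂) ≈ app (lam q₁ (app (lam q₂ b) s₂)) s₁
    r = cut-pair suc≢ (rt≢ q X) (n₂ ∘ inl) (n₁ ∘ inl) (n₁ ∘ inr (FV s₁)) (n₂ ∘ inr (FV s₁)) l
    lr : Lin (app (lam q₁ (app (lam q₂ b) s₂)) s₁)
    lr = proj₁ (≈-Lin r) l
    K₂ : Cross G (rt p X) Y (FV s₂) n C (FV b)
    K₂ i j = K (Reg-⊑ (λ k → in-goal (in-r X Y k)) (inr (FV s₁)) i) (Reg-let {q} {X} {b} {G} lu e e₁ e₂ j)
    T₂ : Sep G n C (FV b)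
    T₂ = Sep-let {q} {X} {b} lu e e₁ e₂ T
    S₂ : Sep G (rt p X) Y (FV s₂)
    S₂ = Sep-⊑ (in-r X Y) (inr (FV s₁)) S
    K₁ : ∀ {w₁} → w₁ ≈ app (lam q₂ b) s₂ → Cross G (suc p) X (FV s₁) n C (FV w₁)
    K₁ r₁ i (in-goal j) = K (Reg-⊑ (λ k → in-goal (in-l X Y k)) inl i) (in-goal j)
    K₁ r₁ i (in-ctx m j) with ∈++ (FV b ─ q₂) (proj₁ (≈-FV r₁) m)
    ... | inj₁ m′ = K (Reg-⊑ (λ k → in-goal (in-l X Y k)) inl i) (Reg-let {q} {X} {b} {G} lu e e₁ e₂ (in-ctx (proj₁ (∈─⁻ {xs = FV b} m′)) j))
    K₁ r₁ (in-goal i) (in-ctx m j) | inj₂ m′ = sep-goal S (inr (FV s₁) m′) j (in-l X Y i)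
    K₁ r₁ (in-ctx k i) (in-ctx m j) | inj₂ m′ = sep-ctx S (inl k) (inr (FV s₁) m′) (λ { refl → d₁₂ k m′ }) i j
    result : ∃[ w ] (Nf G n C w × w ≈ app (lam q (letp q₁ q₂ (var q) b)) (pair s₁ s₂))
    result =
      let (w₁ , W₁ , r₁) = cutY D₂ E e₂ m₂ S₂ T₂ K₂ (proj₁ (proj₁ lr))
          (w₂ , W₂ , r₂) = cutX D₁ W₁ e₁ (proj₂ (≈-FV r₁) (inl (∈─⁺ m₁ (l≢r q X)))) (Sep-⊑ (in-l X Y) inl S) (Sep-cut S₂ T₂ K₂ (proj₁ (≈-FV r₁))) (K₁ r₁)
                              (proj₂ (≈-Lin (≈-app (≈-lam {x = q₁} r₁) (≈-refl {s₁}))) lr)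
      in w₂ , W₂ , ≈-trans r₂ (≈-trans (≈-app (≈-lam r₁) ≈-refl) (≈-sym r))

-- A cut on `X ⊸ Y` becomes a cut on `X` of the argument `v` into the body `c`, and a cut on `Y` of
-- the outcome into the continuation `b`.
cut-nlam : ∀ {X Y b c} → Cut X → Cut Y → G (suc p) ≡ X → Nf G (rt p X) Y c → let u = app (lam (rt q X) b) (app (var q) v) in
  Nf G (suc q) X v → Nf G n C b → G q ≡ X ⊸ Y → G (rt q X) ≡ Y → Sep G p (X ⊸ Y) (FV (lam (suc p) c)) → Sep G n C (FV u) →
  Cross G p (X ⊸ Y) (FV (lam (suc p) c)) n C (FV u) → Lin (app (lam q u) (lam (suc p) c)) → ∃[ w ] (Nf G n C w × w ≈ app (lam q u) (lam (suc p) c))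
cut-nlam {G} {p} {q} {v} {n} {C} {X} {Y} {b} {c} cutX cutY f D E₁ E₂ e e₂ S T K l@(((_ , (_ , lv , qv) , bv) , _) , lt , _) = result
  where
    U = app (lam (rt q X) b) (app (var q) v)
    Y' = rt q X
    lu : Lin U
    lu = proj₁ (proj₁ l)
    T' = lam (suc p) c
    q∉b : q ∉ FV b ─ Y'
    q∉b m = bv m (here refl)
    r₀ : app (lam Y' b) (app (lam q (app (var q) v)) T') ≈ app (lam q U) T'
    r₀ = unfloat {u = app (var q) v} (appRF (lam Y' b)) q∉b (here refl) (λ _ ()) l
    r₁ : app (app (lam q (var q)) T') v ≈ app (lam q (app (var q) v)) T'
    r₁ = unfloat {u = var q} (appLF v) (qv (here refl)) (here refl) (λ _ ()) (inner-Lin {t = app (lam q (app (var q) v)) T'} (appRF (lam Y' b)) (proj₂ (≈-Lin r₀) l))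
    -- By linearity `q` occurs only as the head of the application. The cut is moved to that place
    -- and contracted there by `β-id`.
    r : app (lam Y' b) (app T' v) ≈ app (lam q U) T'
    r = ≈-trans (≈-app ≈-refl (≈-trans (≈-app (≈-sym (β-id lt)) ≈-refl) r₁)) r₀
    lr : Lin (app (lam Y' b) (app T' v))
    lr = proj₂ (≈-Lin r) l
    Sv : Sep G (suc q) X (FV v)
    Sv = Sep-app₁ {q} {X} {b} {v} lu e T
    Sc : Sep G (rt p X) Y (FV c)
    Sc = Sep-lam S f
    K₁ : Cross G (suc q) X (FV v) (rt p X) Y (FV c)
    K₁ i j = K (Reg-lam {G} f j) (Reg-app₁ {G} {q} {v = v} {u = b} e i)
    K₂ : ∀ {w₁} → w₁ ≈ app (lam (suc p) c) v → Cross G (rt p X) Y (FV w₁) n C (FV b)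
    K₂ r₁ (in-goal i) j = K (in-goal (in-r X Y i)) (Reg-app₂ {q} {X} {b} {v} {G} lu e e₂ j)
    K₂ r₁ (in-ctx m i) j with ∈++ (FV c ─ suc p) (proj₁ (≈-FV r₁) m)
    ... | inj₁ m′ = K (in-ctx m′ i) (Reg-app₂ {q} {X} {b} {v} {G} lu e e₂ j)
    K₂ r₁ (in-ctx m i) (in-goal j) | inj₂ m′ = sep-goal T (inr (FV b ─ Y') (there m′)) i j
    K₂ r₁ (in-ctx m i) (in-ctx {x} k j) | inj₂ m′ with x ≟ Y'
    ... | yes refl = sep-ctx T (inr (FV b ─ Y') (there m′)) (inr (FV b ─ Y') (here refl)) (λ { refl → qv (here refl) m′ }) i
                           (in-r′ {G} e (≡subst (In _ x) e₂ j))
    ... | no ne = sep-ctx T (inr (FV b ─ Y') (there m′)) (inl (∈─⁺ k ne)) (λ { refl → bv (∈─⁺ k ne) (there m′) }) i j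
    result : ∃[ w ] (Nf G n C w × w ≈ app (lam q U) T')
    result =
      let (w₁ , W₁ , r₁) = cutX E₁ D f (proj₂ lt) Sv Sc K₁ (proj₁ (proj₂ lr))
          (w₂ , W₂ , r₂) = cutY W₁ E₂ e₂ (proj₂ (proj₁ lr)) (Sep-cut Sv Sc K₁ (proj₁ (≈-FV r₁))) (Sep-app₂ {q} {X} {b} {v} lu e e₂ T) (K₂ r₁)
                              (proj₂ (≈-Lin (≈-app (≈-refl {lam Y' b}) r₁)) lr)
      in w₂ , W₂ , ≈-trans r₂ (≈-trans (≈-app ≈-refl r₁) r)

-- The recursion is on the cut formula, then on the right proof until its last rule decomposes `q`,
-- then, in `cut-⊗` and `cut-⊸`, on the left proof until its last rule introduces the formula.
cut : ∀ {G p t n C u q} A → Nf G p A t → Nf G n C u → G q ≡ A → q ∈ FV u → Sep G p A (FV t) → Sep G n C (FV u) →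
      Cross G p A (FV t) n C (FV u) → Lin (app (lam q u) t) → ∃[ w ] (Nf G n C w × w ≈ app (lam q u) t)

cut-⊗ : ∀ {G p t s n C q} A B → Nf G p (A ⊗ B) t → let u = letp (suc q) (rt q A) (var q) s in
      Nf G n C s → G q ≡ A ⊗ B → G (suc q) ≡ A → G (rt q A) ≡ B → Sep G p (A ⊗ B) (FV t) → Sep G n C (FV u) →
      Cross G p (A ⊗ B) (FV t) n C (FV u) → Lin (app (lam q u) t) → ∃[ w ] (Nf G n C w × w ≈ app (lam q u) t)

cut-⊸ : ∀ {G p t s v q n C} A B → Nf G p (A ⊸ B) t → let u = app (lam (rt q A) s) (app (var q) v) in
      Nf G (suc q) A v → Nf G n C s → G q ≡ A ⊸ B → G (rt q A) ≡ B → Sep G p (A ⊸ B) (FV t) → Sep G n C (FV u) →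
      Cross G p (A ⊸ B) (FV t) n C (FV u) → Lin (app (lam q u) t) → ∃[ w ] (Nf G n C w × w ≈ app (lam q u) t)

cut A D (nvar {a = a} e′) e (here refl) S T K l@(_ , lt , _) with trans (sym e) e′
... | refl = _ , readdress D , ≈-sym (β-id lt)
cut A D (nlam {n = n} {A = X} {B = Y} {t = b} ex E) e m S T K l with ∈─⁻ {xs = FV b} m
... | mq , _ with commute (lamF (suc n)) b (λ ()) mq (#1 (goal∉ K (in-l X Y (in-root (suc n) X)))) l
... | l′ , r with cut A D E e mq S (Sep-lam T ex) (λ i j → K i (Reg-lam ex j)) l′
... | w , W , r' = _ , nlam ex W , r r'
cut A D (npair {A = X} {s = a} {B = Y} {t = b} E E') e m S T K l@(((_ , _ , d) , _) , _) with ∈++ (FV a) m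
... | inj₁ mq with commute (pairLF b) a (d mq) mq (λ _ ()) l
...   | l′ , r with cut A D E e mq S (Sep-⊑ (in-l X Y) inl T) (λ i j → K i (Reg-⊑ (λ k → in-goal (in-l X Y k)) inl j)) l′
...   | w , W , r' = _ , npair W E' , r r'
cut A D (npair {A = X} {s = a} {B = Y} {t = b} E E') e m S T K l@(((_ , _ , d) , _) , _) | inj₂ mq
  with commute (pairRF a) b (λ i → d i mq) mq (λ _ ()) l
...   | l′ , r with cut A D E' e mq S (Sep-⊑ (in-r X Y) (inr (FV a)) T) (λ i j → K i (Reg-⊑ (λ k → in-goal (in-r X Y k)) (inr (FV a)) j)) l′
...   | w , W , r' = _ , npair E W , r r'
cut {q = q} A D (nlet {x = x} {A = X} {B = Y} {t = b} e₀ e₁ e₂ E) e m S T K l with q ≟ x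
... | yes refl = case trans (sym e) e₀ of λ { refl → cut-⊗ X Y D E e e₁ e₂ S T K l }
... | no q≢x = cut-nlet D e₀ e₁ e₂ q≢x m T K l (λ {mq} → cut A D E e mq S)
cut {q = q} A D (napp {x = x} {A = X} {B = Y} {v = v} {u = b} e₀ e₂ E₁ E₂) e m S T K l with q ≟ x
... | yes refl = case trans (sym e) e₀ of λ { refl → cut-⊸ X Y D E₁ E₂ e e₂ S T K l }
... | no q≢x with ∈++ (FV b ─ rt x X) m
...   | inj₂ (here q≡x) = ⊥-elim (q≢x q≡x)
...   | inj₂ (there mq) = cut-napp₁ e₀ e₂ E₂ q≢x mq T K l (cut A D E₁ e mq S)
...   | inj₁ mq = cut-napp₂ {v = v} e₀ e₂ E₁ q≢x mq T K l (cut A D E₂ e (proj₁ (∈─⁻ {xs = FV b} mq)) S)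

cut-⊗ X Y (npair D₁ D₂) E e e₁ e₂ S T K l = cut-npair (cut X) (cut Y) D₁ D₂ E e e₁ e₂ S T K l
cut-⊗ {G = G} {p = p} {s = b} {n = n} {C = C} {q = q} X Y (nlet {x = x} {A = A'} {B = B'} {t = d} f₀ f₁ f₂ D) E e e₁ e₂ S T K l@(_ , lt , _) =
  let r = float-let {t = var x} {u = d} (appRF (lam q (letp (suc q) (rt q X) (var q) b)))
              (reg∉ K (in-ctx (here refl) (in-l″ {G} f₀ (in-root (suc x) A'))) ∘ proj₁ ∘ ∈─⁻)
              (reg∉ K (in-ctx (here refl) (in-r″ {G} f₀ (in-root (rt x A') B'))) ∘ proj₁ ∘ ∈─⁻) (λ _ ()) l
      (w , W , r') = cut-⊗ X Y D E e e₁ e₂ (Sep-let {x} {A'} {d} lt f₀ f₁ f₂ S) T (λ i j → K (Reg-let {x} {A'} {d} {G} lt f₀ f₁ f₂ i) j) (proj₁ (proj₂ (proj₁ (≈-Lin r) l)))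
  in _ , nlet f₀ f₁ f₂ W , ≈-trans (≈-let ≈-refl r') (≈-sym r)
cut-⊗ {G = G} {p = p} {s = b} {n = n} {C = C} {q = q} X Y (napp {x = x} {A = A'} {B = B'} {v = v} {u = d} f₀ f₂ D₁ D₂) E e e₁ e₂ S T K l@(_ , lt , _) =
  let r = float {u = d} (appRF (lam q (letp (suc q) (rt q X) (var q) b)))
              (reg∉ K (in-ctx (inr (FV d ─ rt x A') (here refl)) (in-r′ {G} f₀ (in-root (rt x A') B'))) ∘ proj₁ ∘ ∈─⁻) (λ _ ()) l
      (w , W , r') = cut-⊗ X Y D₂ E e e₁ e₂ (Sep-app₂ {x} {A'} {d} {v} lt f₀ f₂ S) T (λ i j → K (Reg-app₂ {x} {A'} {d} {v} {G} lt f₀ f₂ i) j) (proj₁ (proj₁ (proj₁ (≈-Lin r) l)))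
  in _ , napp f₀ f₂ D₁ W , ≈-trans (≈-app (≈-lam r') ≈-refl) (≈-sym r)

cut-⊸ X Y (nlam f D) E₁ E₂ e e₂ S T K l = cut-nlam (cut X) (cut Y) f D E₁ E₂ e e₂ S T K l
cut-⊸ {G = G} {p = p} {s = b} {v = v₀} {q = q} {n = n} {C = C} X Y (nlet {x = x} {A = A'} {B = B'} {t = d} f₀ f₁ f₂ D) E₁ E₂ e e₂ S T K l@(_ , lt , _) =
  let r = float-let {t = var x} {u = d} (appRF (lam q (app (lam (rt q X) b) (app (var q) v₀))))
              (reg∉ K (in-ctx (here refl) (in-l″ {G} f₀ (in-root (suc x) A'))) ∘ proj₁ ∘ ∈─⁻)
              (reg∉ K (in-ctx (here refl) (in-r″ {G} f₀ (in-root (rt x A') B'))) ∘ proj₁ ∘ ∈─⁻) (λ _ ()) l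
      (w , W , r') = cut-⊸ X Y D E₁ E₂ e e₂ (Sep-let {x} {A'} {d} lt f₀ f₁ f₂ S) T (λ i j → K (Reg-let {x} {A'} {d} {G} lt f₀ f₁ f₂ i) j) (proj₁ (proj₂ (proj₁ (≈-Lin r) l)))
  in _ , nlet f₀ f₁ f₂ W , ≈-trans (≈-let ≈-refl r') (≈-sym r)
cut-⊸ {G = G} {p = p} {s = b} {v = v₀} {q = q} {n = n} {C = C} X Y (napp {x = x} {A = A'} {B = B'} {v = v} {u = d} f₀ f₂ D₁ D₂) E₁ E₂ e e₂ S T K l@(_ , lt , _) =
  let r = float {u = d} (appRF (lam q (app (lam (rt q X) b) (app (var q) v₀))))
              (reg∉ K (in-ctx (inr (FV d ─ rt x A') (here refl)) (in-r′ {G} f₀ (in-root (rt x A') B'))) ∘ proj₁ ∘ ∈─⁻) (λ _ ()) l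
      (w , W , r') = cut-⊸ X Y D₂ E₁ E₂ e e₂ (Sep-app₂ {x} {A'} {d} {v} lt f₀ f₂ S) T (λ i j → K (Reg-app₂ {x} {A'} {d} {v} {G} lt f₀ f₂ i) j) (proj₁ (proj₁ (proj₁ (≈-Lin r) l)))
  in _ , napp f₀ f₂ D₁ W , ≈-trans (≈-app (≈-lam r') ≈-refl) (≈-sym r)

-- Axiom links

-- The goal side comes first, the hypothesis side second. Both are addresses in the end sequent,
-- which makes links of different proofs of one sequent comparable.
Link : Nf G n C t → ℕ → ℕ → Set
Link (nvar {x = x} {n = n} _) i j = i ≡ n × j ≡ x
Link (nlam _ D) = Link D
Link (npair D E) i j = Link D i j ⊎ Link E i j
Link (nlet _ _ _ D) = Link D
Link (napp _ _ D E) i j = Link D i j ⊎ Link E i j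

variable
  χ : ℕ → Bool
  b c c' : Bool

-- Two-colourings reveal how a proof decomposes. A colouring that respects the links and is constant
-- on each formula of the sequent has only one colour there, by `connect`; two colours can occur
-- only on opposite sides of a branching.
Mono : (ℕ → Bool) → Bool → ℕ → Ty → Set
Mono χ c n A = ∀ {z} → In z n A → χ z ≡ c

Respects : (ℕ → Bool) → Nf G n C t → Set
Respects χ D = ∀ {i j} → Link D i j → χ i ≡ χ j

mono-root : Mono χ c n A → χ n ≡ c
mono-root {n = n} {A = A} M = M (in-root n A)

recolor : Mono χ c n A → χ n ≡ c' → Mono χ c' n A
recolor {n = n} {A = A} M e i = trans (M i) (trans (sym (M (in-root n A))) e)

MonoCtx : (ℕ → Bool) → (ℕ → Ty) → List ℕ → Set
MonoCtx χ G xs = ∀ {x} → x ∈ xs → ∃[ c ] Mono χ c x (G x)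

mono-l : G x ≡ A ⊸ B → Mono χ c x (G x) → Mono χ c (suc x) A
mono-l {G} e M i = M (in-l′ {G} e i)

mono-r : G x ≡ A ⊸ B → Mono χ c x (G x) → Mono χ c (rt x A) B
mono-r {G} e M i = M (in-r′ {G} e i)

mono-l″ : G x ≡ A ⊗ B → Mono χ c x (G x) → Mono χ c (suc x) A
mono-l″ {G} e M i = M (in-l″ {G} e i)

mono-r″ : G x ≡ A ⊗ B → Mono χ c x (G x) → Mono χ c (rt x A) B
mono-r″ {G} e M i = M (in-r″ {G} e i)

mono-≡ : G x ≡ A → Mono χ c x A → Mono χ c x (G x)
mono-≡ {x = x} e M i = M (≡subst (In _ x) e i)

cx-bind : ∀ xs → Mono χ c x (G x) → MonoCtx χ G (xs ─ x) → MonoCtx χ G xs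
cx-bind {x = x} xs M cx {z} m with z ≟ x
... | yes refl = _ , M
... | no ne = cx (∈─⁺ m ne)

cx-bind₂ : ∀ xs → Mono χ c x (G x) → Mono χ c' y (G y) → MonoCtx χ G ((xs ─ x) ─ y) → MonoCtx χ G xs
cx-bind₂ {x = x} xs M M' cx = cx-bind xs M (cx-bind (xs ─ x) M' cx)

-- Connectedness of proof nets.
connect : (D : Nf G n C t) → Lin t → Respects χ D → MonoCtx χ G (FV t) → Mono χ c n C →
          ∀ {x} → x ∈ FV t → Mono χ c x (G x)
connect (nvar {a = a} e) l lk cx M (here refl) =
  recolor (proj₂ (cx (here refl))) (trans (sym (lk (refl , refl))) (mono-root {A = tv a} M))
connect {G} {t = lam _ b} (nlam {A = A} {B = B} e D) (l , _) lk cx M m =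
  connect D l lk (cx-bind (FV b) (mono-≡ {G} e (λ i → M (in-l A B i))) cx) (λ i → M (in-r A B i)) (proj₁ (∈─⁻ {xs = FV b} m))
connect {t = pair a b} (npair {A = A} {B = B} D E) (l , l' , _) lk cx M m with ∈++ (FV a) m
... | inj₁ i = connect D l (lk ∘ inj₁) (cx ∘ inl) (λ j → M (in-l A B j)) i
... | inj₂ i = connect E l' (lk ∘ inj₂) (cx ∘ inr (FV a)) (λ j → M (in-r A B j)) i
connect {G} {t = letp _ _ _ b} {χ} {c} (nlet {x = x} {A = A} {B = B} e₀ e₁ e₂ D) (_ , l , mx , _) lk cx M = res
  where
    Mx = proj₂ (cx (here refl))
    ih : ∀ {z} → z ∈ FV b → Mono χ c z (G z)
    ih = connect D l lk (cx-bind₂ (FV b) (mono-≡ {G} e₁ (mono-l″ {G} e₀ Mx)) (mono-≡ {G} e₂ (mono-r″ {G} e₀ Mx)) (cx ∘ there)) M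
    res : ∀ {z} → z ∈ x ∷ ((FV b ─ suc x) ─ rt x A) → Mono χ c z (G z)
    -- The component `suc x` occurs in the body by linearity, and it hands the colour of the goal on
    -- to `x`.
    res (here refl) = recolor Mx (trans (mono-root Mx) (trans (sym (mono-root (mono-l″ {G} e₀ Mx))) (mono-root (ih mx))))
    res (there i) = ih (proj₁ (∈─⁻ {xs = FV b} (proj₁ (∈─⁻ {xs = FV b ─ suc x} i))))
connect {G} {t = app (lam _ u) (app _ v)} {χ} {c} (napp {x = x} {A = A} e₀ e₂ D E) ((l , my) , (_ , l' , _) , _) lk cx M = res
  where
    Mx = proj₂ (cx (inr (FV u ─ rt x A) (here refl)))
    ihu : ∀ {z} → z ∈ FV u → Mono χ c z (G z)
    ihu = connect E l (lk ∘ inj₂) (cx-bind (FV u) (mono-≡ {G} e₂ (mono-r {G} e₀ Mx)) (cx ∘ inl)) M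
    Mx′ : Mono χ c x (G x)
    Mx′ = recolor Mx (trans (mono-root Mx) (trans (sym (mono-root (mono-r {G} e₀ Mx))) (mono-root (ihu my))))
    res : ∀ {z} → z ∈ (FV u ─ rt x A) ++ x ∷ FV v → Mono χ c z (G z)
    res m with ∈++ (FV u ─ rt x A) m
    ... | inj₁ i = ihu (proj₁ (∈─⁻ {xs = FV u} i))
    ... | inj₂ (here refl) = Mx′
    ... | inj₂ (there i) = connect D l' (lk ∘ inj₁) (λ j → cx (inr (FV u ─ rt x A) (there j))) (mono-l {G} e₀ Mx′) i

-- Permuting a prescribed rule to the end of a proof

lift : ∀ F → t ≈ app (lam y u) s → y ∉ FVF F → FV s # BVF F → Lin (F ⟦ t ⟧) → F ⟦ t ⟧ ≈ app (lam y (F ⟦ u ⟧)) s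
lift {u = u} F r n d l = ≈-trans (≈-frame F r) (float {u = u} F n d (proj₁ (≈-Lin (≈-frame F r)) l))

lift-let : ∀ F → t ≈ letp x y s u → x ∉ FVF F → y ∉ FVF F → FV s # BVF F → Lin (F ⟦ t ⟧) → F ⟦ t ⟧ ≈ letp x y s (F ⟦ u ⟧)
lift-let {s = s} {u} F r n n' d l = ≈-trans (≈-frame F r) (float-let {t = s} {u = u} F n n' d (proj₁ (≈-Lin (≈-frame F r)) l))

sink-let : ∀ F → x ∉ FVF F → y ∉ FVF F → FV s # BVF F → Lin (letp x y s (F ⟦ u ⟧)) → letp x y s (F ⟦ u ⟧) ≈ F ⟦ letp x y s u ⟧
sink-let {s = s} {u} F n n' d l = ≈-sym (float-let {t = s} {u = u} F n n' d (c-Lin← {t = s} {u} F n n' d l))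

comp∉ : Sep G n C xs → x ∈ xs → In y x (G x) → y ≢ x → y ∉ xs
comp∉ {G} {y = y} S mx i ne m = sep-ctx S m mx ne (in-root y (G y)) i

clash : {c : Bool} → c ≡ true → c ≡ false → ⊥
clash refl ()

-- A rearrangement of `D` that ends in the left rule at `f`. The links stay as they were, and the
-- colouring says to which premise a free variable goes.
record Extraction {G n C t} (D : Nf G n C t) (f : ℕ) (A : Ty) (χ : ℕ → Bool) : Set where
  field
    {arg body} : Tm
    argNf      : Nf G (suc f) A arg
    bodyNf     : Nf G n C body
    equal      : t ≈ app (lam (rt f A) body) (app (var f) arg)
    arg-true   : ∀ {x} → x ∈ FV arg → χ x ≡ true
    body-false : ∀ {x} → x ∈ FV body → χ x ≡ false
    link-to    : ∀ {i j} → Link D i j → Link argNf i j ⊎ Link bodyNf i j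
    link-from  : ∀ {i j} → Link argNf i j ⊎ Link bodyNf i j → Link D i j

-- The names coloured true by χ are those of the subproof that becomes the
-- argument of f once f is moved to the last rule.
extract : (D : Nf G n C t) → ∀ f → G f ≡ A ⊸ B → f ∈ FV t → Lin t → Sep G n C (FV t) → Respects χ D →
          (∀ {x} → x ∈ FV t → x ≢ f → ∃[ c ] Mono χ c x (G x)) →
          Mono χ true (suc f) A → Mono χ false (rt f A) B → Mono χ false n C → Extraction D f A χ
extract (nvar e) f ef (here refl) l S lk cx TA FB FC = case trans (sym ef) e of λ ()
extract {G} {A = A} {B} {χ} (nlam {n = n} {A = X} {B = Y} {t = b} e D) f ef m l S lk cx TA FB FC = record
  { argNf = argNf ; bodyNf = nlam e bodyNf
  ; equal = lift (lamF (suc n)) equal (λ ()) (#1 λ { (here refl) → f≢ refl ; (there i) → clash (arg-true i) (mono-root M₁) }) l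
  ; arg-true = arg-true ; body-false = λ i → body-false (proj₁ (∈─⁻ {xs = FV body} i))
  ; link-to = link-to ; link-from = link-from }
  where
    f∈ = proj₁ (∈─⁻ {xs = FV b} m)
    f≢ : f ≢ suc n
    f≢ = proj₂ (∈─⁻ {xs = FV b} m)
    M₁ : Mono χ false (suc n) X
    M₁ i = FC (in-l X Y i)
    cx′ : ∀ {x} → x ∈ FV b → x ≢ f → ∃[ c ] Mono χ c x (G x)
    cx′ {x} i ne with x ≟ suc n
    ... | yes refl = _ , mono-≡ {G} e M₁
    ... | no n' = cx (∈─⁺ i n') ne
    open Extraction (extract D f ef f∈ (proj₁ l) (Sep-lam S e) lk cx′ TA FB (λ i → FC (in-r X Y i)))
extract {G} {A = A} {B} {χ} (npair {s = a} {t = b} D E) f ef m l@(la , lb , d) S lk cx TA FB FC with ∈++ (FV a) m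
extract {G} {A = A} {B} {χ} (npair {A = X} {s = a} {B = Y} {t = b} D E) f ef m l@(la , lb , d) S lk cx TA FB FC | inj₁ f∈ = record
  { argNf = argNf ; bodyNf = npair bodyNf E
  ; equal = lift (pairLF b) equal (λ i → comp∉ S m (in-r′ {G} ef (in-root (rt f A) B)) (rt≢ f A ∘ sym) (inr (FV a) i)) (λ _ ()) l
  ; arg-true = arg-true ; body-false = λ i → case ∈++ (FV body) i of λ { (inj₁ j) → body-false j ; (inj₂ j) → other j }
  ; link-to = λ { (inj₁ k) → case link-to k of (λ { (inj₁ o) → inj₁ o ; (inj₂ o) → inj₂ (inj₁ o) }) ; (inj₂ k) → inj₂ (inj₂ k) }
  ; link-from = λ { (inj₁ k) → inj₁ (link-from (inj₁ k)) ; (inj₂ (inj₁ k)) → inj₁ (link-from (inj₂ k)) ; (inj₂ (inj₂ k)) → inj₂ k } }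
  where
    -- By linearity `f` does not occur in `b`, so connectedness gives all its variables the colour
    -- of its goal.
    other : ∀ {x} → x ∈ FV b → χ x ≡ false
    other i = mono-root (connect E lb (lk ∘ inj₂) (λ j → cx (inr (FV a) j) (λ { refl → d f∈ j })) (λ k → FC (in-r X Y k)) i)
    open Extraction (extract D f ef f∈ la (Sep-⊑ (in-l X Y) inl S) (lk ∘ inj₁) (cx ∘ inl) TA FB (λ i → FC (in-l X Y i)))
extract {G} {A = A} {B} {χ} (npair {A = X} {s = a} {B = Y} {t = b} D E) f ef m l@(la , lb , d) S lk cx TA FB FC | inj₂ f∈ = record
  { argNf = argNf ; bodyNf = npair D bodyNf
  ; equal = lift (pairRF a) equal (λ i → comp∉ S m (in-r′ {G} ef (in-root (rt f A) B)) (rt≢ f A ∘ sym) (inl i)) (λ _ ()) l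
  ; arg-true = arg-true ; body-false = λ i → case ∈++ (FV a) i of λ { (inj₂ j) → body-false j ; (inj₁ j) → other j }
  ; link-to = λ { (inj₂ k) → case link-to k of (λ { (inj₁ o) → inj₁ o ; (inj₂ o) → inj₂ (inj₂ o) }) ; (inj₁ k) → inj₂ (inj₁ k) }
  ; link-from = λ { (inj₁ k) → inj₂ (link-from (inj₁ k)) ; (inj₂ (inj₂ k)) → inj₂ (link-from (inj₂ k)) ; (inj₂ (inj₁ k)) → inj₁ k } }
  where
    other : ∀ {x} → x ∈ FV a → χ x ≡ false
    other i = mono-root (connect D la (lk ∘ inj₁) (λ j → cx (inl j) (λ { refl → d j f∈ })) (λ k → FC (in-l X Y k)) i)
    open Extraction (extract E f ef f∈ lb (Sep-⊑ (in-r X Y) (inr (FV a)) S) (lk ∘ inj₂) (cx ∘ inr (FV a)) TA FB (λ i → FC (in-r X Y i)))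
extract (nlet e₀ e₁ e₂ D) f ef (here refl) l S lk cx TA FB FC = case trans (sym ef) e₀ of λ ()
extract {G} {A = A} {B} {χ} (nlet {x = x} {A = X} {B = Y} {n = n} {C = C} {t = b} e₀ e₁ e₂ D) f ef m@(there m′) l@(_ , lb , mx , my , _) S lk cx TA FB FC =
  go (proj₁ colx) (proj₂ colx)
  where
    f∈₁ = ∈─⁻ {xs = FV b ─ suc x} m′
    f∈₂ = ∈─⁻ {xs = FV b} (proj₁ f∈₁)
    x≢f : x ≢ f
    x≢f refl = case trans (sym ef) e₀ of λ ()
    colx : ∃[ c ] Mono χ c x (G x)
    colx = cx (here refl) x≢f
    cx′ : Mono χ c x (G x) → ∀ {z} → z ∈ FV b → z ≢ f → ∃[ c ] Mono χ c z (G z)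
    cx′ M {z} i ne with z ≟ suc x | z ≟ rt x X
    ... | yes refl | _ = _ , mono-≡ {G} e₁ (mono-l″ {G} e₀ M)
    ... | no _ | yes refl = _ , mono-≡ {G} e₂ (mono-r″ {G} e₀ M)
    ... | no n₁ | no n₂ = cx (there (∈─⁺ (∈─⁺ i n₁) n₂)) ne
    go : ∀ c → Mono χ c x (G x) → Extraction (nlet {A = X} {B = Y} e₀ e₁ e₂ D) f A χ
    go c M = fin c M ih
      where
        ih : Extraction D f A χ
        ih = extract D f ef (proj₁ f∈₂) lb (Sep-let {x = x} {X} {b} l e₀ e₁ e₂ S) lk (cx′ M) TA FB FC
        -- The colour of `x` decides where its let ends up: with the continuation if false, inside
        -- the argument of `f` if true.
        fin : ∀ c → Mono χ c x (G x) → Extraction D f A χ → Extraction (nlet {A = X} {B = Y} e₀ e₁ e₂ D) f A χ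
        fin false M ih = record
          { argNf = argNf ; bodyNf = nlet e₀ e₁ e₂ bodyNf
          ; equal = lift (letRF (suc x) (rt x X) (var x)) equal
              (λ { (here o) → comp∉ S m (in-r′ {G} ef (in-root (rt f A) B)) (rt≢ f A ∘ sym) (here o) })
              (#2 (λ { (here o) → proj₂ f∈₂ (sym o) ; (there i) → clash (arg-true i) (mono-root (mono-l″ {G} e₀ M)) })
                  (λ { (here o) → proj₂ f∈₁ (sym o) ; (there i) → clash (arg-true i) (mono-root (mono-r″ {G} e₀ M)) })) l
          ; arg-true = arg-true
          ; body-false = λ { (here refl) → mono-root M ; (there i) → body-false (proj₁ (∈─⁻ {xs = FV body} (proj₁ (∈─⁻ {xs = FV body ─ suc x} i)))) }
          ; link-to = link-to ; link-from = link-from }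
          where open Extraction ih
        fin true M ih = record
          { argNf = nlet e₀ e₁ e₂ argNf ; bodyNf = bodyNf
          ; equal = ≈-trans r₀ (≈-trans r₁ (≈-frame (appRF (lam (rt f A) body)) r₂))
          ; arg-true = λ { (here refl) → mono-root M ; (there i) → arg-true (proj₁ (∈─⁻ {xs = FV arg} (proj₁ (∈─⁻ {xs = FV arg ─ suc x} i)))) }
          ; body-false = body-false ; link-to = link-to ; link-from = link-from }
          where
            open Extraction ih
            r₀ : letp (suc x) (rt x X) (var x) b ≈ letp (suc x) (rt x X) (var x) (app (lam (rt f A) body) (app (var f) arg))
            r₀ = ≈-let ≈-refl equal
            r₁ : letp (suc x) (rt x X) (var x) (app (lam (rt f A) body) (app (var f) arg)) ≈
                 app (lam (rt f A) body) (letp (suc x) (rt x X) (var x) (app (var f) arg))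
            r₁ = sink-let {u = app (var f) arg} (appRF (lam (rt f A) body))
              (λ i → clash (mono-root (mono-l″ {G} e₀ M)) (body-false (proj₁ (∈─⁻ {xs = FV body} i))))
              (λ i → clash (mono-root (mono-r″ {G} e₀ M)) (body-false (proj₁ (∈─⁻ {xs = FV body} i)))) (λ _ ()) (proj₁ (≈-Lin r₀) l)
            r₂ : letp (suc x) (rt x X) (var x) (app (var f) arg) ≈ app (var f) (letp (suc x) (rt x X) (var x) arg)
            r₂ = sink-let {u = arg} (appRF (var f)) (λ { (here o) → proj₂ f∈₂ (sym o) }) (λ { (here o) → proj₂ f∈₁ (sym o) }) (λ _ ())
              (inner-Lin {t = letp (suc x) (rt x X) (var x) (app (var f) arg)} (appRF (lam (rt f A) body)) (proj₁ (≈-Lin (≈-trans r₀ r₁)) l))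
extract {G} {χ = χ} (napp {x = x} e₀ e₂ D E) f ef m l S lk cx TA FB FC with x ≟ f
extract {G} {χ = χ} (napp {x = x} {A = X} {B = Y} {v = v} {n = n} {u = u} e₀ e₂ D E) f ef m l@((lu , _) , (_ , lv , dv) , d) S lk cx TA FB FC | yes refl
  with trans (sym ef) e₀
... | refl = record
  { argNf = D ; bodyNf = E ; equal = ≈-refl
  ; arg-true = λ i → mono-root (connect D lv (lk ∘ inj₁) (λ j → cx (inr (FV u ─ rt x X) (there j)) (λ { refl → dv (here refl) j })) TA i)
  ; body-false = λ i → mono-root (connect E lu (lk ∘ inj₂)
      (cx-bind (FV u) (mono-≡ {G} e₂ FB) (λ j → cx (inl j) (λ { refl → d j (here refl) }))) FC i)
  ; link-to = id ; link-from = id }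
extract {G} {A = A} {B} {χ} (napp {x = x} {A = X} {B = Y} {v = v} {n = n} {C = C} {u = u} e₀ e₂ D E) f ef m l@((lu , my) , (_ , lv , dv) , d) S lk cx TA FB FC | no x≢f =
  go (∈++ (FV u ─ rt x X) m) (proj₁ colx) (proj₂ colx)
  where
    D₀ : Nf G n C (app (lam (rt x X) u) (app (var x) v))
    D₀ = napp e₀ e₂ D E
    f-arg : Tm → Tm
    f-arg arg = app (var f) arg
    x∈ = inr (FV u ─ rt x X) (here refl)
    colx : ∃[ c ] Mono χ c x (G x)
    colx = cx x∈ x≢f
    yf∉ : rt f A ∉ (FV u ─ rt x X) ++ x ∷ FV v
    yf∉ = comp∉ S m (in-r′ {G} ef (in-root (rt f A) B)) (rt≢ f A ∘ sym)
    cxu : Mono χ c x (G x) → ∀ {z} → z ∈ FV u → z ≢ f → ∃[ c ] Mono χ c z (G z)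
    cxu M {z} i ne with z ≟ rt x X
    ... | yes refl = _ , mono-≡ {G} e₂ (mono-r {G} e₀ M)
    ... | no n₁ = cx (inl (∈─⁺ i n₁)) ne
    cxv : ∀ {z} → z ∈ FV v → z ≢ f → ∃[ c ] Mono χ c z (G z)
    cxv i ne = cx (inr (FV u ─ rt x X) (there i)) ne
    u-false : f ∈ FV v → Mono χ c x (G x) → ∀ {z} → z ∈ FV u → χ z ≡ false
    u-false f∈ M i = mono-root (connect E lu (lk ∘ inj₂)
      (cx-bind (FV u) (mono-≡ {G} e₂ (mono-r {G} e₀ M)) (λ j → cx (inl j) (λ { refl → d j (there f∈) }))) FC i)
    v-col : f ∈ FV u ─ rt x X → Mono χ c x (G x) → ∀ {z} → z ∈ FV v → χ z ≡ c
    v-col f∈ M i = mono-root (connect D lv (lk ∘ inj₁) (λ j → cxv j (λ { refl → d f∈ (there j) })) (mono-l {G} e₀ M) i)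
    go : f ∈ FV u ─ rt x X ⊎ f ∈ x ∷ FV v → ∀ c → Mono χ c x (G x) → Extraction D₀ f A χ
    go (inj₂ (here o)) _ _ = ⊥-elim (x≢f (sym o))
    -- Here `f` is used in the argument of `x`. The continuation `u` is then free of `f`, and
    -- connectedness colours it false, including the result of `x`, which would have to be true.
    go (inj₂ (there f∈)) true M = ⊥-elim (clash (mono-root (mono-r {G} e₀ M)) (u-false f∈ M my))
    go (inj₂ (there f∈)) false M = record
      { argNf = argNf ; bodyNf = napp e₀ e₂ bodyNf E
      ; equal = lift (appRF (lam (rt x X) u)) (lift (appRF (var x)) equal (λ { (here o) → yf∉ (inr (FV u ─ rt x X) (here o)) }) (λ _ ()) (proj₁ (proj₂ l)))
                  (λ i → yf∉ (inl i)) (λ _ ()) l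
      ; arg-true = arg-true
      ; body-false = λ i → case ∈++ (FV u ─ rt x X) i of λ
          { (inj₁ j) → u-false f∈ M (proj₁ (∈─⁻ {xs = FV u} j)) ; (inj₂ (here refl)) → mono-root M ; (inj₂ (there j)) → body-false j }
      ; link-to = λ { (inj₁ k) → case link-to k of (λ { (inj₁ o) → inj₁ o ; (inj₂ o) → inj₂ (inj₁ o) }) ; (inj₂ k) → inj₂ (inj₂ k) }
      ; link-from = λ { (inj₁ k) → inj₁ (link-from (inj₁ k)) ; (inj₂ (inj₁ k)) → inj₁ (link-from (inj₂ k)) ; (inj₂ (inj₂ k)) → inj₂ k } }
      where open Extraction (extract D f ef f∈ lv (Sep-app₁ {x = x} {X} {u} {v} l e₀ S) (lk ∘ inj₁) cxv TA FB (mono-l {G} e₀ M))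
    go (inj₁ f∈) c M = fin c M (extract E f ef (proj₁ (∈─⁻ {xs = FV u} f∈)) lu (Sep-app₂ {x = x} {X} {u} {v} l e₀ e₂ S) (lk ∘ inj₂) (cxu M) TA FB FC)
      where
        f≢y : f ≢ rt x X
        f≢y = proj₂ (∈─⁻ {xs = FV u} f∈)
        fin : ∀ c → Mono χ c x (G x) → Extraction E f A χ → Extraction D₀ f A χ
        fin false M ih = record
          { argNf = argNf ; bodyNf = napp e₀ e₂ D bodyNf
          ; equal = lift (appLF (app (var x) v)) (lift (lamF (rt x X)) equal (λ ())
                (#1 (λ { (here o) → f≢y (sym o) ; (there i) → clash (arg-true i) (mono-root (mono-r {G} e₀ M)) })) (proj₁ l))
                (λ i → yf∉ (inr (FV u ─ rt x X) i)) (λ _ ()) l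
          ; arg-true = arg-true
          ; body-false = λ i → case ∈++ (FV body ─ rt x X) i of λ
              { (inj₁ j) → body-false (proj₁ (∈─⁻ {xs = FV body} j)) ; (inj₂ (here refl)) → mono-root M ; (inj₂ (there j)) → v-col f∈ M j }
          ; link-to = λ { (inj₂ k) → case link-to k of (λ { (inj₁ o) → inj₁ o ; (inj₂ o) → inj₂ (inj₂ o) }) ; (inj₁ k) → inj₂ (inj₁ k) }
          ; link-from = λ { (inj₁ k) → inj₂ (link-from (inj₁ k)) ; (inj₂ (inj₂ k)) → inj₂ (link-from (inj₂ k)) ; (inj₂ (inj₁ k)) → inj₁ k } }
          where open Extraction ih
        fin true M ih = record
          { argNf = napp e₀ e₂ D argNf ; bodyNf = bodyNf
          ; equal = ≈-trans r₀ (≈-sym (≈-trans (≈-frame (appRF (lam (rt f A) body)) (proj₂ c₂ ≈-refl)) (proj₂ c₁ ≈-refl)))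
          ; arg-true = λ i → case ∈++ (FV arg ─ rt x X) i of λ
              { (inj₁ j) → arg-true (proj₁ (∈─⁻ {xs = FV arg} j)) ; (inj₂ (here refl)) → mono-root M ; (inj₂ (there j)) → v-col f∈ M j }
          ; body-false = body-false
          ; link-to = λ { (inj₂ k) → case link-to k of (λ { (inj₁ o) → inj₁ (inj₂ o) ; (inj₂ o) → inj₂ o }) ; (inj₁ k) → inj₁ (inj₁ k) }
          ; link-from = λ { (inj₂ k) → inj₂ (link-from (inj₂ k)) ; (inj₁ (inj₂ k)) → inj₂ (link-from (inj₁ k)) ; (inj₁ (inj₁ k)) → inj₁ k } }
          where
            open Extraction ih
            r₀ : app (lam (rt x X) u) (app (var x) v) ≈ app (lam (rt x X) (app (lam (rt f A) body) (f-arg arg))) (app (var x) v)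
            r₀ = ≈-app (≈-lam equal) ≈-refl
            y∈arg : rt x X ∈ FV arg
            y∈arg with ∈++ (FV body ─ rt f A) (proj₁ (≈-FV equal) my)
            ... | inj₁ i = ⊥-elim (clash (mono-root (mono-r {G} e₀ M)) (body-false (proj₁ (∈─⁻ {xs = FV body} i))))
            ... | inj₂ (here o) = ⊥-elim (f≢y (sym o))
            ... | inj₂ (there i) = i
            c₁ = commute (appRF (lam (rt f A) body)) (f-arg arg)
              (λ i → clash (mono-root (mono-r {G} e₀ M)) (body-false (proj₁ (∈─⁻ {xs = FV body} i)))) (there y∈arg) (λ _ ()) (proj₁ (≈-Lin r₀) l)
            c₂ = commute (appRF (var f)) arg (λ { (here o) → f≢y (sym o) }) y∈arg (λ _ ()) (proj₁ c₁)

-- Premises with disjoint regions have therefore no link in common, which is how a link is later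
-- attributed to its premise.
link-loc : (D : Nf G n C t) → Lin t → ∀ {i j} → Link D i j → Reg G n C (FV t) i × Reg G n C (FV t) j
link-loc {G} {n} {C} (nvar {x = x} e) l (refl , refl) = in-goal (in-root n C) , in-ctx (here refl) (in-root x (G x))
link-loc {G} (nlam e D) (l , _) k = case link-loc D l k of λ (p , q) → Reg-lam {G} e p , Reg-lam {G} e q
link-loc (npair {A = A} {B = B} D E) (l , _) (inj₁ k) = case link-loc D l k of λ (p , q) → f p , f q
  where f : Reg _ _ _ _ z → Reg _ _ _ _ z
        f = Reg-⊑ (λ i → in-goal (in-l A B i)) inl
link-loc (npair {A = A} {s = a} {B = B} D E) (_ , l , _) (inj₂ k) = case link-loc E l k of λ (p , q) → f p , f q
  where f : Reg _ _ _ _ z → Reg _ _ _ _ z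
        f = Reg-⊑ (λ i → in-goal (in-r A B i)) (inr (FV a))
link-loc {G} (nlet {x = x} {A = X} {t = b} e₀ e₁ e₂ D) l k =
  case link-loc D (proj₁ (proj₂ l)) k of λ (p , q) → Reg-let {x} {X} {b} {G} l e₀ e₁ e₂ p , Reg-let {x} {X} {b} {G} l e₀ e₁ e₂ q
link-loc {G} (napp {x = x} {A = X} {v = v} {u = u} e₀ e₂ D E) l (inj₁ k) =
  case link-loc D (proj₁ (proj₂ (proj₁ (proj₂ l)))) k of λ (p , q) → Reg-app₁ {G} {x} {v = v} {u = u} e₀ p , Reg-app₁ {G} {x} {v = v} {u = u} e₀ q
link-loc {G} (napp {x = x} {A = X} {v = v} {u = u} e₀ e₂ D E) l (inj₂ k) =
  case link-loc E (proj₁ (proj₁ l)) k of λ (p , q) → Reg-app₂ {x} {X} {u} {v} {G} l e₀ e₂ p , Reg-app₂ {x} {X} {u} {v} {G} l e₀ e₂ q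

record Splitting {G n A B t} (D : Nf G n (A ⊗ B) t) (χ : ℕ → Bool) : Set where
  field
    {left right} : Tm
    leftNf       : Nf G (suc n) A left
    rightNf      : Nf G (rt n A) B right
    equal        : t ≈ pair left right
    left-true    : ∀ {x} → x ∈ FV left → χ x ≡ true
    right-false  : ∀ {x} → x ∈ FV right → χ x ≡ false
    link-to      : ∀ {i j} → Link D i j → Link leftNf i j ⊎ Link rightNf i j
    link-from    : ∀ {i j} → Link leftNf i j ⊎ Link rightNf i j → Link D i j

-- Left rules may stand below the pair. Each is moved into the component that has the colour of its
-- variable.
split : (D : Nf G n (A ⊗ B) t) → Lin t → Respects χ D → MonoCtx χ G (FV t) →
        Mono χ true (suc n) A → Mono χ false (rt n A) B → Splitting D χ
split (npair {s = a} D E) (la , lb , d) lk cx TA FB = record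
  { leftNf = D ; rightNf = E ; equal = ≈-refl
  ; left-true = λ i → mono-root (connect D la (lk ∘ inj₁) (cx ∘ inl) TA i)
  ; right-false = λ i → mono-root (connect E lb (lk ∘ inj₂) (cx ∘ inr (FV a)) FB i)
  ; link-to = id ; link-from = id }
split {G} {χ = χ} (nlet {x = x} {A = X} {B = Y} {t = b} e₀ e₁ e₂ D) l@(_ , lb , mx , my , _) lk cx TA FB =
  fin (proj₁ (cx (here refl))) (proj₂ (cx (here refl)))
    (split D lb lk (cx-bind₂ (FV b) (mono-≡ {G} e₁ (mono-l″ {G} e₀ Mx)) (mono-≡ {G} e₂ (mono-r″ {G} e₀ Mx)) (cx ∘ there)) TA FB)
  where
    Mx = proj₂ (cx (here refl))
    fin : ∀ c → Mono χ c x (G x) → Splitting D χ → Splitting (nlet {A = X} {B = Y} e₀ e₁ e₂ D) χ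
    fin true M S = record
      { leftNf = nlet e₀ e₁ e₂ leftNf ; rightNf = rightNf
      ; equal = ≈-trans (≈-let ≈-refl equal) (sink-let {u = left} (pairLF right)
          (λ i → clash (mono-root (mono-l″ {G} e₀ M)) (right-false i)) (λ i → clash (mono-root (mono-r″ {G} e₀ M)) (right-false i)) (λ _ ())
          (proj₁ (≈-Lin (≈-let (≈-refl {var x}) equal)) l))
      ; left-true = λ { (here refl) → mono-root M ; (there i) → left-true (proj₁ (∈─⁻ {xs = FV left} (proj₁ (∈─⁻ {xs = FV left ─ suc x} i)))) }
      ; right-false = right-false ; link-to = link-to ; link-from = link-from }
      where open Splitting S
    fin false M S = record
      { leftNf = leftNf ; rightNf = nlet e₀ e₁ e₂ rightNf
      ; equal = ≈-trans (≈-let ≈-refl equal) (sink-let {u = right} (pairRF left)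
          (λ i → clash (left-true i) (mono-root (mono-l″ {G} e₀ M))) (λ i → clash (left-true i) (mono-root (mono-r″ {G} e₀ M))) (λ _ ())
          (proj₁ (≈-Lin (≈-let (≈-refl {var x}) equal)) l))
      ; right-false = λ { (here refl) → mono-root M ; (there i) → right-false (proj₁ (∈─⁻ {xs = FV right} (proj₁ (∈─⁻ {xs = FV right ─ suc x} i)))) }
      ; left-true = left-true ; link-to = link-to ; link-from = link-from }
      where open Splitting S
split {G} {n} {A} {B} {χ = χ} (napp {x = x} {A = X} {B = Y} {v = v} {u = u} e₀ e₂ D E) l@((lu , my) , (_ , lv , dv) , d) lk cx TA FB =
  fin (proj₁ colx) (proj₂ colx) (split E lu (lk ∘ inj₂) (cx-bind (FV u) (mono-≡ {G} e₂ (mono-r {G} e₀ (proj₂ colx))) (cx ∘ inl)) TA FB)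
  where
    colx : ∃[ c ] Mono χ c x (G x)
    colx = cx (inr (FV u ─ rt x X) (here refl))
    v-col : Mono χ c x (G x) → ∀ {z} → z ∈ FV v → χ z ≡ c
    v-col M i = mono-root (connect D lv (lk ∘ inj₁) (λ j → cx (inr (FV u ─ rt x X) (there j))) (mono-l {G} e₀ M) i)
    fin : ∀ c → Mono χ c x (G x) → Splitting E χ → Splitting (napp {B = Y} e₀ e₂ D E) χ
    fin true M S = record
      { leftNf = napp e₀ e₂ D leftNf ; rightNf = rightNf
      ; equal = ≈-trans r₀ (≈-sym (proj₂ (commute (pairLF right) left (λ i → clash (mono-root (mono-r {G} e₀ M)) (right-false i)) y∈ (λ _ ()) (proj₁ (≈-Lin r₀) l)) ≈-refl))
      ; left-true = λ i → case ∈++ (FV left ─ rt x X) i of λ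
          { (inj₁ j) → left-true (proj₁ (∈─⁻ {xs = FV left} j)) ; (inj₂ (here refl)) → mono-root M ; (inj₂ (there j)) → v-col M j }
      ; right-false = right-false
      ; link-to = λ { (inj₂ k) → case link-to k of (λ { (inj₁ o) → inj₁ (inj₂ o) ; (inj₂ o) → inj₂ o }) ; (inj₁ k) → inj₁ (inj₁ k) }
      ; link-from = λ { (inj₂ k) → inj₂ (link-from (inj₂ k)) ; (inj₁ (inj₂ k)) → inj₂ (link-from (inj₁ k)) ; (inj₁ (inj₁ k)) → inj₁ k } }
      where
        open Splitting S
        r₀ : app (lam (rt x X) u) (app (var x) v) ≈ app (lam (rt x X) (pair left right)) (app (var x) v)
        r₀ = ≈-app (≈-lam equal) ≈-refl
        y∈ : rt x X ∈ FV left
        y∈ with ∈++ (FV left) (proj₁ (≈-FV equal) my)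
        ... | inj₁ i = i
        ... | inj₂ i = ⊥-elim (clash (mono-root (mono-r {G} e₀ M)) (right-false i))
    fin false M S = record
      { leftNf = leftNf ; rightNf = napp e₀ e₂ D rightNf
      ; equal = ≈-trans r₀ (≈-sym (proj₂ (commute (pairRF left) right (λ i → clash (left-true i) (mono-root (mono-r {G} e₀ M))) y∈ (λ _ ()) (proj₁ (≈-Lin r₀) l)) ≈-refl))
      ; right-false = λ i → case ∈++ (FV right ─ rt x X) i of λ
          { (inj₁ j) → right-false (proj₁ (∈─⁻ {xs = FV right} j)) ; (inj₂ (here refl)) → mono-root M ; (inj₂ (there j)) → v-col M j }
      ; left-true = left-true
      ; link-to = λ { (inj₂ k) → case link-to k of (λ { (inj₂ o) → inj₂ (inj₂ o) ; (inj₁ o) → inj₁ o }) ; (inj₁ k) → inj₂ (inj₁ k) }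
      ; link-from = λ { (inj₁ k) → inj₂ (link-from (inj₁ k)) ; (inj₂ (inj₂ k)) → inj₂ (link-from (inj₂ k)) ; (inj₂ (inj₁ k)) → inj₁ k } }
      where
        open Splitting S
        r₀ : app (lam (rt x X) u) (app (var x) v) ≈ app (lam (rt x X) (pair left right)) (app (var x) v)
        r₀ = ≈-app (≈-lam equal) ≈-refl
        y∈ : rt x X ∈ FV right
        y∈ with ∈++ (FV left) (proj₁ (≈-FV equal) my)
        ... | inj₂ i = i
        ... | inj₁ i = ⊥-elim (clash (left-true i) (mono-root (mono-r {G} e₀ M)))

-- D can be rearranged to end in the rule with term former E.
record Inversion {G n C t} (D : Nf G n C t) (m : ℕ) (B : Ty) (E : Tm → Tm) : Set where
  field
    {premise}  : Tm
    premiseNf  : Nf G m B premise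
    equal      : t ≈ E premise
    link-to    : ∀ {i j} → Link D i j → Link premiseNf i j
    link-from  : ∀ {i j} → Link premiseNf i j → Link D i j

-- The right rule for `⊸` is invertible: left rules below the abstraction commute into its body,
-- since separation keeps the bound name `suc n` away from their variables.
invert-lam : (D : Nf G n (A ⊸ B) t) → Lin t → Sep G n (A ⊸ B) (FV t) → Inversion D (rt n A) B (lam (suc n))
invert-lam (nlam e D) l S = record { premiseNf = D ; equal = ≈-refl ; link-to = id ; link-from = id }
invert-lam {G} {n} {A} {B} (nlet {x = x} {A = X} {B = Y} {t = b} e₀ e₁ e₂ D) l S = record
  { premiseNf = nlet e₀ e₁ e₂ premiseNf
  ; equal = ≈-trans (≈-let ≈-refl equal) (sink-let {u = premise} (lamF (suc n)) (λ ()) (λ ())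
      (#1 (λ { (here o) → name∉goal S (here refl) (≡subst (λ k → In k n (A ⊸ B)) o (in-l A B (in-root (suc n) A))) }))
      (proj₁ (≈-Lin (≈-let (≈-refl {var x}) equal)) l))
  ; link-to = link-to ; link-from = link-from }
  where open Inversion (invert-lam D (proj₁ (proj₂ l)) (Sep-let {x = x} {X} {b} l e₀ e₁ e₂ S))
invert-lam {G} {n} {A} {B} (napp {x = x} {A = X} {B = Y} {v = v} {u = u} e₀ e₂ D E) l@((lu , my) , _) S = record
  { premiseNf = napp e₀ e₂ D premiseNf
  ; equal = ≈-trans r₀ (≈-sym (proj₂ (commute (lamF (suc n)) premise (λ ()) (proj₁ (∈─⁻ {xs = FV premise} (proj₁ (≈-FV equal) my)))
       (#1 λ i → name∉goal S (inr (FV u ─ rt x X) i) (in-l A B (in-root (suc n) A))) (proj₁ (≈-Lin r₀) l)) ≈-refl))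
  ; link-to = λ { (inj₁ k) → inj₁ k ; (inj₂ k) → inj₂ (link-to k) }
  ; link-from = λ { (inj₁ k) → inj₁ k ; (inj₂ k) → inj₂ (link-from k) } }
  where
    open Inversion (invert-lam E lu (Sep-app₂ {x = x} {X} {u} {v} l e₀ e₂ S))
    r₀ : app (lam (rt x X) u) (app (var x) v) ≈ app (lam (rt x X) (lam (suc n) premise)) (app (var x) v)
    r₀ = ≈-app (≈-lam equal) ≈-refl

-- The left rule for `⊗` is invertible too. It has one premise, so nothing has to be distributed and
-- no colouring enters, in contrast to `extract`.
invert-let : (D : Nf G n C t) → ∀ x → G x ≡ A ⊗ B → G (suc x) ≡ A → G (rt x A) ≡ B → x ∈ FV t → Lin t → Sep G n C (FV t) →
             Inversion D n C (letp (suc x) (rt x A) (var x))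
invert-let (nvar e) x e₀ e₁ e₂ (here refl) l S = case trans (sym e) e₀ of λ ()
invert-let {G} {n} {A = A} {B} (nlam {t = b} e D) x e₀ e₁ e₂ m l S = record
  { premiseNf = nlam e premiseNf
  ; equal = lift-let {u = premise} (lamF (suc n)) equal (λ ()) (λ ()) (#1 λ { (here o) → proj₂ (∈─⁻ {xs = FV b} m) (sym o) }) l
  ; link-to = link-to ; link-from = link-from }
  where open Inversion (invert-let D x e₀ e₁ e₂ (proj₁ (∈─⁻ {xs = FV b} m)) (proj₁ l) (Sep-lam S e))
invert-let {G} {A = A} {B} (npair {A = X} {s = a} {B = Y} {t = b} D E) x e₀ e₁ e₂ m l@(la , lb , d) S with ∈++ (FV a) m
... | inj₁ mx = record
  { premiseNf = npair premiseNf E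
  ; equal = lift-let {u = premise} (pairLF b) equal (λ i → comp∉ S m (in-l″ {G} e₀ (in-root (suc x) A)) (λ ()) (inr (FV a) i))
      (λ i → comp∉ S m (in-r″ {G} e₀ (in-root (rt x A) B)) (rt≢ x A ∘ sym) (inr (FV a) i)) (λ _ ()) l
  ; link-to = λ { (inj₁ k) → inj₁ (link-to k) ; (inj₂ k) → inj₂ k }
  ; link-from = λ { (inj₁ k) → inj₁ (link-from k) ; (inj₂ k) → inj₂ k } }
  where open Inversion (invert-let D x e₀ e₁ e₂ mx la (Sep-⊑ (in-l X Y) inl S))
... | inj₂ mx = record
  { premiseNf = npair D premiseNf
  ; equal = lift-let {u = premise} (pairRF a) equal (λ i → comp∉ S m (in-l″ {G} e₀ (in-root (suc x) A)) (λ ()) (inl i))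
      (λ i → comp∉ S m (in-r″ {G} e₀ (in-root (rt x A) B)) (rt≢ x A ∘ sym) (inl i)) (λ _ ()) l
  ; link-to = λ { (inj₂ k) → inj₂ (link-to k) ; (inj₁ k) → inj₁ k }
  ; link-from = λ { (inj₂ k) → inj₂ (link-from k) ; (inj₁ k) → inj₁ k } }
  where open Inversion (invert-let E x e₀ e₁ e₂ mx lb (Sep-⊑ (in-r X Y) (inr (FV a)) S))
invert-let {G} {A = A} {B} (nlet f₀ f₁ f₂ D) x e₀ e₁ e₂ (here refl) l S with trans (sym f₀) e₀
... | refl = record { premiseNf = D ; equal = ≈-refl ; link-to = id ; link-from = id }
invert-let {G} {A = A} {B} (nlet {x = x'} {A = X} {B = Y} {t = b} f₀ f₁ f₂ D) x e₀ e₁ e₂ m@(there m′) l@(_ , lb , _) S = record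
  { premiseNf = nlet f₀ f₁ f₂ premiseNf
  ; equal = lift-let {u = premise} (letRF (suc x') (rt x' X) (var x')) equal
      (λ { (here o) → comp∉ S m (in-l″ {G} e₀ (in-root (suc x) A)) (λ ()) (here o) })
      (λ { (here o) → comp∉ S m (in-r″ {G} e₀ (in-root (rt x A) B)) (rt≢ x A ∘ sym) (here o) })
      (#2 (λ { (here o) → proj₂ m₂ (sym o) }) (λ { (here o) → proj₂ m₁ (sym o) })) l
  ; link-to = link-to ; link-from = link-from }
  where
    m₁ = ∈─⁻ {xs = FV b ─ suc x'} m′
    m₂ = ∈─⁻ {xs = FV b} (proj₁ m₁)
    open Inversion (invert-let D x e₀ e₁ e₂ (proj₁ m₂) lb (Sep-let {x = x'} {X} {b} l f₀ f₁ f₂ S))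
invert-let {G} {n} {C} {A = A} {B} (napp {x = x'} {A = X} {B = Y} {v = v} {u = u} f₀ f₂ D E) x e₀ e₁ e₂ m l@((lu , my) , (_ , lv , _) , _) S =
  go (∈++ (FV u ─ rt x' X) m)
  where
    l∉ : suc x ∉ (FV u ─ rt x' X) ++ x' ∷ FV v
    l∉ = comp∉ S m (in-l″ {G} e₀ (in-root (suc x) A)) (λ ())
    r∉ : rt x A ∉ (FV u ─ rt x' X) ++ x' ∷ FV v
    r∉ = comp∉ S m (in-r″ {G} e₀ (in-root (rt x A) B)) (rt≢ x A ∘ sym)
    go : x ∈ FV u ─ rt x' X ⊎ x ∈ x' ∷ FV v → Inversion (napp {B = Y} f₀ f₂ D E) n C (letp (suc x) (rt x A) (var x))
    go (inj₂ (here refl)) = case trans (sym f₀) e₀ of λ ()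
    go (inj₂ (there mx)) = record
      { premiseNf = napp f₀ f₂ premiseNf E
      ; equal = lift-let {u = app (var x') premise} (appRF (lam (rt x' X) u))
          (lift-let {u = premise} (appRF (var x')) equal (λ { (here o) → l∉ (inr (FV u ─ rt x' X) (here o)) })
             (λ { (here o) → r∉ (inr (FV u ─ rt x' X) (here o)) }) (λ _ ()) (proj₁ (proj₂ l))) (l∉ ∘ inl) (r∉ ∘ inl) (λ _ ()) l
      ; link-to = λ { (inj₁ k) → inj₁ (link-to k) ; (inj₂ k) → inj₂ k }
      ; link-from = λ { (inj₁ k) → inj₁ (link-from k) ; (inj₂ k) → inj₂ k } }
      where open Inversion (invert-let D x e₀ e₁ e₂ mx lv (Sep-app₁ {x = x'} {X} {u} {v} l f₀ S))
    go (inj₁ mx) = record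
      { premiseNf = napp f₀ f₂ D premiseNf
      ; equal = lift-let {u = lam (rt x' X) premise} (appLF (app (var x') v))
          (lift-let {u = premise} (lamF (rt x' X)) equal (λ ()) (λ ()) (#1 λ { (here o) → proj₂ (∈─⁻ {xs = FV u} mx) (sym o) }) (proj₁ l))
          (l∉ ∘ inr (FV u ─ rt x' X)) (r∉ ∘ inr (FV u ─ rt x' X)) (λ _ ()) l
      ; link-to = λ { (inj₂ k) → inj₂ (link-to k) ; (inj₁ k) → inj₁ k }
      ; link-from = λ { (inj₂ k) → inj₂ (link-from k) ; (inj₁ k) → inj₁ k } }
      where open Inversion (invert-let E x e₀ e₁ e₂ (proj₁ (∈─⁻ {xs = FV u} mx)) lu (Sep-app₂ {x = x'} {X} {u} {v} l f₀ f₂ S))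

-- Axiom links determine a proof up to conversion

in? : ∀ z n A → Dec (In z n A)
in? z n A = (n ≤? z) ×-dec (z <? n + ∥ A ∥)

reg? : ∀ G n C xs z → Dec (Reg G n C xs z)
reg? G n C xs z = map′ to from (in? z n C ⊎-dec Any.any? (λ x → in? z x (G x)) xs)
  where
    to : In z n C ⊎ Any (λ x → In z x (G x)) xs → Reg G n C xs z
    to (inj₁ i) = in-goal i
    to (inj₂ a) = case find a of λ (x , m , i) → in-ctx m i
    from : Reg G n C xs z → In z n C ⊎ Any (λ x → In z x (G x)) xs
    from (in-goal i) = inj₁ i
    from (in-ctx m i) = inj₂ (lose m i)

abstract
  -- The colouring by one premise of a proof. Another proof with the same links respects it, and so
  -- can be divided in the same way.
  colour : (ℕ → Ty) → ℕ → Ty → List ℕ → ℕ → Bool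
  colour G n C xs z = does (reg? G n C xs z)

  colour-in : Reg G n C xs z → colour G n C xs z ≡ true
  colour-in {G} {n} {C} {xs} {z} r = dec-true (reg? G n C xs z) r

  colour-out : (Reg G n C xs z → ⊥) → colour G n C xs z ≡ false
  colour-out {G} {n} {C} {xs} {z} r = dec-false (reg? G n C xs z) r

bind-≋ : x ∈ xs → x ∈ ys → (xs ─ x) ≋ (ys ─ x) → xs ≋ ys
bind-≋ {x} {xs} {ys} m m' e = f m' (proj₁ e) , f m (proj₂ e)
  where
    f : ∀ {xs ys} → x ∈ ys → (xs ─ x) ⊑ (ys ─ x) → xs ⊑ ys
    f {ys = ys} m' e {z} i with z ≟ x
    ... | yes refl = m'
    ... | no ne = proj₁ (∈─⁻ {xs = ys} (e (∈─⁺ i ne)))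

≋-trans : xs ≋ ys → ys ≋ zs → xs ≋ zs
≋-trans p q = (λ m → proj₁ q (proj₁ p m)) , (λ m → proj₂ p (proj₂ q m))

pair-cross : Lin (pair s t) → Sep G n (A ⊗ B) (FV s ++ FV t) → Cross G (suc n) A (FV s) (rt n A) B (FV t)
pair-cross {n = n} {A} {B} (_ , _ , d) S (in-goal i) (in-goal j) = in-lr {n = n} A B i j
pair-cross {s} {A = A} {B} (_ , _ , d) S (in-goal i) (in-ctx m j) = sep-goal S (inr (FV s) m) j (in-l A B i)
pair-cross {A = A} {B} (_ , _ , d) S (in-ctx m i) (in-goal j) = sep-goal S (inl m) i (in-r A B j)
pair-cross {s} (_ , _ , d) S (in-ctx m i) (in-ctx m' j) = sep-ctx S (inl m) (inr (FV s) m') (λ { refl → d m m' }) i j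

app-cross : Lin (app (lam (rt x A) u) (app (var x) v)) → G x ≡ A ⊸ B → G (rt x A) ≡ B →
            Sep G n C (FV (app (lam (rt x A) u) (app (var x) v))) → Cross G (suc x) A (FV v) n C (FV u)
-- The goal `tv 0` named 0 is a dummy; `Reg-app₁` serves to place the name in the context of the
-- conclusion.
app-cross {x} {A} {u} {v} {G} l e₀ e₂ S i (in-goal j) = case Reg-app₁ {G} {x} {v = v} {n = 0} {tv 0} {u = u} e₀ i of λ
  { (in-goal k) → f i j ; (in-ctx m k) → sep-goal S m k j }
  where
    f : ∀ {z} → Reg G (suc x) A (FV v) z → In z _ _ → ⊥
    f (in-goal i) j = sep-goal S (inr (FV u ─ rt x A) (here refl)) (in-l′ {G} e₀ i) j
    f (in-ctx m i) j = sep-goal S (inr (FV u ─ rt x A) (there m)) i j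
app-cross {x} {A} {u} {v} {G} {B} l@(_ , (_ , _ , dv) , d) e₀ e₂ S i (in-ctx {y} m j) = go i {j} (y ≟ rt x A)
  where
    x∈ = inr (FV u ─ rt x A) (here refl)
    r : ∀ {z} → y ≡ rt x A → In z y (G y) → In z (rt x A) B
    r refl j = ≡subst (In _ (rt x A)) e₂ j
    go : ∀ {z} → Reg G (suc x) A (FV v) z → {_ : In z y (G y)} → Dec (y ≡ rt x A) → ⊥
    go (in-goal i) {j} (yes o) = in-lr {n = x} A B i (r o j)
    go (in-goal i) {j} (no ne) = sep-ctx S x∈ (inl (∈─⁺ m ne)) (λ { refl → d (∈─⁺ m ne) (here refl) }) (in-l′ {G} e₀ i) j
    go (in-ctx m' i) {j} (yes o) = sep-ctx S x∈ (inr (FV u ─ rt x A) (there m')) (λ { refl → dv (here refl) m' }) (in-r′ {G} e₀ (r o j)) i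
    go (in-ctx m' i) {j} (no ne) = sep-ctx S (inl (∈─⁺ m ne)) (inr (FV u ─ rt x A) (there m')) (λ { refl → d (∈─⁺ m ne) (there m') }) j i

-- The motive of an induction on `D` alone: `E` stays arbitrary and is rearranged at each stage to
-- end in the last rule of `D`.
SameLinks : Nf G n C t → Set
SameLinks {G} {n} {C} {t} D = ∀ {s} (E : Nf G n C s) → Lin s → FV t ≋ FV s → Sep G n C (FV t) →
  (∀ {i j} → Link D i j → Link E i j) → (∀ {i j} → Link E i j → Link D i j) → t ≈ s

same-links-lam : ∀ {b} (e : G (suc n) ≡ A) (D : Nf G (rt n A) B b) → Lin (lam (suc n) b) → SameLinks D → SameLinks (nlam e D)
same-links-lam {G} {n} {A} {B} {b} e D l@(lb , mb) ihD {s} E l' fv S f f' =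
  ≈-trans (≈-lam (ihD premiseNf (proj₁ lp) fv′ (Sep-lam S e) (link-to ∘ f) (f' ∘ link-from))) (≈-sym equal)
  where
    open Inversion (invert-lam E l' (Sep-⊑ id (proj₂ fv) S))
    lp : Lin (lam (suc n) premise)
    lp = proj₁ (≈-Lin equal) l'
    fv′ : FV b ≋ FV premise
    fv′ = bind-≋ mb (proj₂ lp) (≋-trans fv (≈-FV equal))

same-links-let : ∀ {b} (e₀ : G x ≡ A ⊗ B) (e₁ : G (suc x) ≡ A) (e₂ : G (rt x A) ≡ B) (D : Nf G n C b) →
  Lin (letp (suc x) (rt x A) (var x) b) → SameLinks D → SameLinks (nlet e₀ e₁ e₂ D)
same-links-let {G} {x} {A} {B} {n} {C} {b} e₀ e₁ e₂ D l@(_ , lb , m₁ , m₂ , ne , d) ihD {s} E l' fv S f f' =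
  ≈-trans (≈-let ≈-refl (ihD premiseNf (proj₁ (proj₂ lp)) fv′ (Sep-let {x = x} {A} {b} l e₀ e₁ e₂ S) (link-to ∘ f) (f' ∘ link-from))) (≈-sym equal)
  where
    open Inversion (invert-let E x e₀ e₁ e₂ (proj₁ fv (here refl)) l' (Sep-⊑ id (proj₂ fv) S))
    lp : Lin (letp (suc x) (rt x A) (var x) premise)
    lp = proj₁ (≈-Lin equal) l'
    fv″ : (x ∷ ((FV b ─ suc x) ─ rt x A)) ≋ (x ∷ ((FV premise ─ suc x) ─ rt x A))
    fv″ = ≋-trans fv (≈-FV equal)
    tail : ∀ {xs ys : List ℕ} → x ∉ xs → (x ∷ xs) ⊑ (x ∷ ys) → xs ⊑ ys
    tail n i m with i (there m)
    ... | here refl = ⊥-elim (n m)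
    ... | there k = k
    fv′ : FV b ≋ FV premise
    fv′ = bind-≋ m₁ (proj₁ (proj₂ (proj₂ lp))) (bind-≋ (∈─⁺ m₂ (ne ∘ sym)) (∈─⁺ (proj₁ (proj₂ (proj₂ (proj₂ lp)))) (ne ∘ sym))
      (tail (d (here refl)) (proj₁ fv″) , tail (proj₂ (proj₂ (proj₂ (proj₂ (proj₂ lp)))) (here refl)) (proj₂ fv″)))

-- The region of `D` is coloured true. The links of `E` are those of the two premises, so they
-- respect this colouring and `E` splits into a pair. Disjointness of the regions then tells which
-- half a variable or a link belongs to.
same-links-pair : ∀ {a b} (D : Nf G (suc n) A a) (D' : Nf G (rt n A) B b) → Lin (pair a b) → SameLinks D → SameLinks D' → SameLinks (npair D D')
same-links-pair {G} {n} {A} {B} {a} {b} D D' l@(la , lb , d) ihD ihD' {s} E l' fv S f f' =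
  ≈-trans (≈-pair (ihD leftNf (proj₁ lp) fvl (Sep-⊑ (in-l A B) inl S) to-l from-l)
                  (ihD' rightNf (proj₁ (proj₂ lp)) fvr (Sep-⊑ (in-r A B) (inr (FV a)) S) to-r from-r)) (≈-sym equal)
  where
    K : Cross G (suc n) A (FV a) (rt n A) B (FV b)
    K = pair-cross {a} {b} l S
    χ₀ = colour G (suc n) A (FV a)
    out : ∀ {z} → Reg G (rt n A) B (FV b) z → χ₀ z ≡ false
    out j = colour-out λ i → K i j
    lk : Respects χ₀ E
    lk k with f' k
    ... | inj₁ o = case link-loc D la o of λ (p , q) → trans (colour-in p) (sym (colour-in q))
    ... | inj₂ o = case link-loc D' lb o of λ (p , q) → trans (out p) (sym (out q))
    cx : MonoCtx χ₀ G (FV s)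
    cx m with ∈++ (FV a) (proj₂ fv m)
    ... | inj₁ i = true , λ j → colour-in (in-ctx i j)
    ... | inj₂ i = false , λ j → out (in-ctx i j)
    open Splitting (split E l' lk cx (λ i → colour-in (in-goal i)) (λ i → out (in-goal i)))
    lp : Lin (pair left right)
    lp = proj₁ (≈-Lin equal) l'
    name-a : ∀ {z} → z ∈ FV a → χ₀ z ≡ true
    name-a {z} i = colour-in (in-ctx i (in-root z (G z)))
    name-b : ∀ {z} → z ∈ FV b → χ₀ z ≡ false
    name-b {z} i = out (in-ctx i (in-root z (G z)))
    fv₂ : (FV a ++ FV b) ≋ (FV left ++ FV right)
    fv₂ = ≋-trans fv (≈-FV equal)
    fvl : FV a ≋ FV left
    fvl = (λ i → case ∈++ (FV left) (proj₁ fv₂ (inl i)) of λ { (inj₁ j) → j ; (inj₂ j) → ⊥-elim (clash (name-a i) (right-false j)) }) ,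
          (λ i → case ∈++ (FV a) (proj₂ fv₂ (inl i)) of λ { (inj₁ j) → j ; (inj₂ j) → ⊥-elim (clash (left-true i) (name-b j)) })
    fvr : FV b ≋ FV right
    fvr = (λ i → case ∈++ (FV left) (proj₁ fv₂ (inr (FV a) i)) of λ { (inj₂ j) → j ; (inj₁ j) → ⊥-elim (clash (left-true j) (name-b i)) }) ,
          (λ i → case ∈++ (FV a) (proj₂ fv₂ (inr (FV left) i)) of λ { (inj₂ j) → j ; (inj₁ j) → ⊥-elim (clash (name-a j) (right-false i)) })
    locl : ∀ {i j} → Link leftNf i j → Reg G (suc n) A (FV a) i
    locl k = Reg-⊑ in-goal (proj₂ fvl) (proj₁ (link-loc leftNf (proj₁ lp) k))
    locr : ∀ {i j} → Link rightNf i j → Reg G (rt n A) B (FV b) i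
    locr k = Reg-⊑ in-goal (proj₂ fvr) (proj₁ (link-loc rightNf (proj₁ (proj₂ lp)) k))
    to-l : ∀ {i j} → Link D i j → Link leftNf i j
    to-l k with link-to (f (inj₁ k))
    ... | inj₁ o = o
    ... | inj₂ o = ⊥-elim (K (proj₁ (link-loc D la k)) (locr o))
    to-r : ∀ {i j} → Link D' i j → Link rightNf i j
    to-r k with link-to (f (inj₂ k))
    ... | inj₂ o = o
    ... | inj₁ o = ⊥-elim (K (locl o) (proj₁ (link-loc D' lb k)))
    from-l : ∀ {i j} → Link leftNf i j → Link D i j
    from-l k with f' (link-from (inj₁ k))
    ... | inj₁ o = o
    ... | inj₂ o = ⊥-elim (K (locl k) (proj₁ (link-loc D' lb o)))
    from-r : ∀ {i j} → Link rightNf i j → Link D' i j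
    from-r k with f' (link-from (inj₂ k))
    ... | inj₂ o = o
    ... | inj₁ o = ⊥-elim (K (proj₁ (link-loc D la o)) (locr k))

-- The argument for pairs, with the region of the argument of `x` coloured true and `extract` in the
-- place of `split`.
same-links-app : (e₀ : G x ≡ A ⊸ B) (e₂ : G (rt x A) ≡ B) (D : Nf G (suc x) A v) (D' : Nf G n C u) →
  Lin (app (lam (rt x A) u) (app (var x) v)) → SameLinks D → SameLinks D' → SameLinks (napp e₀ e₂ D D')
same-links-app {G} {x} {A} {B} {v} {n} {C} {u} e₀ e₂ D D' l@((lu , my) , (_ , lv , dv) , d) ihD ihD' {s} E l' fv S f f' =
  ≈-trans (≈-app (≈-lam (ihD' bodyNf lbody fvu (Sep-app₂ {x = x} {A} {u} {v} l e₀ e₂ S) to-u from-u))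
                 (≈-app ≈-refl (ihD argNf larg fvv (Sep-app₁ {x = x} {A} {u} {v} l e₀ S) to-v from-v))) (≈-sym equal)
  where
    Y' = rt x A
    T' = app (lam (rt x A) u) (app (var x) v)
    x∈ : x ∈ FV T'
    x∈ = inr (FV u ─ Y') (here refl)
    K : Cross G (suc x) A (FV v) n C (FV u)
    K = app-cross {x} {A} {u} {v} {G} l e₀ e₂ S
    χ₀ = colour G (suc x) A (FV v)
    out : ∀ {z} → Reg G n C (FV u) z → χ₀ z ≡ false
    out j = colour-out λ i → K i j
    lk : Respects χ₀ E
    lk k with f' k
    ... | inj₁ o = case link-loc D lv o of λ (p , q) → trans (colour-in p) (sym (colour-in q))
    ... | inj₂ o = case link-loc D' lu o of λ (p , q) → trans (out p) (sym (out q))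
    cx : ∀ {z} → z ∈ FV s → z ≢ x → ∃[ c ] Mono χ₀ c z (G z)
    cx m ne with ∈++ (FV u ─ Y') (proj₂ fv m)
    ... | inj₁ i = false , λ j → out (in-ctx (proj₁ (∈─⁻ {xs = FV u} i)) j)
    ... | inj₂ (here o) = ⊥-elim (ne o)
    ... | inj₂ (there i) = true , λ j → colour-in (in-ctx i j)
    open Extraction (extract E x e₀ (proj₁ fv x∈) l' (Sep-⊑ id (proj₂ fv) S) lk cx (λ i → colour-in (in-goal i))
                       (λ i → out (in-ctx my (≡subst (In _ Y') (sym e₂) i))) (λ i → out (in-goal i)))
    lp : Lin (app (lam Y' body) (app (var x) arg))
    lp = proj₁ (≈-Lin equal) l'
    lbody : Lin body
    lbody = proj₁ (proj₁ lp)
    larg : Lin arg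
    larg = proj₁ (proj₂ (proj₁ (proj₂ lp)))
    name-v : ∀ {z} → z ∈ FV v → χ₀ z ≡ true
    name-v {z} i = colour-in (in-ctx i (in-root z (G z)))
    name-u : ∀ {z} → z ∈ FV u → χ₀ z ≡ false
    name-u {z} i = out (in-ctx i (in-root z (G z)))
    fv₂ : FV T' ≋ ((FV body ─ Y') ++ x ∷ FV arg)
    fv₂ = ≋-trans fv (≈-FV equal)
    fvv : FV v ≋ FV arg
    fvv = (λ i → case ∈++ (FV body ─ Y') (proj₁ fv₂ (inr (FV u ─ Y') (there i))) of λ
             { (inj₁ j) → ⊥-elim (clash (name-v i) (body-false (proj₁ (∈─⁻ {xs = FV body} j)))) ; (inj₂ (here refl)) → ⊥-elim (dv (here refl) i) ; (inj₂ (there j)) → j }) ,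
          (λ i → case ∈++ (FV u ─ Y') (proj₂ fv₂ (inr (FV body ─ Y') (there i))) of λ
             { (inj₁ j) → ⊥-elim (clash (arg-true i) (name-u (proj₁ (∈─⁻ {xs = FV u} j))))
             ; (inj₂ (here refl)) → ⊥-elim (proj₂ (proj₂ (proj₁ (proj₂ lp))) (here refl) i) ; (inj₂ (there j)) → j })
    fvu : FV u ≋ FV body
    fvu = bind-≋ my (proj₂ (proj₁ lp))
      ((λ i → case ∈++ (FV body ─ Y') (proj₁ fv₂ (inl i)) of λ
         { (inj₁ j) → j ; (inj₂ (here refl)) → ⊥-elim (d i (here refl)) ; (inj₂ (there j)) → ⊥-elim (clash (arg-true j) (name-u (proj₁ (∈─⁻ {xs = FV u} i)))) }) ,
       (λ i → case ∈++ (FV u ─ Y') (proj₂ fv₂ (inl i)) of λ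
         { (inj₁ j) → j ; (inj₂ (here refl)) → ⊥-elim (proj₂ (proj₂ lp) i (here refl)) ; (inj₂ (there j)) → ⊥-elim (clash (name-v j) (body-false (proj₁ (∈─⁻ {xs = FV body} i)))) }))
    locv : ∀ {i j} → Link argNf i j → Reg G (suc x) A (FV v) i
    locv k = Reg-⊑ in-goal (proj₂ fvv) (proj₁ (link-loc argNf larg k))
    locu : ∀ {i j} → Link bodyNf i j → Reg G n C (FV u) i
    locu k = Reg-⊑ in-goal (proj₂ fvu) (proj₁ (link-loc bodyNf lbody k))
    to-v : ∀ {i j} → Link D i j → Link argNf i j
    to-v k with link-to (f (inj₁ k))
    ... | inj₁ o = o
    ... | inj₂ o = ⊥-elim (K (proj₁ (link-loc D lv k)) (locu o))
    to-u : ∀ {i j} → Link D' i j → Link bodyNf i j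
    to-u k with link-to (f (inj₂ k))
    ... | inj₂ o = o
    ... | inj₁ o = ⊥-elim (K (locv o) (proj₁ (link-loc D' lu k)))
    from-v : ∀ {i j} → Link argNf i j → Link D i j
    from-v k with f' (link-from (inj₁ k))
    ... | inj₁ o = o
    ... | inj₂ o = ⊥-elim (K (locv k) (proj₁ (link-loc D' lu o)))
    from-u : ∀ {i j} → Link bodyNf i j → Link D' i j
    from-u k with f' (link-from (inj₂ k))
    ... | inj₂ o = o
    ... | inj₁ o = ⊥-elim (K (proj₁ (link-loc D lv o)) (locu k))

same-links : (D : Nf G n C t) → Lin t → SameLinks D
same-links (nvar e) l (nvar e') l' fv S f f' = case proj₁ fv (here refl) of λ { (here refl) → ≈-refl }
-- The only free variable is an atom, so `E` cannot end in a left rule.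
same-links (nvar e) l (nlet e₀ e₁ e₂ E) l' fv S f f' = case proj₂ fv (here refl) of λ { (here refl) → case trans (sym e) e₀ of λ () }
same-links (nvar e) l (napp {x = x} {A = X} {u = u} e₀ e₂ E E') l' fv S f f' =
  case proj₂ fv (inr (FV u ─ rt x X) (here refl)) of λ { (here refl) → case trans (sym e) e₀ of λ () }
same-links (nlam e D) l = same-links-lam e D l (same-links D (proj₁ l))
same-links (nlet e₀ e₁ e₂ D) l = same-links-let e₀ e₁ e₂ D l (same-links D (proj₁ (proj₂ l)))
same-links (npair D D') l = same-links-pair D D' l (same-links D (proj₁ l)) (same-links D' (proj₁ (proj₂ l)))
same-links (napp e₀ e₂ D D') l@((lu , _) , (_ , lv , _) , _) = same-links-app e₀ e₂ D D' l (same-links D lv) (same-links D' lu)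

-- Bits

variable
  k l k' l' e : Tm

#? : ∀ xs ys → Dec (xs # ys)
#? xs ys = map′ (λ a i j → All.lookup a i j) (λ d → All.tabulate λ i j → d i j) (All.all? (λ z → ¬? (z ∈? ys)) xs)

-- Lets the linearity of the concrete combinators be established by evaluation.
Lin? : ∀ t → Dec (Lin t)
Lin? (var x)        = yes tt
Lin? (app t s)      = Lin? t ×-dec Lin? s ×-dec #? (FV t) (FV s)
Lin? (lam x t)      = Lin? t ×-dec (x ∈? FV t)
Lin? (pair t s)     = Lin? t ×-dec Lin? s ×-dec #? (FV t) (FV s)
Lin? (letp x y s t) = Lin? s ×-dec Lin? t ×-dec (x ∈? FV t) ×-dec (y ∈? FV t) ×-dec ¬? (x ≟ y) ×-dec #? (FV s) ((FV t ─ x) ─ y)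

-- Evaluation of linear terms in closing environments

record Cl (t : Tm) : Set where
  constructor cl
  field
    no-fv  : ∀ {z} → z ∈ FV t → ⊥
    linear : Lin t
open Cl

Cl-app : Cl t → Cl s → Cl (app t s)
Cl-app {t} p q = cl (λ m → case ∈++ (FV t) m of λ { (inj₁ i) → no-fv p i ; (inj₂ i) → no-fv q i })
                    (linear p , linear q , λ i _ → no-fv p i)

Cl-pair : Cl t → Cl s → Cl (pair t s)
Cl-pair p q = cl (no-fv (Cl-app p q)) (linear (Cl-app p q))

Cl-≈ : t ≈ s → Cl t → Cl s
Cl-≈ p c = cl (λ m → no-fv c (proj₂ (≈-FV p) m)) (proj₁ (≈-Lin p) (linear c))

-- A closing substitution. It brings in no free variables at all, so capture cannot arise.
record Env (σ : Subst) (xs : List ℕ) : Set where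
  constructor env
  field
    env-fvs : ∀ {z} → z ∈ FVS σ → ⊥
    env-cl  : ∀ {z} → z ∈ xs → Cl (look σ z)
open Env

Env-⊑ : ys ⊑ xs → Env σ xs → Env σ ys
Env-⊑ i E = env (env-fvs E) (env-cl E ∘ i)

Env-∷ : ∀ {e} xs → Env σ (xs ─ x) → Cl e → Env ((x , e) ∷ σ) xs
Env-∷ {σ} {x} {e} xs E c = env (λ m → case ∈++ (FV e) m of λ { (inj₁ i) → no-fv c i ; (inj₂ i) → env-fvs E i }) f
  where
    f : ∀ {z} → z ∈ xs → Cl (look ((x , e) ∷ σ) z)
    f {z} m with z ≟ x
    ... | yes _ = c
    ... | no ne = env-cl E (∈─⁺ m ne)

Env-NC : Env σ xs → NC σ t
Env-NC E i = ⊥-elim (env-fvs E i)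

Cl-subst : ∀ t → Lin t → Env σ (FV t) → Cl (subst σ t)
Cl-subst {σ} t l E = cl (λ m → case FV-subst⁻ σ t (Env-NC {t = t} E) m of λ (w , i , j) → no-fv (env-cl E i) j)
  (Lin-subst σ t (Env-NC {t = t} E) l (λ m → linear (env-cl E m)) (λ p _ _ i _ → no-fv (env-cl E p) i))

subst-Cl : Cl t → subst σ t ≡ t
subst-Cl {t} {σ} c = subst-id σ t λ m → ⊥-elim (no-fv c m)

β-cl : ∀ {e} → Lin (lam x t) → Cl e → app (lam x t) e ≈ subst ((x , e) ∷ []) t
β-cl {x} {t} {e} l c = step (β-lam (NC₁ {t} {e} {x} λ _ j → no-fv c j)) (l , linear c , λ _ j → no-fv c j)

subst-∷ : ∀ {e} t → Env σ (FV t ─ x) → subst ((x , e) ∷ []) (subst (dropS x σ) t) ≡ subst ((x , e) ∷ σ) t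
subst-∷ {σ} {x} {e} t E = subst-comp (dropS x σ) ((x , e) ∷ []) ((x , e) ∷ σ) t (λ m _ → env-fvs E (dropFVS x σ m)) f
  where
    f : ∀ {z} → z ∈ FV t → subst ((x , e) ∷ []) (look (dropS x σ) z) ≡ look ((x , e) ∷ σ) z
    f {z} m = go (z ≟ x)
      where
        go : Dec (z ≡ x) → _
        go (yes refl) = trans (cong (subst ((x , e) ∷ [])) (drop-same x σ)) (trans (look-here x e []) (sym (look-here x e σ)))
        go (no ne) = trans (cong (subst ((x , e) ∷ [])) (drop-other σ ne)) (trans (subst-Cl (env-cl E (∈─⁺ m ne))) (sym (look-there e σ ne)))

-- Under a closing substitution a β step only extends the substitution, as in an environment
-- machine.
β-env : ∀ {e} t → Lin (lam x t) → Env σ (FV (lam x t)) → Cl e → app (subst σ (lam x t)) e ≈ subst ((x , e) ∷ σ) t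
β-env {x} {σ} {e} t l E c = ≈-trans (β-cl (linear (Cl-subst (lam x t) l E)) c) (≈-≡ (subst-∷ t E))

βp-env : ∀ s t → Lin (letp x y s t) → Env σ (FV (letp x y s t)) → subst σ s ≈ pair u v → Cl u → Cl v →
         subst σ (letp x y s t) ≈ subst ((x , u) ∷ (y , v) ∷ σ) t
βp-env {x} {y} {σ} {u} {v} s t l@(_ , _ , mx , my , ne , d) E r cu cv =
  ≈-trans r′ (≈-trans (step (β-let nc) (proj₁ (≈-Lin r′) (linear (Cl-subst (letp x y s t) l E)))) (≈-≡ comp))
  where
    r′ : subst σ (letp x y s t) ≈ letp x y (pair u v) (subst (drop₂ x y σ) t)
    r′ = ≈-let r ≈-refl
    nc : NC ((x , u) ∷ (y , v) ∷ []) (subst (drop₂ x y σ) t)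
    nc m _ = case ∈++ (FV u) m of λ { (inj₁ i) → no-fv cu i ; (inj₂ i) → case ∈++ (FV v) i of λ { (inj₁ i) → no-fv cv i } }
    comp : subst ((x , u) ∷ (y , v) ∷ []) (subst (drop₂ x y σ) t) ≡ subst ((x , u) ∷ (y , v) ∷ σ) t
    comp = subst-comp (drop₂ x y σ) ((x , u) ∷ (y , v) ∷ []) ((x , u) ∷ (y , v) ∷ σ) t
      (λ m _ → env-fvs E (dropFVS x σ (dropFVS y (dropS x σ) m))) (λ {z} m → go m (z ≟ x) (z ≟ y))
      where
        go : ∀ {z} → z ∈ FV t → Dec (z ≡ x) → Dec (z ≡ y) → subst ((x , u) ∷ (y , v) ∷ []) (look (drop₂ x y σ) z) ≡ look ((x , u) ∷ (y , v) ∷ σ) z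
        go m (yes refl) _ = trans (cong (subst ((x , u) ∷ (y , v) ∷ [])) (drop₂-x x y σ)) (trans (look-here x u _) (sym (look-here x u _)))
        go m (no n) (yes refl) = trans (cong (subst ((x , u) ∷ (y , v) ∷ [])) (drop₂-y x y σ))
           (trans (trans (look-there u _ n) (look-here y v _)) (sym (trans (look-there u _ n) (look-here y v σ))))
        go m (no n) (no n') = trans (cong (subst ((x , u) ∷ (y , v) ∷ [])) (drop₂-other σ n n'))
           (trans (subst-Cl (env-cl E (inr (FV s) (∈─⁺ (∈─⁺ m n) n')))) (sym (trans (look-there u _ n) (look-there v σ n'))))

lams : Subst → Tm → Tm
lams [] t            = t
lams ((x , _) ∷ σ) t = lam x (lams σ t)

app* : Tm → Subst → Tm
app* t []            = t
app* t ((_ , e) ∷ σ) = app* (app t e) σ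

≈-app* : ∀ σ → t ≈ s → app* t σ ≈ app* s σ
≈-app* [] p = p
≈-app* ((_ , e) ∷ σ) p = ≈-app* σ (≈-app p ≈-refl)

ClS : Subst → Set
ClS = All (λ p → Cl (proj₂ p))

subst-lams : ∀ ρ σ t → All (λ p → look ρ (proj₁ p) ≡ var (proj₁ p) × dropS (proj₁ p) ρ ≡ ρ) σ → subst ρ (lams σ t) ≡ lams σ (subst ρ t)
subst-lams ρ [] t a = refl
subst-lams ρ ((x , e) ∷ σ) t ((_ , d) ∷ a) = cong (lam x) (trans (cong (λ k → subst k (lams σ t)) d) (subst-lams ρ σ t a))

FVS-ClS : ∀ {σ} → ClS σ → z ∈ FVS σ → ⊥
FVS-ClS {σ = (x , e) ∷ σ} (c ∷ cs) m = case ∈++ (FV e) m of λ { (inj₁ i) → no-fv c i ; (inj₂ i) → FVS-ClS cs i }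

-- One list serves as the binders and as the arguments, so a curried combinator is evaluated on all
-- its arguments at once.
β* : ∀ σ t → Unique (List.map proj₁ σ) → ClS σ → Lin (lams σ t) → app* (lams σ t) σ ≈ subst σ t
β* [] t _ _ l = ≈-≡ (sym (subst-id [] t λ _ → refl))
β* ((x , e) ∷ σ) t (n ∷ u) (c ∷ cs) l =
  ≈-trans (≈-app* σ (≈-trans r (≈-≡ (subst-lams ρ σ t (dist σ n)))))
  (≈-trans (β* σ (subst ρ t) u cs (≡subst Lin (subst-lams ρ σ t (dist σ n)) (proj₁ (≈-Lin r) (l , linear c , λ _ j → no-fv c j))))
           (≈-≡ (subst-comp ρ σ ((x , e) ∷ σ) t (λ m _ → FVS-ClS {σ = ρ} (c ∷ []) m) λ {z} _ → go z (z ≟ x))))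
  where
    ρ = (x , e) ∷ []
    r : app (lam x (lams σ t)) e ≈ subst ρ (lams σ t)
    r = β-cl l c
    dist : ∀ σ → All (x ≢_) (List.map proj₁ σ) → All (λ p → look ρ (proj₁ p) ≡ var (proj₁ p) × dropS (proj₁ p) ρ ≡ ρ) σ
    dist [] _ = []
    dist ((y , _) ∷ σ) (ne ∷ n) = (look-there e [] (ne ∘ sym) , drop-single y (ne ∘ sym)) ∷ dist σ n
    go : ∀ z → Dec (z ≡ x) → subst σ (look ρ z) ≡ look ((x , e) ∷ σ) z
    go z (yes refl) = trans (cong (subst σ) (look-here x e [])) (trans (subst-Cl c) (sym (look-here x e σ)))
    go z (no ne) = trans (cong (subst σ) (look-there e [] ne)) (sym (look-there e σ ne))

look-Cl : ClS σ → z ∈ List.map proj₁ σ → Cl (look σ z)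
look-Cl {(x , e) ∷ σ} {z} (c ∷ cs) m with z ≟ x
... | yes _ = c
... | no ne with m
...   | here o = ⊥-elim (ne o)
...   | there i = look-Cl cs i

Env-ClS : ClS σ → ∀ xs → All (_∈ List.map proj₁ σ) xs → Env σ xs
Env-ClS cs xs a = env (FVS-ClS cs) (λ m → look-Cl cs (All.lookup a m))

-- Identity, exchange of the components of a pair, and composition.
𝐈 𝐓 𝐂 : Tm
𝐈 = lam 0 (var 0)
𝐓 = lam 0 (letp 1 2 (var 0) (pair (var 2) (var 1)))
𝐂 = lam 0 (lam 1 (lam 2 (app (var 0) (app (var 1) (var 2)))))

Cl! : ∀ t → {FV t ≡ []} → Lin t → Cl t
Cl! t {e} l = cl (λ m → case ≡subst (_ ∈_) e m of λ ()) l

Cl-𝐈 : Cl 𝐈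
Cl-𝐈 = Cl! 𝐈 {refl} (from-yes (Lin? 𝐈))
Cl-𝐓 : Cl 𝐓
Cl-𝐓 = Cl! 𝐓 {refl} (from-yes (Lin? 𝐓))
Cl-𝐂 : Cl 𝐂
Cl-𝐂 = Cl! 𝐂 {refl} (from-yes (Lin? 𝐂))

infixl 8 _·_
_·_ : Tm → Tm → Tm
_·_ = app

_⨾_ : Tm → Tm → Tm
k ⨾ l = 𝐂 · k · l

unique? : ∀ (xs : List ℕ) → Dec (Unique xs)
unique? = UniqueDec.unique? _≟_

swap-if : Bool → Tm → Tm → Tm
swap-if false u v = pair u v
swap-if true u v  = pair v u

-- A bit is known by its action on closed pairs, which frees it from any particular shape: the
-- outcome of a test counts as a bit whatever it looks like.
record Code (b : Bool) (k : Tm) : Set where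
  constructor code
  field
    code-cl : Cl k
    runs    : ∀ {u v} → Cl u → Cl v → k · pair u v ≈ swap-if b u v
open Code

Code-≈ : k ≈ k' → Code b k → Code b k'
Code-≈ p (code c r) = code (Cl-≈ p c) λ cu cv → ≈-trans (≈-app (≈-sym p) ≈-refl) (r cu cv)

𝐈-β : Cl t → 𝐈 · t ≈ t
𝐈-β {t} c = β* ((0 , t) ∷ []) (var 0) (from-yes (unique? (0 ∷ []))) (c ∷ []) (linear Cl-𝐈)

Code-𝐈 : Code false 𝐈
Code-𝐈 = code Cl-𝐈 λ cu cv → 𝐈-β (Cl-pair cu cv)

Code-𝐓 : Code true 𝐓
Code-𝐓 = code Cl-𝐓 λ {u} {v} cu cv → ≈-trans (β-cl (linear Cl-𝐓) (Cl-pair cu cv))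
  (βp-env {u = u} {v} (var 0) (pair (var 2) (var 1)) (from-yes (Lin? (letp 1 2 (var 0) (pair (var 2) (var 1)))))
    (Env-ClS (Cl-pair cu cv ∷ []) (0 ∷ []) (from-yes (All.all? (_∈? (0 ∷ [])) (0 ∷ [])))) ≈-refl cu cv)

-- The two actions form the group of order two, so composition is addition modulo 2.
Code-⨾ : Code b k → Code c l → Code (b xor c) (k ⨾ l)
Code-⨾ {b} {k} {c} {l} K L = code (Cl-app (Cl-app Cl-𝐂 (code-cl K)) (code-cl L)) λ {u} {v} cu cv →
  ≈-trans (β* ((0 , k) ∷ (1 , l) ∷ (2 , pair u v) ∷ []) (var 0 · (var 1 · var 2)) (from-yes (unique? (0 ∷ 1 ∷ 2 ∷ [])))
             (code-cl K ∷ code-cl L ∷ Cl-pair cu cv ∷ []) (linear Cl-𝐂))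
          (≈-trans (≈-app ≈-refl (runs L cu cv)) (go b c K cu cv))
  where
    go : ∀ b c → Code b k → Cl u → Cl v → k · swap-if c u v ≈ swap-if (b xor c) u v
    go b false K cu cv = ≈-trans (runs K cu cv) (≈-≡ (cong (λ k → swap-if k _ _) (sym (Bool.xor-identityʳ b))))
    go false true K cu cv = runs K cv cu
    go true true K cu cv = runs K cv cu

-- Absorbs a bit without discarding anything: both bits send `pair 𝐈 𝐈` to itself, and its two
-- components are then used up by applying them to the second argument.
𝐊 : Tm
𝐊 = lam 0 (letp 1 2 (var 0 · pair 𝐈 𝐈) (lam 3 (var 1 · (var 2 · var 3))))

Cl-𝐊 : Cl 𝐊
Cl-𝐊 = Cl! 𝐊 {refl} (from-yes (Lin? 𝐊))

𝐊-β : Code b k → 𝐊 · k ≈ lam 3 (𝐈 · (𝐈 · var 3))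
𝐊-β {b} {k} K = ≈-trans (β-cl (linear Cl-𝐊) (code-cl K))
  (βp-env {u = 𝐈} {𝐈} (var 0 · pair 𝐈 𝐈) (lam 3 (var 1 · (var 2 · var 3))) (from-yes (Lin? (letp 1 2 (var 0 · pair 𝐈 𝐈) (lam 3 (var 1 · (var 2 · var 3))))))
    (Env-ClS (code-cl K ∷ []) (0 ∷ []) (from-yes (All.all? (_∈? (0 ∷ [])) (0 ∷ [])))) (≈-trans (runs K Cl-𝐈 Cl-𝐈) (≈-≡ (same b))) Cl-𝐈 Cl-𝐈)
  where
    same : ∀ b → swap-if b 𝐈 𝐈 ≡ pair 𝐈 𝐈
    same false = refl
    same true = refl

𝐊-id : Code b k → Cl t → 𝐊 · k · t ≈ t
𝐊-id {t = t} K c = ≈-trans (≈-app (𝐊-β K) ≈-refl)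
  (≈-trans (β-cl (from-yes (Lin? (lam 3 (𝐈 · (𝐈 · var 3))))) c) (≈-trans (𝐈-β (Cl-app Cl-𝐈 c)) (𝐈-β c)))

-- Multiplication by a known bit: a mark is counted at the address in question and absorbed at every
-- other one.
inspect : Bool → Tm
inspect true  = 𝐈
inspect false = 𝐊

Cl-inspect : ∀ b → Cl (inspect b)
Cl-inspect true = Cl-𝐈
Cl-inspect false = Cl-𝐊

Code-inspect : ∀ c → Code b k → Code (c ∧ b) (inspect c · k)
Code-inspect true K = Code-≈ (≈-sym (𝐈-β (code-cl K))) K
Code-inspect false K = code (Cl-app Cl-𝐊 (code-cl K)) λ cu cv → 𝐊-id K (Cl-pair cu cv)

-- Feeding and probing a type

bit : Bool → Tm
bit false = 𝐈
bit true  = 𝐓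

Code-bit : ∀ b → Code b (bit b)
Code-bit false = Code-𝐈
Code-bit true = Code-𝐓

-- The clauses of `Feed` and `Probe` as closed combinators. At an atom the pair holds the mark and
-- the surplus bit in transit. A surplus cannot be duplicated, so `𝐅⊗` hands it to the left
-- component and gives the right one `𝐈`, which is zero.
𝐅₀ 𝐅⊗ 𝐅⊸ 𝐏₀ 𝐏⊗ 𝐏⊸ : Tm
𝐅₀ = lam 0 (lam 1 (pair (var 0) (var 1)))
𝐅⊗ = lam 0 (lam 1 (lam 2 (pair (var 0 · var 2) (var 1 · 𝐈))))
𝐅⊸ = lam 0 (lam 1 (lam 2 (lam 3 (var 0 · (var 2 ⨾ (var 1 · var 3))))))
𝐏₀ = lam 0 (lam 1 (letp 2 3 (var 1) ((var 0 · var 2) ⨾ var 3)))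
𝐏⊗ = lam 0 (lam 1 (lam 2 (letp 3 4 (var 2) ((var 0 · var 3) ⨾ (var 1 · var 4)))))
𝐏⊸ = lam 0 (lam 1 (lam 2 (var 0 · (var 2 · (var 1 · 𝐈)))))

Cl-𝐅₀ : Cl 𝐅₀
Cl-𝐅₀ = Cl! 𝐅₀ {refl} (from-yes (Lin? 𝐅₀))
Cl-𝐅⊗ : Cl 𝐅⊗
Cl-𝐅⊗ = Cl! 𝐅⊗ {refl} (from-yes (Lin? 𝐅⊗))
Cl-𝐅⊸ : Cl 𝐅⊸
Cl-𝐅⊸ = Cl! 𝐅⊸ {refl} (from-yes (Lin? 𝐅⊸))
Cl-𝐏₀ : Cl 𝐏₀
Cl-𝐏₀ = Cl! 𝐏₀ {refl} (from-yes (Lin? 𝐏₀))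
Cl-𝐏⊗ : Cl 𝐏⊗
Cl-𝐏⊗ = Cl! 𝐏⊗ {refl} (from-yes (Lin? 𝐏⊗))
Cl-𝐏⊸ : Cl 𝐏⊸
Cl-𝐏⊸ = Cl! 𝐏⊸ {refl} (from-yes (Lin? 𝐏⊸))

-- The test for a link between the goal atom named α and the hypothesis atom
-- named β: feeding A turns a bit into a term of type A whose atoms all carry
-- bits, marking β; probing A sums up the bits reaching the goals and adds the
-- mark found at α.  The surplus bit of a fed A ⊸ B is the sum of what was fed
-- and what the argument's probe yields.
module Test (α β : ℕ) where

  Feed Probe : ℕ → Ty → Tm
  Feed n (tv a)   = 𝐅₀ · bit (n ≡ᵇ β)
  Feed n (A ⊗ B)  = 𝐅⊗ · Feed (suc n) A · Feed (rt n A) B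
  Feed n (A ⊸ B)  = 𝐅⊸ · Feed (rt n A) B · Probe (suc n) A
  Probe n (tv a)  = 𝐏₀ · inspect (n ≡ᵇ α)
  Probe n (A ⊗ B) = 𝐏⊗ · Probe (suc n) A · Probe (rt n A) B
  Probe n (A ⊸ B) = 𝐏⊸ · Probe (rt n A) B · Feed (suc n) A

  Cl-Feed : ∀ n A → Cl (Feed n A)
  Cl-Probe : ∀ n A → Cl (Probe n A)
  Cl-Feed n (tv a) = Cl-app Cl-𝐅₀ (code-cl (Code-bit (n ≡ᵇ β)))
  Cl-Feed n (A ⊗ B) = Cl-app (Cl-app Cl-𝐅⊗ (Cl-Feed _ A)) (Cl-Feed _ B)
  Cl-Feed n (A ⊸ B) = Cl-app (Cl-app Cl-𝐅⊸ (Cl-Feed _ B)) (Cl-Probe _ A)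
  Cl-Probe n (tv a) = Cl-app Cl-𝐏₀ (Cl-inspect (n ≡ᵇ α))
  Cl-Probe n (A ⊗ B) = Cl-app (Cl-app Cl-𝐏⊗ (Cl-Probe _ A)) (Cl-Probe _ B)
  Cl-Probe n (A ⊸ B) = Cl-app (Cl-app Cl-𝐏⊸ (Cl-Probe _ B)) (Cl-Feed _ A)

  feed-tv : Cl k → Feed n (tv a) · k ≈ pair (bit (n ≡ᵇ β)) k
  feed-tv {k} {n} c = β* ((0 , bit (n ≡ᵇ β)) ∷ (1 , k) ∷ []) (pair (var 0) (var 1)) (from-yes (unique? (0 ∷ 1 ∷ [])))
    (code-cl (Code-bit (n ≡ᵇ β)) ∷ c ∷ []) (linear Cl-𝐅₀)

  feed-⊗ : Cl k → Feed n (A ⊗ B) · k ≈ pair (Feed (suc n) A · k) (Feed (rt n A) B · 𝐈)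
  feed-⊗ {k} {n} {A} {B} c = β* ((0 , Feed (suc n) A) ∷ (1 , Feed (rt n A) B) ∷ (2 , k) ∷ []) (pair (var 0 · var 2) (var 1 · 𝐈))
    (from-yes (unique? (0 ∷ 1 ∷ 2 ∷ []))) (Cl-Feed _ A ∷ Cl-Feed _ B ∷ c ∷ []) (linear Cl-𝐅⊗)

  feed-⊸ : Cl k → Cl e → Feed n (A ⊸ B) · k · e ≈ Feed (rt n A) B · (k ⨾ (Probe (suc n) A · e))
  feed-⊸ {k} {e} {n} {A} {B} c d = β* ((0 , Feed (rt n A) B) ∷ (1 , Probe (suc n) A) ∷ (2 , k) ∷ (3 , e) ∷ [])
    (var 0 · (var 2 ⨾ (var 1 · var 3))) (from-yes (unique? (0 ∷ 1 ∷ 2 ∷ 3 ∷ []))) (Cl-Feed _ B ∷ Cl-Probe _ A ∷ c ∷ d ∷ []) (linear Cl-𝐅⊸)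

  probe-tv : Cl k → Cl l → t ≈ pair k l → Probe n (tv a) · t ≈ (inspect (n ≡ᵇ α) · k) ⨾ l
  probe-tv {k} {l} {t} {n} ck cl′ r = ≈-trans
    (β* ρ (letp 2 3 (var 1) ((var 0 · var 2) ⨾ var 3)) (from-yes (unique? (0 ∷ 1 ∷ []))) cρ (linear Cl-𝐏₀))
    (βp-env (var 1) ((var 0 · var 2) ⨾ var 3) (from-yes (Lin? (letp 2 3 (var 1) ((var 0 · var 2) ⨾ var 3))))
      (Env-ClS cρ (1 ∷ 0 ∷ []) (from-yes (All.all? (_∈? (0 ∷ 1 ∷ [])) (1 ∷ 0 ∷ [])))) r ck cl′)
    where
      ρ = (0 , inspect (n ≡ᵇ α)) ∷ (1 , t) ∷ []
      cρ : ClS ρ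
      cρ = Cl-inspect (n ≡ᵇ α) ∷ Cl-≈ (≈-sym r) (Cl-pair ck cl′) ∷ []

  probe-⊗ : Cl u → Cl v → t ≈ pair u v → Probe n (A ⊗ B) · t ≈ (Probe (suc n) A · u) ⨾ (Probe (rt n A) B · v)
  probe-⊗ {u} {v} {t} {n} {A} {B} cu cv r = ≈-trans
    (β* ρ (letp 3 4 (var 2) ((var 0 · var 3) ⨾ (var 1 · var 4))) (from-yes (unique? (0 ∷ 1 ∷ 2 ∷ []))) cρ (linear Cl-𝐏⊗))
    (βp-env (var 2) ((var 0 · var 3) ⨾ (var 1 · var 4)) (from-yes (Lin? (letp 3 4 (var 2) ((var 0 · var 3) ⨾ (var 1 · var 4)))))
      (Env-ClS cρ (2 ∷ 0 ∷ 1 ∷ []) (from-yes (All.all? (_∈? (0 ∷ 1 ∷ 2 ∷ [])) (2 ∷ 0 ∷ 1 ∷ [])))) r cu cv)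
    where
      ρ = (0 , Probe (suc n) A) ∷ (1 , Probe (rt n A) B) ∷ (2 , t) ∷ []
      cρ : ClS ρ
      cρ = Cl-Probe _ A ∷ Cl-Probe _ B ∷ Cl-≈ (≈-sym r) (Cl-pair cu cv) ∷ []

  probe-⊸ : Cl t → Probe n (A ⊸ B) · t ≈ Probe (rt n A) B · (t · (Feed (suc n) A · 𝐈))
  probe-⊸ {t} {n} {A} {B} c = β* ((0 , Probe (rt n A) B) ∷ (1 , Feed (suc n) A) ∷ (2 , t) ∷ []) (var 0 · (var 2 · (var 1 · 𝐈)))
    (from-yes (unique? (0 ∷ 1 ∷ 2 ∷ []))) (Cl-Probe _ B ∷ Cl-Feed _ A ∷ c ∷ []) (linear Cl-𝐏⊸)

-- A logical relation; related terms at an atom carry the same bits.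
R : Ty → Tm → Tm → Set
R (tv a) t s  = Cl t × Cl s × ∃[ b ] ∃[ c ] ∃[ k ] ∃[ l ] ∃[ k' ] ∃[ l' ]
  (t ≈ pair k l × s ≈ pair k' l' × Code b k × Code b k' × Code c l × Code c l')
R (A ⊗ B) t s = Cl t × Cl s × ∃[ u ] ∃[ v ] ∃[ u' ] ∃[ v' ] (t ≈ pair u v × s ≈ pair u' v' × R A u u' × R B v v')
R (A ⊸ B) t s = Cl t × Cl s × (∀ e e' → R A e e' → R B (t · e) (s · e'))

R-Cl : ∀ A → R A t s → Cl t × Cl s
R-Cl (tv a) (p , q , _) = p , q
R-Cl (A ⊗ B) (p , q , _) = p , q
R-Cl (A ⊸ B) (p , q , _) = p , q

R-≈ : ∀ A → t ≈ t' → s ≈ s' → R A t s → R A t' s'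
R-≈ (tv a) p q (c , d , b , b' , k , l , k' , l' , e , f , r) =
  Cl-≈ p c , Cl-≈ q d , b , b' , k , l , k' , l' , ≈-trans (≈-sym p) e , ≈-trans (≈-sym q) f , r
R-≈ (A ⊗ B) p q (c , d , u , v , u' , v' , e , f , r) =
  Cl-≈ p c , Cl-≈ q d , u , v , u' , v' , ≈-trans (≈-sym p) e , ≈-trans (≈-sym q) f , r
R-≈ (A ⊸ B) p q (c , d , f) = Cl-≈ p c , Cl-≈ q d , λ e e' r → R-≈ B (≈-app p ≈-refl) (≈-app q ≈-refl) (f e e' r)

and₁ : ∀ b c → b ∧ c ≡ true → b ≡ true
and₁ true c p = refl

and₂ : ∀ b c → b ∧ c ≡ true → c ≡ true
and₂ true c p = p

xor-one : ∀ b c → (b ≡ true → c ≡ true → ⊥) → b ≡ true ⊎ c ≡ true → b xor c ≡ true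
xor-one true true d _ = ⊥-elim (d refl refl)
xor-one true false d _ = refl
xor-one false true d _ = refl
xor-one false false d (inj₁ ())
xor-one false false d (inj₂ ())

module TestR (α β : ℕ) where
  open Test α β public

  SameCode : Tm → Tm → Set
  SameCode k k' = ∃[ b ] (Code b k × Code b k')

  SameCode-≈ : k ≈ l → k' ≈ l' → SameCode k k' → SameCode l l'
  SameCode-≈ p q (b , K , K') = b , Code-≈ p K , Code-≈ q K'

  SameCode-⨾ : SameCode k k' → SameCode l l' → SameCode (k ⨾ l) (k' ⨾ l')
  SameCode-⨾ (b , K , K') (c , L , L') = b xor c , Code-⨾ K L , Code-⨾ K' L'

  -- Probing and feeding go hand in hand because the two sides of an arrow exchange roles. This
  -- carries the outcome of a test from a cut-free proof to the term it came from, across the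
  -- η-expansions that `≈` does not contain.
  probe-R : ∀ A n → R A t s → SameCode (Probe n A · t) (Probe n A · s)
  feed-R  : ∀ A n → SameCode k k' → R A (Feed n A · k) (Feed n A · k')
  probe-R (tv a) n (c , d , b , b' , k , l , k' , l' , p , q , K , K' , L , L') =
    ((n ≡ᵇ α) ∧ b) xor b' ,
    Code-≈ (≈-sym (probe-tv {n = n} {a} (code-cl K) (code-cl L) p)) (Code-⨾ (Code-inspect (n ≡ᵇ α) K) L) ,
    Code-≈ (≈-sym (probe-tv {n = n} {a} (code-cl K') (code-cl L') q)) (Code-⨾ (Code-inspect (n ≡ᵇ α) K') L')
  probe-R (A ⊗ B) n (c , d , u , v , u' , v' , p , q , r , r') =
    SameCode-≈ (≈-sym (probe-⊗ (proj₁ (R-Cl A r)) (proj₁ (R-Cl B r')) p)) (≈-sym (probe-⊗ (proj₂ (R-Cl A r)) (proj₂ (R-Cl B r')) q))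
      (SameCode-⨾ (probe-R A (suc n) r) (probe-R B (rt n A) r'))
  probe-R (A ⊸ B) n (c , d , f) =
    SameCode-≈ (≈-sym (probe-⊸ c)) (≈-sym (probe-⊸ d)) (probe-R B (rt n A) (f _ _ (feed-R A (suc n) (false , Code-𝐈 , Code-𝐈))))
  feed-R (tv a) n (b , K , K') = Cl-app (Cl-Feed n (tv a)) (code-cl K) , Cl-app (Cl-Feed n (tv a)) (code-cl K') ,
    (n ≡ᵇ β) , b , _ , _ , _ , _ , feed-tv {n = n} {a} (code-cl K) , feed-tv {n = n} {a} (code-cl K') , Code-bit (n ≡ᵇ β) , Code-bit (n ≡ᵇ β) , K , K'
  feed-R (A ⊗ B) n S@(b , K , K') = Cl-app (Cl-Feed n (A ⊗ B)) (code-cl K) , Cl-app (Cl-Feed n (A ⊗ B)) (code-cl K') ,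
    _ , _ , _ , _ , feed-⊗ (code-cl K) , feed-⊗ (code-cl K') , feed-R A (suc n) S , feed-R B (rt n A) (false , Code-𝐈 , Code-𝐈)
  feed-R (A ⊸ B) n S@(b , K , K') = Cl-app (Cl-Feed n (A ⊸ B)) (code-cl K) , Cl-app (Cl-Feed n (A ⊸ B)) (code-cl K') ,
    λ e e' r → R-≈ B (≈-sym (feed-⊸ (code-cl K) (proj₁ (R-Cl A r)))) (≈-sym (feed-⊸ (code-cl K') (proj₂ (R-Cl A r))))
      (feed-R B (rt n A) (SameCode-⨾ S (probe-R A (suc n) r)))

  -- The number of links from α to β modulo 2, the form in which composed bits can report it.
  par : Nf G n C t → Bool
  par (nvar {x = x} {n = n} _) = (n ≡ᵇ α) ∧ (x ≡ᵇ β)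
  par (nlam _ D)       = par D
  par (npair D E)      = par D xor par E
  par (nlet _ _ _ D)   = par D
  par (napp _ _ D E)   = par D xor par E

  sum : (ℕ → Bool) → List ℕ → Bool
  sum κ []       = false
  sum κ (x ∷ xs) = κ x xor sum κ xs

  sum-++ : ∀ κ xs ys → sum κ (xs ++ ys) ≡ sum κ xs xor sum κ ys
  sum-++ κ [] ys = refl
  sum-++ κ (x ∷ xs) ys = trans (cong (κ x xor_) (sum-++ κ xs ys)) (sym (Bool.xor-assoc (κ x) (sum κ xs) (sum κ ys)))

  sum-↭ : ∀ κ → xs ↭ ys → sum κ xs ≡ sum κ ys
  sum-↭ κ ↭.refl = refl
  sum-↭ κ (prep x p) = cong (κ x xor_) (sum-↭ κ p)
  sum-↭ κ (swap {xs} x y p) = trans (sym (Bool.xor-assoc (κ x) (κ y) (sum κ xs)))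
    (trans (cong₂ _xor_ (Bool.xor-comm (κ x) (κ y)) (sum-↭ κ p)) (Bool.xor-assoc (κ y) (κ x) _))
  sum-↭ κ (↭.trans p q) = trans (sum-↭ κ p) (sum-↭ κ q)

  sum-cong : ∀ {κ κ'} → (∀ {z} → z ∈ xs → κ z ≡ κ' z) → sum κ xs ≡ sum κ' xs
  sum-cong {[]} e = refl
  sum-cong {x ∷ xs} e = cong₂ _xor_ (e (here refl)) (sum-cong (e ∘ there))

  set : (ℕ → Bool) → ℕ → Bool → ℕ → Bool
  set κ x b z with z ≟ x
  ... | yes _ = b
  ... | no _  = κ z

  set-same : ∀ κ x b → set κ x b x ≡ b
  set-same κ x b with x ≟ x
  ... | yes _ = refl
  ... | no ne = ⊥-elim (ne refl)

  set-other : ∀ κ x b → z ≢ x → set κ x b z ≡ κ z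
  set-other {z} κ x b ne with z ≟ x
  ... | yes e = ⊥-elim (ne e)
  ... | no _ = refl

  sum-set : ∀ κ b t → Lin t → x ∈ FV t → sum (set κ x b) (FV t) ≡ b xor sum κ (FV t ─ x)
  sum-set {x} κ b t l m = trans (sum-↭ (set κ x b) (unique-remove (Lin⇒Unique t l) m))
    (cong₂ _xor_ (set-same κ x b) (sum-cong λ i → set-other κ x b (proj₂ (∈─⁻ {xs = FV t} i))))

  Fed : (ℕ → Ty) → (ℕ → Bool) → Subst → List ℕ → Set
  Fed G κ σ xs = ∀ {z} → z ∈ xs → ∃[ k ] (Code (κ z) k × look σ z ≈ Feed z (G z) · k)

  Fed-∷ : ∀ {κ} xs → Fed G κ σ (xs ─ x) → Code b k → e ≈ Feed x (G x) · k → Fed G (set κ x b) ((x , e) ∷ σ) xs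
  Fed-∷ {x = x} xs f K r {z} m with z ≟ x
  ... | yes refl = _ , K , r
  ... | no ne = f (∈─⁺ m ne)

  Fed-Env : ∀ {κ} → (∀ {z} → z ∈ FVS σ → ⊥) → Fed G κ σ xs → Env σ xs
  Fed-Env {G = G} c f = env c λ {z} m → case f m of λ (k , K , r) → Cl-≈ (≈-sym r) (Cl-app (Cl-Feed z (G z)) (code-cl K))

  Code-≡ : b ≡ c → Code b k → Code c k
  Code-≡ refl K = K

  fvs-∷ : ∀ σ x → Cl e → (∀ {z} → z ∈ FVS σ → ⊥) → ∀ {z} → z ∈ FVS ((x , e) ∷ σ) → ⊥
  fvs-∷ {e} σ x ce c m = case ∈++ (FV e) m of λ { (inj₁ i) → no-fv ce i ; (inj₂ i) → c i }

  -- Probing a cut-free proof counts its links from α to β modulo 2, plus the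
  -- bits fed to its variables.
  probe-Nf : (D : Nf G n C t) → Lin t → ∀ κ σ → (∀ {z} → z ∈ FVS σ → ⊥) → Fed G κ σ (FV t) →
             Code (par D xor sum κ (FV t)) (Probe n C · subst σ t)
  probe-Nf {G} (nvar {x = x} {a = a} {n = n} e) l κ σ c f = case f (here refl) of λ (k , K , r) →
    let r′ : look σ x ≈ pair (bit (x ≡ᵇ β)) k
        r′ = ≈-trans r (≈-trans (≈-≡ (cong (λ A → Feed x A · k) e)) (feed-tv {n = x} {a} (code-cl K)))
    in Code-≡ (cong (((n ≡ᵇ α) ∧ (x ≡ᵇ β)) xor_) (sym (Bool.xor-identityʳ (κ x))))
         (Code-≈ (≈-sym (probe-tv {n = n} {a} (code-cl (Code-bit (x ≡ᵇ β))) (code-cl K) r′))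
                 (Code-⨾ (Code-inspect (n ≡ᵇ α) (Code-bit (x ≡ᵇ β))) K))
  probe-Nf {G} (nlam {n = n} {A = A} {B = B} {t = b} e D) l@(lb , mb) κ σ c f =
    Code-≡ (cong (par D xor_) (sum-set κ false b lb mb))
      (Code-≈ (≈-sym (≈-trans (probe-⊸ (Cl-subst (lam (suc n) b) l E)) (≈-app ≈-refl (β-env b l E ce))))
        (probe-Nf D lb (set κ (suc n) false) ((suc n , F𝐈) ∷ σ) (fvs-∷ σ (suc n) ce c)
          (Fed-∷ (FV b) f Code-𝐈 (≈-≡ (cong (λ A → Feed (suc n) A · 𝐈) (sym e))))))
    where
      E = Fed-Env {G = G} {κ = κ} c f
      F𝐈 = Feed (suc n) A · 𝐈
      ce : Cl F𝐈
      ce = Cl-app (Cl-Feed (suc n) A) Cl-𝐈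
  probe-Nf {G} (npair {s = s} {t = t} D E) l@(ls , lt , d) κ σ c f =
    Code-≡ (trans (xor-swap (par D) (sum κ (FV s)) (par E) (sum κ (FV t))) (cong ((par D xor par E) xor_) (sym (sum-++ κ (FV s) (FV t)))))
      (Code-≈ (≈-sym (probe-⊗ (Cl-subst s ls (Env-⊑ inl En)) (Cl-subst t lt (Env-⊑ (inr (FV s)) En)) ≈-refl))
        (Code-⨾ (probe-Nf D ls κ σ c (f ∘ inl)) (probe-Nf E lt κ σ c (f ∘ inr (FV s)))))
    where
      En = Fed-Env {G = G} {κ = κ} c f
      xor-swap : ∀ a b c d → (a xor b) xor (c xor d) ≡ (a xor c) xor (b xor d)
      xor-swap a b c d = solve 4 (λ a b c d → (a ⊕ b) ⊕ (c ⊕ d) ⊜ (a ⊕ c) ⊕ (b ⊕ d)) refl a b c d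
  probe-Nf {G} {C = C} (nlet {x = x} {A = A} {B = B} {t = b} e₀ e₁ e₂ D) l@(_ , lb , m₁ , m₂ , ne , _) κ σ c f = case f (here refl) of λ (k , K , r) →
    let r′ : look σ x ≈ pair (Feed (suc x) A · k) (Feed (rt x A) B · 𝐈)
        r′ = ≈-trans r (≈-trans (≈-≡ (cong (λ A → Feed x A · k) e₀)) (feed-⊗ (code-cl K)))
        c₁ = Cl-app (Cl-Feed (suc x) A) (code-cl K)
        c₂ = Cl-app (Cl-Feed (rt x A) B) Cl-𝐈
        -- As in `𝐅⊗`, the surplus of `x` goes to the left component and the right one starts from
        -- zero.
        κ' = set (set κ (rt x A) false) (suc x) (κ x)
    in Code-≡ (cong (par D xor_) (trans (sum-set (set κ (rt x A) false) (κ x) b lb m₁)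
                 (cong (κ x xor_) (sum-set κ false (lam (suc x) b) (lb , m₁) (∈─⁺ m₂ (ne ∘ sym))))))
        (Code-≈ (≈-app ≈-refl (≈-sym (βp-env (var x) b l (Fed-Env {G = G} {κ = κ} c f) r′ c₁ c₂)))
          (probe-Nf D lb κ' ((suc x , Feed (suc x) A · k) ∷ (rt x A , Feed (rt x A) B · 𝐈) ∷ σ) (fvs-∷ ((rt x A , Feed (rt x A) B · 𝐈) ∷ σ) (suc x) c₁ (fvs-∷ σ (rt x A) c₂ c))
            (Fed-∷ (FV b) (Fed-∷ (FV b ─ suc x) (f ∘ there) Code-𝐈 (≈-≡ (cong (λ A → Feed _ A · 𝐈) (sym e₂)))) K (≈-≡ (cong (λ A → Feed _ A · k) (sym e₁))))))
  probe-Nf {G} {C = C} (napp {x = x} {A = A} {B = B} {v = v} {u = u} e₀ e₂ D E) l@((lu , my) , (_ , lv , _) , _) κ σ c f = case f (inr (FV u ─ Y') (here refl)) of λ (k , K , r) →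
    let En = Fed-Env {G = G} {κ = κ} c f
        fv = λ {z} (i : z ∈ FV v) → f (inr (FV u ─ Y') (there i))
        cv = Cl-subst v lv (Env-⊑ (λ i → inr (FV u ─ Y') (there i)) En)
        cx = env-cl En (inr (FV u ─ Y') (here refl))
        -- The result of `x` carries the surplus of `x` plus the probe of the argument. This is how
        -- the links inside the argument enter the count.
        L = Code-⨾ K (probe-Nf D lv κ σ c fv)
        r′ : look σ x · subst σ v ≈ Feed Y' B · (k ⨾ (Probe (suc x) A · subst σ v))
        r′ = ≈-trans (≈-app (≈-trans r (≈-≡ (cong (λ A → Feed x A · k) e₀))) ≈-refl) (feed-⊸ (code-cl K) cv)
        κ' = set κ Y' (κ x xor (par D xor sum κ (FV v)))
    in Code-≡ (trans (cong (par E xor_) (sum-set κ _ u lu my)) (arith (par D) (par E) (κ x) (sum κ (FV v)) (sum κ (FV u ─ Y')) (sum-++ κ (FV u ─ Y') (x ∷ FV v))))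
        (Code-≈ (≈-app ≈-refl (≈-sym (β-env u (lu , my) (Env-⊑ inl En) (Cl-app cx cv))))
          (probe-Nf E lu κ' ((Y' , look σ x · subst σ v) ∷ σ) (fvs-∷ σ Y' (Cl-app cx cv) c)
            (Fed-∷ (FV u) (f ∘ inl) L (≈-trans r′ (≈-≡ (cong (λ A → Feed Y' A · _) (sym e₂)))))))
    where
      Y' = rt x A
      arith : ∀ d e k s r {w} → w ≡ r xor (k xor s) → e xor ((k xor (d xor s)) xor r) ≡ (d xor e) xor w
      arith d e k s r refl = solve 5 (λ d e k s r → e ⊕ ((k ⊕ (d ⊕ s)) ⊕ r) ⊜ (d ⊕ e) ⊕ (r ⊕ (k ⊕ s))) refl d e k s r

  par⇒Link : (D : Nf G n C t) → par D ≡ true → Link D α β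
  par⇒Link (nvar {x = x} {n = n} e) p with n ≟ α | x ≟ β
  ... | yes refl | yes refl = refl , refl
  ... | no ne | _ = ⊥-elim (ne (ℕ.≡ᵇ⇒≡ n α (≡subst T (sym (and₁ _ _ p)) tt)))
  ... | yes _ | no ne = ⊥-elim (ne (ℕ.≡ᵇ⇒≡ x β (≡subst T (sym (and₂ (n ≡ᵇ α) _ p)) tt)))
  par⇒Link (nlam e D) p = par⇒Link D p
  par⇒Link (npair D E) p with par D in d | par E in e
  ... | true | _ = inj₁ (par⇒Link D d)
  ... | false | true = inj₂ (par⇒Link E e)
  ... | false | false = case p of λ ()
  par⇒Link (nlet _ _ _ D) p = par⇒Link D p
  par⇒Link (napp _ _ D E) p with par D in d | par E in e
  ... | true | _ = inj₁ (par⇒Link D d)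
  ... | false | true = inj₂ (par⇒Link E e)
  ... | false | false = case p of λ ()

  -- The premises of a binary rule own disjoint regions, so the link is found in exactly one of them
  -- and two occurrences cannot cancel.
  Link⇒par : (D : Nf G n C t) → Lin t → Sep G n C (FV t) → Link D α β → par D ≡ true
  Link⇒par (nvar {x = x} {n = n} e) l S (refl , refl) = cong₂ _∧_ (≡ᵇ-refl n) (≡ᵇ-refl x)
    where
      ≡ᵇ-refl : ∀ n → (n ≡ᵇ n) ≡ true
      ≡ᵇ-refl zero = refl
      ≡ᵇ-refl (suc n) = ≡ᵇ-refl n
  Link⇒par (nlam e D) (l , _) S k = Link⇒par D l (Sep-lam S e) k
  Link⇒par (npair {A = A} {s = s} {B = B} {t = t} D E) l@(ls , lt , _) S k = xor-one (par D) (par E)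
    (λ p q → pair-cross {s} {t} l S (proj₁ (link-loc D ls (par⇒Link D p))) (proj₁ (link-loc E lt (par⇒Link E q))))
    (case k of λ { (inj₁ o) → inj₁ (Link⇒par D ls (Sep-⊑ (in-l A B) inl S) o) ; (inj₂ o) → inj₂ (Link⇒par E lt (Sep-⊑ (in-r A B) (inr (FV s)) S) o) })
  Link⇒par (nlet {x = x} {A = X} {t = b} e₀ e₁ e₂ D) l S k = Link⇒par D (proj₁ (proj₂ l)) (Sep-let {x = x} {X} {b} l e₀ e₁ e₂ S) k
  Link⇒par {G} (napp {x = x} {A = A} {v = v} {u = u} e₀ e₂ D E) l@((lu , _) , (_ , lv , _) , _) S k = xor-one (par D) (par E)
    (λ p q → app-cross {x} {A} {u} {v} {G} l e₀ e₂ S (proj₁ (link-loc D lv (par⇒Link D p))) (proj₁ (link-loc E lu (par⇒Link E q))))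
    (case k of λ { (inj₁ o) → inj₁ (Link⇒par D lv (Sep-app₁ {x = x} {A} {u} {v} l e₀ S) o)
                 ; (inj₂ o) → inj₂ (Link⇒par E lu (Sep-app₂ {x = x} {A} {u} {v} l e₀ e₂ S) o) })

-- Normalisation

At : (ℕ → Ty) → ℕ → Ty → Set
At G n (tv a)  = G n ≡ tv a
At G n (A ⊗ B) = G n ≡ A ⊗ B × At G (suc n) A × At G (rt n A) B
At G n (A ⊸ B) = G n ≡ A ⊸ B × At G (suc n) A × At G (rt n A) B

at-root : ∀ A → At G n A → G n ≡ A
at-root (tv a) e = e
at-root (A ⊗ B) (e , _) = e
at-root (A ⊸ B) (e , _) = e

At-ext : ∀ A → (∀ {z} → In z n A → G z ≡ g z) → At G n A → At g n A
At-ext {n} (tv a) e p = trans (sym (e (in-root n (tv a)))) p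
At-ext {n} (A ⊗ B) e (p , q , r) =
  trans (sym (e (in-root n (A ⊗ B)))) p , At-ext A (λ i → e (in-l A B i)) q , At-ext B (λ i → e (in-r A B i)) r
At-ext {n} (A ⊸ B) e (p , q , r) =
  trans (sym (e (in-root n (A ⊸ B)))) p , At-ext A (λ i → e (in-l A B i)) q , At-ext B (λ i → e (in-r A B i)) r

lay : ℕ → Ty → (ℕ → Ty) → ℕ → Ty
lay n (tv a) G  = upd G n (tv a)
lay n (A ⊗ B) G = lay (suc n) A (lay (rt n A) B (upd G n (A ⊗ B)))
lay n (A ⊸ B) G = lay (suc n) A (lay (rt n A) B (upd G n (A ⊸ B)))

lay-other : ∀ n A G → (In z n A → ⊥) → lay n A G z ≡ G z
lay-other n (tv a) G o = upd-other G n (tv a) (λ { refl → o (in-root n (tv a)) })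
lay-other n (A ⊗ B) G o = trans (lay-other (suc n) A _ (o ∘ in-l A B)) (trans (lay-other (rt n A) B _ (o ∘ in-r A B))
  (upd-other G n (A ⊗ B) (λ { refl → o (in-root n (A ⊗ B)) })))
lay-other n (A ⊸ B) G o = trans (lay-other (suc n) A _ (o ∘ in-l A B)) (trans (lay-other (rt n A) B _ (o ∘ in-r A B))
  (upd-other G n (A ⊸ B) (λ { refl → o (in-root n (A ⊸ B)) })))

lay-At : ∀ n A G → At (lay n A G) n A
lay-At n (tv a) G = upd-same G n (tv a)
lay-At n (A ⊗ B) G =
  trans (lay-other (suc n) A _ (root∉l A)) (trans (lay-other (rt n A) B _ (root∉r A B)) (upd-same G n (A ⊗ B))) ,
  lay-At (suc n) A _ , At-ext B (λ i → sym (lay-other (suc n) A _ (λ j → in-lr {n = n} A B j i))) (lay-At (rt n A) B _)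
lay-At n (A ⊸ B) G =
  trans (lay-other (suc n) A _ (root∉l A)) (trans (lay-other (rt n A) B _ (root∉r A B)) (upd-same G n (A ⊸ B))) ,
  lay-At (suc n) A _ , At-ext B (λ i → sym (lay-other (suc n) A _ (λ j → in-lr {n = n} A B j i))) (lay-At (rt n A) B _)

upd-self : G x ≡ A → upd G x A ≗ G
upd-self {G} {x} {A} e z with z ≟ x
... | yes refl = sym e
... | no _ = refl

Nf-⊩ : Nf G n C t → G ⊩ t ∶ C
Nf-⊩ (nvar e) = ⊩var e
Nf-⊩ (nlam e D) = ⊩lam (⊩-≗ (λ z → sym (upd-self e z)) (Nf-⊩ D))
Nf-⊩ (npair D E) = ⊩pair (Nf-⊩ D) (Nf-⊩ E)
Nf-⊩ {G} (nlet {x = x} e₀ e₁ e₂ D) = ⊩let (⊩var e₀) (⊩-≗ (λ z → sym (trans (upd-≗ (suc x) _ (upd-self e₂) z) (upd-self e₁ z))) (Nf-⊩ D))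
Nf-⊩ (napp e₀ e₂ D E) = ⊩app (⊩lam (⊩-≗ (λ z → sym (upd-self e₂ z)) (Nf-⊩ E))) (⊩app (⊩var e₀) (Nf-⊩ D))

-- A proof consults `G` in its own region only.
Nf-ext : Nf G n C t → (∀ {z} → Reg G n C (FV t) z → G z ≡ g z) → Lin t → Nf g n C t
Nf-ext {G} (nvar {x = x} e) f l = nvar (trans (sym (f (in-ctx (here refl) (in-root x (G x))))) e)
Nf-ext {G} (nlam {n = n} {A} {B} e D) f (l , _) =
  nlam (trans (sym (f (in-goal (in-l A B (in-root (suc n) A))))) e) (Nf-ext D (f ∘ Reg-lam {G} e) l)
Nf-ext (npair {A = A} {s = s} {B = B} D E) f (l , l' , _) =
  npair (Nf-ext D (f ∘ Reg-⊑ (λ i → in-goal (in-l A B i)) inl) l) (Nf-ext E (f ∘ Reg-⊑ (λ i → in-goal (in-r A B i)) (inr (FV s))) l')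
Nf-ext {G} (nlet {x = x} {A = A} {B} {t = b} e₀ e₁ e₂ D) f l = nlet (trans (sym (f (in-ctx (here refl) (in-root x (G x))))) e₀)
  (trans (sym (f (in-ctx (here refl) (in-l″ {G} e₀ (in-root (suc x) A))))) e₁)
  (trans (sym (f (in-ctx (here refl) (in-r″ {G} e₀ (in-root (rt x A) B))))) e₂)
  (Nf-ext D (f ∘ Reg-let {x} {A} {b} {G} l e₀ e₁ e₂) (proj₁ (proj₂ l)))
Nf-ext {G} (napp {x = x} {A = A} {B} {v = v} {u = u} e₀ e₂ D E) f l = napp (trans (sym (f (in-ctx x∈ (in-root x (G x))))) e₀)
  (trans (sym (f (in-ctx x∈ (in-r′ {G} e₀ (in-root (rt x A) B))))) e₂)
  (Nf-ext D (f ∘ Reg-app₁ {G} {x} {v = v} {u = u} e₀) (proj₁ (proj₂ (proj₁ (proj₂ l)))))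
  (Nf-ext E (f ∘ Reg-app₂ {x} {A} {u} {v} {G} l e₀ e₂) (proj₁ (proj₁ l)))
  where x∈ = inr (FV u ─ rt x A) (here refl)

-- Each entry is simulated by a β step, so congruence of application does the work. An entry for a
-- variable that does not occur is skipped, as abstracting it would break linearity.
subst-≈ : ∀ σ → t ≈ s → Lin t → Env σ (FV t) → subst σ t ≈ subst σ s
subst-≈ {t} {s} [] p l E = ≈-trans (≈-≡ (subst-id [] t λ _ → refl)) (≈-trans p (≈-≡ (sym (subst-id [] s λ _ → refl))))
subst-≈ {t} {s} ((x , e) ∷ σ) p l E =
  ≈-trans (≈-≡ (sym (comp t))) (≈-trans (subst-≈ σ r (proj₂ (split-x (x ∈? FV t))) E′) (≈-≡ (comp s)))
  where
    fe : ∀ {z} → z ∈ FV e → ⊥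
    fe m = env-fvs E (inl m)
    nc : ∀ t → NC ((x , e) ∷ []) t
    nc t m _ = case ∈++ (FV e) m of λ { (inj₁ i) → fe i }
    comp : ∀ t → subst σ (subst ((x , e) ∷ []) t) ≡ subst ((x , e) ∷ σ) t
    comp t = subst-comp ((x , e) ∷ []) σ ((x , e) ∷ σ) t (nc t) λ {z} _ → go (z ≟ x)
      where
        go : ∀ {z} → Dec (z ≡ x) → subst σ (look ((x , e) ∷ []) z) ≡ look ((x , e) ∷ σ) z
        go (yes refl) = trans (cong (subst σ) (look-here x e [])) (trans (subst-id σ e (λ m → ⊥-elim (fe m))) (sym (look-here x e σ)))
        go (no ne) = trans (cong (subst σ) (look-there e [] ne)) (sym (look-there e σ ne))
    split-x : Dec (x ∈ FV t) → subst ((x , e) ∷ []) t ≈ subst ((x , e) ∷ []) s × Lin (subst ((x , e) ∷ []) t)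
    split-x (yes m) = ≈-trans (≈-sym (β-cl (l , m) ce)) (≈-trans (≈-app (≈-lam p) ≈-refl) (β-cl (proj₁ (≈-Lin (≈-lam p)) (l , m)) ce)) ,
                      Lin-subst₁ x e t (nc t) l (linear ce) (λ _ i → fe i)
      where ce : Cl e
            ce = ≡subst Cl (look-here x e σ) (env-cl E m)
    split-x (no n) = ≈-trans (≈-≡ (subst-fresh n)) (≈-trans p (≈-≡ (sym (subst-fresh (n ∘ proj₂ (≈-FV p)))))) , ≡subst Lin (sym (subst-fresh n)) l
    r = proj₁ (split-x (x ∈? FV t))
    E′ : Env σ (FV (subst ((x , e) ∷ []) t))
    E′ = env (λ m → env-fvs E (inr (FV e) m)) λ {z} m → f (FV-subst₁⁻ x e t (nc t) m)
      where
        f : ∀ {z} → z ∈ FV (lam x t) ++ FV e → Cl (look σ z)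
        f m with ∈++ (FV t ─ x) m
        ... | inj₂ i = ⊥-elim (fe i)
        ... | inj₁ i = case ∈─⁻ {xs = FV t} i of λ (i , ne) → ≡subst Cl (look-there e σ ne) (env-cl E i)

-- Elimination rules become cuts: an application is the function cut against a left rule on a fresh
-- `q`.
cut-app : Lin (app (lam q (app (lam y u) (app (var q) v))) t) → app (lam y u) (app t v) ≈ app (lam q (app (lam y u) (app (var q) v))) t
cut-app {q} {y} {u} {v} {t} l@(((_ , (_ , _ , qv) , d) , _) , lt , _) =
  let (l₁ , r₁) = commute (appRF (lam y u)) (app (var q) v) (λ m → d m (here refl)) (here refl) (λ _ ()) l
      (_ , r₂) = commute (appLF v) (var q) (qv (here refl)) (here refl) (λ _ ()) l₁
  in r₁ (r₂ (≈-sym (β-id lt)))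

cut-let : q ≢ x → q ≢ y → x ∉ FV t → y ∉ FV t → Lin (app (lam q (letp x y (var q) u)) t) → letp x y t u ≈ app (lam q (letp x y (var q) u)) t
cut-let {q} {x} {y} {t} {u} qx qy xt yt l@(((_ , lu , _ , _ , _ , d) , _) , _) = case refresh (FV t) u lu of λ (u' , p , du) →
  let p′ = ≈-app (≈-lam (≈-let (≈-refl {var q}) p)) (≈-refl {t})
      q∉ : q ∉ FV u'
      q∉ m = d (here refl) (∈─⁺ (∈─⁺ (proj₂ (≈-FV p) m) qx) qy)
      nc : NC ((q , t) ∷ []) (letp x y (var q) u')
      nc = NC₁ {letp x y (var q) u'} {t} {q} λ { (here refl) j → xt j ; (there (here refl)) j → yt j ; (there (there i)) j → du i j }
      body : subst (drop₂ x y ((q , t) ∷ [])) u' ≡ u'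
      body = trans (cong (λ ρ → subst ρ u') (trans (cong (dropS y) (drop-single x (qx ∘ sym))) (drop-single y (qy ∘ sym)))) (subst-fresh q∉)
  in ≈-sym (≈-trans p′ (≈-trans (step (β-lam nc) (proj₁ (≈-Lin p′) l))
       (≈-let (≈-≡ (look-here q t [])) (≈-trans (≈-≡ body) (≈-sym p)))))

-- Axioms expanded to atoms

Env-look : ∀ {e} xs → Env σ xs → Cl e → Env ((x , e) ∷ σ) (x ∷ xs)
Env-look {σ} {x} {e} xs E c = Env-∷ (x ∷ xs) (Env-⊑ f E) c
  where
    f : ((x ∷ xs) ─ x) ⊑ xs
    f m with ∈─⁻ {xs = x ∷ xs} m
    ... | here o , n = ⊥-elim (n o)
    ... | there i , _ = i

-- The η-expansion of the variable `x`. It is equal to `x` only in the typed sense, recorded by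
-- `eq`; `rel` says in addition that evaluation cannot distinguish the two.
record Identity (G : ℕ → Ty) (A : Ty) (x n : ℕ) : Set where
  field
    {tm}  : Tm
    nf    : Nf G n A tm
    fvs   : FV tm ≋ (x ∷ [])
    lin   : Lin tm
    eq    : G ⊩ var x ≐ tm ∶ A
    rel   : ∀ σ {e} → Env σ (x ∷ []) → R A e (look σ x) → R A e (subst σ tm)

identity-⊗ : ∀ {G A B x n} → At G x (A ⊗ B) → Identity G A (suc x) (suc n) → Identity G B (rt x A) (rt n A) → Identity G (A ⊗ B) x n
identity-⊗ {G} {A} {B} {x} {n} (p , p₁ , p₂) I J = record
  { nf = nlet p (at-root A p₁) (at-root B p₂) (npair I₁.nf I₂.nf)
  ; fvs = (λ { (here o) → here o ; (there i) → ⊥-elim (none (proj₁ (∈─⁻ {xs = pairs} (proj₁ (∈─⁻ {xs = pairs ─ x₁} i)))) (proj₂ (∈─⁻ {xs = pairs} (proj₁ (∈─⁻ {xs = pairs ─ x₁} i)))) (proj₂ (∈─⁻ {xs = pairs ─ x₁} i))) }) ,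
          (λ { (here o) → here o })
  ; lin = lt
  ; eq = ≐-trans tt l₀ f₀ (≐-sym l₀ tt (≋-sym f₀) (≐-axiom η-let l₀ tt (≋-sym f₀) ty₀ (⊩var p)))
           (≐-let l₀ (≐-refl tt (⊩var p)) (≐-ext (λ {z} _ → sym (upd₂-self z)) (≐-pair (tt , tt , λ { (here refl) (here o) → l≢r x A o }) I₁.eq I₂.eq)))
  ; rel = rel′ }
  where
    x₁ = suc x
    x₂ = rt x A
    module I₁ = Identity I
    module I₂ = Identity J
    pairs = FV I₁.tm ++ FV I₂.tm
    T' = letp x₁ x₂ (var x) (pair I₁.tm I₂.tm)
    none : ∀ {z} → z ∈ pairs → z ≢ x₁ → z ≢ x₂ → ⊥
    none m n₁ n₂ with ∈++ (FV I₁.tm) m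
    ... | inj₁ i = n₁ (∈1 (proj₁ I₁.fvs i))
    ... | inj₂ i = n₂ (∈1 (proj₁ I₂.fvs i))
    x₁≢x₂ = l≢r x A
    lt : Lin T'
    lt = tt , (I₁.lin , I₂.lin , λ i j → x₁≢x₂ (trans (sym (∈1 (proj₁ I₁.fvs i))) (∈1 (proj₁ I₂.fvs j)))) ,
         inl (proj₂ I₁.fvs (here refl)) , inr (FV I₁.tm) (proj₂ I₂.fvs (here refl)) , x₁≢x₂ ,
         λ _ j → none (proj₁ (∈─⁻ {xs = pairs} (proj₁ (∈─⁻ {xs = pairs ─ x₁} j)))) (proj₂ (∈─⁻ {xs = pairs} (proj₁ (∈─⁻ {xs = pairs ─ x₁} j)))) (proj₂ (∈─⁻ {xs = pairs ─ x₁} j))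
    T₀ = letp x₁ x₂ (var x) (pair (var x₁) (var x₂))
    ∉₀ : ∀ {z} → z ∈ ((x₁ ∷ x₂ ∷ []) ─ x₁) ─ x₂ → ⊥
    ∉₀ m with ∈─⁻ {xs = (x₁ ∷ x₂ ∷ []) ─ x₁} m
    ... | m , n₂ with ∈─⁻ {xs = x₁ ∷ x₂ ∷ []} m
    ... | here o , n₁ = n₁ o
    ... | there (here o) , _ = n₂ o
    l₀ : Lin T₀
    l₀ = tt , (tt , tt , λ { (here refl) (here o) → x₁≢x₂ o }) , here refl , there (here refl) , x₁≢x₂ , λ _ j → ∉₀ j
    f₀ : (x ∷ []) ≋ FV T₀
    f₀ = (λ { (here o) → here o }) , (λ { (here o) → here o ; (there i) → ⊥-elim (∉₀ i) })
    upd₂-self : upd (upd G x₂ B) x₁ A ≗ G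
    upd₂-self z = trans (upd-≗ x₁ A (upd-self (at-root B p₂)) z) (upd-self (at-root A p₁) z)
    ty₀ : G ⊩ T₀ ∶ A ⊗ B
    ty₀ = ⊩let (⊩var p) (⊩pair (⊩var (trans (upd₂-self x₁) (at-root A p₁))) (⊩var (trans (upd₂-self x₂) (at-root B p₂))))
    rel′ : ∀ σ {e} → Env σ (x ∷ []) → R (A ⊗ B) e (look σ x) → R (A ⊗ B) e (subst σ T')
    rel′ σ E (c , c' , u , v , u' , v' , r , r' , ru , rv) = c , Cl-≈ (≈-sym b₀) (Cl-pair (proj₂ (R-Cl A s₁)) (proj₂ (R-Cl B s₂))) , u , v , _ , _ , r , b₀ , s₁ , s₂
      where
        cu = proj₂ (R-Cl A ru)
        cv = proj₂ (R-Cl B rv)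
        ρ = (x₁ , u') ∷ (x₂ , v') ∷ σ
        E₂ : Env ρ (x₁ ∷ x₂ ∷ x ∷ [])
        E₂ = Env-look _ (Env-look _ E cv) cu
        E′ : Env σ (FV T')
        E′ = Env-⊑ (λ { (here o) → here o ; (there i) → ⊥-elim (none (proj₁ (∈─⁻ {xs = pairs} (proj₁ (∈─⁻ {xs = pairs ─ x₁} i)))) (proj₂ (∈─⁻ {xs = pairs} (proj₁ (∈─⁻ {xs = pairs ─ x₁} i)))) (proj₂ (∈─⁻ {xs = pairs ─ x₁} i))) }) E
        b₀ : subst σ T' ≈ pair (subst ρ I₁.tm) (subst ρ I₂.tm)
        b₀ = βp-env (var x) (pair I₁.tm I₂.tm) lt E′ r' cu cv
        s₁ : R A u (subst ρ I₁.tm)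
        s₁ = I₁.rel ρ (Env-⊑ (λ { (here o) → here o }) E₂) (≡subst (R A u) (sym (look-here x₁ u' _)) ru)
        s₂ : R B v (subst ρ I₂.tm)
        s₂ = I₂.rel ρ (Env-⊑ (λ { (here o) → there (here o) }) E₂)
               (≡subst (R B v) (sym (trans (look-there u' _ (x₁≢x₂ ∘ sym)) (look-here x₂ v' σ))) rv)
identity-⊸ : ∀ {G A B x n} → At G x (A ⊸ B) → At G n (A ⊸ B) → Disj x (A ⊸ B) n (A ⊸ B) →
  Identity G A (suc n) (suc x) → Identity G B (rt x A) (rt n A) → Identity G (A ⊸ B) x n
identity-⊸ {G} {A} {B} {x} {n} (p , p₁ , p₂) (q , q₁ , q₂) d I J = record
  { nf = nlam (at-root A q₁) (napp p (at-root B p₂) I₁.nf I₂.nf)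
  ; fvs = fvs′ ; lin = lt
  ; eq = ≐-trans tt l₀ f₀ (≐-sym l₀ tt (≋-sym f₀) (≐-axiom η-lam l₀ tt (≋-sym f₀) ty₀ (⊩var p)))
          (≐-lam l₀ (≐-ext (λ {z} _ → sym (upd-self (at-root A q₁) z)) body≐))
  ; rel = rel′ }
  where
    n₁ = suc n
    y₂ = rt x A
    module I₁ = Identity I
    module I₂ = Identity J
    x≢n₁ : x ≢ n₁
    x≢n₁ o = d (in-root x (A ⊸ B)) (in-l A B (≡subst (λ k → In k n₁ A) (sym o) (in-root n₁ A)))
    bd = app (lam y₂ I₂.tm) (app (var x) I₁.tm)
    T' = lam n₁ bd
    no₂ : ∀ {z} → z ∈ FV I₂.tm ─ y₂ → ⊥
    no₂ m = case ∈─⁻ {xs = FV I₂.tm} m of λ (i , ne) → ne (∈1 (proj₁ I₂.fvs i))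
    bd-fv : FV bd ≋ (x ∷ n₁ ∷ [])
    bd-fv = (λ m → case ∈++ (FV I₂.tm ─ y₂) m of λ { (inj₁ i) → ⊥-elim (no₂ i) ; (inj₂ (here o)) → here o ; (inj₂ (there i)) → there (proj₁ I₁.fvs i) }) ,
            (λ { (here o) → inr (FV I₂.tm ─ y₂) (here o) ; (there i) → inr (FV I₂.tm ─ y₂) (there (proj₂ I₁.fvs i)) })
    lbd : Lin bd
    lbd = (I₂.lin , proj₂ I₂.fvs (here refl)) , (tt , I₁.lin , λ { (here refl) i → x≢n₁ (∈1 (proj₁ I₁.fvs i)) }) , λ i _ → no₂ i
    lt : Lin T'
    lt = lbd , proj₂ bd-fv (there (here refl))
    fvs′ : FV T' ≋ (x ∷ [])
    fvs′ = (λ m → case ∈─⁻ {xs = FV bd} m of λ (i , ne) → case proj₁ bd-fv i of λ { (here o) → here o ; (there (here o)) → ⊥-elim (ne o) }) ,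
           (λ { (here refl) → ∈─⁺ (proj₂ bd-fv (here refl)) x≢n₁ })
    T₀ = lam n₁ (app (var x) (var n₁))
    lb₀ : Lin (app (var x) (var n₁))
    lb₀ = tt , tt , λ { (here refl) (here o) → x≢n₁ o }
    l₀ : Lin T₀
    l₀ = lb₀ , there (here refl)
    f₀ : (x ∷ []) ≋ FV T₀
    f₀ = (λ { (here refl) → ∈─⁺ (here refl) x≢n₁ }) ,
         (λ m → case ∈─⁻ {xs = x ∷ n₁ ∷ []} m of λ { (here o , _) → here o ; (there (here o) , ne) → ⊥-elim (ne o) })
    ty₀ : G ⊩ T₀ ∶ A ⊸ B
    ty₀ = ⊩lam (⊩-≗ (λ z → sym (upd-self (at-root A q₁) z)) (⊩app (⊩var p) (⊩var (at-root A q₁))))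
    e₁ : Tm
    e₁ = app (var x) I₁.tm
    le₁ : Lin e₁
    le₁ = proj₁ (proj₂ lbd)
    ty₁ : G ⊩ e₁ ∶ B
    ty₁ = ⊩app (⊩var p) (Nf-⊩ I₁.nf)
    -- A trivial redex is inserted so that the expanded identity on `B` can replace `var y₂`; the
    -- term thereby takes the shape of the left rule.
    r : e₁ ≈ app (lam y₂ (var y₂)) e₁
    r = ≈-sym (β-id le₁)
    l₂ : Lin (app (lam y₂ (var y₂)) e₁)
    l₂ = proj₁ (≈-Lin r) le₁
    body≐ : G ⊩ app (var x) (var n₁) ≐ bd ∶ B
    body≐ = ≐-trans lb₀ le₁ f₁ (≐-app lb₀ (≐-refl tt (⊩var p)) I₁.eq)
              (≐-trans le₁ l₂ (≈-FV r) (≈⇒≐ r le₁ ty₁)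
                (≐-app l₂ (≐-lam (tt , here refl) (≐-ext (λ {z} _ → sym (upd-self (at-root B p₂) z)) I₂.eq)) (≐-refl le₁ ty₁)))
      where
        f₁ : (x ∷ n₁ ∷ []) ≋ (x ∷ FV I₁.tm)
        f₁ = (λ { (here o) → here o ; (there i) → there (proj₂ I₁.fvs i) }) , (λ { (here o) → here o ; (there i) → there (proj₁ I₁.fvs i) })
    rel′ : ∀ σ {e} → Env σ (x ∷ []) → R (A ⊸ B) e (look σ x) → R (A ⊸ B) e (subst σ T')
    rel′ σ {e} E (c , c' , f) = c , Cl-subst T' lt E′ , fun
      where
        E′ : Env σ (FV T')
        E′ = Env-⊑ (proj₁ fvs′) E
        fun : ∀ a a' → R A a a' → R B (e · a) (subst σ T' · a')
        fun a a' ra = R-≈ B ≈-refl (≈-sym (≈-trans (β-env bd lt E′ ca) (β-env I₂.tm (I₂.lin , proj₂ I₂.fvs (here refl)) E₂ ce₁)))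
                        (I₂.rel ρ₂ E₃ (≡subst (R B (e · a)) (sym (look-here y₂ _ ρ₁)) rb))
          where
            ca = proj₂ (R-Cl A ra)
            ρ₁ = (n₁ , a') ∷ σ
            E₁ : Env ρ₁ (n₁ ∷ x ∷ [])
            E₁ = Env-look _ E ca
            sa : R A a (subst ρ₁ I₁.tm)
            sa = I₁.rel ρ₁ (Env-⊑ (λ { (here o) → here o }) E₁) (≡subst (R A a) (sym (look-here n₁ a' σ)) ra)
            rb : R B (e · a) (look ρ₁ x · subst ρ₁ I₁.tm)
            rb = ≡subst (λ k → R B (e · a) (k · subst ρ₁ I₁.tm)) (sym (look-there a' σ x≢n₁)) (f a _ sa)
            ce₁ : Cl (look ρ₁ x · subst ρ₁ I₁.tm)
            ce₁ = proj₂ (R-Cl B rb)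
            E₂ : Env ρ₁ (FV I₂.tm ─ y₂)
            E₂ = env (env-fvs E₁) (λ m → ⊥-elim (no₂ m))
            ρ₂ = (y₂ , look ρ₁ x · subst ρ₁ I₁.tm) ∷ ρ₁
            E₃ : Env ρ₂ (y₂ ∷ [])
            E₃ = Env-⊑ (λ { (here o) → here o }) (Env-look [] (env (env-fvs E₁) (λ ())) ce₁)

identity : ∀ A x n → At G x A → At G n A → Disj x A n A → Identity G A x n
identity (tv a) x n p q d = record { nf = nvar p ; fvs = ≋refl ; lin = tt ; eq = ≐-refl tt (⊩var p) ; rel = λ _ _ r → r }
identity (A ⊗ B) x n p@(_ , p₁ , p₂) (_ , q₁ , q₂) d = identity-⊗ p
  (identity A (suc x) (suc n) p₁ q₁ (λ i j → d (in-l A B i) (in-l A B j)))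
  (identity B (rt x A) (rt n A) p₂ q₂ (λ i j → d (in-r A B i) (in-r A B j)))
identity (A ⊸ B) x n p@(_ , p₁ , p₂) q@(_ , q₁ , q₂) d = identity-⊸ p q d
  -- To the left of an arrow hypothesis and goal change places.
  (identity A (suc n) (suc x) q₁ p₁ (λ i j → d (in-l A B j) (in-l A B i)))
  (identity B (rt x A) (rt n A) p₂ q₂ (λ i j → d (in-r A B i) (in-r A B j)))

-- A variable of a typed term is a single name, whereas a hypothesis of a cut-free proof owns an
-- interval. `r` says where the interval of each variable begins, and the intervals are to be
-- disjoint and filled in by `G`.
record Place (G g : ℕ → Ty) (r : ℕ → ℕ) (xs : List ℕ) (n : ℕ) (A : Ty) : Set where
  field
    at-var  : x ∈ xs → At G (r x) (g x)
    at-goal : At G n A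
    dj-var  : x ∈ xs → y ∈ xs → x ≢ y → Disj (r x) (g x) (r y) (g y)
    dj-goal : x ∈ xs → Disj (r x) (g x) n A
open Place

variable
  r : ℕ → ℕ
  ρ : Subst
  N M : ℕ

Image : (ℕ → ℕ) → List ℕ → List ℕ → Set
Image r xs zs = ∀ {z} → z ∈ zs → ∃[ x ] (x ∈ xs × z ≡ r x)

Place-⊑ : ys ⊑ xs → Place G g r xs n A → Place G g r ys n A
Place-⊑ i P = record { at-var = at-var P ∘ i ; at-goal = at-goal P ; dj-var = λ a b → dj-var P (i a) (i b) ; dj-goal = dj-goal P ∘ i }

Place-root : Place G g r xs n A → x ∈ xs → G (r x) ≡ g x
Place-root {g = g} {x = x} P m = at-root (g x) (at-var P m)

r-inj : Place G g r xs n A → x ∈ xs → y ∈ xs → x ≢ y → r x ≢ r y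
r-inj {g = g} {r} {x = x} {y} P p q ne e = dj-var P p q ne (in-root (r x) (g x)) (≡subst (λ k → In k (r y) (g y)) (sym e) (in-root (r y) (g y)))

In-image : Place G g r xs n A → x ∈ xs → ∀ {z k} → k ≡ r x → In z k (G k) → In z (r x) (g x)
In-image P m refl i = ≡subst (In _ _) (Place-root P m) i

Sep-place : Place G g r xs n A → Image r xs zs → Sep G n A zs
Sep-place {G} {g} {r} {xs} {n} {A} {zs} P im = record
  { sep-goal = λ m i j → case im m of λ (x , mx , e) → dj-goal P mx (In-image P mx e i) j ; sep-ctx = ctx′ }
  where
    ctx′ : ∀ {y z} → y ∈ zs → z ∈ zs → y ≢ z → Disj y (G y) z (G z)
    ctx′ m m' ne i j with im m | im m'
    ... | x , mx , e | x' , mx' , e' = dj-var P mx mx' (λ { refl → ne (trans e (sym e')) }) (In-image P mx e i) (In-image P mx' e' j)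

Reg-place : Place G g r xs n A → Image r xs zs → Reg G n A zs z → In z n A ⊎ ∃[ x ] (x ∈ xs × In z (r x) (g x))
Reg-place P im (in-goal i) = inj₁ i
Reg-place P im (in-ctx m i) = case im m of λ (x , mx , e) → inj₂ (x , mx , In-image P mx e i)

-- The names of the given term lie below `N` and the new ones do not, so the naive substitution `ρ`
-- captures nothing. The entries of `ρ` bind no variables, which keeps the binders under control.
record Ren (ρ : Subst) (r : ℕ → ℕ) (xs : List ℕ) (N : ℕ) : Set where
  field
    ren  : x ∈ xs → look ρ x ≡ var (r x)
    big  : x ∈ xs → N ≤ r x
    fvs≥ : z ∈ FVS ρ → N ≤ z
    bvs  : ∀ w → BV (look ρ w) ⊑ []
open Ren

Ren-⊑ : ys ⊑ xs → Ren ρ r xs N → Ren ρ r ys N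
Ren-⊑ i P = record { ren = ren P ∘ i ; big = big P ∘ i ; fvs≥ = fvs≥ P ; bvs = bvs P }

Below : Tm → ℕ → Set
Below t N = ∀ {z} → z ∈ Vars t → z < N

Below-BV : Below t N → z ∈ BV t → z < N
Below-BV {t} b m = b (inr (FV t) m)

Ren-NC : Ren ρ r xs N → Below t N → NC ρ t
Ren-NC {t = t} P b i j = ℕ.<⇒≱ (Below-BV {t} b j) (fvs≥ P i)

module _ {s : Tm} (P : Ren ρ r (FV s) N) (b : Below s N) where

  ren-image : Image r (FV s) (FV (subst ρ s))
  ren-image {z} m = case FV-subst⁻ ρ s (Ren-NC {t = s} P b) m of λ (x , i , j) →
    x , i , ∈1 (≡subst (λ k → z ∈ FV k) (ren P i) j)

  ren-in : x ∈ FV s → r x ∈ FV (subst ρ s)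
  ren-in {x} m = FV-subst⁺ ρ s (Ren-NC {t = s} P b) m (≡subst (λ k → r x ∈ FV k) (sym (ren P m)) (here refl))

  ren-Lin : Lin s → Place G g r (FV s) n A → Lin (subst ρ s)
  ren-Lin l Q = Lin-subst ρ s (Ren-NC {t = s} P b) l (λ m → ≡subst Lin (sym (ren P m)) tt)
    λ {x} {y} p q ne {z} i j → r-inj Q p q ne (trans (sym (∈1 (≡subst (λ k → z ∈ FV k) (ren P p) i))) (∈1 (≡subst (λ k → z ∈ FV k) (ren P q) j)))

  ren-⊩ : Place G g r (FV s) n A → g ⊩ s ∶ B → G ⊩ subst ρ s ∶ B
  ren-⊩ {G = G} Q E = ⊩-subst ρ s (Ren-NC {t = s} P b) (λ {z} m → ≡subst (λ k → G ⊩ k ∶ _) (sym (ren P m)) (⊩var (Place-root Q m))) E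

updN : (ℕ → ℕ) → ℕ → ℕ → ℕ → ℕ
updN r x m z with z ≟ x
... | yes _ = m
... | no _ = r z

Ren-bind : ∀ xs → Ren ρ r (xs ─ x) N → N ≤ m → Ren ((x , var m) ∷ ρ) (updN r x m) xs N
Ren-bind {ρ} {r} {x} {N} {m} xs P le = record { ren = λ {z} → f {z} ; big = λ {z} → h′ {z} ; fvs≥ = λ { (here refl) → le ; (there i) → fvs≥ P i } ; bvs = bv }
  where
    f : ∀ {z} → z ∈ xs → look ((x , var m) ∷ ρ) z ≡ var (updN r x m z)
    f {z} i with z ≟ x
    ... | yes _ = refl
    ... | no ne = ren P (∈─⁺ i ne)
    h′ : ∀ {z} → z ∈ xs → N ≤ updN r x m z
    h′ {z} i with z ≟ x
    ... | yes _ = le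
    ... | no ne = big P (∈─⁺ i ne)
    bv : ∀ w → BV (look ((x , var m) ∷ ρ) w) ⊑ []
    bv w i with w ≟ x
    ... | no _ = bvs P w i

Place-bind : ∀ xs → Place G g r (xs ─ x) n C → At G m A → Disj m A n C → (∀ {z} → z ∈ xs ─ x → Disj m A (r z) (g z)) →
             Place G (upd g x A) (updN r x m) xs n C
Place-bind {G} {g} {r} {x} {n} {C} {m} {A} xs P a d dv = record
  { at-var = λ {z} → av {z} ; at-goal = at-goal P ; dj-var = λ {y} {z} → djv {y} {z} ; dj-goal = λ {z} → djg {z} }
  where
    av : ∀ {z} → z ∈ xs → At G (updN r x m z) (upd g x A z)
    av {z} i with z ≟ x
    ... | yes _ = a
    ... | no ne = at-var P (∈─⁺ i ne)
    djg : ∀ {z} → z ∈ xs → Disj (updN r x m z) (upd g x A z) n C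
    djg {z} i with z ≟ x
    ... | yes _ = d
    ... | no ne = dj-goal P (∈─⁺ i ne)
    djv : ∀ {y z} → y ∈ xs → z ∈ xs → y ≢ z → Disj (updN r x m y) (upd g x A y) (updN r x m z) (upd g x A z)
    djv {y} {z} i j ne with y ≟ x | z ≟ x
    ... | yes refl | yes refl = ⊥-elim (ne refl)
    ... | yes refl | no nz = dv (∈─⁺ j nz)
    ... | no ny | yes refl = λ a b → dv (∈─⁺ i ny) b a
    ... | no ny | no nz = dj-var P (∈─⁺ i ny) (∈─⁺ j nz) ne

record Related (g : ℕ → Ty) (r : ℕ → ℕ) (xs : List ℕ) (σ σ' : Subst) : Set where
  field
    closed  : ∀ {z} → z ∈ FVS σ → ⊥
    closed′ : ∀ {z} → z ∈ FVS σ' → ⊥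
    related : x ∈ xs → R (g x) (look σ x) (look σ' (r x))
open Related

Related-⊑ : ∀ {σ σ'} → ys ⊑ xs → Related g r xs σ σ' → Related g r ys σ σ'
Related-⊑ i Q = record { closed = closed Q ; closed′ = closed′ Q ; related = related Q ∘ i }

Related-Env : ∀ {σ σ'} → Related g r xs σ σ' → Env σ xs
Related-Env {g} Q = env (closed Q) λ {z} m → proj₁ (R-Cl (g z) (related Q m))

Related-Env′ : ∀ {σ σ'} → Related g r xs σ σ' → Image r xs zs → Env σ' zs
Related-Env′ {g} {σ' = σ'} Q im = env (closed′ Q) λ m → case im m of λ (x , mx , e) →
  ≡subst (λ k → Cl (look σ' k)) (sym e) (proj₂ (R-Cl (g x) (related Q mx)))

Related-bind : ∀ {σ σ' e e'} xs → Related g r (xs ─ x) σ σ' → (∀ {z} → z ∈ xs ─ x → r z ≢ m) → R A e e' →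
  Related (upd g x A) (updN r x m) xs ((x , e) ∷ σ) ((m , e') ∷ σ')
Related-bind {g} {r} {x} {m} {A} {σ} {σ'} {e} {e'} xs Q n q = record
  { closed = λ i → case ∈++ (FV e) i of λ { (inj₁ j) → no-fv (proj₁ (R-Cl A q)) j ; (inj₂ j) → closed Q j }
  ; closed′ = λ i → case ∈++ (FV e') i of λ { (inj₁ j) → no-fv (proj₂ (R-Cl A q)) j ; (inj₂ j) → closed′ Q j }
  ; related = λ {z} → f {z} }
  where
    f : ∀ {z} → z ∈ xs → R (upd g x A z) (look ((x , e) ∷ σ) z) (look ((m , e') ∷ σ') (updN r x m z))
    f {z} i with z ≟ x
    ... | yes _ = ≡subst (R A e) (sym (look-here m e' σ')) q
    ... | no ne = ≡subst (R (g z) (look σ z)) (sym (look-there e' σ' (n (∈─⁺ i ne)))) (related Q (∈─⁺ i ne))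

-- The double comparison of a term with its cut-free form: `eq` yields the final equation when the
-- forms of two terms agree, and `rel` transfers the outcome of a test when they differ.
record Normal (G g : ℕ → Ty) (r : ℕ → ℕ) (ρ : Subst) (s : Tm) (n : ℕ) (A : Ty) : Set where
  field
    {tm} : Tm
    nf   : Nf G n A tm
    fvs  : FV (subst ρ s) ≋ FV tm
    lin  : Lin tm
    eq   : G ⊩ subst ρ s ≐ tm ∶ A
    rel  : ∀ σ σ' → Related g r (FV s) σ σ' → R A (subst σ s) (subst σ' tm)

id-cut : (I : Identity G B y n) → G y ≡ B → Lin e → G ⊩ e ∶ B →
  let e' = app (lam y (Identity.tm I)) e in (G ⊩ e ≐ e' ∶ B) × Lin e' × FV e ≋ FV e'
id-cut {G} {B} {y} {e = e} I ey l ty = ≐-trans l l₁ (≈-FV r₀) (≈⇒≐ r₀ l ty)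
    (≐-app l₁ (≐-lam (tt , here refl) (≐-ext (λ {z} _ → sym (upd-self ey z)) I.eq)) (≐-refl l ty)) , l₂ , fv₂
  where
    module I = Identity I
    r₀ : e ≈ app (lam y (var y)) e
    r₀ = ≈-sym (β-id l)
    l₁ : Lin (app (lam y (var y)) e)
    l₁ = proj₁ (≈-Lin r₀) l
    none : ∀ {z} → z ∈ FV I.tm ─ y → ⊥
    none m = case ∈─⁻ {xs = FV I.tm} m of λ (i , ne) → ne (∈1 (proj₁ I.fvs i))
    l₂ : Lin (app (lam y I.tm) e)
    l₂ = (I.lin , proj₂ I.fvs (here refl)) , l , λ i _ → none i
    fv₂ : FV e ≋ ((FV I.tm ─ y) ++ FV e)
    fv₂ = inr (FV I.tm ─ y) , λ m → case ∈++ (FV I.tm ─ y) m of λ { (inj₁ i) → ⊥-elim (none i) ; (inj₂ i) → i }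

α-lam-ren : Lin (lam x s) → Ren ρ r (FV (lam x s)) N → Below (lam x s) N → N ≤ m → Place G g r (FV (lam x s)) n C →
            (∀ {z} → z ∈ FV s ─ x → r z ≢ m) → subst ρ (lam x s) ≈ lam m (subst ((x , var m) ∷ ρ) s)
α-lam-ren {x} {s} {ρ} {r} {N} {m} l P b le Q n =
  ≈-trans (step (α-lam nv) (ren-Lin {s = lam x s} P b l Q))
          (≈-lam (≈-≡ (subst-comp (dropS x ρ) ((x , var m) ∷ []) ((x , var m) ∷ ρ) s (NC-lam ρ x s nc) λ {z} i → comp i (z ≟ x))))
  where
    nc = Ren-NC {t = lam x s} P b
    x<N : x < N
    x<N = Below-BV {lam x s} b (here refl)
    nv : m ∉ Vars (subst (dropS x ρ) s)
    nv i with ∈++ (FV (subst (dropS x ρ) s)) i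
    ... | inj₂ j = case ∈++ (BV s) (BV-subst (dropS x ρ) s (drop-BV x ρ (bvs P)) j) of λ { (inj₁ k) → ℕ.<⇒≱ (Below-BV {lam x s} b (there k)) le }
    ... | inj₁ j = case FV-subst⁻ (dropS x ρ) s (NC-lam ρ x s nc) j of λ (w , k , o) → go k o (w ≟ x)
      where
        go : ∀ {w} → w ∈ FV s → m ∈ FV (look (dropS x ρ) w) → Dec (w ≡ x) → ⊥
        go k o (yes refl) = case ∈1 (≡subst (λ t → m ∈ FV t) (drop-same x ρ) o) of λ { refl → ℕ.<⇒≱ x<N le }
        go k o (no ne) = n (∈─⁺ k ne) (sym (∈1 (≡subst (λ t → m ∈ FV t) (trans (drop-other ρ ne) (ren P (∈─⁺ k ne))) o)))
    comp : ∀ {z} → z ∈ FV s → Dec (z ≡ x) → subst ((x , var m) ∷ []) (look (dropS x ρ) z) ≡ look ((x , var m) ∷ ρ) z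
    comp i (yes refl) = trans (cong (subst ((x , var m) ∷ [])) (drop-same x ρ)) (trans (look-here x (var m) []) (sym (look-here x (var m) ρ)))
    comp i (no ne) = trans (cong (subst ((x , var m) ∷ [])) (trans (drop-other ρ ne) (ren P i′)))
      (trans (look-there (var m) [] (λ e → ℕ.<⇒≱ x<N (≡subst (N ≤_) e (big P i′)))) (sym (trans (look-there (var m) ρ ne) (ren P i′))))
      where i′ = ∈─⁺ i ne

α-let-ren : ∀ {m'} → Lin (letp x y s t) → Ren ρ r (FV (letp x y s t)) N → Below (letp x y s t) N → N ≤ m → N ≤ m' → m ≢ m' →
            Place G g r (FV (letp x y s t)) n C → (∀ {z} → z ∈ (FV t ─ x) ─ y → r z ≢ m × r z ≢ m') →
            subst ρ (letp x y s t) ≈ letp m m' (subst ρ s) (subst ((x , var m) ∷ (y , var m') ∷ ρ) t)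
α-let-ren {x} {y} {s} {t} {ρ} {r} {N} {m} {m' = m'} l P b le le' m≢m' Q n =
  ≈-trans (step (α-let m≢m' (nv le (λ i → proj₁ (n i))) (nv le' (λ i → proj₂ (n i)))) (ren-Lin {s = letp x y s t} P b l Q))
          (≈-let ≈-refl (≈-≡ (subst-comp (drop₂ x y ρ) ((x , var m) ∷ (y , var m') ∷ []) ((x , var m) ∷ (y , var m') ∷ ρ) t nct λ {z} i → comp i (z ≟ x) (z ≟ y))))
  where
    nct : NC (drop₂ x y ρ) t
    nct = NC-let ρ x y s t (Ren-NC {t = letp x y s t} P b)
    x<N : x < N
    x<N = Below-BV {letp x y s t} b (here refl)
    y<N : y < N
    y<N = Below-BV {letp x y s t} b (there (here refl))
    nv : ∀ {k} → N ≤ k → (∀ {z} → z ∈ (FV t ─ x) ─ y → r z ≢ k) → k ∉ Vars (subst (drop₂ x y ρ) t)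
    nv {k} le n i with ∈++ (FV (subst (drop₂ x y ρ) t)) i
    ... | inj₂ j = case ∈++ (BV t) (BV-subst (drop₂ x y ρ) t (drop-BV y (dropS x ρ) (drop-BV x ρ (bvs P))) j) of λ
             { (inj₁ o) → ℕ.<⇒≱ (Below-BV {letp x y s t} b (there (there (inr (BV s) o)))) le }
    ... | inj₁ j = case FV-subst⁻ (drop₂ x y ρ) t nct j of λ (w , i , o) → go i o (w ≟ x) (w ≟ y)
      where
        go : ∀ {w} → w ∈ FV t → k ∈ FV (look (drop₂ x y ρ) w) → Dec (w ≡ x) → Dec (w ≡ y) → ⊥
        go i o (yes refl) _ = case ∈1 (≡subst (λ t → k ∈ FV t) (drop₂-x x y ρ) o) of λ { refl → ℕ.<⇒≱ x<N le }
        go i o (no _) (yes refl) = case ∈1 (≡subst (λ t → k ∈ FV t) (drop₂-y x y ρ) o) of λ { refl → ℕ.<⇒≱ y<N le }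
        go i o (no n₁) (no n₂) = n i′ (sym (∈1 (≡subst (λ t → k ∈ FV t) (trans (drop₂-other ρ n₁ n₂) (ren P (inr (FV s) i′))) o)))
          where i′ = ∈─⁺ (∈─⁺ i n₁) n₂
    comp : ∀ {z} → z ∈ FV t → Dec (z ≡ x) → Dec (z ≡ y) →
           subst ((x , var m) ∷ (y , var m') ∷ []) (look (drop₂ x y ρ) z) ≡ look ((x , var m) ∷ (y , var m') ∷ ρ) z
    comp i (yes refl) _ = trans (cong (subst ((x , var m) ∷ (y , var m') ∷ [])) (drop₂-x x y ρ)) (trans (look-here x (var m) _) (sym (look-here x (var m) _)))
    comp i (no n₁) (yes refl) = trans (cong (subst ((x , var m) ∷ (y , var m') ∷ [])) (drop₂-y x y ρ))
      (trans (trans (look-there (var m) _ n₁) (look-here y (var m') [])) (sym (trans (look-there (var m) _ n₁) (look-here y (var m') ρ))))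
    comp i (no n₁) (no n₂) = trans (cong (subst ((x , var m) ∷ (y , var m') ∷ [])) (trans (drop₂-other ρ n₁ n₂) (ren P i′)))
      (trans (trans (look-there (var m) _ (λ e → ℕ.<⇒≱ x<N (≡subst (N ≤_) e (big P i′)))) (look-there (var m') [] (λ e → ℕ.<⇒≱ y<N (≡subst (N ≤_) e (big P i′)))))
             (sym (trans (look-there (var m) _ n₁) (trans (look-there (var m') ρ n₂) (ren P i′)))))
      where i′ = inr (FV s) (∈─⁺ (∈─⁺ i n₁) n₂)

normal-image : Ren ρ r (FV s) N → Below s N → (I : Normal G g r ρ s n A) → Image r (FV s) (FV (Normal.tm I))
normal-image {s = s} P b I m = ren-image {s = s} P b (proj₂ (Normal.fvs I) m)

normalise-var : Ren ρ r (x ∷ []) N → Place G g r (x ∷ []) n (g x) → Normal G g r ρ (var x) n (g x)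
normalise-var {ρ} {r} {x} {G = G} {g} {n} P Q = record
  { nf = I.nf ; lin = I.lin
  ; fvs = ≡subst (λ t → FV t ≋ FV I.tm) (sym e₀) (≋-sym I.fvs)
  ; eq = ≡subst (λ t → G ⊩ t ≐ I.tm ∶ g x) (sym e₀) I.eq
  ; rel = λ σ σ' q → I.rel σ' (Related-Env′ q (λ { (here o) → x , here refl , o })) (related q (here refl)) }
  where
    e₀ : look ρ x ≡ var (r x)
    e₀ = ren P (here refl)
    module I = Identity (identity (g x) (r x) n (at-var Q (here refl)) (at-goal Q) (dj-goal Q (here refl)))

module _ {x : ℕ} {s : Tm} {A B : Ty} {ρ : Subst} {r : ℕ → ℕ} {N : ℕ} {G g : ℕ → Ty} {n : ℕ} (l : Lin (lam x s)) (P : Ren ρ r (FV (lam x s)) N) (b : Below (lam x s) N) (le : N ≤ n)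
         (Q : Place G g r (FV (lam x s)) n (A ⊸ B)) where

  lam-fresh : ∀ {z} → z ∈ FV s ─ x → r z ≢ suc n
  lam-fresh {z} i e = dj-goal Q i (in-root (r z) (g z)) (≡subst (λ k → In k n (A ⊸ B)) (sym e) (in-l A B (in-root (suc n) A)))

  lam-Place : Place G (upd g x A) (updN r x (suc n)) (FV s) (rt n A) B
  lam-Place = Place-bind (FV s) (record { at-var = at-var Q ; at-goal = proj₂ (proj₂ (at-goal Q)) ; dj-var = dj-var Q ; dj-goal = λ i a c → dj-goal Q i a (in-r A B c) })
    (proj₁ (proj₂ (at-goal Q))) (in-lr {n = n} A B) (λ i a c → dj-goal Q i c (in-l A B a))

  normalise-lam : upd g x A ⊩ s ∶ B → Normal G (upd g x A) (updN r x (suc n)) ((x , var (suc n)) ∷ ρ) s (rt n A) B → Normal G g r ρ (lam x s) n (A ⊸ B)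
  normalise-lam E I = record
    { nf = nlam (at-root A a₁) I.nf ; fvs = ≋-trans (≈-FV al) (─-≋ (suc n) I.fvs) ; lin = ln
    ; eq = ≐-trans l₁ l₂ (≈-FV al) (≈⇒≐ al l₁ (ren-⊩ {s = lam x s} P b Q (⊩lam E)))
             (≐-lam l₂ (≐-ext (λ {z} _ → sym (upd-self (at-root A a₁) z)) I.eq))
    ; rel = rel′ }
    where
      module I = Normal I
      a₁ = proj₁ (proj₂ (at-goal Q))
      al : subst ρ (lam x s) ≈ lam (suc n) (subst ((x , var (suc n)) ∷ ρ) s)
      al = α-lam-ren l P b (ℕ.≤-trans le (ℕ.n≤1+n n)) Q lam-fresh
      l₁ = ren-Lin {s = lam x s} P b l Q
      l₂ = proj₁ (≈-Lin al) l₁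
      ln : Lin (lam (suc n) I.tm)
      ln = I.lin , proj₁ I.fvs (proj₂ l₂)
      im : Image r (FV (lam x s)) (FV (lam (suc n) I.tm))
      im m = ren-image {s = lam x s} P b (proj₂ (≈-FV al) (proj₂ (─-≋ (suc n) I.fvs) m))
      rel′ : ∀ σ σ' → Related g r (FV (lam x s)) σ σ' → R (A ⊸ B) (subst σ (lam x s)) (subst σ' (lam (suc n) I.tm))
      rel′ σ σ' q = Cl-subst (lam x s) l (Related-Env q) , Cl-subst (lam (suc n) I.tm) ln (Related-Env′ q im) , λ e e' re →
        R-≈ B (≈-sym (β-env s l (Related-Env q) (proj₁ (R-Cl A re)))) (≈-sym (β-env I.tm ln (Related-Env′ q im) (proj₂ (R-Cl A re))))
          (I.rel _ _ (Related-bind (FV s) q lam-fresh re))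

module _ {s t : Tm} {A B : Ty} {ρ : Subst} {r : ℕ → ℕ} {N : ℕ} {G g : ℕ → Ty} {n : ℕ} (l : Lin (pair s t)) (P : Ren ρ r (FV (pair s t)) N) (b : Below (pair s t) N)
         (Q : Place G g r (FV (pair s t)) n (A ⊗ B)) where

  normalise-pair : Normal G g r ρ s (suc n) A → Normal G g r ρ t (rt n A) B → Normal G g r ρ (pair s t) n (A ⊗ B)
  normalise-pair I J = record
    { nf = npair I.nf J.nf ; fvs = ++-≋ I.fvs J.fvs
    ; lin = I.lin , J.lin , #-≋ I.fvs J.fvs (proj₂ (proj₂ l₁))
    ; eq = ≐-pair l₁ I.eq J.eq
    ; rel = λ σ σ' q → let rs = I.rel σ σ' (Related-⊑ inl q)
                           rt = J.rel σ σ' (Related-⊑ (inr (FV s)) q)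
                       in Cl-pair (proj₁ (R-Cl A rs)) (proj₁ (R-Cl B rt)) , Cl-pair (proj₂ (R-Cl A rs)) (proj₂ (R-Cl B rt)) ,
                          _ , _ , _ , _ , ≈-refl , ≈-refl , rs , rt }
    where
      module I = Normal I
      module J = Normal J
      l₁ = ren-Lin {s = pair s t} P b l Q

-- Application and let by cuts on fresh occurrences

variable
  xs' ys' ws : List ℕ

fresh-block : ∀ xs (r : ℕ → ℕ) (g : ℕ → Ty) N n A →
  ∃[ M ] (N ≤ M × n + ∥ A ∥ ≤ M × (∀ {x} → x ∈ xs → r x + ∥ g x ∥ ≤ M))
fresh-block xs r g N n A = M₀ ,
  ℕ.≤-trans (ℕ.m≤m+n N (n + ∥ A ∥)) (⊥≤max base ends) , ℕ.≤-trans (ℕ.m≤n+m (n + ∥ A ∥) N) (⊥≤max base ends) ,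
  λ m → All.lookup (xs≤max base ends) (∈-map⁺ _ m)
  where
    base = N + (n + ∥ A ∥)
    ends = List.map (λ x → r x + ∥ g x ∥) xs
    M₀ = max base ends

-- Two fresh occurrences M and top of the type T, for cutting on T.
module Extend {G g : ℕ → Ty} {r : ℕ → ℕ} {xs : List ℕ} {n : ℕ} {C : Ty} (Q : Place G g r xs n C) (M : ℕ) (goal< : n + ∥ C ∥ ≤ M) (vars< : ∀ {x} → x ∈ xs → r x + ∥ g x ∥ ≤ M) (T : Ty) where

  top = M + ∥ T ∥
  G₁ = lay M T (lay top T G)

  goal-old : ∀ {z} → In z n C → z < M
  goal-old (_ , i) = ℕ.<-≤-trans i goal<

  var-old : ∀ {z} → x ∈ xs → In z (r x) (g x) → z < M
  var-old m (_ , i) = ℕ.<-≤-trans i (vars< m)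

  new₂ : ∀ {z} → In z top T → top ≤ z
  new₂ = proj₁

  old≢₁ : ∀ {z} → z < M → In z M T → ⊥
  old≢₁ o (i , _) = ℕ.<⇒≱ o i

  old≢₂ : ∀ {z} → z < M → In z top T → ⊥
  old≢₂ o (i , _) = ℕ.<⇒≱ o (ℕ.≤-trans (ℕ.m≤m+n M ∥ T ∥) i)

  new≢ : ∀ {z} → In z M T → In z top T → ⊥
  new≢ (_ , i) (j , _) = ℕ.<⇒≱ i j

  agree : ∀ {z} → z < M → G₁ z ≡ G z
  agree o = trans (lay-other M T _ (old≢₁ o)) (lay-other top T G (old≢₂ o))

  at-M : At G₁ M T
  at-M = lay-At M T _

  at-top : At G₁ top T
  at-top = At-ext T (λ i → sym (lay-other M T _ (λ j → new≢ j i))) (lay-At top T G)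

  old : Place G₁ g r xs n C
  old = record { at-var = λ {x} m → At-ext (g x) (λ i → sym (agree (var-old m i))) (at-var Q m)
               ; at-goal = At-ext C (λ i → sym (agree (goal-old i))) (at-goal Q)
               ; dj-var = dj-var Q ; dj-goal = dj-goal Q }

  at-new : ∀ {m B} → At G₁ m B → (∀ {z} → In z m B → M ≤ z) → ys ⊑ xs → Place G₁ g r ys m B
  at-new a f i = record { at-var = at-var old ∘ i ; at-goal = a ; dj-var = λ p q → dj-var Q (i p) (i q)
                        ; dj-goal = λ m j k → ℕ.<⇒≱ (var-old (i m) j) (f k) }

  top∉ : Image r xs zs → top ∉ zs
  top∉ im m = case im m of λ (x , mx , e) → old≢₂ (var-old mx (≡subst (λ k → In k (r x) (g x)) (sym e) (in-root (r x) (g x)))) (in-root top T)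

  Sep-top : (∀ {z} → z ∈ zs → z ≡ top ⊎ ∃[ x ] (x ∈ xs × z ≡ r x)) → Sep G₁ n C zs
  Sep-top {zs} f = record { sep-goal = λ m i j → goal (f m) i j ; sep-ctx = λ m m' ne i j → ctx′ (f m) (f m') ne i j }
    where
      in-top : ∀ {z k} → k ≡ top → In z k (G₁ k) → In z top T
      in-top refl i = ≡subst (In _ top) (at-root T at-top) i
      in-old : ∀ {z k x} → x ∈ xs → k ≡ r x → In z k (G₁ k) → In z (r x) (g x)
      in-old m e i = In-image old m e i
      goal : ∀ {k z} → k ≡ top ⊎ ∃[ x ] (x ∈ xs × k ≡ r x) → In z k (G₁ k) → In z n C → ⊥
      goal (inj₁ e) i j = old≢₂ (goal-old j) (in-top e i)
      goal (inj₂ (x , m , e)) i j = dj-goal Q m (in-old m e i) j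
      ctx′ : ∀ {k l z} → k ≡ top ⊎ ∃[ x ] (x ∈ xs × k ≡ r x) → l ≡ top ⊎ ∃[ x ] (x ∈ xs × l ≡ r x) → k ≢ l → In z k (G₁ k) → In z l (G₁ l) → ⊥
      ctx′ (inj₁ e) (inj₁ e') ne _ _ = ne (trans e (sym e'))
      ctx′ (inj₁ e) (inj₂ (x , m , e')) ne i j = old≢₂ (var-old m (in-old m e' j)) (in-top e i)
      ctx′ (inj₂ (x , m , e)) (inj₁ e') ne i j = old≢₂ (var-old m (in-old m e i)) (in-top e' j)
      ctx′ (inj₂ (x , m , e)) (inj₂ (x' , m' , e')) ne i j = dj-var Q m m' (λ { refl → ne (trans e (sym e')) }) (in-old m e i) (in-old m' e' j)

  Cross-top : xs' ⊑ xs → ys' ⊑ xs → xs' # ys' → Image r xs' zs → (∀ {z} → z ∈ ws → z ≡ top ⊎ ∃[ x ] (x ∈ ys' × z ≡ r x)) → Cross G₁ M T zs n C ws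
  Cross-top {xs'} {ys'} {zs} {ws} ix iy d im f i j = go (Reg-place (at-new at-M proj₁ ix) im i) j
    where
      go : ∀ {z} → In z M T ⊎ ∃[ x ] (x ∈ xs' × In z (r x) (g x)) → Reg G₁ n C ws z → ⊥
      go (inj₁ i) (in-goal j) = old≢₁ (goal-old j) i
      go (inj₂ (x , m , i)) (in-goal j) = dj-goal Q (ix m) i j
      go i (in-ctx m j) with f m
      go (inj₁ i) (in-ctx m j) | inj₁ refl = new≢ i (≡subst (In _ top) (at-root T at-top) j)
      go (inj₂ (x , m' , i)) (in-ctx m j) | inj₁ refl = old≢₂ (var-old (ix m') i) (≡subst (In _ top) (at-root T at-top) j)
      go (inj₁ i) (in-ctx m j) | inj₂ (x , mx , e) = old≢₁ (var-old (iy mx) (In-image old (iy mx) e j)) i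
      go (inj₂ (x' , m' , i)) (in-ctx m j) | inj₂ (x , mx , e) =
        dj-var Q (ix m') (iy mx) (λ { refl → d m' mx }) i (In-image old (iy mx) e j)

  -- Once the cut is eliminated only the old sequent is left. Its region lies below `M`, where `G₁`
  -- and `G` agree.
  back : Image r xs (FV t) → Nf G₁ n C t → Lin t → Nf G n C t
  back im W l = Nf-ext W (λ i → agree (case Reg-place old im i of λ { (inj₁ j) → goal-old j ; (inj₂ (x , m , j)) → var-old m j })) l

  back-≐ : Image r xs (FV t) → G₁ ⊩ t ≐ s ∶ A → G ⊩ t ≐ s ∶ A
  back-≐ im p = ≐-ext (λ m → case im m of λ (x , mx , e) → agree (var-old mx (≡subst (λ k → In k (r x) (g x)) (sym e) (in-root (r x) (g x))))) p

module _ {t s : Tm} {A B : Ty} {ρ : Subst} {r : ℕ → ℕ} {N : ℕ} {G g : ℕ → Ty} {n : ℕ} (l : Lin (app t s)) (P : Ren ρ r (FV (app t s)) N) (b : Below (app t s) N)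
         (Q : Place G g r (FV (app t s)) n B) (M : ℕ) (goal< : n + ∥ B ∥ ≤ M)
         (vars< : ∀ {x} → x ∈ FV (app t s) → r x + ∥ g x ∥ ≤ M) where
  open Extend Q M goal< vars< (A ⊸ B)

  -- The function is normalised with goal `M`, the argument with the domain of `top` as goal. A left
  -- rule on the hypothesis `top`, continued by the expanded identity from the codomain of `top` to
  -- `n`, is cut against the function.
  normalise-app : Normal G₁ g r ρ t M (A ⊸ B) → Normal G₁ g r ρ s (suc top) A → Normal G g r ρ (app t s) n B
  normalise-app I J = record
    { nf = back im-w (proj₁ (proj₂ cutted)) lw ; fvs = fvs-w ; lin = lw
    ; eq = back-≐ im-0 (≐-trans l₀ l₁ (++-≋ I.fvs J.fvs) (≐-app l₀ I.eq J.eq)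
             (≐-trans l₁ l₂ (proj₂ (proj₂ e₂)) (proj₁ e₂) (≈⇒≐ rr l₂ ty₂)))
    ; rel = rel′ }
    where
      module I = Normal I
      module J = Normal J
      y' = rt top A
      K : Identity G₁ B y' n
      K = identity B y' n (proj₂ (proj₂ at-top)) (at-goal old) (λ i j → old≢₂ (goal-old j) (in-r A B i))
      module K = Identity K
      bt : Below t N
      bt m = b (case ∈++ (FV t) m of λ { (inj₁ i) → inl (inl i) ; (inj₂ i) → inr (FV t ++ FV s) (inl i) })
      bs : Below s N
      bs m = b (case ∈++ (FV s) m of λ { (inj₁ i) → inl (inr (FV t) i) ; (inj₂ i) → inr (FV t ++ FV s) (inr (BV t) i) })
      im-t : Image r (FV t) (FV I.tm)
      im-t = normal-image (Ren-⊑ inl P) bt I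
      im-s : Image r (FV s) (FV J.tm)
      im-s = normal-image (Ren-⊑ (inr (FV t)) P) bs J
      l₀ : Lin (app (subst ρ t) (subst ρ s))
      l₀ = ren-Lin {s = app t s} P b l Q
      l₁ : Lin (app I.tm J.tm)
      l₁ = I.lin , J.lin , #-≋ I.fvs J.fvs (proj₂ (proj₂ l₀))
      U = app (lam y' K.tm) (app (var top) J.tm)
      top∉s : top ∉ FV J.tm
      top∉s = top∉ (λ m → case im-s m of λ (x , mx , e) → x , inr (FV t) mx , e)
      none : ∀ {z} → z ∈ FV K.tm ─ y' → ⊥
      none m = case ∈─⁻ {xs = FV K.tm} m of λ (i , ne) → ne (∈1 (proj₁ K.fvs i))
      lU : Lin U
      lU = (K.lin , proj₂ K.fvs (here refl)) , (tt , J.lin , λ { (here refl) m → top∉s m }) , λ i _ → none i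
      fU : ∀ {z} → z ∈ FV U → z ≡ top ⊎ ∃[ x ] (x ∈ FV s × z ≡ r x)
      fU m with ∈++ (FV K.tm ─ y') m
      ... | inj₁ i = ⊥-elim (none i)
      ... | inj₂ (here e) = inj₁ e
      ... | inj₂ (there i) = inj₂ (im-s i)
      fU′ : ∀ {z} → z ∈ FV U → z ≡ top ⊎ ∃[ x ] (x ∈ FV t ++ FV s × z ≡ r x)
      fU′ m = case fU m of λ { (inj₁ e) → inj₁ e ; (inj₂ (x , mx , e)) → inj₂ (x , inr (FV t) mx , e) }
      lc : Lin (app (lam top U) I.tm)
      lc = (lU , inr (FV K.tm ─ y') (here refl)) , I.lin , λ i j → case ∈─⁻ {xs = FV U} i of λ (i , ne) → case fU i of λ
        { (inj₁ e) → ne e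
        ; (inj₂ (x , mx , e)) → case im-t j of λ (x' , mx' , e') →
            r-inj Q (inr (FV t) mx) (inl mx') (λ { refl → proj₂ (proj₂ l) mx' mx }) (trans (sym e) e') }
      cutted : ∃[ w ] (Nf G₁ n B w × w ≈ app (lam top U) I.tm)
      cutted = cut (A ⊸ B) I.nf (napp (proj₁ at-top) (at-root B (proj₂ (proj₂ at-top))) J.nf K.nf) (proj₁ at-top) (inr (FV K.tm ─ y') (here refl))
        (Sep-place (at-new at-M proj₁ inl) im-t) (Sep-top fU′) (Cross-top inl (inr (FV t)) (proj₂ (proj₂ l)) im-t fU) lc
      W = proj₁ cutted
      rr : app (lam y' K.tm) (app I.tm J.tm) ≈ W
      rr = ≈-trans (cut-app lc) (≈-sym (proj₂ (proj₂ cutted)))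
      lw : Lin W
      lw = proj₂ (≈-Lin (proj₂ (proj₂ cutted))) lc
      ty₁ : G₁ ⊩ app I.tm J.tm ∶ B
      ty₁ = ⊩app (Nf-⊩ I.nf) (Nf-⊩ J.nf)
      e₂ = id-cut K (at-root B (proj₂ (proj₂ at-top))) l₁ ty₁
      l₂ = proj₁ (proj₂ e₂)
      ty₂ : G₁ ⊩ app (lam y' K.tm) (app I.tm J.tm) ∶ B
      ty₂ = ≈-⊩← rr (Nf-⊩ (proj₁ (proj₂ cutted)))
      fvs-w : FV (app (subst ρ t) (subst ρ s)) ≋ FV W
      fvs-w = ≋-trans (++-≋ I.fvs J.fvs) (≋-trans (proj₂ (proj₂ e₂)) (≈-FV rr))
      im-0 : Image r (FV t ++ FV s) (FV (app (subst ρ t) (subst ρ s)))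
      im-0 = ren-image {s = app t s} P b
      im-w : Image r (FV t ++ FV s) (FV W)
      im-w m = im-0 (proj₂ fvs-w m)
      rel′ : ∀ σ σ' → Related g r (FV t ++ FV s) σ σ' → R B (subst σ (app t s)) (subst σ' W)
      rel′ σ σ' q = R-≈ B ≈-refl
          (≈-trans (≈-sym (β-env K.tm (K.lin , proj₂ K.fvs (here refl)) (env (closed′ q) (λ m → ⊥-elim (none m))) ce))
            (subst-≈ σ' rr l₂ (Related-Env′ q (λ m → im-w (proj₁ (≈-FV rr) m)))))
          (K.rel _ (Env-⊑ (λ { (here e) → here e }) (Env-look [] (env (closed′ q) (λ ())) ce)) (≡subst (R B _) (sym (look-here y' _ σ')) rb))
        where
          rb : R B (subst σ t · subst σ s) (subst σ' I.tm · subst σ' J.tm)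
          rb = proj₂ (proj₂ (I.rel σ σ' (Related-⊑ inl q))) _ _ (J.rel σ σ' (Related-⊑ (inr (FV t)) q))
          ce = proj₂ (R-Cl B rb)

module _ {x y : ℕ} {s t : Tm} {A B C : Ty} {ρ : Subst} {r : ℕ → ℕ} {N : ℕ} {G g : ℕ → Ty} {n : ℕ} (l : Lin (letp x y s t)) (P : Ren ρ r (FV (letp x y s t)) N) (b : Below (letp x y s t) N) (le : N ≤ n)
         (Q : Place G g r (FV (letp x y s t)) n C) (M : ℕ) (leM : N ≤ M) (goal< : n + ∥ C ∥ ≤ M)
         (vars< : ∀ {z} → z ∈ FV (letp x y s t) → r z + ∥ g z ∥ ≤ M) where
  open Extend Q M goal< vars< (A ⊗ B)

  private
    q₁ = suc top
    q₂ = rt top A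
    xs₂ = (FV t ─ x) ─ y
    N≤top : N ≤ top
    N≤top = ℕ.≤-trans leM (ℕ.m≤m+n M _)
    N≤q₁ : N ≤ q₁
    N≤q₁ = ℕ.≤-trans N≤top (ℕ.n≤1+n top)
    N≤q₂ : N ≤ q₂
    N≤q₂ = ℕ.≤-trans (ℕ.≤-trans N≤top (ℕ.m≤m+n top ∥ A ∥)) (ℕ.n≤1+n _)

  let-Ren : Ren ((x , var q₁) ∷ (y , var q₂) ∷ ρ) (updN (updN r y q₂) x q₁) (FV t) N
  let-Ren = Ren-bind (FV t) (Ren-bind (FV t ─ x) (Ren-⊑ (inr (FV s)) P) N≤q₂) N≤q₁

  private
    q₂-Place : Place G₁ (upd g y B) (updN r y q₂) (FV t ─ x) n C
    q₂-Place = Place-bind (FV t ─ x) (Place-⊑ (inr (FV s)) old) (proj₂ (proj₂ at-top))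
      (λ i j → old≢₂ (goal-old j) (in-r A B i)) (λ m i j → old≢₂ (var-old (inr (FV s) m) j) (in-r A B i))

    q₁-dj : ∀ {z} → z ∈ FV t ─ x → Disj q₁ A (updN r y q₂ z) (upd g y B z)
    q₁-dj {z} m i j with z ≟ y
    ... | yes _ = in-lr {n = top} A B i j
    ... | no ne = old≢₂ (var-old (inr (FV s) (∈─⁺ m ne)) j) (in-l A B i)

  let-Place : Place G₁ (upd (upd g y B) x A) (updN (updN r y q₂) x q₁) (FV t) n C
  let-Place = Place-bind (FV t) q₂-Place (proj₁ (proj₂ at-top)) (λ i j → old≢₂ (goal-old j) (in-l A B i)) q₁-dj

  -- As for application, with the left rule for `⊗`. The variables `x` and `y` are placed at the two
  -- components of `top`, so the form of the body is already the premise of that rule.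
  normalise-let : upd (upd g y B) x A ⊩ t ∶ C → g ⊩ s ∶ A ⊗ B → Normal G₁ g r ρ s M (A ⊗ B) →
    Normal G₁ (upd (upd g y B) x A) (updN (updN r y q₂) x q₁) ((x , var q₁) ∷ (y , var q₂) ∷ ρ) t n C → Normal G g r ρ (letp x y s t) n C
  normalise-let Et Es I J = record
    { nf = back im-w (proj₁ (proj₂ cutted)) lw ; fvs = fvs-w ; lin = lw
    ; eq = back-≐ im-0 (≐-trans l₀ l₁ (≈-FV al) (≈⇒≐ al l₀ (ren-⊩ {s = letp x y s t} P b old (⊩let Es Et)))
             (≐-trans l₁ l₂ fv₁₂ (≐-let l₁ I.eq (≐-ext (λ {z} _ → sym (upd₂-self z)) J.eq)) (≈⇒≐ rr l₂ ty₂)))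
    ; rel = rel′ }
    where
      module I = Normal I
      module J = Normal J
      a₁ = at-root A (proj₁ (proj₂ at-top))
      a₂ = at-root B (proj₂ (proj₂ at-top))
      upd₂-self : upd (upd G₁ q₂ B) q₁ A ≗ G₁
      upd₂-self z = trans (upd-≗ q₁ A (upd-self a₂) z) (upd-self a₁ z)
      bs : Below s N
      bs m = b (case ∈++ (FV s) m of λ { (inj₁ i) → inl (inl i) ; (inj₂ i) → inr (FV s ++ xs₂) (there (there (inl i))) })
      x≢y = proj₁ (proj₂ (proj₂ (proj₂ (proj₂ l))))
      d = proj₂ (proj₂ (proj₂ (proj₂ (proj₂ l))))
      im-s : Image r (FV s) (FV I.tm)
      im-s = normal-image (Ren-⊑ inl P) bs I
      fresh₂ : ∀ {z} → z ∈ xs₂ → r z ≢ q₁ × r z ≢ q₂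
      fresh₂ {z} m = (λ e → old≢₂ (lt m) (in-l A B (≡subst (λ k → In k q₁ A) (sym e) (in-root q₁ A)))) ,
                     (λ e → old≢₂ (lt m) (in-r A B (≡subst (λ k → In k q₂ B) (sym e) (in-root q₂ B))))
        where lt : z ∈ xs₂ → r z < M
              lt m = var-old (inr (FV s) m) (in-root (r z) (g z))
      al : subst ρ (letp x y s t) ≈ letp q₁ q₂ (subst ρ s) (subst ((x , var q₁) ∷ (y , var q₂) ∷ ρ) t)
      al = α-let-ren l P b N≤q₁ N≤q₂ (l≢r top A) Q fresh₂
      l₀ = ren-Lin {s = letp x y s t} P b l Q
      l₁ = proj₁ (≈-Lin al) l₀
      L' = letp q₁ q₂ I.tm J.tm
      fv₁₂ : FV (letp q₁ q₂ (subst ρ s) (subst ((x , var q₁) ∷ (y , var q₂) ∷ ρ) t)) ≋ FV L'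
      fv₁₂ = ++-≋ I.fvs (─-≋ q₂ (─-≋ q₁ J.fvs))
      l₂ : Lin L'
      l₂ = I.lin , J.lin , proj₁ J.fvs (proj₁ (proj₂ (proj₂ l₁))) , proj₁ J.fvs (proj₁ (proj₂ (proj₂ (proj₂ l₁)))) , l≢r top A ,
           #-≋ I.fvs (─-≋ q₂ (─-≋ q₁ J.fvs)) (proj₂ (proj₂ (proj₂ (proj₂ (proj₂ l₁)))))
      im-0 : Image r (FV (letp x y s t)) (FV (subst ρ (letp x y s t)))
      im-0 = ren-image {s = letp x y s t} P b
      im-L : Image r (FV (letp x y s t)) (FV L')
      im-L m = im-0 (proj₂ (≋-trans (≈-FV al) fv₁₂) m)
      im-t : Image r xs₂ ((FV J.tm ─ q₁) ─ q₂)
      im-t m = case ∈++ (FV s) (proj₁ (proj₂ iL)) of λ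
          { (inj₂ i) → proj₁ iL , i , proj₂ (proj₂ iL)
          ; (inj₁ i) → ⊥-elim (proj₂ (proj₂ (proj₂ (proj₂ (proj₂ l₂)))) (proj₁ I.fvs (≡subst (_∈ FV (subst ρ s)) (sym (proj₂ (proj₂ iL))) (ren-in {s = s} (Ren-⊑ inl P) bs i))) m) }
        where iL = im-L (inr (FV I.tm) m)
      U = letp q₁ q₂ (var top) J.tm
      fU : ∀ {z} → z ∈ FV U → z ≡ top ⊎ ∃[ k ] (k ∈ xs₂ × z ≡ r k)
      fU (here e) = inj₁ e
      fU (there m) = inj₂ (im-t m)
      fU′ : ∀ {z} → z ∈ FV U → z ≡ top ⊎ ∃[ k ] (k ∈ FV s ++ xs₂ × z ≡ r k)
      fU′ m = case fU m of λ { (inj₁ e) → inj₁ e ; (inj₂ (k , mk , e)) → inj₂ (k , inr (FV s) mk , e) }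
      lU : Lin U
      lU = tt , J.lin , proj₁ (proj₂ (proj₂ l₂)) , proj₁ (proj₂ (proj₂ (proj₂ l₂))) , l≢r top A ,
           λ { (here refl) m → top∉ (λ m → case im-t m of λ (k , mk , e) → k , inr (FV s) mk , e) m }
      lc : Lin (app (lam top U) I.tm)
      lc = (lU , here refl) , I.lin , λ i j → case ∈─⁻ {xs = FV U} i of λ (i , ne) → case fU i of λ
        { (inj₁ e) → ne e
        ; (inj₂ (k , mk , e)) → case im-s j of λ (k' , mk' , e') → r-inj Q (inr (FV s) mk) (inl mk') (λ { refl → d mk' mk }) (trans (sym e) e') }
      cutted : ∃[ w ] (Nf G₁ n C w × w ≈ app (lam top U) I.tm)
      cutted = cut (A ⊗ B) I.nf (nlet (proj₁ at-top) a₁ a₂ J.nf) (proj₁ at-top) (here refl)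
        (Sep-place (at-new at-M proj₁ inl) im-s) (Sep-top fU′) (Cross-top inl (inr (FV s)) d im-s fU) lc
      W = proj₁ cutted
      q∉ : ∀ {q} → In q top (A ⊗ B) → q ∉ FV I.tm
      q∉ i m = case im-s m of λ (k , mk , e) → old≢₂ (var-old (inl mk) (≡subst (λ j → In j (r k) (g k)) (sym e) (in-root (r k) (g k)))) i
      rr : L' ≈ W
      rr = ≈-trans (cut-let suc≢ (rt≢ top A) (q∉ (in-l A B (in-root q₁ A))) (q∉ (in-r A B (in-root q₂ B))) lc) (≈-sym (proj₂ (proj₂ cutted)))
      lw : Lin W
      lw = proj₁ (≈-Lin rr) l₂
      ty₂ : G₁ ⊩ L' ∶ C
      ty₂ = ≈-⊩← rr (Nf-⊩ (proj₁ (proj₂ cutted)))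
      fvs-w : FV (subst ρ (letp x y s t)) ≋ FV W
      fvs-w = ≋-trans (≈-FV al) (≋-trans fv₁₂ (≈-FV rr))
      im-w : Image r (FV (letp x y s t)) (FV W)
      im-w m = im-0 (proj₂ fvs-w m)
      rel′ : ∀ σ σ' → Related g r (FV (letp x y s t)) σ σ' → R C (subst σ (letp x y s t)) (subst σ' W)
      rel′ σ σ' q = case I.rel σ σ' (Related-⊑ inl q) of λ (c , c' , u , v , u' , v' , p , p' , ru , rv) →
        R-≈ C (≈-sym (βp-env s t l (Related-Env q) p (proj₁ (R-Cl A ru)) (proj₁ (R-Cl B rv))))
          (≈-trans (≈-sym (βp-env I.tm J.tm l₂ (Related-Env′ q im-L) p' (proj₂ (R-Cl A ru)) (proj₂ (R-Cl B rv))))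
                   (subst-≈ σ' rr l₂ (Related-Env′ q im-L)))
          (J.rel _ _ (Related-bind (FV t) (Related-bind (FV t ─ x) (Related-⊑ (inr (FV s)) q) (λ m → proj₂ (fresh₂ m)) rv) fresh₁ ru))
        where
          fresh₁ : ∀ {z} → z ∈ FV t ─ x → updN r y q₂ z ≢ q₁
          fresh₁ {z} m e with z ≟ y
          ... | yes _ = l≢r top A (sym e)
          ... | no ne = proj₁ (fresh₂ (∈─⁺ m ne)) e

normalise : g ⊩ s ∶ A → Lin s → Below s N → N ≤ n → Ren ρ r (FV s) N → Place G g r (FV s) n A → Normal G g r ρ s n A
normalise (⊩var refl) l b le P Q = normalise-var P Q
normalise {s = lam x s} (⊩lam E) l b le P Q = normalise-lam l P b le Q E
  (normalise E (proj₁ l) b′ (ℕ.≤-trans le (ℕ.≤-trans (ℕ.m≤m+n _ _) (ℕ.n≤1+n _))) (Ren-bind (FV s) P (ℕ.≤-trans le (ℕ.n≤1+n _))) (lam-Place l P b le Q))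
  where
    b′ : Below s _
    b′ {z} m with ∈++ (FV s) m | z ≟ x
    ... | inj₂ i | _ = b (inr (FV s ─ x) (there i))
    ... | inj₁ i | yes refl = b (inr (FV s ─ x) (here refl))
    ... | inj₁ i | no ne = b (inl (∈─⁺ i ne))
normalise {g} {s = pair s t} (⊩pair E E') l b le P Q = normalise-pair l P b Q
  (normalise E (proj₁ l) (λ m → b (case ∈++ (FV s) m of λ { (inj₁ i) → inl (inl i) ; (inj₂ i) → inr (FV s ++ FV t) (inl i) }))
    (ℕ.≤-trans le (ℕ.n≤1+n _)) (Ren-⊑ inl P)
    (record { at-var = at-var Q ∘ inl ; at-goal = proj₁ (proj₂ (at-goal Q)) ; dj-var = λ p q → dj-var Q (inl p) (inl q) ; dj-goal = λ m i j → dj-goal Q (inl m) i (in-l _ _ j) }))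
  (normalise E' (proj₁ (proj₂ l)) (λ m → b (case ∈++ (FV t) m of λ { (inj₁ i) → inl (inr (FV s) i) ; (inj₂ i) → inr (FV s ++ FV t) (inr (BV s) i) }))
    (ℕ.≤-trans le (ℕ.≤-trans (ℕ.m≤m+n _ _) (ℕ.n≤1+n _))) (Ren-⊑ (inr (FV s)) P)
    (record { at-var = at-var Q ∘ inr (FV s) ; at-goal = proj₂ (proj₂ (at-goal Q)) ; dj-var = λ p q → dj-var Q (inr (FV s) p) (inr (FV s) q)
            ; dj-goal = λ m i j → dj-goal Q (inr (FV s) m) i (in-r _ _ j) }))
normalise {g} {s = app t s} {N = N} {n = n} {r = r} (⊩app {A = A} {B = B} E E') l b le P Q =
  case fresh-block (FV t ++ FV s) r g N n B of λ (M , leM , gM , vM) →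
    let open Extend Q M gM vM (A ⊸ B) in
    normalise-app l P b Q M gM vM
      (normalise E (proj₁ l) (λ m → b (case ∈++ (FV t) m of λ { (inj₁ i) → inl (inl i) ; (inj₂ i) → inr (FV t ++ FV s) (inl i) }))
         leM (Ren-⊑ inl P) (at-new at-M proj₁ inl))
      (normalise E' (proj₁ (proj₂ l)) (λ m → b (case ∈++ (FV s) m of λ { (inj₁ i) → inl (inr (FV t) i) ; (inj₂ i) → inr (FV t ++ FV s) (inr (BV t) i) }))
         (ℕ.≤-trans (ℕ.≤-trans leM (ℕ.m≤m+n M _)) (ℕ.n≤1+n _)) (Ren-⊑ (inr (FV t)) P)
         (at-new (proj₁ (proj₂ at-top)) (λ i → ℕ.≤-trans (ℕ.m≤m+n M _) (new₂ (in-l A B i))) (inr (FV t))))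
normalise {g} {s = letp x y s t} {N = N} {n = n} {r = r} (⊩let {A = A} {B = B} {C = C} E E') l b le P Q =
  case fresh-block (FV (letp x y s t)) r g N n C of λ (M , leM , gM , vM) →
    let open Extend Q M gM vM (A ⊗ B) in
    normalise-let l P b le Q M leM gM vM E' E
      (normalise E (proj₁ l) (λ m → b (case ∈++ (FV s) m of λ { (inj₁ i) → inl (inl i) ; (inj₂ i) → inr (FV s ++ ((FV t ─ x) ─ y)) (there (there (inl i))) }))
         leM (Ren-⊑ inl P) (at-new at-M proj₁ inl))
      (normalise E' (proj₁ (proj₂ l)) b′ le (let-Ren l P b le Q M leM gM vM) (let-Place l P b le Q M leM gM vM))
  where
    b′ : Below t _
    b′ {z} m with ∈++ (FV t) m | z ≟ x | z ≟ y
    ... | inj₂ i | _ | _ = b (inr (FV s ++ ((FV t ─ x) ─ y)) (there (there (inr (BV s) i))))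
    ... | inj₁ i | yes refl | _ = b (inr (FV s ++ ((FV t ─ x) ─ y)) (here refl))
    ... | inj₁ i | no _ | yes refl = b (inr (FV s ++ ((FV t ─ x) ─ y)) (there (here refl)))
    ... | inj₁ i | no n₁ | no n₂ = b (inl (inr (FV s) (∈─⁺ (∈─⁺ i n₁) n₂)))

-- Unification and principal types

Eqs : Set
Eqs = List (Ty × Ty)

Unifies : TySub → Eqs → Set
Unifies θ = All λ (A , B) → tsub θ A ≡ tsub θ B

data Occurs (a : ℕ) : Ty → Set where
  o-tv : Occurs a (tv a)
  o-⊗l : Occurs a A → Occurs a (A ⊗ B)
  o-⊗r : Occurs a B → Occurs a (A ⊗ B)
  o-⊸l : Occurs a A → Occurs a (A ⊸ B)
  o-⊸r : Occurs a B → Occurs a (A ⊸ B)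

occurs? : ∀ a A → Dec (Occurs a A)
occurs? a (tv b) with a ≟ b
... | yes refl = yes o-tv
... | no ne = no λ { o-tv → ne refl }
occurs? a (A ⊗ B) = map′ (λ { (inj₁ o) → o-⊗l o ; (inj₂ o) → o-⊗r o }) (λ { (o-⊗l o) → inj₁ o ; (o-⊗r o) → inj₂ o }) (occurs? a A ⊎-dec occurs? a B)
occurs? a (A ⊸ B) = map′ (λ { (inj₁ o) → o-⊸l o ; (inj₂ o) → o-⊸r o }) (λ { (o-⊸l o) → inj₁ o ; (o-⊸r o) → inj₂ o }) (occurs? a A ⊎-dec occurs? a B)

tsub-cong : ∀ {θ φ : TySub} A → (∀ {a} → Occurs a A → θ a ≡ φ a) → tsub θ A ≡ tsub φ A
tsub-cong (tv a) e = e o-tv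
tsub-cong (A ⊗ B) e = cong₂ _⊗_ (tsub-cong A (e ∘ o-⊗l)) (tsub-cong B (e ∘ o-⊗r))
tsub-cong (A ⊸ B) e = cong₂ _⊸_ (tsub-cong A (e ∘ o-⊸l)) (tsub-cong B (e ∘ o-⊸r))

tsub-∘ : ∀ θ φ A → tsub θ (tsub φ A) ≡ tsub (tsub θ ∘ φ) A
tsub-∘ θ φ (tv a) = refl
tsub-∘ θ φ (A ⊗ B) = cong₂ _⊗_ (tsub-∘ θ φ A) (tsub-∘ θ φ B)
tsub-∘ θ φ (A ⊸ B) = cong₂ _⊸_ (tsub-∘ θ φ A) (tsub-∘ θ φ B)

occurs-size : ∀ θ A → Occurs a A → ∥ θ a ∥ ≤ ∥ tsub θ A ∥
occurs-size θ (tv a) o-tv = ℕ.≤-refl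
occurs-size θ (A ⊗ B) (o-⊗l o) = ℕ.≤-trans (occurs-size θ A o) (ℕ.≤-trans (ℕ.m≤m+n _ _) (ℕ.n≤1+n _))
occurs-size θ (A ⊗ B) (o-⊗r o) = ℕ.≤-trans (occurs-size θ B o) (ℕ.≤-trans (ℕ.m≤n+m _ ∥ tsub θ A ∥) (ℕ.n≤1+n _))
occurs-size θ (A ⊸ B) (o-⊸l o) = ℕ.≤-trans (occurs-size θ A o) (ℕ.≤-trans (ℕ.m≤m+n _ _) (ℕ.n≤1+n _))
occurs-size θ (A ⊸ B) (o-⊸r o) = ℕ.≤-trans (occurs-size θ B o) (ℕ.≤-trans (ℕ.m≤n+m _ ∥ tsub θ A ∥) (ℕ.n≤1+n _))

proper-occurs : ∀ θ A B → Occurs a (A ⊸ B) → ∥ θ a ∥ < ∥ tsub θ (A ⊸ B) ∥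
proper-occurs θ A B (o-⊸l o) = s≤s (ℕ.≤-trans (occurs-size θ A o) (ℕ.m≤m+n _ _))
proper-occurs θ A B (o-⊸r o) = s≤s (ℕ.≤-trans (occurs-size θ B o) (ℕ.m≤n+m _ ∥ tsub θ A ∥))

-- The two types have the same size, so the occurs check for `⊸` also settles `⊗`.
⊗⇒⊸ : Occurs a (A ⊗ B) → Occurs a (A ⊸ B)
⊗⇒⊸ (o-⊗l o) = o-⊸l o
⊗⇒⊸ (o-⊗r o) = o-⊸r o

weight : TySub → Eqs → ℕ
weight θ []            = 0
weight θ ((A , B) ∷ E) = ∥ tsub θ A ∥ + weight θ E

MGU : Eqs → Set
MGU E = ∃[ μ ] (Unifies μ E × (∀ θ → Unifies θ E → ∃[ φ ] (∀ a → θ a ≡ tsub φ (μ a))))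

_↦_ : ℕ → Ty → TySub
_↦_ = upd tv

map₂ : (Ty → Ty) → Eqs → Eqs
map₂ f = List.map λ (A , B) → f A , f B

-- A unifier of `tv a` and `T` already factors through `a ↦ T`. Eliminating `a` thus affects neither
-- the unifier nor the weight of the remaining equations.
absorb : ∀ θ a T → θ a ≡ tsub θ T → ∀ X → tsub θ (tsub (a ↦ T) X) ≡ tsub θ X
absorb θ a T e X = trans (tsub-∘ θ (a ↦ T) X) (tsub-cong X λ {b} _ → go b)
  where
    go : ∀ b → tsub θ ((a ↦ T) b) ≡ θ b
    go b with b ≟ a
    ... | yes refl = sym e
    ... | no _ = refl

absorb-unifies : ∀ θ a T E → θ a ≡ tsub θ T → Unifies θ E → Unifies θ (map₂ (tsub (a ↦ T)) E)
absorb-unifies θ a T [] e [] = []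
absorb-unifies θ a T ((A , B) ∷ E) e (u ∷ us) = trans (absorb θ a T e A) (trans u (sym (absorb θ a T e B))) ∷ absorb-unifies θ a T E e us

absorb-weight : ∀ θ a T E → θ a ≡ tsub θ T → weight θ (map₂ (tsub (a ↦ T)) E) ≡ weight θ E
absorb-weight θ a T [] e = refl
absorb-weight θ a T ((A , B) ∷ E) e = cong₂ _+_ (cong ∥_∥ (absorb θ a T e A)) (absorb-weight θ a T E e)

unabsorb : ∀ μ a T E → Unifies μ (map₂ (tsub (a ↦ T)) E) → Unifies (tsub μ ∘ (a ↦ T)) E
unabsorb μ a T [] [] = []
unabsorb μ a T ((A , B) ∷ E) (u ∷ us) = trans (sym (tsub-∘ μ (a ↦ T) A)) (trans u (tsub-∘ μ (a ↦ T) B)) ∷ unabsorb μ a T E us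

eliminate : ∀ a T E → ¬ Occurs a T → MGU (map₂ (tsub (a ↦ T)) E) → MGU ((tv a , T) ∷ E)
eliminate a T E no-a (μ , u , least) = (tsub μ ∘ (a ↦ T)) , (eq ∷ unabsorb μ a T E u) , general
  where
    eq : tsub μ ((a ↦ T) a) ≡ tsub (tsub μ ∘ (a ↦ T)) T
    eq = trans (cong (tsub μ) (upd-same tv a T)) (tsub-cong T λ {b} o → cong (tsub μ) (sym (upd-other tv a T (λ { refl → no-a o }))))
    general : ∀ θ → Unifies θ ((tv a , T) ∷ E) → ∃[ φ ] (∀ b → θ b ≡ tsub φ (tsub μ ((a ↦ T) b)))
    general θ (e ∷ us) = case least θ (absorb-unifies θ a T E e us) of λ (φ , f) → φ , λ b →
      sym (trans (tsub-∘ φ μ ((a ↦ T) b)) (trans (tsub-cong ((a ↦ T) b) (λ {c} _ → sym (f c))) (absorb θ a T e (tv b))))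

MGU-map : ∀ {E E'} → (∀ {θ} → Unifies θ E → Unifies θ E') → (∀ {θ} → Unifies θ E' → Unifies θ E) → MGU E → MGU E'
MGU-map f f' (μ , u , least) = μ , f u , λ θ u' → least θ (f' u')

⊗-inj : ∀ {A B C D : Ty} → A ⊗ B ≡ C ⊗ D → A ≡ C × B ≡ D
⊗-inj refl = refl , refl

⊸-inj : ∀ {A B C D : Ty} → A ⊸ B ≡ C ⊸ D → A ≡ C × B ≡ D
⊸-inj refl = refl , refl

-- A given unifier bounds the search: the size of its image of the equations
-- decreases, also when a variable is eliminated.
unify : ∀ k E θ → Unifies θ E → weight θ E < k → MGU E
unify (suc k) [] θ u lt = tv , [] , λ φ _ → φ , λ a → refl
unify (suc k) ((tv a , T) ∷ E) θ (e ∷ u) (s≤s lt) with occurs? a T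
... | no n = eliminate a T E n (unify k _ θ (absorb-unifies θ a T E e u)
       (≡subst (_< k) (sym (absorb-weight θ a T E e)) (ℕ.<-≤-trans (ℕ.m<n+m (weight θ E) (∥∥>0 (θ a))) lt)))
... | yes o-tv = MGU-map (refl ∷_) (λ { (_ ∷ u) → u }) (unify k E θ u (ℕ.<-≤-trans (ℕ.m<n+m (weight θ E) (∥∥>0 (θ a))) lt))
... | yes o@(o-⊸l _) = ⊥-elim (ℕ.<-irrefl (cong ∥_∥ e) (proper-occurs θ _ _ o))
... | yes o@(o-⊸r _) = ⊥-elim (ℕ.<-irrefl (cong ∥_∥ e) (proper-occurs θ _ _ o))
... | yes o@(o-⊗l _) = ⊥-elim (ℕ.<-irrefl (cong ∥_∥ e) (proper-occurs θ _ _ (⊗⇒⊸ o)))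
... | yes o@(o-⊗r _) = ⊥-elim (ℕ.<-irrefl (cong ∥_∥ e) (proper-occurs θ _ _ (⊗⇒⊸ o)))
unify (suc k) ((T@(A ⊗ B) , tv a) ∷ E) θ (e ∷ u) (s≤s lt) with occurs? a T
... | no n = MGU-map (λ { (e ∷ u) → sym e ∷ u }) (λ { (e ∷ u) → sym e ∷ u }) (eliminate a T E n (unify k _ θ (absorb-unifies θ a T E (sym e) u)
       (≡subst (_< k) (sym (absorb-weight θ a T E (sym e))) (ℕ.<-≤-trans (ℕ.m<n+m (weight θ E) (∥∥>0 (tsub θ T))) lt))))
... | yes o = ⊥-elim (ℕ.<-irrefl (cong ∥_∥ (sym e)) (proper-occurs θ _ _ (⊗⇒⊸ o)))
unify (suc k) ((T@(A ⊸ B) , tv a) ∷ E) θ (e ∷ u) (s≤s lt) with occurs? a T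
... | no n = MGU-map (λ { (e ∷ u) → sym e ∷ u }) (λ { (e ∷ u) → sym e ∷ u }) (eliminate a T E n (unify k _ θ (absorb-unifies θ a T E (sym e) u)
       (≡subst (_< k) (sym (absorb-weight θ a T E (sym e))) (ℕ.<-≤-trans (ℕ.m<n+m (weight θ E) (∥∥>0 (tsub θ T))) lt))))
... | yes o = ⊥-elim (ℕ.<-irrefl (cong ∥_∥ (sym e)) (proper-occurs θ _ _ o))
unify (suc k) ((A ⊗ B , C ⊗ D) ∷ E) θ (e ∷ u) (s≤s lt) =
  MGU-map (λ { (e ∷ e' ∷ u) → cong₂ _⊗_ e e' ∷ u }) (λ { (e ∷ u) → proj₁ (⊗-inj e) ∷ proj₂ (⊗-inj e) ∷ u })
    (unify k ((A , C) ∷ (B , D) ∷ E) θ (proj₁ (⊗-inj e) ∷ proj₂ (⊗-inj e) ∷ u)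
      (≡subst (_< k) (ℕ.+-assoc ∥ tsub θ A ∥ ∥ tsub θ B ∥ (weight θ E)) lt))
unify (suc k) ((A ⊸ B , C ⊸ D) ∷ E) θ (e ∷ u) (s≤s lt) =
  MGU-map (λ { (e ∷ e' ∷ u) → cong₂ _⊸_ e e' ∷ u }) (λ { (e ∷ u) → proj₁ (⊸-inj e) ∷ proj₂ (⊸-inj e) ∷ u })
    (unify k ((A , C) ∷ (B , D) ∷ E) θ (proj₁ (⊸-inj e) ∷ proj₂ (⊸-inj e) ∷ u)
      (≡subst (_< k) (ℕ.+-assoc ∥ tsub θ A ∥ ∥ tsub θ B ∥ (weight θ E)) lt))
unify (suc k) ((A ⊗ B , C ⊸ D) ∷ E) θ (() ∷ u) lt
unify (suc k) ((A ⊸ B , C ⊗ D) ∷ E) θ (() ∷ u) lt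

Bounded : ℕ → Ty → Set
Bounded N A = ∀ {a} → Occurs a A → a < N

Bounded-≤ : N ≤ M → Bounded N A → Bounded M A
Bounded-≤ le b o = ℕ.<-≤-trans (b o) le

BoundedE : ℕ → Eqs → Set
BoundedE N = All λ (A , B) → Bounded N A × Bounded N B

Agree : ℕ → TySub → TySub → Set
Agree N θ φ = ∀ a → a < N → θ a ≡ φ a

agree-Unifies : ∀ {θ φ E} → Agree N θ φ → BoundedE N E → Unifies θ E → Unifies φ E
agree-Unifies g [] [] = []
agree-Unifies g ((b , b') ∷ bs) (_∷_ {x = A , B} e u) =
  trans (sym (tsub-cong A (λ o → g _ (b o)))) (trans e (tsub-cong B (λ o → g _ (b' o)))) ∷ agree-Unifies g bs u

-- Fresh type variables are taken from `N` on. In `complete` a derivation fixes their values, so θ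
-- is kept below `N` and redefined above.
record Constraints (t : Tm) (h : ℕ → Ty) (T : Ty) (N : ℕ) : Set where
  field
    eqs      : Eqs
    next     : ℕ
    mono     : N ≤ next
    bounded  : BoundedE next eqs
    sound    : ∀ θ → Unifies θ eqs → (tsub θ ∘ h) ⊩ t ∶ tsub θ T
    complete : ∀ θ → (tsub θ ∘ h) ⊩ t ∶ tsub θ T → ∃[ φ ] (Agree N θ φ × Unifies φ eqs)
open Constraints

BoundedEnv : ℕ → (ℕ → Ty) → Set
BoundedEnv N h = ∀ x → Bounded N (h x)

bounded-tv : a < N → Bounded N (tv a)
bounded-tv lt o-tv = lt

bounded-⊗ : Bounded N A → Bounded N B → Bounded N (A ⊗ B)
bounded-⊗ p q (o-⊗l o) = p o
bounded-⊗ p q (o-⊗r o) = q o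

bounded-⊸ : Bounded N A → Bounded N B → Bounded N (A ⊸ B)
bounded-⊸ p q (o-⊸l o) = p o
bounded-⊸ p q (o-⊸r o) = q o

bounded-upd : BoundedEnv N h → Bounded N A → ∀ x → BoundedEnv N (upd h x A)
bounded-upd bh bA x z with z ≟ x
... | yes _ = bA
... | no _ = bh z

agree-upd : ∀ θ a A → Agree a θ (upd θ a A)
agree-upd θ a A b lt = sym (upd-other θ a A (ℕ.<⇒≢ lt))

agree-trans : ∀ {θ φ ψ} → N ≤ M → Agree N θ φ → Agree M φ ψ → Agree N θ ψ
agree-trans le p q a lt = trans (p a lt) (q a (ℕ.<-≤-trans lt le))

agree-tsub : ∀ {θ φ} → Agree N θ φ → Bounded N A → tsub θ A ≡ tsub φ A
agree-tsub {A = A} p b = tsub-cong A (λ o → p _ (b o))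

agree-⊩ : ∀ {θ φ} → Agree N θ φ → BoundedEnv N h → (tsub θ ∘ h) ⊩ t ∶ A → (tsub φ ∘ h) ⊩ t ∶ A
agree-⊩ p b = ⊩-≗ λ z → agree-tsub p (b z)

tsub-upd : ∀ θ h x A → upd (tsub θ ∘ h) x (tsub θ A) ≗ (tsub θ ∘ upd h x A)
tsub-upd θ h x A z with z ≟ x
... | yes _ = refl
... | no _ = refl

BoundedE-≤ : ∀ {E} → N ≤ M → BoundedE N E → BoundedE M E
BoundedE-≤ le = All.map λ (p , q) → Bounded-≤ le p , Bounded-≤ le q

⊩-≡ : A ≡ B → g ⊩ t ∶ A → g ⊩ t ∶ B
⊩-≡ refl p = p

module Assign (θ : TySub) (N : ℕ) (A B : Ty) where
  θ⁺ = upd (upd θ N A) (suc N) B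
  ag : Agree N θ θ⁺
  ag = agree-trans (ℕ.n≤1+n N) (agree-upd θ N A) (agree-upd (upd θ N A) (suc N) B)
  eN : θ⁺ N ≡ A
  eN = trans (upd-other {N} (upd θ N A) (suc N) B (λ ())) (upd-same θ N A)
  eN′ : θ⁺ (suc N) ≡ B
  eN′ = upd-same (upd θ N A) (suc N) B

constraints : ∀ t h T N → BoundedEnv N h → Bounded N T → Constraints t h T N

constraints₂ : ∀ t h T s h' T' N → BoundedEnv N h → Bounded N T → BoundedEnv N h' → Bounded N T' →
  ∃[ E ] ∃[ M ] (N ≤ M × BoundedE M E ×
    (∀ θ → Unifies θ E → ((tsub θ ∘ h) ⊩ t ∶ tsub θ T) × ((tsub θ ∘ h') ⊩ s ∶ tsub θ T')) ×
    (∀ θ → (tsub θ ∘ h) ⊩ t ∶ tsub θ T → (tsub θ ∘ h') ⊩ s ∶ tsub θ T' → ∃[ φ ] (Agree N θ φ × Unifies φ E)))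
constraints₂ t h T s h' T' N bh bT bh' bT' =
  eqs c₁ ++ eqs c₂ , next c₂ , ℕ.≤-trans (mono c₁) (mono c₂) ,
  AllP.++⁺ (BoundedE-≤ (mono c₂) (bounded c₁)) (bounded c₂) ,
  (λ θ u → sound c₁ θ (AllP.++⁻ˡ (eqs c₁) u) , sound c₂ θ (AllP.++⁻ʳ (eqs c₁) u)) ,
  -- The second extension changes nothing below `next c₁`, so it still solves the equations of the
  -- first term.
  λ θ p q → case complete c₁ θ p of λ (φ , a , u) →
    case complete c₂ φ (⊩-≡ (agree-tsub a bT') (agree-⊩ a bh' q)) of λ (ψ , a' , u') →
      ψ , agree-trans (mono c₁) a a' , AllP.++⁺ (agree-Unifies a' (bounded c₁) u) u'
  where
    c₁ = constraints t h T N bh bT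
    c₂ = constraints s h' T' (next c₁) (λ x → Bounded-≤ (mono c₁) (bh' x)) (Bounded-≤ (mono c₁) bT')

constraints (var x) h T N bh bT = record
  { eqs = (h x , T) ∷ [] ; next = N ; mono = ℕ.≤-refl ; bounded = (bh x , bT) ∷ []
  ; sound = λ { θ (e ∷ []) → ⊩var e } ; complete = λ { θ (⊩var e) → θ , (λ _ _ → refl) , e ∷ [] } }
constraints (app t s) h T N bh bT =
  case constraints₂ t h (tv N ⊸ T) s h (tv N) (suc N) bh⁺ (bounded-⊸ bN bT⁺) bh⁺ bN of λ (E , M , le , bE , snd , cmp) → record
  { eqs = E ; next = M ; mono = ℕ.≤-trans (ℕ.n≤1+n N) le ; bounded = bE
  ; sound = λ θ u → ⊩app (proj₁ (snd θ u)) (proj₂ (snd θ u))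
  ; complete = λ { θ (⊩app {A = A} p q) → let θ⁺ = upd θ N A ; ag = agree-upd θ N A in
      case cmp θ⁺ (⊩-≡ (cong₂ _⊸_ (sym (upd-same θ N A)) (agree-tsub ag bT)) (agree-⊩ ag bh p))
                  (⊩-≡ (sym (upd-same θ N A)) (agree-⊩ ag bh q)) of λ (φ , a , u) → φ , agree-trans (ℕ.n≤1+n N) ag a , u } }
  where
    bh⁺ : BoundedEnv (suc N) h
    bh⁺ x = Bounded-≤ (ℕ.n≤1+n N) (bh x)
    bT⁺ : Bounded (suc N) T
    bT⁺ = Bounded-≤ (ℕ.n≤1+n N) bT
    bN : Bounded (suc N) (tv N)
    bN = bounded-tv ℕ.≤-refl
constraints (lam x t) h T N bh bT = record
  { eqs = (T , tv N ⊸ tv (suc N)) ∷ eqs c₁ ; next = next c₁ ; mono = ℕ.≤-trans le₂ (mono c₁)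
  ; bounded = (Bounded-≤ (ℕ.≤-trans le₂ (mono c₁)) bT , Bounded-≤ (mono c₁) (bounded-⊸ bN bN′)) ∷ bounded c₁
  ; sound = λ { θ (e ∷ u) → ⊩-≡ (sym e) (⊩lam (⊩-≗ (λ z → sym (tsub-upd θ h x (tv N) z)) (sound c₁ θ u))) }
  ; complete = comp }
  where
    le₂ : N ≤ suc (suc N)
    le₂ = ℕ.≤-trans (ℕ.n≤1+n N) (ℕ.n≤1+n (suc N))
    bN : Bounded (suc (suc N)) (tv N)
    bN = bounded-tv (ℕ.n≤1+n (suc N))
    bN′ : Bounded (suc (suc N)) (tv (suc N))
    bN′ = bounded-tv ℕ.≤-refl
    c₁ = constraints t (upd h x (tv N)) (tv (suc N)) (suc (suc N)) (bounded-upd (λ z → Bounded-≤ le₂ (bh z)) bN x) bN′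
    comp : ∀ θ → (tsub θ ∘ h) ⊩ lam x t ∶ tsub θ T → ∃[ φ ] (Agree N θ φ × Unifies φ ((T , tv N ⊸ tv (suc N)) ∷ eqs c₁))
    comp θ p = go (tsub θ T) refl p
      where
        go : ∀ X → X ≡ tsub θ T → (tsub θ ∘ h) ⊩ lam x t ∶ X → ∃[ φ ] (Agree N θ φ × Unifies φ ((T , tv N ⊸ tv (suc N)) ∷ eqs c₁))
        go _ e (⊩lam {A = A} {B = B} p) = case complete c₁ θ⁺ p⁺ of λ (φ , a , u) →
            φ , agree-trans le₂ ag a ,
            trans (trans (sym (agree-tsub (agree-trans le₂ ag a) bT)) (sym e)) (cong₂ _⊸_ (trans (sym eN) (a N (ℕ.n≤1+n (suc N)))) (trans (sym eN′) (a (suc N) ℕ.≤-refl))) ∷ u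
          where
            open Assign θ N A B
            p⁺ : (tsub θ⁺ ∘ upd h x (tv N)) ⊩ t ∶ θ⁺ (suc N)
            p⁺ = ⊩-≡ (sym eN′) (⊩-≗ (≗-trans (≗-trans (upd-≗ x A (λ z → agree-tsub ag (bh z)))
                   (λ z → cong (λ X → upd (tsub θ⁺ ∘ h) x X z) (sym eN))) (tsub-upd θ⁺ h x (tv N))) p)
constraints (pair t s) h T N bh bT =
  case constraints₂ t h (tv N) s h (tv (suc N)) (suc (suc N)) bh⁺ bN bh⁺ bN′ of λ (E , M , le , bE , snd , cmp) → record
  { eqs = (T , tv N ⊗ tv (suc N)) ∷ E ; next = M ; mono = ℕ.≤-trans le₂ le
  ; bounded = (Bounded-≤ (ℕ.≤-trans le₂ le) bT , Bounded-≤ le (bounded-⊗ bN bN′)) ∷ bE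
  ; sound = λ { θ (e ∷ u) → ⊩-≡ (sym e) (⊩pair (proj₁ (snd θ u)) (proj₂ (snd θ u))) }
  ; complete = λ θ p → comp θ cmp _ refl p }
  where
    le₂ : N ≤ suc (suc N)
    le₂ = ℕ.≤-trans (ℕ.n≤1+n N) (ℕ.n≤1+n (suc N))
    bh⁺ : BoundedEnv (suc (suc N)) h
    bh⁺ x = Bounded-≤ le₂ (bh x)
    bN : Bounded (suc (suc N)) (tv N)
    bN = bounded-tv (ℕ.n≤1+n (suc N))
    bN′ : Bounded (suc (suc N)) (tv (suc N))
    bN′ = bounded-tv ℕ.≤-refl
    comp : ∀ {E} θ → (∀ θ → (tsub θ ∘ h) ⊩ t ∶ θ N → (tsub θ ∘ h) ⊩ s ∶ θ (suc N) → ∃[ φ ] (Agree (suc (suc N)) θ φ × Unifies φ E)) →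
           ∀ X → X ≡ tsub θ T → (tsub θ ∘ h) ⊩ pair t s ∶ X → ∃[ φ ] (Agree N θ φ × Unifies φ ((T , tv N ⊗ tv (suc N)) ∷ E))
    comp θ cmp _ e (⊩pair {A = A} {B = B} p q) = case cmp θ⁺ (⊩-≡ (sym eN) (agree-⊩ ag bh p)) (⊩-≡ (sym eN′) (agree-⊩ ag bh q)) of λ (φ , a , u) →
        φ , agree-trans le₂ ag a ,
        trans (trans (sym (agree-tsub (agree-trans le₂ ag a) bT)) (sym e)) (cong₂ _⊗_ (trans (sym eN) (a N (ℕ.n≤1+n (suc N)))) (trans (sym eN′) (a (suc N) ℕ.≤-refl))) ∷ u
      where
        open Assign θ N A B
constraints (letp x y s t) h T N bh bT =
  case constraints₂ s h (tv N ⊗ tv (suc N)) t (upd (upd h y (tv (suc N))) x (tv N)) T (suc (suc N)) bh⁺ (bounded-⊗ bN bN′)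
         (bounded-upd (bounded-upd bh⁺ bN′ y) bN x) (Bounded-≤ le₂ bT) of λ (E , M , le , bE , snd , cmp) → record
  { eqs = E ; next = M ; mono = ℕ.≤-trans le₂ le ; bounded = bE
  ; sound = λ θ u → ⊩let (proj₁ (snd θ u)) (⊩-≗ (λ z → sym (two θ z)) (proj₂ (snd θ u)))
  ; complete = λ { θ (⊩let {A = A} {B = B} p q) → comp θ A B p q cmp } }
  where
    le₂ : N ≤ suc (suc N)
    le₂ = ℕ.≤-trans (ℕ.n≤1+n N) (ℕ.n≤1+n (suc N))
    bh⁺ : BoundedEnv (suc (suc N)) h
    bh⁺ x = Bounded-≤ le₂ (bh x)
    bN : Bounded (suc (suc N)) (tv N)
    bN = bounded-tv (ℕ.n≤1+n (suc N))
    bN′ : Bounded (suc (suc N)) (tv (suc N))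
    bN′ = bounded-tv ℕ.≤-refl
    h₂ = upd (upd h y (tv (suc N))) x (tv N)
    two : ∀ θ → upd (upd (tsub θ ∘ h) y (θ (suc N))) x (θ N) ≗ (tsub θ ∘ h₂)
    two θ = ≗-trans (upd-≗ x (θ N) (tsub-upd θ h y (tv (suc N)))) (tsub-upd θ (upd h y (tv (suc N))) x (tv N))
    comp : ∀ {E} θ A B → (tsub θ ∘ h) ⊩ s ∶ A ⊗ B → upd (upd (tsub θ ∘ h) y B) x A ⊩ t ∶ tsub θ T →
      (∀ θ → (tsub θ ∘ h) ⊩ s ∶ θ N ⊗ θ (suc N) → (tsub θ ∘ h₂) ⊩ t ∶ tsub θ T → ∃[ φ ] (Agree (suc (suc N)) θ φ × Unifies φ E)) →
      ∃[ φ ] (Agree N θ φ × Unifies φ E)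
    comp θ A B p q cmp = case cmp θ⁺ (⊩-≡ (sym (cong₂ _⊗_ eN eN′)) (agree-⊩ ag bh p)) (⊩-≡ (agree-tsub ag bT) (⊩-≗ e₂ q)) of λ (φ , a , u) →
        φ , agree-trans le₂ ag a , u
      where
        open Assign θ N A B
        e₂ : upd (upd (tsub θ ∘ h) y B) x A ≗ (tsub θ⁺ ∘ h₂)
        e₂ = ≗-trans (upd-≗ x A (≗-trans (upd-≗ y B (λ z → agree-tsub ag (bh z))) (λ z → cong (λ X → upd (tsub θ⁺ ∘ h) y X z) (sym eN′))))
               (≗-trans (λ z → cong (λ X → upd (upd (tsub θ⁺ ∘ h) y (θ⁺ (suc N))) x X z) (sym eN)) (two θ⁺))

principal : Lin t → (∀ {z} → z ∈ FV t → ⊥) → g ⊩ t ∶ A → ∃[ P ] IsPT t P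
principal {t} {g} {A} l c p = P , ⊢-closed (sound cs (proj₁ mgu) (proj₁ (proj₂ mgu))) , λ B d → case general (⊢⇒⊩ d) of λ (φ , e) → φ , e
  where
    h₀ : ℕ → Ty
    h₀ _ = tv 0
    cs : Constraints t h₀ (tv 0) 1
    -- The unknown type of `t` is `tv 0`, so fresh variables start at 1. For a closed term any
    -- environment will do; a constant one stays bounded.
    cs = constraints t h₀ (tv 0) 1 (λ _ → bounded-tv ℕ.≤-refl) (bounded-tv ℕ.≤-refl)
    ⊢-closed : ∀ {g A} → g ⊩ t ∶ A → [] ⊢ t ∶ A
    ⊢-closed {g} {A} p = ≡subst (λ xs → ctx g xs ⊢ t ∶ A) (no-elements (FV t) c) (⊩⇒⊢ l p)
      where
        no-elements : ∀ xs → (∀ {z} → z ∈ xs → ⊥) → xs ≡ []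
        no-elements [] _ = refl
        no-elements (x ∷ xs) n = ⊥-elim (n (here refl))
    ⊢⇒⊩ : ∀ {B} → [] ⊢ t ∶ B → (tsub (λ _ → B) ∘ h₀) ⊩ t ∶ B
    ⊢⇒⊩ d = typed (⊢⇒Cart d) λ ()
    solve₁ : ∀ {B} → (tsub (λ _ → B) ∘ h₀) ⊩ t ∶ B → ∃[ φ ] (Agree 1 (λ _ → B) φ × Unifies φ (eqs cs))
    solve₁ {B} p = complete cs (λ _ → B) p
    first : ∃[ φ ] (Agree 1 (λ _ → A) φ × Unifies φ (eqs cs))
    first = solve₁ (⊩-ext (λ m → ⊥-elim (c m)) p)
    mgu : MGU (eqs cs)
    mgu = unify (suc (weight (proj₁ first) (eqs cs))) (eqs cs) (proj₁ first) (proj₂ (proj₂ first)) ℕ.≤-refl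
    P = proj₁ mgu 0
    general : ∀ {B} → (tsub (λ _ → B) ∘ h₀) ⊩ t ∶ B → ∃[ φ ] (tsub φ P ≡ B)
    general {B} p = case solve₁ p of λ (φ , a , u) → case proj₂ (proj₂ mgu) φ u of λ (ψ , e) →
      ψ , trans (sym (e 0)) (sym (a 0 ℕ.≤-refl))

-- Closed terms and poly-typability

closed-[] : (∀ {z} → z ∈ xs → ⊥) → xs ≡ []
closed-[] {[]} n = refl
closed-[] {x ∷ xs} n = ⊥-elim (n (here refl))

⊢⇒Cl : [] ⊢ t ∶ A → Cl t
⊢⇒Cl d = cl (λ m → case proj₁ (fv (⊢⇒Cart d)) m of λ ()) (lin (⊢⇒Cart d))

⊢⇒⊩ : [] ⊢ t ∶ A → g ⊩ t ∶ A
⊢⇒⊩ d = typed (⊢⇒Cart d) λ ()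

⊩⇒⊢[] : Cl t → g ⊩ t ∶ A → [] ⊢ t ∶ A
⊩⇒⊢[] {t} {g} {A} c p = ≡subst (λ xs → ctx g xs ⊢ t ∶ A) (closed-[] (no-fv c)) (⊩⇒⊢ (linear c) p)

⊩≐⇒⊢≐ : Cl t → g ⊩ t ≐ s ∶ A → [] ⊢ t ≐ s ∶ A
⊩≐⇒⊢≐ {t} {g} {s} {A} c p = ≡subst (λ xs → ctx g xs ⊢ t ≐ s ∶ A) (closed-[] (no-fv c)) (conv p)

⊩-tsub : ∀ θ → g ⊩ t ∶ A → (tsub θ ∘ g) ⊩ t ∶ tsub θ A
⊩-tsub θ (⊩var e) = ⊩var (cong (tsub θ) e)
⊩-tsub θ (⊩app p q) = ⊩app (⊩-tsub θ p) (⊩-tsub θ q)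
⊩-tsub {g} θ (⊩lam {x = x} {A = A} p) = ⊩lam (⊩-≗ (λ z → sym (tsub-upd θ g x A z)) (⊩-tsub θ p))
⊩-tsub θ (⊩pair p q) = ⊩pair (⊩-tsub θ p) (⊩-tsub θ q)
⊩-tsub {g} θ (⊩let {A = A} {B = B} {y = y} {x = x} p q) = ⊩let (⊩-tsub θ p)
  (⊩-≗ (λ z → sym (trans (upd-≗ x (tsub θ A) (tsub-upd θ g y B) z) (tsub-upd θ (upd g y B) x A z))) (⊩-tsub θ q))

interleave : TySub → TySub → TySub
interleave θ φ zero          = θ 0
interleave θ φ (suc zero)    = φ 0
interleave θ φ (suc (suc m)) = interleave (θ ∘ suc) (φ ∘ suc) m

double : ℕ → ℕ
double zero    = zero
double (suc m) = suc (suc (double m))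

evens odds : TySub
evens = tv ∘ double
odds  = tv ∘ suc ∘ double

interleave-even : ∀ θ φ m → interleave θ φ (double m) ≡ θ m
interleave-even θ φ zero = refl
interleave-even θ φ (suc m) = interleave-even (θ ∘ suc) (φ ∘ suc) m

interleave-odd : ∀ θ φ m → interleave θ φ (suc (double m)) ≡ φ m
interleave-odd θ φ zero = refl
interleave-odd θ φ (suc m) = interleave-odd (θ ∘ suc) (φ ∘ suc) m

tsub-evens : ∀ θ φ A → tsub (interleave θ φ) (tsub evens A) ≡ tsub θ A
tsub-evens θ φ A = trans (tsub-∘ (interleave θ φ) evens A) (tsub-cong A λ {a} _ → interleave-even θ φ a)

tsub-odds : ∀ θ φ A → tsub (interleave θ φ) (tsub odds A) ≡ tsub φ A
tsub-odds θ φ A = trans (tsub-∘ (interleave θ φ) odds A) (tsub-cong A λ {a} _ → interleave-odd θ φ a)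

IsPT-rename : ∀ ren → (∀ φ → ∃[ ψ ] (∀ A → tsub ψ (tsub ren A) ≡ tsub φ A)) → ∀ {P} → IsPT t P → IsPT t (tsub ren P)
IsPT-rename ren back {P} (d , f) = ⊩⇒⊢[] (⊢⇒Cl d) (⊩-tsub ren (⊢⇒⊩ {g = λ _ → tv 0} d)) , λ B d' → case f B d' of λ (φ , e) →
  case back φ of λ (ψ , e') → ψ , trans (e' P) e

-- One substitution serves all principal types once their variables are
-- separated by parity.
joint-PT : ∀ {n} (ss : Vec Tm n) (As : Vec Ty n) → (∀ i → [] ⊢ Vec.lookup ss i ∶ Vec.lookup As i) →
  ∃[ Ps ] ∃[ θ ] ((∀ i → IsPT (Vec.lookup ss i) (Vec.lookup Ps i)) × Vec.map (tsub θ) Ps ≡ As)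
joint-PT Vec.[] Vec.[] d = Vec.[] , tv , (λ ()) , refl
joint-PT (s Vec.∷ ss) (A Vec.∷ As) d =
  case principal {g = λ _ → tv 0} (linear (⊢⇒Cl (d Fin.zero))) (no-fv (⊢⇒Cl (d Fin.zero))) (⊢⇒⊩ (d Fin.zero)) of λ (P , pt) →
  case proj₂ pt A (d Fin.zero) of λ (θ , e) →
  case joint-PT ss As (d ∘ Fin.suc) of λ (Ps , φ , pts , es) →
  (tsub evens P Vec.∷ Vec.map (tsub odds) Ps) , interleave θ φ ,
  (λ { Fin.zero → IsPT-rename evens (λ θ → interleave θ tv , tsub-evens θ tv) pt
     ; (Fin.suc i) → ≡subst (IsPT (Vec.lookup ss i)) (sym (Vec.lookup-map i (tsub odds) Ps)) (IsPT-rename odds (λ φ → interleave tv φ , tsub-odds tv φ) (pts i)) }) ,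
  cong₂ Vec._∷_ (trans (tsub-evens θ φ P) e)
    (trans (sym (Vec.map-∘ (tsub (interleave θ φ)) (tsub odds) Ps)) (trans (Vec.map-cong (tsub-odds θ φ) Ps) es))

apps-⊩⁻ : ∀ {n} t (ss : Vec Tm n) → g ⊩ apps t ss ∶ B →
  ∃[ As ] ((g ⊩ t ∶ arrows As B) × (∀ i → g ⊩ Vec.lookup ss i ∶ Vec.lookup As i))
apps-⊩⁻ t Vec.[] p = Vec.[] , p , λ ()
apps-⊩⁻ t (s Vec.∷ ss) p = case apps-⊩⁻ (app t s) ss p of λ { (As , ⊩app {A = A} q q' , qs) →
  A Vec.∷ As , q , λ { Fin.zero → q' ; (Fin.suc i) → qs i } }

-- A typing of the whole application shows at which types its parts fit together. `joint-PT`,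
-- applied to the function along with its arguments, turns these types into one common substitution
-- instance of the principal ones.
typable⇒PolyTypable : ∀ {n} t (ss : Vec Tm n) As B → Cl t → (∀ i → [] ⊢ Vec.lookup ss i ∶ Vec.lookup As i) →
  g ⊩ apps t ss ∶ B → PolyTypable t ss As B
typable⇒PolyTypable t ss As B c ds p = case apps-⊩⁻ t ss p of λ (As' , q , qs) →
  case joint-PT (t Vec.∷ ss) (arrows As' B Vec.∷ As') (λ { Fin.zero → ⊩⇒⊢[] c q ; (Fin.suc i) → ⊩⇒⊢[] (⊢⇒Cl (ds i)) (qs i) }) of λ
    { ((P Vec.∷ Ps) , θ , pts , es) → (As' , B , ⊩⇒⊢[] c q) , ds ,
      (P , Ps , θ , pts Fin.zero , pts ∘ Fin.suc , trans (Vec.∷-injectiveˡ es) (cong (λ As → arrows As B) (sym (Vec.∷-injectiveʳ es)))) }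

Cl-apps : ∀ {n} (ss : Vec Tm n) → Cl t → (∀ i → Cl (Vec.lookup ss i)) → Cl (apps t ss)
Cl-apps Vec.[] c cs = c
Cl-apps (s Vec.∷ ss) c cs = Cl-apps ss (Cl-app c (cs Fin.zero)) (cs ∘ Fin.suc)

≈-apps : ∀ {n} (ss : Vec Tm n) → t ≈ s → apps t ss ≈ apps s ss
≈-apps Vec.[] p = p
≈-apps (s Vec.∷ ss) p = ≈-apps ss (≈-app p ≈-refl)

-- A test that separates two different closed terms

module _ {A : Ty} {s₁ s₂ : Tm} (d₁ : [] ⊢ s₁ ∶ A) (d₂ : [] ⊢ s₂ ∶ A) where

  private
    c₁ = ⊢⇒Cl d₁
    c₂ = ⊢⇒Cl d₂
    n₀ : ℕ
    -- Beyond the variables of both terms, so that both are normalised to the same goal address and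
    -- their links can be compared.
    n₀ = suc (max 0 (Vars s₁ ++ Vars s₂))
    G₀ : ℕ → Ty
    G₀ = lay n₀ A (λ _ → tv 0)

    below₁ : Below s₁ n₀
    below₁ m = s≤s (All.lookup (xs≤max 0 (Vars s₁ ++ Vars s₂)) (inl m))

    below₂ : Below s₂ n₀
    below₂ m = s≤s (All.lookup (xs≤max 0 (Vars s₁ ++ Vars s₂)) (inr (Vars s₁) m))

    norm : ∀ {s} → [] ⊢ s ∶ A → Below s n₀ → Normal G₀ (λ _ → tv 0) id [] s n₀ A
    norm d b = normalise (⊢⇒⊩ d) (linear (⊢⇒Cl d)) b ℕ.≤-refl
      (record { ren = λ _ → refl ; big = λ m → ⊥-elim (no-fv (⊢⇒Cl d) m) ; fvs≥ = λ () ; bvs = λ _ m → m })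
      (record { at-var = λ m → ⊥-elim (no-fv (⊢⇒Cl d) m) ; at-goal = lay-At n₀ A _
              ; dj-var = λ m → ⊥-elim (no-fv (⊢⇒Cl d) m) ; dj-goal = λ m → ⊥-elim (no-fv (⊢⇒Cl d) m) })

    subst-[] : ∀ s → subst [] s ≡ s
    subst-[] s = subst-id [] s λ _ → refl

    module N₁ = Normal (norm d₁ below₁)
    module N₂ = Normal (norm d₂ below₂)

    closed-nf : ∀ {s} → Cl s → (I : Normal G₀ (λ _ → tv 0) id [] s n₀ A) → ∀ {z} → z ∈ FV (Normal.tm I) → ⊥
    closed-nf {s} c I m = no-fv c (≡subst (λ t → _ ∈ FV t) (subst-[] s) (proj₂ (Normal.fvs I) m))

    no₁ : ∀ {z} → z ∈ FV N₁.tm → ⊥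
    no₁ = closed-nf c₁ (norm d₁ below₁)

    no₂ : ∀ {z} → z ∈ FV N₂.tm → ⊥
    no₂ = closed-nf c₂ (norm d₂ below₂)

    sep₁ : Sep G₀ n₀ A (FV N₁.tm)
    sep₁ = record { sep-goal = λ m → ⊥-elim (no₁ m) ; sep-ctx = λ m → ⊥-elim (no₁ m) }

    sep₂ : Sep G₀ n₀ A (FV N₂.tm)
    sep₂ = record { sep-goal = λ m → ⊥-elim (no₂ m) ; sep-ctx = λ m → ⊥-elim (no₂ m) }

    same⇒≐ : N₁.tm ≈ N₂.tm → [] ⊢ s₁ ≐ s₂ ∶ A
    same⇒≐ p = e-trans (to c₁ N₁.eq) (e-trans (⊩≐⇒⊢≐ (cl no₁ N₁.lin) (≈⇒≐ p N₁.lin (Nf-⊩ N₁.nf))) (e-sym (to c₂ N₂.eq)))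
      where
        to : ∀ {s t} → Cl s → G₀ ⊩ subst [] s ≐ t ∶ A → [] ⊢ s ≐ t ∶ A
        to {s} {t} c p = ⊩≐⇒⊢≐ c (≡subst (λ k → G₀ ⊩ k ≐ t ∶ A) (subst-[] s) p)

    bound : ∀ {t α β} (D : Nf G₀ n₀ A t) → Lin t → (∀ {z} → z ∈ FV t → ⊥) → Link D α β → α < n₀ + ∥ A ∥ × β < n₀ + ∥ A ∥
    bound D l c k = case link-loc D l k of λ { (in-goal i , in-goal j) → proj₂ i , proj₂ j
      ; (in-ctx m _ , _) → ⊥-elim (c m) ; (_ , in-ctx m _) → ⊥-elim (c m) }

    Differ : ℕ → ℕ → Set
    Differ α β = TestR.par α β N₁.nf ≢ TestR.par α β N₂.nf

    -- The links of a closed proof lie in the interval of `A`, so the search is finite and the pair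
    -- of addresses is found constructively.
    differ? : Dec (∃[ α ] (α < n₀ + ∥ A ∥ × ∃[ β ] (β < n₀ + ∥ A ∥ × Differ α β)))
    differ? = ℕ.anyUpTo? (λ α → ℕ.anyUpTo? (λ β → ¬? (TestR.par α β N₁.nf Bool.≟ TestR.par α β N₂.nf)) _) _

    -- `probe-Nf` evaluates the test on the cut-free form. The logical relation provides some bit
    -- common to that form and `s`; comparing actions on pairs shows that it behaves like the
    -- parity.
    code-of : ∀ {s} α β (I : Normal G₀ (λ _ → tv 0) id [] s n₀ A) → Cl s → Code (TestR.par α β (Normal.nf I)) (Test.Probe α β n₀ A · s)
    code-of {s} α β I c = case T.probe-R A n₀ rel′ of λ (b , K , K') → code (code-cl K) λ cu cv →
        ≈-trans (runs K cu cv) (≈-trans (≈-sym (runs K' cu cv)) (runs C′ cu cv))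
      where
        module T = TestR α β
        module I = Normal I
        none : ∀ {z} → z ∈ FV I.tm → ⊥
        none = closed-nf c I
        rel′ : R A s I.tm
        rel′ = R-≈ A (≈-≡ (subst-[] s)) (≈-≡ (subst-[] I.tm)) (I.rel [] [] (record { closed = λ () ; closed′ = λ () ; related = λ m → ⊥-elim (no-fv c m) }))
        C′ : Code (T.par I.nf) (T.Probe n₀ A · I.tm)
        C′ = T.Code-≡ (trans (cong (λ xs → T.par I.nf xor T.sum (λ _ → false) xs) (closed-[] none)) (Bool.xor-identityʳ _))
               (Code-≈ (≈-app ≈-refl (≈-≡ (subst-[] I.tm))) (T.probe-Nf I.nf I.lin (λ _ → false) [] (λ ()) (λ m → ⊥-elim (none m))))

  separate : ¬ ([] ⊢ s₁ ≐ s₂ ∶ A) → ∃[ Q ] ∃[ b₁ ] ∃[ b₂ ] (Cl Q × b₁ ≢ b₂ × Code b₁ (Q · s₁) × Code b₂ (Q · s₂))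
  separate ne = go differ?
    where
      go : Dec (∃[ α ] (α < n₀ + ∥ A ∥ × ∃[ β ] (β < n₀ + ∥ A ∥ × Differ α β))) →
           ∃[ Q ] ∃[ b₁ ] ∃[ b₂ ] (Cl Q × b₁ ≢ b₂ × Code b₁ (Q · s₁) × Code b₂ (Q · s₂))
      go (yes (α , _ , β , _ , df)) = Test.Probe α β n₀ A , _ , _ , Test.Cl-Probe α β n₀ A , df ,
        code-of α β (norm d₁ below₁) c₁ , code-of α β (norm d₂ below₂) c₂
      go (no nd) = ⊥-elim (ne (same⇒≐ (same-links N₁.nf N₁.lin N₂.nf N₂.lin ((λ m → ⊥-elim (no₁ m)) , (λ m → ⊥-elim (no₂ m))) sep₁ to from)))
        where
          equal-par : ∀ α β → α < n₀ + ∥ A ∥ → β < n₀ + ∥ A ∥ → TestR.par α β N₁.nf ≡ TestR.par α β N₂.nf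
          equal-par α β p q = decidable-stable (TestR.par α β N₁.nf Bool.≟ TestR.par α β N₂.nf) λ n → nd (α , p , β , q , n)
          to : ∀ {α β} → Link N₁.nf α β → Link N₂.nf α β
          to {α} {β} k = case bound N₁.nf N₁.lin no₁ k of λ (p , q) →
            TestR.par⇒Link α β N₂.nf (trans (sym (equal-par α β p q)) (TestR.Link⇒par α β N₁.nf N₁.lin sep₁ k))
          from : ∀ {α β} → Link N₂.nf α β → Link N₁.nf α β
          from {α} {β} k = case bound N₂.nf N₂.lin no₂ k of λ (p , q) →
            TestR.par⇒Link α β N₁.nf (trans (equal-par α β p q) (TestR.Link⇒par α β N₂.nf N₂.lin sep₂ k))

-- Realisers of Boolean functions

𝐙 𝐒 𝐋 : Tm
𝐙 = lam 0 (lam 1 (lam 2 (𝐊 · (var 0 · var 1) · var 2)))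
𝐒 = lam 0 (lam 1 (lam 2 (lam 3 (var 0 · (var 2 · var 1) · var 3))))
𝐋 = lam 0 (lam 1 (lam 2 (lam 3 (lam 4 (letp 5 6 (var 0 · var 4 · pair (var 1) (var 2)) (var 3 · var 6 · var 5))))))

Cl-𝐙 : Cl 𝐙
Cl-𝐙 = Cl! 𝐙 {refl} (from-yes (Lin? 𝐙))
Cl-𝐒 : Cl 𝐒
Cl-𝐒 = Cl! 𝐒 {refl} (from-yes (Lin? 𝐒))
Cl-𝐋 : Cl 𝐋
Cl-𝐋 = Cl! 𝐋 {refl} (from-yes (Lin? 𝐋))

𝐙-β : ∀ {q} → Cl q → Cl v → Cl u → 𝐙 · q · v · u ≈ 𝐊 · (q · v) · u
𝐙-β {v} {u} {q} cq cv cu = β* ((0 , q) ∷ (1 , v) ∷ (2 , u) ∷ []) (𝐊 · (var 0 · var 1) · var 2)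
  (from-yes (unique? (0 ∷ 1 ∷ 2 ∷ []))) (cq ∷ cv ∷ cu ∷ []) (linear Cl-𝐙)

𝐒-β : Cl e → Cl s → Cl v → Cl u → 𝐒 · e · s · v · u ≈ e · (v · s) · u
𝐒-β {e} {s} {v} {u} ce cs cv cu = β* ((0 , e) ∷ (1 , s) ∷ (2 , v) ∷ (3 , u) ∷ []) (var 0 · (var 2 · var 1) · var 3)
  (from-yes (unique? (0 ∷ 1 ∷ 2 ∷ 3 ∷ []))) (ce ∷ cs ∷ cv ∷ cu ∷ []) (linear Cl-𝐒)

-- The bit obtained from `s` arranges the two candidates; the first component is kept and the second
-- is left to the eraser `e`.
𝐋-β : ∀ {q a b} → Cl q → Cl a → Cl b → Cl e → Cl s → Cl u → Cl v → q · s · pair a b ≈ pair u v → 𝐋 · q · a · b · e · s ≈ e · v · u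
𝐋-β {e} {s} {u} {v} {q} {a} {b} cq ca cb ce cs cu cv r = ≈-trans
  (β* ρ₀ (letp 5 6 (var 0 · var 4 · pair (var 1) (var 2)) (var 3 · var 6 · var 5)) (from-yes (unique? (0 ∷ 1 ∷ 2 ∷ 3 ∷ 4 ∷ []))) cs* (linear Cl-𝐋))
  (βp-env (var 0 · var 4 · pair (var 1) (var 2)) (var 3 · var 6 · var 5)
    (from-yes (Lin? (letp 5 6 (var 0 · var 4 · pair (var 1) (var 2)) (var 3 · var 6 · var 5))))
    (Env-ClS cs* (0 ∷ 4 ∷ 1 ∷ 2 ∷ 3 ∷ []) (from-yes (All.all? (_∈? (0 ∷ 1 ∷ 2 ∷ 3 ∷ 4 ∷ [])) (0 ∷ 4 ∷ 1 ∷ 2 ∷ 3 ∷ [])))) r cu cv)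
  where
    ρ₀ = (0 , q) ∷ (1 , a) ∷ (2 , b) ∷ (3 , e) ∷ (4 , s) ∷ []
    cs* : ClS ρ₀
    cs* = cq ∷ ca ∷ cb ∷ ce ∷ cs ∷ []

module _ {s₁ s₂ Q : Tm} {b₁ b₂ : Bool} (c₁ : Cl s₁) (c₂ : Cl s₂) (cQ : Cl Q) (b₁≢b₂ : b₁ ≢ b₂) (K₁ : Code b₁ (Q · s₁)) (K₂ : Code b₂ (Q · s₂)) where

  Cl-enc : ∀ b → Cl (enc s₁ s₂ b)
  Cl-enc false = c₁
  Cl-enc true = c₂

  -- A function of n arguments is erased by applying it to s₁,…,s₁ and
  -- erasing the resulting bit.
  eraser : ℕ → Tm
  eraser zero    = 𝐙 · Q
  eraser (suc n) = 𝐒 · eraser n · s₁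

  Cl-eraser : ∀ n → Cl (eraser n)
  Cl-eraser zero = Cl-app Cl-𝐙 cQ
  Cl-eraser (suc n) = Cl-app (Cl-app Cl-𝐒 (Cl-eraser n)) c₁

  erases : ∀ n {v u} b → Cl v → Cl u → apps v (Vec.replicate n s₁) ≈ enc s₁ s₂ b → eraser n · v · u ≈ u
  erases zero b cv cu r = ≈-trans (𝐙-β cQ cv cu) (go b r)
    where
      go : ∀ b → _ ≈ enc s₁ s₂ b → _
      go false r = 𝐊-id (Code-≈ (≈-app ≈-refl (≈-sym r)) K₁) cu
      go true r = 𝐊-id (Code-≈ (≈-app ≈-refl (≈-sym r)) K₂) cu
  erases (suc n) b cv cu r = ≈-trans (𝐒-β (Cl-eraser n) c₁ cv cu) (erases n b (Cl-app cv c₁) cu r)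

  Realises : ∀ {n} → (Vec Bool n → Bool) → Tm → Set
  Realises f t = Cl t × (∀ xs → apps t (Vec.map (enc s₁ s₂) xs) ≈ enc s₁ s₂ (f xs))

  -- `Q` gives `s₁` and `s₂` distinct bits without saying which is which, so the order in which the
  -- candidates are stored depends on `b₁` and `b₂`.
  choose-pair : ∀ (T : Bool → Tm) → Cl (T false) → Cl (T true) →
    ∃[ p ] ∃[ q ] (Cl p × Cl q × (∀ x → Q · enc s₁ s₂ x · pair p q ≈ pair (T x) (T (not x))))
  choose-pair T cf ct = go b₁ b₂ b₁≢b₂ K₁ K₂
    where
      go : ∀ b₁ b₂ → b₁ ≢ b₂ → Code b₁ (Q · s₁) → Code b₂ (Q · s₂) → _
      go false false n _ _ = ⊥-elim (n refl)
      go true true n _ _ = ⊥-elim (n refl)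
      go false true _ K₁ K₂ = T false , T true , cf , ct , λ { false → runs K₁ cf ct ; true → runs K₂ cf ct }
      go true false _ K₁ K₂ = T true , T false , ct , cf , λ { false → runs K₁ ct cf ; true → runs K₂ ct cf }

  realise : ∀ n (f : Vec Bool n → Bool) → ∃[ t ] Realises f t
  realise zero f = enc s₁ s₂ (f Vec.[]) , Cl-enc _ , λ { Vec.[] → ≈-refl }
  realise (suc n) f = 𝐋 · Q · proj₁ pq · proj₁ (proj₂ pq) · eraser n , ct , works
    where
      sub : ∀ b → ∃[ t ] Realises (λ xs → f (b Vec.∷ xs)) t
      sub b = realise n λ xs → f (b Vec.∷ xs)
      T' : Bool → Tm
      T' b = proj₁ (sub b)
      cT : ∀ b → Cl (T' b)
      cT b = proj₁ (proj₂ (sub b))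
      pq = choose-pair T' (cT false) (cT true)
      cp = proj₁ (proj₂ (proj₂ pq))
      cq = proj₁ (proj₂ (proj₂ (proj₂ pq)))
      ct : Cl (𝐋 · Q · proj₁ pq · proj₁ (proj₂ pq) · eraser n)
      ct = Cl-app (Cl-app (Cl-app (Cl-app Cl-𝐋 cQ) cp) cq) (Cl-eraser n)
      at-false : ∀ b → apps (T' b) (Vec.replicate n s₁) ≈ enc s₁ s₂ (f (b Vec.∷ Vec.replicate n false))
      at-false b = ≡subst (λ ss → apps (T' b) ss ≈ enc s₁ s₂ (f (b Vec.∷ Vec.replicate n false)))
        (Vec.map-replicate (enc s₁ s₂) false n) (proj₂ (proj₂ (sub b)) (Vec.replicate n false))
      works : ∀ xs → apps (𝐋 · Q · proj₁ pq · proj₁ (proj₂ pq) · eraser n) (Vec.map (enc s₁ s₂) xs) ≈ enc s₁ s₂ (f xs)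
      works (x Vec.∷ xs) = ≈-trans (≈-apps (Vec.map (enc s₁ s₂) xs)
          (≈-trans (𝐋-β cQ cp cq (Cl-eraser n) (Cl-enc x) (cT x) (cT (not x)) (proj₂ (proj₂ (proj₂ (proj₂ pq))) x))
                   (erases n _ (cT (not x)) (cT x) (at-false (not x)))))
        (proj₂ (proj₂ (sub x)) xs)

-- From conversion back to types and typed equality

⊢-enc : ∀ {s₁ s₂} → [] ⊢ s₁ ∶ A → [] ⊢ s₂ ∶ A → ∀ b → [] ⊢ enc s₁ s₂ b ∶ A
⊢-enc d₁ d₂ false = d₁
⊢-enc d₁ d₂ true = d₂

enc-≐-injective : ∀ {s₁ s₂} → ¬ ([] ⊢ s₁ ≐ s₂ ∶ A) → ∀ b c → [] ⊢ enc s₁ s₂ b ≐ enc s₁ s₂ c ∶ A → b ≡ c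
enc-≐-injective ne false false p = refl
enc-≐-injective ne true true p = refl
enc-≐-injective ne false true p = ⊥-elim (ne p)
enc-≐-injective ne true false p = ⊥-elim (ne (e-sym p))

module _ {A : Ty} {s₁ s₂ : Tm} (d₁ : [] ⊢ s₁ ∶ A) (d₂ : [] ⊢ s₂ ∶ A) (ne : ¬ ([] ⊢ s₁ ≐ s₂ ∶ A)) {n : ℕ} (f : Vec Bool n → Bool) {t : Tm} (ct : Cl t)
         (works : ∀ (xs : Vec Bool n) → apps t (Vec.map (enc s₁ s₂) xs) ≈ enc s₁ s₂ (f xs)) where

  private
    args : ∀ (xs : Vec Bool n) i → [] ⊢ Vec.lookup (Vec.map (enc s₁ s₂) xs) i ∶ A
    args xs i = ≡subst (λ s → [] ⊢ s ∶ A) (sym (Vec.lookup-map i (enc s₁ s₂) xs)) (⊢-enc d₁ d₂ (Vec.lookup xs i))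

    apps-typed : ∀ (xs : Vec Bool n) → (λ _ → tv 0) ⊩ apps t (Vec.map (enc s₁ s₂) xs) ∶ A
    apps-typed xs = ≈-⊩← (works xs) (⊢⇒⊩ (⊢-enc d₁ d₂ (f xs)))

    value : ∀ (xs : Vec Bool n) → [] ⊢ apps t (Vec.map (enc s₁ s₂) xs) ≐ enc s₁ s₂ (f xs) ∶ A
    value xs = ⊩≐⇒⊢≐ cx (≈⇒≐ (works xs) (linear cx) (apps-typed xs))
      where cx = Cl-apps (Vec.map (enc s₁ s₂) xs) ct (λ i → ⊢⇒Cl (args xs i))

  realiser-typable : ∀ (xs : Vec Bool n) → PolyTypable t (Vec.map (enc s₁ s₂) xs) (Vec.replicate n A) A
  realiser-typable xs = typable⇒PolyTypable t (Vec.map (enc s₁ s₂) xs) (Vec.replicate n A) A ct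
    (λ i → ≡subst (λ B → [] ⊢ Vec.lookup (Vec.map (enc s₁ s₂) xs) i ∶ B) (sym (Vec.lookup-replicate i A)) (args xs i)) (apps-typed xs)

  realiser-correct : ∀ (xs : Vec Bool n) y → (f xs ≡ y) ⇔ ([] ⊢ apps t (Vec.map (enc s₁ s₂) xs) ≐ enc s₁ s₂ y ∶ A)
  -- For the converse, the encodings of `f xs` and `y` become equal, and the hypothesis that `s₁`
  -- and `s₂` differ separates distinct truth values.
  realiser-correct xs y = mk⇔ (λ { refl → value xs }) (λ p → enc-≐-injective ne (f xs) y (e-trans (e-sym (value xs)) p))

theorem3 : (A : Ty) (s1 s2 : Tm) → [] ⊢ s1 ∶ A → [] ⊢ s2 ∶ A →
    ¬ ([] ⊢ s1 ≐ s2 ∶ A) →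
    (n : ℕ) → 1 ≤ n → (f : Vec Bool n → Bool) →
    ∃[ t ] ((∀ (xs : Vec Bool n) →
               PolyTypable t (map (enc s1 s2) xs) (replicate n A) A) ×
            (∀ (xs : Vec Bool n) (y : Bool) →
               (f xs ≡ y) ⇔ ([] ⊢ apps t (map (enc s1 s2) xs) ≐ enc s1 s2 y ∶ A)))
theorem3 A s1 s2 d₁ d₂ ne n _ f =
  let (Q , b₁ , b₂ , cQ , b≢ , K₁ , K₂) = separate d₁ d₂ ne
      (t , ct , works) = realise (⊢⇒Cl d₁) (⊢⇒Cl d₂) cQ b≢ K₁ K₂ n f
  in t , realiser-typable d₁ d₂ ne f ct works , realiser-correct d₁ d₂ ne f ct works
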